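{- For every integer $k\ge0$, $$\mathrm{Q}_{3k+1,3}(1)=\mathrm{H}_{3k+1,3}[X;q,t]=\Big(\sum_{i=0}^{k-1}s_{(k+2i-1,k-i-1)}\Big)s_3+\Big(\sum_{i=0}^{k-1}\big(s_{(k+2i,k-i-1)}+s_{(k+2i+1,k-i-1)}\big)\Big)s_{21}+\Big(\sum_{i=0}^{k}s_{(k+2i,k-i)}\Big)s_{111},$$ $$\mathrm{Q}_{3k+2,3}(1)=\mathrm{H}_{3k+2,3}[X;q,t]=\Big(\sum_{i=0}^{k-1}s_{(k+2i,k-i-1)}\Big)s_3+\Big(\sum_{i=-1}^{k-1}\big(s_{(k+2i+1,k-i-1)}+s_{(k+2i+2,k-i-1)}\big)\Big)s_{21}+\Big(\sum_{i=0}^{k}s_{(k+2i+1,k-i)}\Big)s_{111},$$ and, for every integer $k\ge1$, $$\mathrm{Q}_{3k,3}(1)=\mathrm{H}_{3k,3}[X;q,t]=\Big(\sum_{i=0}^{k-1}\big(s_{(k+2i-3,k-i-1)}+s_{(k+2i-2,k-i-1)}+s_{(k+2i-1,k-i-1)}\big)\Big)s_3$$ $$+\Big(s_{(k+1,k-1)}+2s_{(k,k-1)}+s_{(k-1,k-1)}+\sum_{i=1}^{k-1}\big(s_{(k+2i-2,k-i-1)}+2s_{(k+2i-1,k-i-1)}+2s_{(k+2i,k-i-1)}+s_{(k+2i+1,k-i-1)}\big)\Big)s_{21}$$ $$+\Big(\sum_{i=0}^{k}\big(s_{(k+2i-2,k-i)}+s_{(k+2i-1,k-i)}+s_{(k+2i,k-i)}\big)\Big)s_{111},$$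 where all $s_{(a,b)}$ with subscripted pairs are the $(q,t)$-Schur functions $s_{(a,b)}(q,t)$ and $s_3,s_{21},s_{111}$ are Schur functions in $X$.
   Context: $[n]_{q,t}=\frac{q^n-t^n}{q-t}$ for $n\ge1$. For integers $a,b$, $s_{(a,b)}(q,t)=(qt)^b[a-b+1]_{q,t}$ if $a\ge b\ge0$ and $s_{(a,b)}(q,t)=0$ otherwise. Operators $\mathrm{Q}_{m,n}$: let $M=(1-q)(1-t)$ and, in plethystic notation, $D_kF[X]=F[X+M/z]\sum_{i\ge0}(-z)^ie_i[X]\big|_{z^k}$. Set $\mathrm{Q}_{1,n}=(-1)^nD_n$ for $n\ge0$. For $m>1$ and $(m,n)$ coprime, let $(a,b)$ be the lattice point of the $m\times n$ rectangle closest to the diagonal $y=\frac nm x$ with $cb-da>0$ where $(c,d)=(m-a,n-b)$, and set $\mathrm{Q}_{m,n}=\frac1M(\mathrm{Q}_{c,d}\mathrm{Q}_{a,b}-\mathrm{Q}_{a,b}\mathrm{Q}_{c,d})$. For non-coprime $(m,n)$, choose a lattice point $(a,b)$ of the rectangle, not on the diagonal, closest to it with the same positivity condition, and set $\mathrm{Q}_{m,n}=\frac1M[\mathrm{Q}_{m-a,n-b},\mathrm{Q}_{a,b}]$ (independent of the choice). Combinatorial side: an $(m,n)$-Dyck path is a north/east lattice path from $(0,0)$ to $(m,n)$ weakly above $y=\frac nm x$. An $(m,n)$-parking function $\pi$ is such a path $\Pi(\pi)$ whose north steps are labeled bijectively by $1,\dots,n$ (cars, in the cells right of the north steps), increasing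 upward in each column; $\mathcal{PF}_{m,n}$ is the set. With $d=\gcd(m,n)$, cell $(x,y)$ (lower-left corner) has rank $my-nx+\lfloor xd/m\rfloor$. $\mathrm{ides}(\pi)=\{i:\mathrm{rank}(i)<\mathrm{rank}(i+1)\}=\{i_1<\dots<i_r\}$, $\mathrm{pides}(\pi)=(i_1,i_2-i_1,\dots,n-i_r)$. $\mathrm{area}$ = number of full cells between path and diagonal. $\lambda(P)$ = partition of cells above $P$ (English), arm/leg as usual; $\mathrm{pdinv}(P)=\#\{c:\frac{\mathrm{arm}(c)}{\mathrm{leg}(c)+1}\le\frac mn<\frac{\mathrm{arm}(c)+1}{\mathrm{leg}(c)}\}$; $\mathrm{tdinv}(\pi)=\#\{i<j:\mathrm{rank}(i)<\mathrm{rank}(j)<\mathrm{rank}(i)+m\}$; $\mathrm{maxdinv}(P)=\max$ tdinv over parking functions on $P$; $\mathrm{dinv}=\mathrm{tdinv}+\mathrm{pdinv}-\mathrm{maxdinv}$. With $(m,n)=(km_0,kn_0)$, $\gcd(m_0,n_0)=1$, $\mathrm{ret}(\pi)$ is the least $i\ge1$ with the path through $(im_0,in_0)$; $[r]_{1/t}=1+t^{ -1}+\dots+t^{ -(r-1)}$. $\mathrm{H}_{m,n}[X;q,t]=\sum_{\pi\in\mathcal{PF}_{m,n}}[\mathrm{ret}(\pi)]_{1/t}t^{\mathrm{area}(\pi)}q^{\mathrm{dinv}(\pi)}F_{\mathrm{pides}(\pi)}[X]$ with $F_\alpha$ Gessel's fundamental quasisymmetric functions.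
   Formalization: In defining Q_{m,n}, the lattice point (a,b) is chosen closest to the diagonal with ad−bc>0 (below it) instead of cb−da>0; with the sign as given, Q_{2,3}(1) is the negative of H_{2,3}, so the identity fails for even m. -}

module Defs where

-- Conventions:
--  * Coefficients live in Q[q^±1,t^±1] localised at M = (1-q)(1-t)
--    (a subring of Q(q,t) containing every quantity in the statement).
--  * Symmetric / quasisymmetric functions of degree n are compared through
--    their specialisations to x_1,…,x_N for EVERY N (equality of formal
--    power series in x_1,x_2,… is equality of all these truncations).

open import Data.Bool using (Bool; true; false; if_then_else_; _∧_; _∨_; not)
open import Data.Nat as ℕ using (ℕ; zero; suc)
open import Data.Nat.GCD using (gcd)
import Data.Nat.DivMod as ℕD
open import Data.Integer as ℤ using (ℤ; +_; -[1+_])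
import Data.Integer.Properties as ℤP
open import Data.Nat.ListAction using () renaming (sum to sumℕ)
open import Data.Bool.ListAction using () renaming (any to anyᵇ; all to allᵇ)
open import Data.Rational as ℚ using (ℚ; 0ℚ; 1ℚ)
open import Data.Fin as Fin using (Fin)
open import Data.List as L using (List; []; _∷_; _++_)
open import Data.Vec as V using (Vec)
open import Data.Product using (_×_; _,_)
open import Relation.Binary.PropositionalEquality using (_≡_)
open import Relation.Nullary.Decidable using (⌊_⌋)

private
  vecEqᵇ : ∀ {n} → Vec ℕ n → Vec ℕ n → Bool
  vecEqᵇ V.[] V.[] = true
  vecEqᵇ (x V.∷ xs) (y V.∷ ys) = (x ℕ.≡ᵇ y) ∧ vecEqᵇ xs ys

_≤ℤᵇ_ : ℤ → ℤ → Bool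
a ≤ℤᵇ b = ⌊ a ℤP.≤? b ⌋

_<ℤᵇ_ : ℤ → ℤ → Bool
a <ℤᵇ b = ⌊ a ℤP.<? b ⌋

infix 4 _≤ℤᵇ_ _<ℤᵇ_

-- floor division, with the (unused) convention a / 0 = 0
fdiv : ℕ → ℕ → ℕ
fdiv a zero = 0
fdiv a (suc m) = a ℕD./ suc m

nth : {A : Set} → A → List A → ℕ → A
nth d [] _ = d
nth d (x ∷ xs) zero = x
nth d (x ∷ xs) (suc i) = nth d xs i

tuples : {A : Set} → List A → ℕ → List (List A)
tuples xs zero = [] ∷ []
tuples xs (suc k) = L.concatMap (λ t → L.map (λ x → x ∷ t) xs) (tuples xs k)

countᵇ : {A : Set} → (A → Bool) → List A → ℕ
countᵇ p xs = L.length (L.filterᵇ p xs)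

oneTo : ℕ → List ℕ
oneTo n = L.applyUpTo suc n

-- monomial q^a t^b x_1^{e_1} … x_N^{e_N}
Mono : ℕ → Set
Mono N = ℤ × ℤ × Vec ℕ N

monoEqᵇ : ∀ {N} → Mono N → Mono N → Bool
monoEqᵇ (a , b , v) (a' , b' , v') = ⌊ a ℤP.≟ a' ⌋ ∧ ⌊ b ℤP.≟ b' ⌋ ∧ vecEqᵇ v v'

monoMul : ∀ {N} → Mono N → Mono N → Mono N
monoMul (a , b , v) (a' , b' , v') = (a ℤ.+ a' , b ℤ.+ b' , V.zipWith ℕ._+_ v v')

mono1 : ∀ {N} → Mono N
mono1 {N} = (+ 0 , + 0 , V.replicate N 0)

Poly : ℕ → Set
Poly N = List (ℚ × Mono N)

_⊕_ : ∀ {N} → Poly N → Poly N → Poly N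
_⊕_ = _++_

_⊗_ : ∀ {N} → Poly N → Poly N → Poly N
p ⊗ r = L.concatMap (λ { (c , m) → L.map (λ { (c' , m') → (c ℚ.* c' , monoMul m m') }) r }) p

scaleP : ∀ {N} → ℚ → Poly N → Poly N
scaleP c = L.map (λ { (c' , m) → (c ℚ.* c' , m) })

sumP : ∀ {N} → List (Poly N) → Poly N
sumP = L.foldr _⊕_ []

prodP : ∀ {N} → List (Poly N) → Poly N
prodP = L.foldr _⊗_ ((1ℚ , mono1) ∷ [])

constP : ∀ {N} → ℚ → Poly N
constP c = (c , mono1) ∷ []

qtP : ∀ {N} → ℤ → ℤ → Poly N
qtP {N} i j = (1ℚ , (i , j , V.replicate N 0)) ∷ []

coeff : ∀ {N} → Poly N → Mono N → ℚ
coeff p m = L.foldr (λ { (c , m') acc → if monoEqᵇ m' m then c ℚ.+ acc else acc }) 0ℚ p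

_≈P_ : ∀ {N} → Poly N → Poly N → Set
p ≈P r = ∀ m → coeff p m ≡ coeff r m

xMono : ∀ {N} → List (Fin N) → Poly N
xMono {N} is = (1ℚ , (+ 0 , + 0 , V.tabulate (λ j → L.length (L.filter (λ i → i Fin.≟ j) is)))) ∷ []

-- The coefficient ring:  p / M^e  with M = (1-q)(1-t)

Mpoly : ∀ {N} → Poly N
Mpoly = (constP 1ℚ ⊕ scaleP (ℚ.- 1ℚ) (qtP (+ 1) (+ 0)))
      ⊗ (constP 1ℚ ⊕ scaleP (ℚ.- 1ℚ) (qtP (+ 0) (+ 1)))

Mpow : ∀ {N} → ℕ → Poly N
Mpow zero = constP 1ℚ
Mpow (suc e) = Mpoly ⊗ Mpow e

K : ℕ → Set
K N = Poly N × ℕ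

polyK : ∀ {N} → Poly N → K N
polyK p = (p , 0)

0K 1K : ∀ {N} → K N
0K = ([] , 0)
1K = polyK (constP 1ℚ)

_+K_ : ∀ {N} → K N → K N → K N
(p , e) +K (r , f) = ((p ⊗ Mpow f) ⊕ (r ⊗ Mpow e) , e ℕ.+ f)

_*K_ : ∀ {N} → K N → K N → K N
(p , e) *K (r , f) = (p ⊗ r , e ℕ.+ f)

divM : ∀ {N} → K N → K N
divM (p , e) = (p , suc e)

sumK : ∀ {N} → List (K N) → K N
sumK = L.foldr _+K_ 0K

prodK : ∀ {N} → List (K N) → K N
prodK = L.foldr _*K_ 1K

constK : ∀ {N} → ℚ → K N
constK c = polyK (constP c)

signQ : ℕ → ℚ
signQ zero = 1ℚ
signQ (suc n) = ℚ.- signQ n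

signK : ∀ {N} → ℕ → K N
signK n = constK (signQ n)

_≈K_ : ∀ {N} → K N → K N → Set
(p , e) ≈K (r , f) = (p ⊗ Mpow f) ≈P (r ⊗ Mpow e)

infixr 6 _⊕_ _+K_
infixr 7 _⊗_ _*K_
infix 4 _≈P_ _≈K_

-- Symmetric functions (over K) in the power-sum basis:
-- a list of terms  c · p_{a_1} p_{a_2} ⋯ p_{a_r}

SF : ℕ → Set
SF N = List (K N × List ℕ)

oneSF : ∀ {N} → SF N
oneSF = (1K , []) ∷ []

sfScale : ∀ {N} → K N → SF N → SF N
sfScale k = L.map (λ { (c , l) → (k *K c , l) })

sfMul : ∀ {N} → SF N → SF N → SF N
sfMul F G = L.concatMap (λ { (c , l) → L.map (λ { (d , l') → (c *K d , l ++ l') }) G }) F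

sfNeg : ∀ {N} → SF N → SF N
sfNeg = sfScale (signK 1)

sfDivM : ∀ {N} → SF N → SF N
sfDivM = L.map (λ { (c , l) → (divM c , l) })

pEval : ∀ {N} → ℕ → Poly N
pEval {N} a = L.map (λ i → (1ℚ , (+ 0 , + 0 , V.tabulate (λ j → if ⌊ i Fin.≟ j ⌋ then a else 0)))) (L.allFin N)

evalSF : ∀ {N} → SF N → K N
evalSF F = sumK (L.map (λ { (c , l) → c *K polyK (prodP (L.map pEval l)) }) F)

-- elementary symmetric functions in the power-sum basis (Newton's identities
--  n e_n = Σ_{j=1}^n (-1)^{j-1} e_{n-j} p_j);  eList n = [e_n, …, e_0]
eList : ∀ {N} → ℕ → List (SF N)
eList zero = oneSF ∷ []
eList {N} (suc n) = enew ∷ eList n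
  where
  enew : SF N
  enew = sfScale (constK (+ 1 ℚ./ suc n))
           (L.concat (L.zipWith (λ j e → sfScale (signK j) (sfMul e ((1K , suc j ∷ []) ∷ [])))
                                (L.upTo (suc n)) (eList n)))

elem : ∀ {N} → ℕ → SF N
elem n with eList n
... | [] = []
... | e ∷ _ = e

-- p_a[M] = (1 - q^a)(1 - t^a)
pM : ∀ {N} → ℕ → K N
pM a = polyK ((constP 1ℚ ⊕ scaleP (ℚ.- 1ℚ) (qtP (+ a) (+ 0)))
            ⊗ (constP 1ℚ ⊕ scaleP (ℚ.- 1ℚ) (qtP (+ 0) (+ a))))

-- c · p_λ[X + M/z] = Σ c' · p_μ[X] · z^{-j}, as a list of (c', μ, j)
plethExpand : ∀ {N} → K N → List ℕ → List (K N × List ℕ × ℕ)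
plethExpand c [] = (c , [] , 0) ∷ []
plethExpand c (a ∷ as) =
  L.concatMap (λ { (d , μ , j) → (d , a ∷ μ , j) ∷ (d *K pM a , μ , j ℕ.+ a) ∷ [] })
              (plethExpand c as)

-- D_k F[X] = F[X + M/z] Σ_{i≥0} (-z)^i e_i[X] |_{z^k}
Dop : ∀ {N} → ℕ → SF N → SF N
Dop k F = L.concatMap
  (λ { (c , l) → L.concatMap
        (λ { (d , μ , j) → sfMul ((signK (k ℕ.+ j) *K d , μ) ∷ []) (elem (k ℕ.+ j)) })
        (plethExpand c l) })
  F

-- choice of the splitting point (a,b) of the m × n rectangle.
-- Among lattice points (a,b), 0 ≤ a ≤ m, 0 ≤ b ≤ n, with  a·d - b·c > 0  (i.e.
-- n·a - m·b > 0, where (c,d) = (m-a,n-b)) and c ≥ 1, take one minimising the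
-- distance n·a - m·b to the diagonal (first one in lexicographic order).
splitPt : ℕ → ℕ → ℕ × ℕ
splitPt m n = pick (L.concatMap (λ a → L.map (λ b → (a , b)) (L.upTo (suc n))) (L.upTo m)) (0 , 0) 0 false
  where
  pick : List (ℕ × ℕ) → ℕ × ℕ → ℕ → Bool → ℕ × ℕ
  pick [] best v found = best
  pick ((a , b) ∷ rest) best v found =
    if (m ℕ.* b ℕ.<ᵇ n ℕ.* a) ∧ (not found ∨ ((n ℕ.* a ℕ.∸ m ℕ.* b) ℕ.<ᵇ v))
    then pick rest (a , b) (n ℕ.* a ℕ.∸ m ℕ.* b) true
    else pick rest best v found

-- Q_{m,n}, defined by recursion with fuel (fuel = m suffices, since 1 ≤ a, c < m)
Qop : ∀ {N} → ℕ → ℕ → ℕ → SF N → SF N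
Qop fuel zero n F = []
Qop fuel (suc zero) n F = sfScale (signK n) (Dop n F)
Qop zero (suc (suc m)) n F = []
Qop (suc f) (suc (suc m)) n F =
  sfDivM (Qop f c d (Qop f a b F) ++ sfNeg (Qop f a b (Qop f c d F)))
  where
  ab = splitPt (suc (suc m)) n
  a = Data.Product.proj₁ ab
  b = Data.Product.proj₂ ab
  c = suc (suc m) ℕ.∸ a
  d = n ℕ.∸ b

Q1 : (N m n : ℕ) → K N
Q1 N m n = evalSF (Qop {N} m m n oneSF)

descSet : List ℕ → List ℕ
descSet = go 0
  where
  go : ℕ → List ℕ → List ℕ
  go acc [] = []
  go acc (a ∷ []) = []
  go acc (a ∷ b ∷ as) = (acc ℕ.+ a) ∷ go (acc ℕ.+ a) (b ∷ as)

memᵇ : ℕ → List ℕ → Bool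
memᵇ x = anyᵇ (x ℕ.≡ᵇ_)

-- i_1 ≤ i_2 ≤ … with i_j < i_{j+1} whenever j ∈ S  (positions counted from 1)
fundOK : ∀ {N} → List ℕ → ℕ → List (Fin N) → Bool
fundOK S j [] = true
fundOK S j (i ∷ []) = true
fundOK S j (i ∷ i' ∷ is) =
  (if memᵇ j S then Fin.toℕ i ℕ.<ᵇ Fin.toℕ i' else Fin.toℕ i ℕ.≤ᵇ Fin.toℕ i')
  ∧ fundOK S (suc j) (i' ∷ is)

Fund : (N : ℕ) → List ℕ → Poly N
Fund N α = sumP (L.map xMono (L.filterᵇ (fundOK (descSet α) 1) (tuples (L.allFin N) (sumℕ α))))

chopRows : {A : Set} → List ℕ → List A → List (List A)
chopRows [] xs = []
chopRows (r ∷ rs) xs = L.take r xs ∷ chopRows rs (L.drop r xs)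

rowWeak : ∀ {N} → List (Fin N) → Bool
rowWeak [] = true
rowWeak (i ∷ []) = true
rowWeak (i ∷ i' ∷ is) = (Fin.toℕ i ℕ.≤ᵇ Fin.toℕ i') ∧ rowWeak (i' ∷ is)

colStrictPair : ∀ {N} → List (Fin N) → List (Fin N) → Bool
colStrictPair (i ∷ is) (i' ∷ is') = (Fin.toℕ i ℕ.<ᵇ Fin.toℕ i') ∧ colStrictPair is is'
colStrictPair _ _ = true

ssytOK : ∀ {N} → List (List (Fin N)) → Bool
ssytOK [] = true
ssytOK (r ∷ []) = rowWeak r
ssytOK (r ∷ r' ∷ rs) = rowWeak r ∧ colStrictPair r r' ∧ ssytOK (r' ∷ rs)

Schur : (N : ℕ) → List ℕ → Poly N
Schur N λs = sumP (L.map xMono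
  (L.filterᵇ (λ T → ssytOK (chopRows λs T)) (tuples (L.allFin N) (sumℕ λs))))

-- [n]_{q,t} = (q^n - t^n)/(q - t) = Σ_{j=0}^{n-1} q^j t^{n-1-j}
qtNum : ∀ {N} → ℕ → Poly N
qtNum n = sumP (L.map (λ j → qtP (+ j) (+ (n ℕ.∸ 1 ℕ.∸ j))) (L.upTo n))

sqt : ∀ {N} → ℤ → ℤ → Poly N
sqt a b = if (+ 0 ≤ℤᵇ b) ∧ (b ≤ℤᵇ a)
          then qtP b b ⊗ qtNum (ℤ.∣ a ℤ.- b ℤ.+ + 1 ∣)
          else []

-- Σ_{i=lo}^{hi} f(i)  (empty if hi < lo)
ΣZ : ∀ {N} → ℤ → ℤ → (ℤ → Poly N) → Poly N
ΣZ lo hi f = sumP (L.map (λ j → f (lo ℤ.+ + j)) (L.upTo ℤ.∣ (hi ℤ.+ + 1 ℤ.- lo) ℤ.⊔ + 0 ∣))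

-- a lattice path is a list of steps, true = North, false = East
allPaths : ℕ → List (List Bool)
allPaths zero = [] ∷ []
allPaths (suc k) = L.concatMap (λ p → (true ∷ p) ∷ (false ∷ p) ∷ []) (allPaths k)

points : ℕ → ℕ → List Bool → List (ℕ × ℕ)
points x y [] = (x , y) ∷ []
points x y (true ∷ s) = (x , y) ∷ points x (suc y) s
points x y (false ∷ s) = (x , y) ∷ points (suc x) y s

aboveDiag : ℕ → ℕ → List Bool → Bool
aboveDiag m n P = allᵇ (λ { (x , y) → n ℕ.* x ℕ.≤ᵇ m ℕ.* y }) (points 0 0 P)

Dyck : ℕ → ℕ → List (List Bool)
Dyck m n = L.filterᵇ (λ P → (countᵇ (λ s → s) P ℕ.≡ᵇ n) ∧ aboveDiag m n P) (allPaths (m ℕ.+ n))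

northXs : List Bool → List ℕ
northXs = go 0
  where
  go : ℕ → List Bool → List ℕ
  go x [] = []
  go x (true ∷ s) = x ∷ go x s
  go x (false ∷ s) = go (suc x) s

distinctᵇ : List ℕ → Bool
distinctᵇ [] = true
distinctᵇ (x ∷ xs) = not (memᵇ x xs) ∧ distinctᵇ xs

colIncr : List ℕ → List ℕ → Bool
colIncr (x ∷ x' ∷ xs) (w ∷ w' ∷ ws) = (not (x ℕ.≡ᵇ x') ∨ (w ℕ.<ᵇ w')) ∧ colIncr (x' ∷ xs) (w' ∷ ws)
colIncr _ _ = true

-- labellings (car on the i-th north step from the bottom) of a path P
labellings : ℕ → List Bool → List (List ℕ)
labellings n P = L.filterᵇ (λ w → distinctᵇ w ∧ colIncr (northXs P) w) (tuples (oneTo n) n)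

-- a parking function: its path and the list of cars on north steps (bottom-up)
PF : ℕ → ℕ → List (List Bool × List ℕ)
PF m n = L.concatMap (λ P → L.map (λ w → (P , w)) (labellings n P)) (Dyck m n)

-- rank of the cell with lower-left corner (x,y)
rank : ℕ → ℕ → ℕ → ℕ → ℤ
rank m n x y = (+ (m ℕ.* y) ℤ.- + (n ℕ.* x)) ℤ.+ + fdiv (x ℕ.* gcd m n) m

carRanks : ℕ → ℕ → List Bool → List ℕ → List (ℕ × ℤ)
carRanks m n P w = L.zipWith (λ c xy → (c , rank m n (Data.Product.proj₁ xy) (Data.Product.proj₂ xy)))
                            w (L.zipWith _,_ (northXs P) (L.upTo (L.length w)))

rankOf : List (ℕ × ℤ) → ℕ → ℤ
rankOf [] c = + 0
rankOf ((c' , r) ∷ rs) c = if c ℕ.≡ᵇ c' then r else rankOf rs c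

ides : ℕ → ℕ → List Bool → List ℕ → List ℕ
ides m n P w = L.filterᵇ (λ i → rankOf rs i <ℤᵇ rankOf rs (suc i)) (oneTo (n ℕ.∸ 1))
  where rs = carRanks m n P w

compOfSet : ℕ → List ℕ → List ℕ
compOfSet n = go 0
  where
  go : ℕ → List ℕ → List ℕ
  go prev [] = (n ℕ.∸ prev) ∷ []
  go prev (i ∷ is) = (i ℕ.∸ prev) ∷ go i is

pides : ℕ → ℕ → List Bool → List ℕ → List ℕ
pides m n P w = compOfSet n (ides m n P w)

tdinv : ℕ → ℕ → List Bool → List ℕ → ℕ
tdinv m n P w = countᵇ (λ { (i , j) → (i ℕ.<ᵇ j) ∧ (r i <ℤᵇ r j) ∧ (r j <ℤᵇ (r i ℤ.+ + m)) })
                       (L.cartesianProduct (oneTo n) (oneTo n))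
  where
  r : ℕ → ℤ
  r = rankOf (carRanks m n P w)

maxdinv : ℕ → ℕ → List Bool → ℕ
maxdinv m n P = L.foldr ℕ._⊔_ 0 (L.map (tdinv m n P) (labellings n P))

-- λ(P): rows of cells above the path, top row first (English notation)
lamP : List Bool → List ℕ
lamP P = L.reverse (northXs P)

-- pdinv: cells c of λ(P) with arm/(leg+1) ≤ m/n < (arm+1)/leg
pdinv : ℕ → ℕ → List Bool → ℕ
pdinv m n P = sumℕ (L.map (λ r → countᵇ (λ j → cond (arm r j) (leg r j)) (L.upTo (nth 0 lam r)))
                           (L.upTo (L.length lam)))
  where
  lam = lamP P
  arm : ℕ → ℕ → ℕ
  arm r j = nth 0 lam r ℕ.∸ j ℕ.∸ 1
  leg : ℕ → ℕ → ℕ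
  leg r j = countᵇ (λ r' → (r ℕ.<ᵇ r') ∧ (j ℕ.<ᵇ nth 0 lam r')) (L.upTo (L.length lam))
  -- arm/(leg+1) ≤ m/n  and  m/n < (arm+1)/leg   (the latter automatic when leg = 0)
  cond : ℕ → ℕ → Bool
  cond a l = (a ℕ.* n ℕ.≤ᵇ m ℕ.* (l ℕ.+ 1)) ∧ (m ℕ.* l ℕ.<ᵇ n ℕ.* (a ℕ.+ 1))

dinv : ℕ → ℕ → List Bool → List ℕ → ℤ
dinv m n P w = (+ tdinv m n P w ℤ.+ + pdinv m n P) ℤ.- + maxdinv m n P

-- area: full cells between the path and the diagonal
area : ℕ → ℕ → List Bool → ℕ
area m n P = sumℕ (L.zipWith (λ x y → countᵇ (λ x' → (x ℕ.≤ᵇ x') ∧ (n ℕ.* suc x' ℕ.≤ᵇ m ℕ.* y)) (L.upTo m))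
                              (northXs P) (L.upTo n))

ret : ℕ → ℕ → List Bool → ℕ
ret m n P = go (oneTo k)
  where
  k = gcd m n
  m₀ = fdiv m k
  n₀ = fdiv n k
  pts = points 0 0 P
  go : List ℕ → ℕ
  go [] = k
  go (i ∷ is) = if anyᵇ (λ { (x , y) → (x ℕ.≡ᵇ i ℕ.* m₀) ∧ (y ℕ.≡ᵇ i ℕ.* n₀) }) pts then i else go is

-- [r]_{1/t} t^{area} q^{dinv}
weight : ∀ {N} → ℕ → ℕ → List Bool → List ℕ → Poly N
weight m n P w = sumP (L.map (λ j → qtP (dinv m n P w) (+ area m n P ℤ.- + j)) (L.upTo (ret m n P)))

Hmn : (N m n : ℕ) → K N
Hmn N m n = polyK (sumP (L.map (λ { (P , w) → weight m n P w ⊗ Fund N (pides m n P w) }) (PF m n)))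

s3 s21 s111 : (N : ℕ) → Poly N
s3 N = Schur N (3 ∷ [])
s21 N = Schur N (2 ∷ 1 ∷ [])
s111 N = Schur N (1 ∷ 1 ∷ 1 ∷ [])

two : ∀ {N} → Poly N → Poly N
two = scaleP (+ 2 ℚ./ 1)

RHS₁ : (N k : ℕ) → Poly N
RHS₁ N k =
    ΣZ (+ 0) (κ ℤ.- + 1) (λ i → sqt (κ ℤ.+ + 2 ℤ.* i ℤ.- + 1) (κ ℤ.- i ℤ.- + 1)) ⊗ s3 N
  ⊕ ΣZ (+ 0) (κ ℤ.- + 1) (λ i → sqt (κ ℤ.+ + 2 ℤ.* i) (κ ℤ.- i ℤ.- + 1)
                                ⊕ sqt (κ ℤ.+ + 2 ℤ.* i ℤ.+ + 1) (κ ℤ.- i ℤ.- + 1)) ⊗ s21 N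
  ⊕ ΣZ (+ 0) κ (λ i → sqt (κ ℤ.+ + 2 ℤ.* i) (κ ℤ.- i)) ⊗ s111 N
  where κ = + k

RHS₂ : (N k : ℕ) → Poly N
RHS₂ N k =
    ΣZ (+ 0) (κ ℤ.- + 1) (λ i → sqt (κ ℤ.+ + 2 ℤ.* i) (κ ℤ.- i ℤ.- + 1)) ⊗ s3 N
  ⊕ ΣZ (ℤ.- + 1) (κ ℤ.- + 1) (λ i → sqt (κ ℤ.+ + 2 ℤ.* i ℤ.+ + 1) (κ ℤ.- i ℤ.- + 1)
                                   ⊕ sqt (κ ℤ.+ + 2 ℤ.* i ℤ.+ + 2) (κ ℤ.- i ℤ.- + 1)) ⊗ s21 N
  ⊕ ΣZ (+ 0) κ (λ i → sqt (κ ℤ.+ + 2 ℤ.* i ℤ.+ + 1) (κ ℤ.- i)) ⊗ s111 N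
  where κ = + k

RHS₀ : (N k : ℕ) → Poly N
RHS₀ N k =
    ΣZ (+ 0) (κ ℤ.- + 1) (λ i → sqt (κ ℤ.+ + 2 ℤ.* i ℤ.- + 3) (κ ℤ.- i ℤ.- + 1)
                               ⊕ sqt (κ ℤ.+ + 2 ℤ.* i ℤ.- + 2) (κ ℤ.- i ℤ.- + 1)
                               ⊕ sqt (κ ℤ.+ + 2 ℤ.* i ℤ.- + 1) (κ ℤ.- i ℤ.- + 1)) ⊗ s3 N
  ⊕ (sqt (κ ℤ.+ + 1) (κ ℤ.- + 1) ⊕ two (sqt κ (κ ℤ.- + 1)) ⊕ sqt (κ ℤ.- + 1) (κ ℤ.- + 1)
     ⊕ ΣZ (+ 1) (κ ℤ.- + 1) (λ i → sqt (κ ℤ.+ + 2 ℤ.* i ℤ.- + 2) (κ ℤ.- i ℤ.- + 1)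
                                  ⊕ two (sqt (κ ℤ.+ + 2 ℤ.* i ℤ.- + 1) (κ ℤ.- i ℤ.- + 1))
                                  ⊕ two (sqt (κ ℤ.+ + 2 ℤ.* i) (κ ℤ.- i ℤ.- + 1))
                                  ⊕ sqt (κ ℤ.+ + 2 ℤ.* i ℤ.+ + 1) (κ ℤ.- i ℤ.- + 1))) ⊗ s21 N
  ⊕ ΣZ (+ 0) κ (λ i → sqt (κ ℤ.+ + 2 ℤ.* i ℤ.- + 2) (κ ℤ.- i)
                     ⊕ sqt (κ ℤ.+ + 2 ℤ.* i ℤ.- + 1) (κ ℤ.- i)
                     ⊕ sqt (κ ℤ.+ + 2 ℤ.* i) (κ ℤ.- i)) ⊗ s111 N
  where κ = + k

{-# OPTIONS --safe #-}
module Submission where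

-- Operator side.  Q_{m,n} is transposed to act on functionals on power sums
-- (here: evaluation at x_1, …, x_N); on degrees ≤ 3 such a functional is given
-- by its values X, Y, Z on s3, s21, s111.  D_0 is diagonal in the modified
-- Macdonald basis, so the value of Q_{m,3}(1) is, after multiplication by
-- Δ = (q - t)(q² - t)(q - t²), a combination of the pairings with H_3, H_21
-- and H_111 whose coefficients are monomials in q^k and t^k up to factors
-- independent of k.
--
-- Combinatorial side.  A path is given by the two columns (x , x + c) of its
-- upper north steps.  The sum over its labellings is a monomial in q and t times
-- one of four symmetric functions, so the parking function sum is a sum of
-- geometric series over a trapezoid.
--
-- Both sides, and the Schur expansion of the theorem, reduce to the sums
-- Σ_{i<k} (qt)^{k-1-i} [3i+s]_{q,t} for s = 1, 2, 3, whose multiples by Δ are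
-- combinations of the same monomials; Δ is not a zero divisor.

open import Defs
open import Algebra.Bundles using (CommutativeRing)
open import Data.Bool using (Bool; true; false; if_then_else_; _∧_; _∨_; not)
open import Data.Fin as Fin using (Fin)
open import Data.Integer as ℤ using (ℤ)
import Data.Integer.Properties as ℤP
open import Data.List as L using (List; []; _∷_; _++_)
open import Data.Nat as ℕ using (ℕ; zero; suc)
import Data.Nat.Properties as ℕP
open import Data.Nat.Tactic.RingSolver using (solve-∀)
open import Data.Product using (_×_; _,_; proj₁; proj₂)
open import Data.Rational as ℚ using (ℚ; 0ℚ; 1ℚ)
import Data.Rational.Properties as ℚP
open import Data.Unit using (tt)
open import Data.Vec as V using (Vec)
import Data.Vec.Properties as VP
open import Level using (0ℓ)
open import Relation.Binary.PropositionalEquality as ≡ using (_≡_)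
open import Relation.Nullary using (¬_; yes; no; contradiction)

-- On the modified Macdonald polynomial H_mu the operator D_0 has eigenvalue 1 - M B_mu, where B_mu
-- adds up the weights q^i t^j of the cells of mu. Commuting an operator with D_0 and dividing by M
-- therefore multiplies its component from H_mu to H_nu, nu being mu with one more cell, by the
-- weight of that cell. So Q_{j,1} is known for all j at once, all other operators needed are nested
-- commutators of these, and the factors of Δ are the differences of the weights of cells that
-- compete for the same place. Two obstacles shape the code. Symmetric functions are unsorted lists
-- of power-sum terms without a normal form; acting on functionals replaces them by scalars. The
-- coefficients are lists as well, with equality meaning equality of all coefficients, so no
-- identity can be checked by evaluation there. The algebra is done over an arbitrary commutative
-- ring, with q, t, 1/M, q^k and t^k as variables, and is specialised at the end to Laurent
-- polynomials (path side) or their localisation at M (operator side). Division is replaced by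
-- cancelling non-zero-divisors.

-- A reflective solver for identities in commutative rings

module RingSolve where
  open import Data.Bool using (T)
  open import Data.Integer using (+_; -[1+_]; +0)
  open import Data.Fin using (zero; suc)
  open import Data.List using (foldr; map)
  open import Data.Vec as Vec using (Vec; []; _∷_)

  infixl 6 _:+_ _:-_
  infixl 7 _:*_
  infix  8 :-_
  infixr 8 _:^_
  infix  4 _:=_

  data Expr (n : ℕ) : Set where
    var      : Fin n → Expr n
    con      : ℤ → Expr n
    :0 :1    : Expr n
    _:+_ _:*_ : Expr n → Expr n → Expr n
    :-_      : Expr n → Expr n
    _:^_     : Expr n → ℕ → Expr n

  _:-_ : ∀ {n} → Expr n → Expr n → Expr n
  a :- b = a :+ (:- b)

  _:=_ : ∀ {n} → Expr n → Expr n → Expr n × Expr n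
  _:=_ = _,_

  -- Normal forms: sums of integer multiples of monomials, sorted by exponent vector.
  NF : ℕ → Set
  NF n = List (ℤ × Vec ℕ n)

  data Cmp {n} (m m' : Vec ℕ n) : Set where
    lt gt : Cmp m m'
    eq : m ≡ m' → Cmp m m'

  cmp : ∀ {n} (m m' : Vec ℕ n) → Cmp m m'
  cmp [] [] = eq ≡.refl
  cmp (a ∷ m) (b ∷ m') with a ℕ.≡ᵇ b in e | a ℕ.<ᵇ b
  ... | false | true  = lt
  ... | false | false = gt
  ... | true  | _ with cmp m m'
  ...   | lt = lt
  ...   | gt = gt
  ...   | eq p = eq (≡.cong₂ _∷_ (ℕP.≡ᵇ⇒≡ a b (≡.subst T (≡.sym e) tt)) p)

  -- Zero coefficients have to be dropped here, because `isNil` recognises the zero polynomial only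
  -- as the empty list.
  cons : ∀ {n} → ℤ → Vec ℕ n → NF n → NF n
  cons +0 m p = p
  cons c  m p = (c , m) ∷ p

  -- The recursion is split so that every call is structural: the outer function descends in the
  -- first list, the local `go` in the second.
  merge : ∀ {n} → NF n → NF n → NF n
  merge [] r = r
  merge {n} ((c , m) ∷ p) = go
    where
    go : NF n → NF n
    go [] = (c , m) ∷ p
    go ((d , m') ∷ r) with cmp m m'
    ... | lt   = (c , m) ∷ merge p ((d , m') ∷ r)
    ... | gt   = (d , m') ∷ go r
    ... | eq _ = cons (c ℤ.+ d) m (merge p r)

  scale : ∀ {n} → ℤ × Vec ℕ n → NF n → NF n
  scale (c , m) = map (λ { (d , m') → (c ℤ.* d , Vec.zipWith ℕ._+_ m m') })

  mul : ∀ {n} → NF n → NF n → NF n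
  mul []      r = []
  mul (x ∷ p) r = merge (scale x r) (mul p r)

  neg : ∀ {n} → NF n → NF n
  neg = map (λ { (c , m) → (ℤ.- c , m) })

  one : ∀ {n} → NF n
  one {n} = (+ 1 , Vec.replicate n 0) ∷ []

  pow : ∀ {n} → NF n → ℕ → NF n
  pow p zero    = one
  pow p (suc k) = mul p (pow p k)

  unit : ∀ {n} → Fin n → Vec ℕ n
  unit {suc n} zero    = 1 ∷ Vec.replicate n 0
  unit         (suc i) = 0 ∷ unit i

  nf : ∀ {n} → Expr n → NF n
  nf (var i)  = (+ 1 , unit i) ∷ []
  nf {n} (con c) = cons c (Vec.replicate n 0) []
  nf :0       = []
  nf :1       = one
  nf (a :+ b) = merge (nf a) (nf b)
  nf (a :* b) = mul (nf a) (nf b)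
  nf (:- a)   = neg (nf a)
  nf (a :^ k) = pow (nf a) k

  isNil : ∀ {n} → NF n → Bool
  isNil []      = true
  isNil (_ ∷ _) = false

  -- The test runs on syntax with integer coefficients only. A proof of it by `refl` never unfolds
  -- an operation of the ring in which the identity is used.
  eqᵇ : ∀ {n} → Expr n × Expr n → Bool
  eqᵇ (a , b) = isNil (nf (a :- b))

  module Solver (R : CommutativeRing 0ℓ 0ℓ) where
    open CommutativeRing R hiding (zero) renaming (Carrier to A)
    open import Algebra.Properties.Ring ring
    open import Algebra.Properties.CommutativeSemigroup *-commutativeSemigroup
      using () renaming (interchange to *-interchange; x∙yz≈y∙xz to x*yz≈y*xz)
    open import Algebra.Properties.CommutativeSemigroup +-commutativeSemigroup
      using () renaming (interchange to +-interchange; x∙yz≈y∙xz to x+yz≈y+xz)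
    open import Algebra.Properties.Semiring.Exp semiring public using (_^_; ^-homo-*)
    open import Algebra.Properties.Semiring.Mult semiring using (×-homo-+; ×1-homo-*) renaming (_×_ to _×R_)
    open import Relation.Binary.Reasoning.Setoid setoid

    ι : ℤ → A
    ι (+ n)    = n ×R 1#
    ι -[1+ n ] = - (suc n ×R 1#)

    ι-⊖ : ∀ m n → ι (m ℤ.⊖ n) ≈ m ×R 1# - n ×R 1#
    ι-⊖ m zero = sym (trans (+-congˡ -0#≈0#) (+-identityʳ _))
    ι-⊖ zero (suc n) = sym (+-identityˡ _)
    ι-⊖ (suc m) (suc n) = begin
      ι (suc m ℤ.⊖ suc n)                     ≡⟨ ≡.cong ι (ℤP.[1+m]⊖[1+n]≡m⊖n m n) ⟩
      ι (m ℤ.⊖ n)                             ≈⟨ ι-⊖ m n ⟩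
      m ×R 1# - n ×R 1#                       ≈⟨ +-identityˡ _ ⟨
      0# + (m ×R 1# - n ×R 1#)                ≈⟨ +-congʳ (-‿inverseʳ 1#) ⟨
      (1# - 1#) + (m ×R 1# - n ×R 1#)         ≈⟨ +-interchange _ _ _ _ ⟩
      (1# + m ×R 1#) + (- 1# - n ×R 1#)       ≈⟨ +-congˡ (-‿+-comm 1# _) ⟩
      (1# + m ×R 1#) - (1# + n ×R 1#)         ∎

    ι-+ : ∀ a b → ι (a ℤ.+ b) ≈ ι a + ι b
    ι-+ (+ m) (+ n) = ×-homo-+ 1# m n
    ι-+ (+ m) -[1+ n ] = ι-⊖ m (suc n)
    ι-+ -[1+ m ] (+ n) = trans (ι-⊖ n (suc m)) (+-comm _ _)
    ι-+ -[1+ m ] -[1+ n ] = begin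
      - (suc (suc (m ℕ.+ n)) ×R 1#)           ≡⟨ ≡.cong (λ z → - (z ×R 1#)) (≡.cong suc (≡.sym (ℕP.+-suc m n))) ⟩
      - ((suc m ℕ.+ suc n) ×R 1#)             ≈⟨ -‿cong (×-homo-+ 1# (suc m) (suc n)) ⟩
      - (suc m ×R 1# + suc n ×R 1#)           ≈⟨ -‿+-comm _ _ ⟨
      - (suc m ×R 1#) - (suc n ×R 1#)         ∎

    ι-neg : ∀ a → ι (ℤ.- a) ≈ - ι a
    ι-neg +0           = sym -0#≈0#
    ι-neg (+ suc n)    = refl
    ι-neg -[1+ n ]     = sym (-‿involutive _)

    ι-*⁺ : ∀ m b → ι (+ m ℤ.* b) ≈ m ×R 1# * ι b
    ι-*⁺ m (+ n) = begin
      ι (+ m ℤ.* + n)       ≡⟨ ≡.cong ι (≡.sym (ℤP.pos-* m n)) ⟩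
      (m ℕ.* n) ×R 1#       ≈⟨ ×1-homo-* m n ⟩
      m ×R 1# * n ×R 1#     ∎
    ι-*⁺ m -[1+ n ] = begin
      ι (+ m ℤ.* -[1+ n ])          ≡⟨ ≡.cong ι (ℤP.neg-distribʳ-* (+ m) (+ suc n)) ⟨
      ι (ℤ.- (+ m ℤ.* + suc n))     ≈⟨ ι-neg (+ m ℤ.* + suc n) ⟩
      - ι (+ m ℤ.* + suc n)         ≈⟨ -‿cong (ι-*⁺ m (+ suc n)) ⟩
      - (m ×R 1# * suc n ×R 1#)     ≈⟨ -‿distribʳ-* _ _ ⟩
      m ×R 1# * - (suc n ×R 1#)     ∎

    ι-* : ∀ a b → ι (a ℤ.* b) ≈ ι a * ι b
    ι-* (+ m) b = ι-*⁺ m b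
    ι-* -[1+ m ] b = begin
      ι (-[1+ m ] ℤ.* b)            ≡⟨ ≡.cong ι (ℤP.neg-distribˡ-* (+ suc m) b) ⟨
      ι (ℤ.- (+ suc m ℤ.* b))       ≈⟨ ι-neg (+ suc m ℤ.* b) ⟩
      - ι (+ suc m ℤ.* b)           ≈⟨ -‿cong (ι-*⁺ (suc m) b) ⟩
      - (suc m ×R 1# * ι b)         ≈⟨ -‿distribˡ-* _ _ ⟩
      - (suc m ×R 1#) * ι b         ∎

    ⟦_⟧ : ∀ {n} → Expr n → Vec A n → A
    ⟦ var i ⟧ ρ  = Vec.lookup ρ i
    ⟦ con c ⟧ ρ  = ι c
    ⟦ :0 ⟧ ρ     = 0#
    ⟦ :1 ⟧ ρ     = 1#
    ⟦ a :+ b ⟧ ρ = ⟦ a ⟧ ρ + ⟦ b ⟧ ρ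
    ⟦ a :* b ⟧ ρ = ⟦ a ⟧ ρ * ⟦ b ⟧ ρ
    ⟦ :- a ⟧ ρ   = - ⟦ a ⟧ ρ
    ⟦ a :^ k ⟧ ρ = ⟦ a ⟧ ρ ^ k

    mon : ∀ {n} → Vec ℕ n → Vec A n → A
    mon []      []      = 1#
    mon (k ∷ m) (x ∷ ρ) = x ^ k * mon m ρ

    val : ∀ {n} → NF n → Vec A n → A
    val p ρ = foldr (λ { (c , m) s → ι c * mon m ρ + s }) 0# p

    mon-+ : ∀ {n} (m m' : Vec ℕ n) ρ → mon (Vec.zipWith ℕ._+_ m m') ρ ≈ mon m ρ * mon m' ρ
    mon-+ []      []        []      = sym (*-identityˡ 1#)
    mon-+ (a ∷ m) (b ∷ m') (x ∷ ρ) = trans (*-cong (^-homo-* x a b) (mon-+ m m' ρ)) (*-interchange _ _ _ _)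

    mon-0 : ∀ {n} (ρ : Vec A n) → mon (Vec.replicate n 0) ρ ≈ 1#
    mon-0 []      = refl
    mon-0 (x ∷ ρ) = trans (*-identityˡ _) (mon-0 ρ)

    mon-unit : ∀ {n} (i : Fin n) ρ → mon (unit i) ρ ≈ Vec.lookup ρ i
    mon-unit zero    (x ∷ ρ) = trans (*-cong (*-identityʳ x) (mon-0 ρ)) (*-identityʳ x)
    mon-unit (suc i) (x ∷ ρ) = trans (*-identityˡ _) (mon-unit i ρ)

    val-cons : ∀ {n} c m (p : NF n) ρ → val (cons c m p) ρ ≈ ι c * mon m ρ + val p ρ
    val-cons +0          m p ρ = sym (trans (+-congʳ (zeroˡ _)) (+-identityˡ _))
    val-cons (+ suc _)   m p ρ = refl
    val-cons -[1+ _ ]    m p ρ = refl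

    val-merge : ∀ {n} (p r : NF n) ρ → val (merge p r) ρ ≈ val p ρ + val r ρ
    val-merge []            r  ρ = sym (+-identityˡ _)
    val-merge {n} ((c , m) ∷ p) r₀ ρ = go r₀
      where
      go : ∀ r → val (merge ((c , m) ∷ p) r) ρ ≈ val ((c , m) ∷ p) ρ + val r ρ
      go [] = sym (+-identityʳ _)
      go ((d , m') ∷ r) with cmp m m'
      ... | lt = trans (+-congˡ (val-merge p ((d , m') ∷ r) ρ)) (sym (+-assoc _ _ _))
      ... | gt = trans (+-congˡ (go r)) (x+yz≈y+xz _ _ _)
      ... | eq ≡.refl = begin
        val (cons (c ℤ.+ d) m (merge p r)) ρ                 ≈⟨ val-cons (c ℤ.+ d) m _ ρ ⟩
        ι (c ℤ.+ d) * mon m ρ + val (merge p r) ρ            ≈⟨ +-cong (*-congʳ (ι-+ c d)) (val-merge p r ρ) ⟩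
        (ι c + ι d) * mon m ρ + (val p ρ + val r ρ)          ≈⟨ +-congʳ (distribʳ _ _ _) ⟩
        (ι c * mon m ρ + ι d * mon m ρ) + (val p ρ + val r ρ) ≈⟨ +-interchange _ _ _ _ ⟩
        _ ∎

    val-scale : ∀ {n} c m (p : NF n) ρ → val (scale (c , m) p) ρ ≈ (ι c * mon m ρ) * val p ρ
    val-scale c m [] ρ = sym (zeroʳ _)
    val-scale c m ((d , m') ∷ p) ρ = begin
      ι (c ℤ.* d) * mon (Vec.zipWith ℕ._+_ m m') ρ + val (scale (c , m) p) ρ
        ≈⟨ +-cong (trans (*-cong (ι-* c d) (mon-+ m m' ρ)) (*-interchange _ _ _ _)) (val-scale c m p ρ) ⟩
      (ι c * mon m ρ) * (ι d * mon m' ρ) + (ι c * mon m ρ) * val p ρ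
        ≈⟨ distribˡ _ _ _ ⟨
      _ ∎

    val-mul : ∀ {n} (p r : NF n) ρ → val (mul p r) ρ ≈ val p ρ * val r ρ
    val-mul [] r ρ = sym (zeroˡ _)
    val-mul ((c , m) ∷ p) r ρ = begin
      val (merge (scale (c , m) r) (mul p r)) ρ         ≈⟨ val-merge (scale (c , m) r) (mul p r) ρ ⟩
      val (scale (c , m) r) ρ + val (mul p r) ρ         ≈⟨ +-cong (val-scale c m r ρ) (val-mul p r ρ) ⟩
      (ι c * mon m ρ) * val r ρ + val p ρ * val r ρ     ≈⟨ distribʳ _ _ _ ⟨
      _ ∎

    val-neg : ∀ {n} (p : NF n) ρ → val (neg p) ρ ≈ - val p ρ
    val-neg [] ρ = sym -0#≈0#
    val-neg ((c , m) ∷ p) ρ = begin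
      ι (ℤ.- c) * mon m ρ + val (neg p) ρ   ≈⟨ +-cong (trans (*-congʳ (ι-neg c)) (sym (-‿distribˡ-* _ _))) (val-neg p ρ) ⟩
      - (ι c * mon m ρ) - val p ρ           ≈⟨ -‿+-comm _ _ ⟩
      _ ∎

    val-one : ∀ {n} (ρ : Vec A n) → val one ρ ≈ 1#
    val-one ρ = trans (+-identityʳ _) (trans (*-cong (+-identityʳ 1#) (mon-0 ρ)) (*-identityʳ 1#))

    val-pow : ∀ {n} (p : NF n) k ρ → val (pow p k) ρ ≈ val p ρ ^ k
    val-pow p zero    ρ = val-one ρ
    val-pow p (suc k) ρ = trans (val-mul p (pow p k) ρ) (*-congˡ (val-pow p k ρ))

    ^-cong : ∀ {x y} k → x ≈ y → x ^ k ≈ y ^ k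
    ^-cong zero    e = refl
    ^-cong (suc k) e = *-cong e (^-cong k e)

    val-nf : ∀ {n} (e : Expr n) ρ → val (nf e) ρ ≈ ⟦ e ⟧ ρ
    val-nf (var i) ρ  = trans (+-identityʳ _) (trans (*-congʳ (+-identityʳ 1#)) (trans (*-identityˡ _) (mon-unit i ρ)))
    val-nf (con c) ρ  = trans (val-cons c _ [] ρ) (trans (+-identityʳ _) (trans (*-congˡ (mon-0 ρ)) (*-identityʳ _)))
    val-nf :0 ρ       = refl
    val-nf :1 ρ       = val-one ρ
    val-nf (a :+ b) ρ = trans (val-merge (nf a) (nf b) ρ) (+-cong (val-nf a ρ) (val-nf b ρ))
    val-nf (a :* b) ρ = trans (val-mul (nf a) (nf b) ρ) (*-cong (val-nf a ρ) (val-nf b ρ))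
    val-nf (:- a) ρ   = trans (val-neg (nf a) ρ) (-‿cong (val-nf a ρ))
    val-nf (a :^ k) ρ = trans (val-pow (nf a) k ρ) (^-cong k (val-nf a ρ))

    x-y≈0⇒x≈y : ∀ x y → x - y ≈ 0# → x ≈ y
    x-y≈0⇒x≈y x y d = begin
      x               ≈⟨ +-identityʳ x ⟨
      x + 0#          ≈⟨ +-congˡ (-‿inverseˡ y) ⟨
      x + (- y + y)   ≈⟨ +-assoc _ _ _ ⟨
      (x - y) + y     ≈⟨ +-congʳ d ⟩
      0# + y          ≈⟨ +-identityˡ y ⟩
      y               ∎

    sound : ∀ {n} (es : Expr n × Expr n) → eqᵇ es ≡ true → ∀ ρ → ⟦ proj₁ es ⟧ ρ ≈ ⟦ proj₂ es ⟧ ρ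
    sound (a , b) h ρ = x-y≈0⇒x≈y _ _ (trans (sym (val-nf (a :- b) ρ)) (vanish (nf (a :- b)) h))
      where
      vanish : ∀ p → isNil p ≡ true → val p ρ ≈ 0#
      vanish [] _ = refl

    Curry : (n : ℕ) → (Vec A n → Set) → Set
    Curry zero    P = P []
    Curry (suc n) P = ∀ x → Curry n (λ ρ → P (x ∷ ρ))

    curryⁿ : ∀ n {P : Vec A n → Set} → (∀ ρ → P ρ) → Curry n P
    curryⁿ zero    f = f []
    curryⁿ (suc n) f = λ x → curryⁿ n (λ ρ → f (x ∷ ρ))

    -- An equation is entered as a function of its variables; `close` applies it to the variables of
    -- `Expr` in order.
    Vars : ℕ → ℕ → Set
    Vars n zero    = Expr n × Expr n
    Vars n (suc k) = Expr n → Vars n k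

    close : ∀ {n} k → (Fin k → Fin n) → Vars n k → Expr n × Expr n
    close zero    f e = e
    close (suc k) f e = close k (λ i → f (suc i)) (e (var (f zero)))

    solve : ∀ n (f : Vars n n) → eqᵇ (close n (λ i → i) f) ≡ true →
            Curry n (λ ρ → ⟦ proj₁ (close n (λ i → i) f) ⟧ ρ ≈ ⟦ proj₂ (close n (λ i → i) f) ⟧ ρ)
    solve n f h = curryⁿ n (sound (close n (λ i → i) f) h)

-- Laurent polynomials as a commutative ring

module PolynomialRing where
  open RingSolve
  open import Data.Bool using (T)
  open import Data.Integer using (+_)
  open import Data.Nat using (_≤_; z≤n; s≤s)
  open import Data.List using (length)
  open import Function using (_∘_)
  open import Relation.Binary.PropositionalEquality

  private
    module Qs = Solver ℚP.+-*-commutativeRing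
    open Qs using () renaming (solve to solveQ)

  -- The exponent vectors are compared by a private function of Defs, which is
  -- reached here as the comparison of two monomials with trivial q and t.
  vecEq : ∀ {N} → Vec ℕ N → Vec ℕ N → Bool
  vecEq v w = monoEqᵇ (+ 0 , + 0 , v) (+ 0 , + 0 , w)

  vecEq-sound : ∀ {N} (v w : Vec ℕ N) → vecEq v w ≡ true → v ≡ w
  vecEq-sound V.[] V.[] _ = refl
  vecEq-sound (a V.∷ v) (b V.∷ w) h with a ℕ.≡ᵇ b in e
  ... | true = cong₂ V._∷_ (ℕP.≡ᵇ⇒≡ a b (subst T (sym e) tt)) (vecEq-sound v w h)

  ≡ᵇ-refl : ∀ n → (n ℕ.≡ᵇ n) ≡ true
  ≡ᵇ-refl zero    = refl
  ≡ᵇ-refl (suc n) = ≡ᵇ-refl n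

  vecEq-refl : ∀ {N} (v : Vec ℕ N) → vecEq v v ≡ true
  vecEq-refl V.[] = refl
  vecEq-refl (a V.∷ v) rewrite ≡ᵇ-refl a = vecEq-refl v

  monoEq-sound : ∀ {N} (m m' : Mono N) → monoEqᵇ m m' ≡ true → m ≡ m'
  monoEq-sound (a , b , v) (a' , b' , v') h with a ℤP.≟ a' | b ℤP.≟ b'
  ... | yes p | yes r = cong₂ _,_ p (cong₂ _,_ r (vecEq-sound v v' h))

  monoEq-refl : ∀ {N} (m : Mono N) → monoEqᵇ m m ≡ true
  monoEq-refl (a , b , v) with a ℤP.≟ a | b ℤP.≟ b
  ... | yes _ | yes _ = vecEq-refl v
  ... | yes _ | no ¬e = contradiction refl ¬e
  ... | no ¬e | _     = contradiction refl ¬e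

  δ : ∀ {N} → Mono N → Mono N → ℚ
  δ m m' = if monoEqᵇ m' m then 1ℚ else 0ℚ

  -- Pairing of a Laurent polynomial with an arbitrary function on monomials.
  -- It depends only on the coefficients (∫-cong), which turns every ring law
  -- into an interchange of finite sums.
  ∫ : ∀ {N} → Poly N → (Mono N → ℚ) → ℚ
  ∫ []            g = 0ℚ
  ∫ ((c , m) ∷ p) g = c ℚ.* g m ℚ.+ ∫ p g

  ∫-ext : ∀ {N} (p : Poly N) {g h} → (∀ m → g m ≡ h m) → ∫ p g ≡ ∫ p h
  ∫-ext []            e = refl
  ∫-ext ((c , m) ∷ p) e = cong₂ (λ x y → c ℚ.* x ℚ.+ y) (e m) (∫-ext p e)

  coeff-∫ : ∀ {N} (p : Poly N) m → coeff p m ≡ ∫ p (δ m)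
  coeff-∫ [] m = refl
  coeff-∫ ((c , m') ∷ p) m with monoEqᵇ m' m
  ... | true  = cong₂ ℚ._+_ (sym (ℚP.*-identityʳ c)) (coeff-∫ p m)
  ... | false = trans (coeff-∫ p m) (sym (trans (cong (ℚ._+ _) (ℚP.*-zeroʳ c)) (ℚP.+-identityˡ _)))

  ∫-++ : ∀ {N} (p r : Poly N) g → ∫ (p ++ r) g ≡ ∫ p g ℚ.+ ∫ r g
  ∫-++ [] r g = sym (ℚP.+-identityˡ _)
  ∫-++ ((c , m) ∷ p) r g = trans (cong (c ℚ.* g m ℚ.+_) (∫-++ p r g)) (sym (ℚP.+-assoc (c ℚ.* g m) (∫ p g) (∫ r g)))

  ∫-linear : ∀ {N} (p : Poly N) g h → ∫ p (λ m → g m ℚ.+ h m) ≡ ∫ p g ℚ.+ ∫ p h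
  ∫-linear [] g h = refl
  ∫-linear ((c , m) ∷ p) g h rewrite ∫-linear p g h =
    solveQ 5 (λ c x y u v → c :* (x :+ y) :+ (u :+ v) := (c :* x :+ u) :+ (c :* y :+ v)) refl
           c (g m) (h m) (∫ p g) (∫ p h)

  ∫-scale : ∀ {N} (p : Poly N) a g → ∫ p (λ m → a ℚ.* g m) ≡ a ℚ.* ∫ p g
  ∫-scale [] a g = sym (ℚP.*-zeroʳ a)
  ∫-scale ((c , m) ∷ p) a g rewrite ∫-scale p a g =
    solveQ 4 (λ c a x u → c :* (a :* x) :+ a :* u := a :* (c :* x :+ u)) refl c a (g m) (∫ p g)

  ∫-zero : ∀ {N} (p : Poly N) → ∫ p (λ _ → 0ℚ) ≡ 0ℚ
  ∫-zero [] = refl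
  ∫-zero ((c , m) ∷ p) rewrite ∫-zero p = trans (ℚP.+-identityʳ _) (ℚP.*-zeroʳ c)

  ∫-swap : ∀ {N} (p r : Poly N) (g : Mono N → Mono N → ℚ) →
           ∫ p (λ m → ∫ r (λ m' → g m m')) ≡ ∫ r (λ m' → ∫ p (λ m → g m m'))
  ∫-swap [] r g = sym (∫-zero r)
  ∫-swap ((c , m) ∷ p) r g = begin
    c ℚ.* ∫ r (g m) ℚ.+ ∫ p (λ m₁ → ∫ r (g m₁))                   ≡⟨ cong₂ ℚ._+_ (sym (∫-scale r c (g m))) (∫-swap p r g) ⟩
    ∫ r (λ m' → c ℚ.* g m m') ℚ.+ ∫ r (λ m' → ∫ p (λ m₁ → g m₁ m')) ≡⟨ ∫-linear r _ _ ⟨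
    _ ∎
    where open ≡-Reasoning

  ∫-map : ∀ {N} (r : Poly N) (h : ℚ × Mono N → ℚ × Mono N) (a : ℚ) (f : Mono N → Mono N) g →
          (∀ c m → h (c , m) ≡ (a ℚ.* c , f m)) → ∫ (L.map h r) g ≡ a ℚ.* ∫ r (g ∘ f)
  ∫-map [] h a f g e = sym (ℚP.*-zeroʳ a)
  ∫-map ((c , m) ∷ r) h a f g e rewrite e c m | ∫-map r h a f g e =
    solveQ 4 (λ c a x u → a :* c :* x :+ a :* u := a :* (c :* x :+ u)) refl c a (g (f m)) (∫ r (g ∘ f))

  ∫-⊗ : ∀ {N} (p r : Poly N) g → ∫ (p ⊗ r) g ≡ ∫ p (λ m → ∫ r (λ m' → g (monoMul m m')))
  ∫-⊗ [] r g = refl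
  ∫-⊗ ((c , m) ∷ p) r g =
    trans (∫-++ (L.map _ r) (p ⊗ r) g)
          (cong₂ ℚ._+_ (∫-map r _ c (monoMul m) g (λ _ _ → refl)) (∫-⊗ p r g))

  ∫-scaleP : ∀ {N} a (p : Poly N) g → ∫ (scaleP a p) g ≡ a ℚ.* ∫ p g
  ∫-scaleP a p g = ∫-map p _ a (λ m → m) g (λ _ _ → refl)

  remove : ∀ {N} → Mono N → Poly N → Poly N
  remove m []             = []
  remove m ((c , m') ∷ p) = if monoEqᵇ m' m then remove m p else (c , m') ∷ remove m p

  remove-length : ∀ {N} (m : Mono N) p → length (remove m p) ≤ length p
  remove-length m [] = z≤n
  remove-length m ((c , m') ∷ p) with monoEqᵇ m' m
  ... | true  = ℕP.m≤n⇒m≤1+n (remove-length m p)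
  ... | false = s≤s (remove-length m p)

  ∫-remove : ∀ {N} (m : Mono N) p g → ∫ p g ≡ coeff p m ℚ.* g m ℚ.+ ∫ (remove m p) g
  ∫-remove m [] g = sym (trans (ℚP.+-identityʳ _) (ℚP.*-zeroˡ (g m)))
  ∫-remove m ((c , m') ∷ p) g with monoEqᵇ m' m in e
  ... | true rewrite monoEq-sound m' m e | ∫-remove m p g =
    solveQ 4 (λ c x k u → c :* x :+ (k :* x :+ u) := (c :+ k) :* x :+ u) refl
           c (g m) (coeff p m) (∫ (remove m p) g)
  ... | false rewrite ∫-remove m p g =
    solveQ 3 (λ c x u → c :+ (x :+ u) := x :+ (c :+ u)) refl
           (c ℚ.* g m') (coeff p m ℚ.* g m) (∫ (remove m p) g)

  -- A list may repeat a monomial, so it need not be empty when its coefficients vanish. Removing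
  -- all terms with the leading monomial changes the pairing by a multiple of that coefficient,
  -- which is 0, and shortens the list; `n` bounds the length for the induction.
  ∫-vanish : ∀ {N} n (p : Poly N) → length p ≤ n → (∀ m → coeff p m ≡ 0ℚ) → ∀ g → ∫ p g ≡ 0ℚ
  ∫-vanish n [] _ h g = refl
  ∫-vanish {N} (suc n) p@((c , m) ∷ p') (s≤s l) h g = begin
    ∫ p g                                             ≡⟨ ∫-remove m p g ⟩
    coeff p m ℚ.* g m ℚ.+ ∫ (remove m p) g            ≡⟨ cong (λ x → x ℚ.* g m ℚ.+ ∫ (remove m p) g) (h m) ⟩
    0ℚ ℚ.* g m ℚ.+ ∫ (remove m p) g                   ≡⟨ drop (g m) _ ⟩
    ∫ (remove m p) g                                  ≡⟨ ∫-vanish n (remove m p) shorter h' g ⟩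
    0ℚ ∎
    where
    open ≡-Reasoning
    drop : ∀ x y → 0ℚ ℚ.* x ℚ.+ y ≡ y
    drop x y = trans (cong (ℚ._+ y) (ℚP.*-zeroˡ x)) (ℚP.+-identityˡ y)
    shorter : length (remove m p) ≤ n
    shorter rewrite monoEq-refl m = ℕP.≤-trans (remove-length m p') l
    h' : ∀ m₁ → coeff (remove m p) m₁ ≡ 0ℚ
    h' m₁ = begin
      coeff (remove m p) m₁                                   ≡⟨ coeff-∫ (remove m p) m₁ ⟩
      ∫ (remove m p) (δ m₁)                                   ≡⟨ drop (δ m₁ m) _ ⟨
      0ℚ ℚ.* δ m₁ m ℚ.+ ∫ (remove m p) (δ m₁)                 ≡⟨ cong (λ x → x ℚ.* δ m₁ m ℚ.+ ∫ (remove m p) (δ m₁)) (h m) ⟨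
      coeff p m ℚ.* δ m₁ m ℚ.+ ∫ (remove m p) (δ m₁)          ≡⟨ ∫-remove m p (δ m₁) ⟨
      ∫ p (δ m₁)                                              ≡⟨ coeff-∫ p m₁ ⟨
      coeff p m₁                                              ≡⟨ h m₁ ⟩
      0ℚ ∎

  -1ℚ : ℚ
  -1ℚ = ℚ.- 1ℚ

  infix 4 _≋_

  -- A record, because `_≈P_` unfolds to a function type from which `p` and `r` could not be
  -- inferred.
  record _≋_ {N} (p r : Poly N) : Set where
    constructor mk
    field at : p ≈P r

  open _≋_ public

  ∫-≋ : ∀ {N} {p r : Poly N} → (∀ g → ∫ p g ≡ ∫ r g) → p ≋ r
  ∫-≋ {p = p} {r} e = mk (λ m → trans (coeff-∫ p m) (trans (e (δ m)) (sym (coeff-∫ r m))))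

  -- The coefficients of the difference of `p` and `r` all vanish, hence so does its pairing with
  -- every `g`, not only with the indicators `δ`.
  ∫-cong : ∀ {N} {p r : Poly N} → p ≋ r → ∀ g → ∫ p g ≡ ∫ r g
  ∫-cong {p = p} {r} (mk e) g = begin
    ∫ p g                             ≡⟨ solveQ 2 (λ x y → x := (x :+ (:- :1) :* y) :+ y) refl (∫ p g) (∫ r g) ⟩
    (∫ p g ℚ.+ -1ℚ ℚ.* ∫ r g) ℚ.+ ∫ r g ≡⟨ cong (ℚ._+ ∫ r g) (sym (diff g)) ⟩
    ∫ d g ℚ.+ ∫ r g                   ≡⟨ cong (ℚ._+ ∫ r g) (∫-vanish (length d) d ℕP.≤-refl zeros g) ⟩
    0ℚ ℚ.+ ∫ r g                      ≡⟨ ℚP.+-identityˡ _ ⟩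
    ∫ r g ∎
    where
    open ≡-Reasoning
    d = p ⊕ scaleP -1ℚ r
    diff : ∀ g → ∫ d g ≡ ∫ p g ℚ.+ -1ℚ ℚ.* ∫ r g
    diff g = trans (∫-++ p (scaleP -1ℚ r) g) (cong (∫ p g ℚ.+_) (∫-scaleP -1ℚ r g))
    zeros : ∀ m → coeff d m ≡ 0ℚ
    zeros m = begin
      coeff d m                                 ≡⟨ coeff-∫ d m ⟩
      ∫ d (δ m)                                 ≡⟨ diff (δ m) ⟩
      ∫ p (δ m) ℚ.+ -1ℚ ℚ.* ∫ r (δ m)           ≡⟨ cong₂ (λ x y → x ℚ.+ -1ℚ ℚ.* y) (trans (sym (coeff-∫ p m)) (e m)) (sym (coeff-∫ r m)) ⟩
      coeff r m ℚ.+ -1ℚ ℚ.* coeff r m           ≡⟨ solveQ 1 (λ x → x :+ (:- :1) :* x := :0) refl (coeff r m) ⟩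
      0ℚ ∎

  monoMul-comm : ∀ {N} (m m' : Mono N) → monoMul m m' ≡ monoMul m' m
  monoMul-comm (a , b , v) (a' , b' , v') =
    cong₂ _,_ (ℤP.+-comm a a') (cong₂ _,_ (ℤP.+-comm b b') (VP.zipWith-comm ℕP.+-comm v v'))
    where import Data.Vec.Properties as VP

  monoMul-assoc : ∀ {N} (m m' m'' : Mono N) → monoMul (monoMul m m') m'' ≡ monoMul m (monoMul m' m'')
  monoMul-assoc (a , b , v) (a' , b' , v') (a'' , b'' , v'') =
    cong₂ _,_ (ℤP.+-assoc a a' a'') (cong₂ _,_ (ℤP.+-assoc b b' b'') (VP.zipWith-assoc ℕP.+-assoc v v' v''))
    where import Data.Vec.Properties as VP

  monoMul-identityˡ : ∀ {N} (m : Mono N) → monoMul mono1 m ≡ m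
  monoMul-identityˡ (a , b , v) =
    cong₂ _,_ (ℤP.+-identityˡ a) (cong₂ _,_ (ℤP.+-identityˡ b) (VP.zipWith-identityˡ ℕP.+-identityˡ v))
    where import Data.Vec.Properties as VP

  module _ {N : ℕ} where
    open ≡-Reasoning

    ⊕-cong : {p p' r r' : Poly N} → p ≋ p' → r ≋ r' → p ⊕ r ≋ p' ⊕ r'
    ⊕-cong {p} {p'} {r} {r'} e f = ∫-≋ λ g →
      trans (∫-++ p r g) (trans (cong₂ ℚ._+_ (∫-cong e g) (∫-cong f g)) (sym (∫-++ p' r' g)))

    ⊗-cong : {p p' r r' : Poly N} → p ≋ p' → r ≋ r' → p ⊗ r ≋ p' ⊗ r'
    ⊗-cong {p} {p'} {r} {r'} e f = ∫-≋ λ g → begin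
      ∫ (p ⊗ r) g                                    ≡⟨ ∫-⊗ p r g ⟩
      ∫ p (λ m → ∫ r (λ m' → g (monoMul m m')))      ≡⟨ ∫-cong e _ ⟩
      ∫ p' (λ m → ∫ r (λ m' → g (monoMul m m')))     ≡⟨ ∫-ext p' (λ m → ∫-cong f _) ⟩
      ∫ p' (λ m → ∫ r' (λ m' → g (monoMul m m')))    ≡⟨ ∫-⊗ p' r' g ⟨
      ∫ (p' ⊗ r') g ∎

    ⊕-comm : (p r : Poly N) → p ⊕ r ≋ r ⊕ p
    ⊕-comm p r = ∫-≋ λ g → trans (∫-++ p r g) (trans (ℚP.+-comm (∫ p g) (∫ r g)) (sym (∫-++ r p g)))

    ⊕-assoc : (p r s : Poly N) → (p ⊕ r) ⊕ s ≋ p ⊕ (r ⊕ s)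
    ⊕-assoc p r s = ∫-≋ λ g → cong (λ x → ∫ x g) (LP.++-assoc p r s)
      where import Data.List.Properties as LP

    ⊗-comm : (p r : Poly N) → p ⊗ r ≋ r ⊗ p
    ⊗-comm p r = ∫-≋ λ g → begin
      ∫ (p ⊗ r) g                                  ≡⟨ ∫-⊗ p r g ⟩
      ∫ p (λ m → ∫ r (λ m' → g (monoMul m m')))    ≡⟨ ∫-swap p r _ ⟩
      ∫ r (λ m' → ∫ p (λ m → g (monoMul m m')))    ≡⟨ ∫-ext r (λ m' → ∫-ext p (λ m → cong g (monoMul-comm m m'))) ⟩
      ∫ r (λ m' → ∫ p (λ m → g (monoMul m' m)))    ≡⟨ ∫-⊗ r p g ⟨
      ∫ (r ⊗ p) g ∎

    ⊗-assoc : (p r s : Poly N) → (p ⊗ r) ⊗ s ≋ p ⊗ (r ⊗ s)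
    ⊗-assoc p r s = ∫-≋ λ g → begin
      ∫ ((p ⊗ r) ⊗ s) g
        ≡⟨ trans (∫-⊗ (p ⊗ r) s g) (∫-⊗ p r _) ⟩
      ∫ p (λ m → ∫ r (λ m' → ∫ s (λ m'' → g (monoMul (monoMul m m') m''))))
        ≡⟨ ∫-ext p (λ m → ∫-ext r (λ m' → ∫-ext s (λ m'' → cong g (monoMul-assoc m m' m'')))) ⟩
      ∫ p (λ m → ∫ r (λ m' → ∫ s (λ m'' → g (monoMul m (monoMul m' m'')))))
        ≡⟨ trans (∫-⊗ p (r ⊗ s) g) (∫-ext p (λ m → ∫-⊗ r s _)) ⟨
      ∫ (p ⊗ (r ⊗ s)) g ∎

    ⊗-identityˡ : (p : Poly N) → constP 1ℚ ⊗ p ≋ p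
    ⊗-identityˡ p = ∫-≋ λ g → begin
      ∫ (constP 1ℚ ⊗ p) g                       ≡⟨ ∫-⊗ (constP 1ℚ) p g ⟩
      1ℚ ℚ.* ∫ p (λ m → g (monoMul mono1 m)) ℚ.+ 0ℚ ≡⟨ trans (ℚP.+-identityʳ _) (ℚP.*-identityˡ _) ⟩
      ∫ p (λ m → g (monoMul mono1 m))           ≡⟨ ∫-ext p (λ m → cong g (monoMul-identityˡ m)) ⟩
      ∫ p g ∎

    ⊗-distribʳ : (p r s : Poly N) → (r ⊕ s) ⊗ p ≋ (r ⊗ p) ⊕ (s ⊗ p)
    ⊗-distribʳ p r s = ∫-≋ λ g → begin
      ∫ ((r ⊕ s) ⊗ p) g              ≡⟨ trans (∫-⊗ (r ⊕ s) p g) (∫-++ r s _) ⟩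
      _                              ≡⟨ cong₂ ℚ._+_ (∫-⊗ r p g) (∫-⊗ s p g) ⟨
      ∫ (r ⊗ p) g ℚ.+ ∫ (s ⊗ p) g    ≡⟨ ∫-++ (r ⊗ p) (s ⊗ p) g ⟨
      _ ∎

    scaleP-cong : ∀ a {p r : Poly N} → p ≋ r → scaleP a p ≋ scaleP a r
    scaleP-cong a {p} {r} e = ∫-≋ λ g →
      trans (∫-scaleP a p g) (trans (cong (a ℚ.*_) (∫-cong e g)) (sym (∫-scaleP a r g)))

    ⊕-inverseˡ : (p : Poly N) → scaleP -1ℚ p ⊕ p ≋ []
    ⊕-inverseˡ p = ∫-≋ λ g → begin
      ∫ (scaleP -1ℚ p ⊕ p) g          ≡⟨ trans (∫-++ (scaleP -1ℚ p) p g) (cong (ℚ._+ ∫ p g) (∫-scaleP -1ℚ p g)) ⟩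
      -1ℚ ℚ.* ∫ p g ℚ.+ ∫ p g         ≡⟨ solveQ 1 (λ x → (:- :1) :* x :+ x := :0) refl (∫ p g) ⟩
      0ℚ ∎

    polyRing : CommutativeRing 0ℓ 0ℓ
    polyRing = record
      { Carrier = Poly N
      ; _≈_ = _≋_
      ; _+_ = _⊕_
      ; _*_ = _⊗_
      ; -_ = scaleP -1ℚ
      ; 0# = []
      ; 1# = constP 1ℚ
      ; isCommutativeRing = record
        { isRing = record
          { +-isAbelianGroup = record
            { isGroup = record
              { isMonoid = record
                { isSemigroup = record
                  { isMagma = record
                    { isEquivalence = record
                      { refl = mk (λ _ → refl)
                      ; sym = λ e → mk (λ m → sym (at e m))
                      ; trans = λ e f → mk (λ m → trans (at e m) (at f m)) }
                    ; ∙-cong = ⊕-cong }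
                  ; assoc = ⊕-assoc }
                ; identity = (λ p → mk (λ _ → refl)) , (λ p → ∫-≋ λ g → trans (∫-++ p [] g) (ℚP.+-identityʳ _)) }
              ; inverse = ⊕-inverseˡ , (λ p → ∫-≋ λ g → trans (∫-cong (⊕-comm p (scaleP -1ℚ p)) g) (∫-cong (⊕-inverseˡ p) g))
              ; ⁻¹-cong = scaleP-cong -1ℚ }
            ; comm = ⊕-comm }
          ; *-cong = ⊗-cong
          ; *-assoc = ⊗-assoc
          ; *-identity = ⊗-identityˡ , (λ p → ∫-≋ λ g → trans (∫-cong (⊗-comm p (constP 1ℚ)) g) (∫-cong (⊗-identityˡ p) g))
          ; distrib = (λ p r s → ∫-≋ λ g → trans (∫-cong (⊗-comm p (r ⊕ s)) g) (trans (∫-cong (⊗-distribʳ p r s) g)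
                        (∫-cong (⊕-cong (⊗-comm r p) (⊗-comm s p)) g)))
                    , ⊗-distribʳ }
        ; *-comm = ⊗-comm } }

-- Non-zero-divisors and localisation

module Localisation where
  open RingSolve
  open import Relation.Binary.PropositionalEquality using (cong)

  module Cancel (R : CommutativeRing 0ℓ 0ℓ) where
    open CommutativeRing R hiding (zero) renaming (Carrier to A)
    open Solver R using (solve)

    record Cancellable (d : A) : Set where
      constructor mkCancel
      field cancel : ∀ f → d * f ≈ 0# → f ≈ 0#

    open Cancellable public

    *-cancellable : ∀ {d e} → Cancellable d → Cancellable e → Cancellable (d * e)
    *-cancellable c c' = mkCancel λ f h → cancel c' f (cancel c _ (trans (sym (*-assoc _ _ f)) h))

    cancellable-resp : ∀ {d e} → d ≈ e → Cancellable e → Cancellable d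
    cancellable-resp h c = mkCancel λ f z → cancel c f (trans (*-congʳ (sym h)) z)

    1-cancellable : Cancellable 1#
    1-cancellable = mkCancel λ f h → trans (sym (*-identityˡ f)) h

    swap-cancellable : ∀ {a b} → Cancellable (a - b) → Cancellable (b - a)
    swap-cancellable {a} {b} c = mkCancel λ f h →
      cancel c f (trans (solve 3 (λ a b f → (a :- b) :* f := :- ((b :- a) :* f)) ≡.refl a b f)
                        (trans (-‿cong h) (solve 0 (:- :0 := :0) ≡.refl)))

    difference-absorbs : ∀ a b f → (a - b) * f ≈ 0# → a * f ≈ b * f
    difference-absorbs a b f h = x-y≈0⇒x≈y _ _ (trans (solve 3 (λ a b f → a :* f :- b :* f := (a :- b) :* f) ≡.refl a b f) h)
      where open Solver R using (x-y≈0⇒x≈y)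

  -- Fractions p / D e, where D e stands for the e-th power of a non-zero-divisor.
  module Localise (R : CommutativeRing 0ℓ 0ℓ) (D : ℕ → CommutativeRing.Carrier R)
    (D-0 : CommutativeRing._≈_ R (D 0) (CommutativeRing.1# R))
    (D-+ : ∀ e f → CommutativeRing._≈_ R (D (e ℕ.+ f)) (CommutativeRing._*_ R (D e) (D f)))
    (D-cancel : ∀ e f → CommutativeRing._≈_ R (CommutativeRing._*_ R (D e) f) (CommutativeRing.0# R) →
                CommutativeRing._≈_ R f (CommutativeRing.0# R))
    where

    open CommutativeRing R hiding (zero) renaming (Carrier to A)
    open Solver R using (solve; x-y≈0⇒x≈y)
    open import Algebra.Properties.Ring ring using (-‿distribˡ-*)

    Frac : Set
    Frac = A × ℕ

    0ᴸ 1ᴸ : Frac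
    0ᴸ = (0# , 0)
    1ᴸ = (1# , 0)

    -- Exponents are added and never reduced. With `D = Mpow` these operations are `_+K_` and `_*K_`
    -- by definition, so results about `Frac` apply to `K` directly.
    _+ᴸ_ _*ᴸ_ : Frac → Frac → Frac
    (p , e) +ᴸ (r , f) = (p * D f + r * D e , e ℕ.+ f)
    (p , e) *ᴸ (r , f) = (p * r , e ℕ.+ f)

    infixr 6 _+ᴸ_
    infixr 7 _*ᴸ_
    infix 4 _≈ᴸ_

    record _≈ᴸ_ (x y : Frac) : Set where
      constructor mkᴸ
      field atᴸ : proj₁ x * D (proj₂ y) ≈ proj₁ y * D (proj₂ x)

    open _≈ᴸ_ public

    private
      open import Relation.Binary.Reasoning.Setoid setoid

      -- Cross-multiplication through the middle fraction gives the equation only up to the factor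
      -- `D f`; this is where `D-cancel` enters.
      transᴸ : ∀ {x y z} → x ≈ᴸ y → y ≈ᴸ z → x ≈ᴸ z
      transᴸ {p , e} {r , f} {s , g} (mkᴸ h) (mkᴸ h') = mkᴸ (x-y≈0⇒x≈y _ _ (D-cancel f _ (begin
        F * (p * G - s * E)         ≈⟨ solve 5 (λ p s E F G → F :* (p :* G :- s :* E) := (p :* F) :* G :- (s :* F) :* E) ≡.refl p s E F G ⟩
        (p * F) * G - (s * F) * E   ≈⟨ +-cong (*-congʳ h) (-‿cong (*-congʳ (sym h'))) ⟩
        (r * E) * G - (r * G) * E   ≈⟨ solve 3 (λ r E G → r :* E :* G :- r :* G :* E := :0) ≡.refl r E G ⟩
        0#                            ∎)))
        where
        E = D e
        F = D f
        G = D g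

      +ᴸ-cong : ∀ {x x' y y'} → x ≈ᴸ x' → y ≈ᴸ y' → x +ᴸ y ≈ᴸ x' +ᴸ y'
      +ᴸ-cong {p , e} {p' , e'} {r , f} {r' , f'} (mkᴸ h) (mkᴸ h') = mkᴸ (begin
        (p * F + r * E) * D (e' ℕ.+ f')   ≈⟨ *-congˡ (D-+ e' f') ⟩
        (p * F + r * E) * (E' * F')
          ≈⟨ solve 6 (λ p r E F E' F' → (p :* F :+ r :* E) :* (E' :* F') := (p :* E') :* (F :* F') :+ (r :* F') :* (E :* E')) ≡.refl p r E F E' F' ⟩
        (p * E') * (F * F') + (r * F') * (E * E')   ≈⟨ +-cong (*-congʳ h) (*-congʳ h') ⟩
        (p' * E) * (F * F') + (r' * F) * (E * E')
          ≈⟨ solve 6 (λ p r E F E' F' → (p :* E) :* (F :* F') :+ (r :* F) :* (E :* E') := (p :* F' :+ r :* E') :* (E :* F)) ≡.refl p' r' E F E' F' ⟩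
        (p' * F' + r' * E') * (E * F)        ≈⟨ *-congˡ (D-+ e f) ⟨
        _ ∎)
        where
        E = D e
        F = D f
        E' = D e'
        F' = D f'

      *ᴸ-cong : ∀ {x x' y y'} → x ≈ᴸ x' → y ≈ᴸ y' → x *ᴸ y ≈ᴸ x' *ᴸ y'
      *ᴸ-cong {p , e} {p' , e'} {r , f} {r' , f'} (mkᴸ h) (mkᴸ h') = mkᴸ (begin
        (p * r) * D (e' ℕ.+ f')           ≈⟨ *-congˡ (D-+ e' f') ⟩
        (p * r) * (E' * F')                  ≈⟨ solve 4 (λ p r E' F' → (p :* r) :* (E' :* F') := (p :* E') :* (r :* F')) ≡.refl p r E' F' ⟩
        (p * E') * (r * F')                  ≈⟨ *-cong h h' ⟩
        (p' * E) * (r' * F)                  ≈⟨ solve 4 (λ p r E' F' → (p :* r) :* (E' :* F') := (p :* E') :* (r :* F')) ≡.refl p' r' E F ⟨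
        (p' * r') * (E * F)                  ≈⟨ *-congˡ (D-+ e f) ⟨
        _ ∎)
        where
        E = D e
        F = D f
        E' = D e'
        F' = D f'

      +ᴸ-assoc : ∀ x y z → (x +ᴸ y) +ᴸ z ≈ᴸ x +ᴸ (y +ᴸ z)
      +ᴸ-assoc (p , e) (r , f) (s , g) = mkᴸ (begin
        ((p * F + r * E) * G + s * D (e ℕ.+ f)) * D (e ℕ.+ (f ℕ.+ g))
          ≈⟨ *-cong (+-congˡ (*-congˡ (D-+ e f))) (reflexive (cong D (≡.sym (ℕP.+-assoc e f g)))) ⟩
        ((p * F + r * E) * G + s * (E * F)) * D ((e ℕ.+ f) ℕ.+ g)
          ≈⟨ *-congʳ (solve 6 (λ p r s E F G → (p :* F :+ r :* E) :* G :+ s :* (E :* F) := p :* (F :* G) :+ (r :* G :+ s :* F) :* E) ≡.refl p r s E F G) ⟩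
        (p * (F * G) + (r * G + s * F) * E) * D ((e ℕ.+ f) ℕ.+ g)
          ≈⟨ *-congʳ (+-congʳ (*-congˡ (D-+ f g))) ⟨
        _ ∎)
        where
        E = D e
        F = D f
        G = D g

      +ᴸ-comm : ∀ x y → x +ᴸ y ≈ᴸ y +ᴸ x
      +ᴸ-comm (p , e) (r , f) = mkᴸ (*-cong (+-comm _ _) (reflexive (cong D (ℕP.+-comm f e))))

      *ᴸ-assoc : ∀ x y z → (x *ᴸ y) *ᴸ z ≈ᴸ x *ᴸ (y *ᴸ z)
      *ᴸ-assoc (p , e) (r , f) (s , g) = mkᴸ (*-cong (*-assoc p r s) (reflexive (cong D (≡.sym (ℕP.+-assoc e f g)))))

      *ᴸ-comm : ∀ x y → x *ᴸ y ≈ᴸ y *ᴸ x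
      *ᴸ-comm (p , e) (r , f) = mkᴸ (*-cong (*-comm _ _) (reflexive (cong D (ℕP.+-comm f e))))

      +ᴸ-identityˡ : ∀ x → 0ᴸ +ᴸ x ≈ᴸ x
      +ᴸ-identityˡ (p , e) = mkᴸ (*-congʳ (trans (+-congˡ (trans (*-congˡ D-0) (*-identityʳ p))) (trans (+-congʳ (zeroˡ _)) (+-identityˡ p))))

      *ᴸ-identityˡ : ∀ x → 1ᴸ *ᴸ x ≈ᴸ x
      *ᴸ-identityˡ (p , e) = mkᴸ (*-congʳ (*-identityˡ p))

      +ᴸ-inverseˡ : ∀ x → (- proj₁ x , proj₂ x) +ᴸ x ≈ᴸ 0ᴸ
      +ᴸ-inverseˡ (p , e) = mkᴸ (solve 4 (λ p E D₀ D₁ → (:- p :* E :+ p :* E) :* D₀ := :0 :* D₁) ≡.refl p (D e) (D 0) (D (e ℕ.+ e)))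

      distribʳᴸ : ∀ x y z → (y +ᴸ z) *ᴸ x ≈ᴸ (y *ᴸ x) +ᴸ (z *ᴸ x)
      distribʳᴸ (p , e) (r , f) (s , g) = mkᴸ (begin
        ((r * G + s * F) * p) * D ((f ℕ.+ e) ℕ.+ (g ℕ.+ e))
          ≈⟨ *-congˡ (trans (D-+ (f ℕ.+ e) (g ℕ.+ e)) (*-cong (D-+ f e) (D-+ g e))) ⟩
        ((r * G + s * F) * p) * ((F * E) * (G * E))
          ≈⟨ solve 6 (λ p r s E F G → ((r :* G :+ s :* F) :* p) :* ((F :* E) :* (G :* E)) := ((r :* p) :* (G :* E) :+ (s :* p) :* (F :* E)) :* ((F :* G) :* E)) ≡.refl p r s E F G ⟩
        ((r * p) * (G * E) + (s * p) * (F * E)) * ((F * G) * E)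
          ≈⟨ *-cong (+-cong (*-congˡ (D-+ g e)) (*-congˡ (D-+ f e))) (trans (D-+ (f ℕ.+ g) e) (*-congʳ (D-+ f g))) ⟨
        _ ∎)
        where
        E = D e
        F = D f
        G = D g

    fractionRing : CommutativeRing 0ℓ 0ℓ
    fractionRing = record
      { Carrier = Frac
      ; _≈_ = _≈ᴸ_
      ; _+_ = _+ᴸ_
      ; _*_ = _*ᴸ_
      ; -_ = λ x → - proj₁ x , proj₂ x
      ; 0# = 0ᴸ
      ; 1# = 1ᴸ
      ; isCommutativeRing = record
        { isRing = record
          { +-isAbelianGroup = record
            { isGroup = record
              { isMonoid = record
                { isSemigroup = record
                  { isMagma = record
                    { isEquivalence = record
                      { refl = mkᴸ refl
                      ; sym = λ h → mkᴸ (sym (atᴸ h))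
                      ; trans = transᴸ }
                    ; ∙-cong = +ᴸ-cong }
                  ; assoc = +ᴸ-assoc }
                ; identity = +ᴸ-identityˡ , (λ x → transᴸ (+ᴸ-comm x 0ᴸ) (+ᴸ-identityˡ x)) }
              ; inverse = +ᴸ-inverseˡ , (λ x → transᴸ (+ᴸ-comm x _) (+ᴸ-inverseˡ x))
              ; ⁻¹-cong = λ { {p , e} {r , f} (mkᴸ h) → mkᴸ (trans (sym (-‿distribˡ-* p _)) (trans (-‿cong h) (-‿distribˡ-* r _))) } }
            ; comm = +ᴸ-comm }
          ; *-cong = *ᴸ-cong
          ; *-assoc = *ᴸ-assoc
          ; *-identity = *ᴸ-identityˡ , (λ x → transᴸ (*ᴸ-comm x 1ᴸ) (*ᴸ-identityˡ x))
          ; distrib = (λ x y z → transᴸ (*ᴸ-comm x (y +ᴸ z)) (transᴸ (distribʳᴸ x y z) (+ᴸ-cong (*ᴸ-comm y x) (*ᴸ-comm z x))))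
                    , distribʳᴸ }
        ; *-comm = *ᴸ-comm } }

-- Cancellation of differences of monomials, and of powers of M

module CoefficientRing where
  open PolynomialRing
  open Localisation
  open import Data.Integer using (+_; -[1+_])
  import Algebra.Properties.AbelianGroup ℤP.+-0-abelianGroup as ℤG
  open import Data.Nat using (s≤s; z≤n)
  open import Relation.Binary.PropositionalEquality using (cong; cong₂; subst)

  module _ {N : ℕ} where
    private
      module P = CommutativeRing (polyRing {N})
    open Cancel (polyRing {N}) public

    shift : ℤ → ℤ → Mono N → Mono N
    shift i j (a , b , v) = (i ℤ.+ a , j ℤ.+ b , v)

    monoMul-shift : ∀ i j m → monoMul (i , j , V.replicate N 0) m ≡ shift i j m
    monoMul-shift i j (a , b , v) = cong (λ z → _ , _ , z) (VP.zipWith-identityˡ ℕP.+-identityˡ v)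

    monoEq-shift : ∀ i j m m' → monoEqᵇ (shift i j m') (shift i j m) ≡ monoEqᵇ m' m
    monoEq-shift i j m@(a , b , v) m'@(a' , b' , v') with monoEqᵇ m' m in e
    ... | true = ≡.trans (cong (λ z → monoEqᵇ (shift i j z) (shift i j m)) (monoEq-sound m' m e)) (monoEq-refl (shift i j m))
    ... | false with monoEqᵇ (shift i j m') (shift i j m) in e'
    ...   | false = ≡.refl
    ...   | true with monoEq-sound (shift i j m') (shift i j m) e'
    ...     | s = contradiction (≡.trans (≡.sym e) (≡.trans (cong (λ z → monoEqᵇ z m) m'≡m) (monoEq-refl m))) λ ()
      where
      m'≡m : m' ≡ m
      m'≡m = cong₂ _,_ (ℤG.∙-cancelˡ i _ _ (cong proj₁ s))
                       (cong₂ _,_ (ℤG.∙-cancelˡ j _ _ (cong (λ z → proj₁ (proj₂ z)) s)) (cong (λ z → proj₂ (proj₂ z)) s))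

    coeff-qtP-⊗ : ∀ i j (f : Poly N) m → coeff (qtP i j ⊗ f) (shift i j m) ≡ coeff f m
    coeff-qtP-⊗ i j f m = begin
      coeff (qtP i j ⊗ f) (shift i j m)            ≡⟨ ≡.trans (coeff-∫ (qtP i j ⊗ f) _) (∫-⊗ (qtP i j) f _) ⟩
      1ℚ ℚ.* ∫ f (λ m' → δ (shift i j m) (monoMul (i , j , V.replicate N 0) m')) ℚ.+ 0ℚ
                                                   ≡⟨ ≡.trans (ℚP.+-identityʳ _) (ℚP.*-identityˡ _) ⟩
      ∫ f (λ m' → δ (shift i j m) (monoMul (i , j , V.replicate N 0) m'))
        ≡⟨ ∫-ext f (λ m' → cong (if_then 1ℚ else 0ℚ)
             (≡.trans (cong (λ z → monoEqᵇ z (shift i j m)) (monoMul-shift i j m')) (monoEq-shift i j m m'))) ⟩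
      ∫ f (δ m)                                    ≡⟨ coeff-∫ f m ⟨
      coeff f m ∎
      where open ≡.≡-Reasoning

    module _ (ℓ : Mono N → ℤ) where

      degBound : Poly N → ℕ
      degBound []            = 0
      degBound ((c , m) ∷ f) = ℤ.∣ ℓ m ∣ ℕ.⊔ degBound f

      i≤∣i∣ : ∀ i → i ℤ.≤ + ℤ.∣ i ∣
      i≤∣i∣ (+ n)    = ℤP.≤-refl
      i≤∣i∣ -[1+ n ] = ℤ.-≤+

      -i≤∣i∣ : ∀ i → ℤ.- i ℤ.≤ + ℤ.∣ i ∣
      -i≤∣i∣ i = subst (λ z → ℤ.- i ℤ.≤ + z) (ℤP.∣-i∣≡∣i∣ i) (i≤∣i∣ (ℤ.- i))

      coeff-beyond : ∀ f m → + degBound f ℤ.< ℓ m → coeff f m ≡ 0ℚ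
      coeff-beyond [] m _ = ≡.refl
      coeff-beyond ((c , m') ∷ f) m h with monoEqᵇ m' m in e
      ... | false = coeff-beyond f m (ℤP.≤-<-trans (ℤ.+≤+ (ℕP.m≤n⊔m _ _)) h)
      ... | true rewrite monoEq-sound m' m e =
        contradiction (ℤP.<-≤-trans (ℤP.≤-<-trans (ℤ.+≤+ (ℕP.m≤m⊔n _ _)) h) (i≤∣i∣ (ℓ m))) (ℤP.<-irrefl ≡.refl)

      -- A finite sum cannot be invariant under a translation that raises a degree.
      invariant⇒0 : ∀ f (s : Mono N → Mono N) → (∀ m → ℤ.suc (ℓ m) ℤ.≤ ℓ (s m)) →
                    (∀ m → coeff f (s m) ≡ coeff f m) → f ≋ []
      invariant⇒0 f s up inv = mk λ m → ≡.trans (≡.sym (iter-inv (n m) m)) (coeff-beyond f (iter (n m) m) (far m))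
        where
        iter : ℕ → Mono N → Mono N
        iter zero    m = m
        iter (suc n) m = s (iter n m)
        iter-inv : ∀ k m → coeff f (iter k m) ≡ coeff f m
        iter-inv zero    m = ≡.refl
        iter-inv (suc k) m = ≡.trans (inv (iter k m)) (iter-inv k m)
        climb : ∀ k m → + k ℤ.+ ℓ m ℤ.≤ ℓ (iter k m)
        climb zero    m = ℤP.≤-reflexive (ℤP.+-identityˡ _)
        climb (suc k) m = ℤP.≤-trans (ℤP.≤-trans (ℤP.≤-reflexive (ℤP.+-assoc (+ 1) (+ k) (ℓ m))) (ℤP.+-monoʳ-≤ (+ 1) (climb k m))) (up (iter k m))
        n : Mono N → ℕ
        -- Enough steps to climb from `ℓ m`, which may be negative, past every degree that occurs in
        -- `f`.
        n m = suc (degBound f ℕ.+ ℤ.∣ ℓ m ∣)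
        far : ∀ m → + degBound f ℤ.< ℓ (iter (n m) m)
        far m = ℤP.<-≤-trans (ℤP.≤-<-trans (ℤP.≤-reflexive lem) (ℤP.+-monoˡ-< (ℓ m) (ℤP.≤-<-trans (ℤP.+-monoʳ-≤ (+ degBound f) (-i≤∣i∣ (ℓ m))) (ℤ.+<+ ℕP.≤-refl)))) (climb (n m) m)
          where
          lem : + degBound f ≡ + degBound f ℤ.+ ℤ.- ℓ m ℤ.+ ℓ m
          lem = ≡.sym (≡.trans (ℤP.+-assoc (+ degBound f) (ℤ.- ℓ m) (ℓ m)) (≡.trans (cong (λ z → + degBound f ℤ.+ z) (ℤP.+-inverseˡ (ℓ m))) (ℤP.+-identityʳ _)))

    module _ (i j i' j' : ℤ) where

      private
        s : Mono N → Mono N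
        s = shift (ℤ.- i' ℤ.+ i) (ℤ.- j' ℤ.+ j)

      shift-split : ∀ m → shift i' j' (s m) ≡ shift i j m
      shift-split (a , b , v) = cong₂ _,_ (lem i' i a) (cong (_, v) (lem j' j b))
        where
        lem : ∀ x y a → x ℤ.+ (ℤ.- x ℤ.+ y ℤ.+ a) ≡ y ℤ.+ a
        lem x y a = ≡.trans (cong (λ z → x ℤ.+ z) (ℤP.+-assoc (ℤ.- x) y a))
          (≡.trans (≡.sym (ℤP.+-assoc x (ℤ.- x) _)) (≡.trans (cong (λ z → z ℤ.+ (y ℤ.+ a)) (ℤP.+-inverseʳ x)) (ℤP.+-identityˡ _)))

      -- Since both monomials have the same product with `f`, the coefficients of `f` are constant
      -- along the translation by the difference of their exponents. If one exponent grows strictly,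
      -- `invariant⇒0` forces `f` to vanish.
      difference-invariant : ∀ f → (qtP i j P.- qtP i' j') ⊗ f ≋ [] → ∀ m → coeff f (s m) ≡ coeff f m
      difference-invariant f h m = begin
        coeff f (s m)                                  ≡⟨ coeff-qtP-⊗ i' j' f (s m) ⟨
        coeff (qtP i' j' ⊗ f) (shift i' j' (s m))      ≡⟨ cong (coeff (qtP i' j' ⊗ f)) (shift-split m) ⟩
        coeff (qtP i' j' ⊗ f) (shift i j m)            ≡⟨ at same (shift i j m) ⟨
        coeff (qtP i j ⊗ f) (shift i j m)              ≡⟨ coeff-qtP-⊗ i j f m ⟩
        coeff f m ∎
        where
        open ≡.≡-Reasoning
        same : qtP i j ⊗ f ≋ qtP i' j' ⊗ f
        same = difference-absorbs (qtP i j) (qtP i' j') f h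

      raise : ∀ x y a → y ℤ.< x → ℤ.suc a ℤ.≤ ℤ.- y ℤ.+ x ℤ.+ a
      raise x y a h = ℤP.+-monoˡ-≤ a (ℤP.≤-trans (ℤP.≤-reflexive (≡.sym (≡.trans (cong (λ z → ℤ.- y ℤ.+ z) (ℤP.+-comm (+ 1) y)) (≡.trans (≡.sym (ℤP.+-assoc (ℤ.- y) y (+ 1))) (cong (ℤ._+ + 1) (ℤP.+-inverseˡ y))))))
                                        (ℤP.+-monoʳ-≤ (ℤ.- y) (ℤP.i<j⇒suc[i]≤j h)))

      q-difference-cancellable : i' ℤ.< i → Cancellable (qtP i j P.- qtP i' j')
      q-difference-cancellable h = mkCancel λ f e → invariant⇒0 proj₁ f s (λ m → raise i i' (proj₁ m) h) (difference-invariant f e)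

      t-difference-cancellable : j' ℤ.< j → Cancellable (qtP i j P.- qtP i' j')
      t-difference-cancellable h = mkCancel λ f e →
        invariant⇒0 (λ m → proj₁ (proj₂ m)) f s (λ m → raise j j' (proj₁ (proj₂ m)) h) (difference-invariant f e)

    M-cancellable : Cancellable Mpoly
    M-cancellable = *-cancellable {constP 1ℚ P.- qtP (+ 1) (+ 0)} {constP 1ℚ P.- qtP (+ 0) (+ 1)}
      -- In 1 - q the monomial of larger degree comes second, whereas the cancellation lemmas want
      -- it first; likewise for 1 - t.
      (swap-cancellable {qtP (+ 1) (+ 0)} {constP 1ℚ} (q-difference-cancellable (+ 1) (+ 0) (+ 0) (+ 0) (ℤ.+<+ (s≤s z≤n))))
      (swap-cancellable {qtP (+ 0) (+ 1)} {constP 1ℚ} (t-difference-cancellable (+ 0) (+ 1) (+ 0) (+ 0) (ℤ.+<+ (s≤s z≤n))))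

    Mpow-cancellable : ∀ e → Cancellable (Mpow e)
    Mpow-cancellable zero    = 1-cancellable
    Mpow-cancellable (suc e) = *-cancellable {Mpoly} {Mpow e} M-cancellable (Mpow-cancellable e)

    Mpow-+ : ∀ e f → Mpow (e ℕ.+ f) ≋ Mpow e ⊗ Mpow f
    Mpow-+ zero    f = P.sym {Mpow 0 ⊗ Mpow f} {Mpow f} (P.*-identityˡ (Mpow f))
    Mpow-+ (suc e) f = P.trans {Mpoly ⊗ Mpow (e ℕ.+ f)} {Mpoly ⊗ (Mpow e ⊗ Mpow f)} {(Mpoly ⊗ Mpow e) ⊗ Mpow f}
      (P.*-congˡ {Mpoly} {Mpow (e ℕ.+ f)} {Mpow e ⊗ Mpow f} (Mpow-+ e f))
      (P.sym {(Mpoly ⊗ Mpow e) ⊗ Mpow f} {Mpoly ⊗ (Mpow e ⊗ Mpow f)} (P.*-assoc Mpoly (Mpow e) (Mpow f)))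

    module Fractions = Localise (polyRing {N}) Mpow (P.refl {constP 1ℚ}) Mpow-+ (λ e → cancel (Mpow-cancellable e))

-- Splitting points of the rectangles with n = 1, 2, 3

module SplitPoints where
  open import Data.Bool using (T)
  open import Data.Nat
  open import Data.Nat.Properties
  open import Data.Nat.DivMod using (m*n%n≡0; [m+kn]%n≡m%n)
  open import Data.List.Relation.Unary.All as All using (All; []; _∷_)
  open import Function using () renaming (_∋_ to the)
  open import Relation.Binary.PropositionalEquality

  <ᵇ-true : ∀ {a b} → a < b → (a <ᵇ b) ≡ true
  <ᵇ-true {a} {b} h with a <ᵇ b | <⇒<ᵇ h
  ... | true | _ = refl

  <ᵇ-false : ∀ {a b} → b ≤ a → (a <ᵇ b) ≡ false
  <ᵇ-false {a} {b} h with a <ᵇ b in e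
  ... | false = refl
  ... | true  = contradiction (<ᵇ⇒< a b (subst T (sym e) tt)) (≤⇒≯ h)

  <ᵇ-true⁻¹ : ∀ a b → (a <ᵇ b) ≡ true → a < b
  <ᵇ-true⁻¹ a b e = <ᵇ⇒< a b (subst T (sym e) tt)

  candidates : ℕ → ℕ → List (ℕ × ℕ)
  candidates m n = L.concatMap (λ a → L.map (λ b → (a , b)) (L.upTo (suc n))) (L.upTo m)

  -- The search loop of splitPt is local to Defs and has no name here; unification
  -- with the unfolded definition recovers it.
  mutual
    pick : ℕ → ℕ → List (ℕ × ℕ) → ℕ × ℕ → ℕ → Bool → ℕ × ℕ
    pick = _

    splitPt-pick : ∀ m n → splitPt m n ≡ pick m n (candidates m n) (0 , 0) 0 false
    splitPt-pick m n with candidates m n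
    ... | l with the (ℕ × ℕ) (0 , 0)
    ... | best with false
    ... | found with 0
    ... | v = refl

  module _ (m n : ℕ) (A B : ℕ) where

    excess : ℕ → ℕ → ℕ
    excess a b = n * a ∸ m * b

    -- The search keeps the first of several minimisers, so the target has to beat earlier points
    -- strictly and later ones only weakly. Points that are not on the positive side of the diagonal
    -- are skipped.
    Before After : ℕ × ℕ → Set
    Before (a , b) = m * b < n * a → excess A B < excess a b
    After  (a , b) = m * b < n * a → excess A B ≤ excess a b

    data Minimal : List (ℕ × ℕ) → Set where
      here  : ∀ {L} → Minimal ((A , B) ∷ L)
      there : ∀ {x L} → Before x → Minimal L → Minimal (x ∷ L)

    module _ (pos : m * B < n * A) (after : ∀ x → After x)
      (f : List (ℕ × ℕ) → ℕ × ℕ → ℕ → Bool → ℕ × ℕ)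
      (f-[] : ∀ best v found → f [] best v found ≡ best)
      (f-∷ : ∀ a b rest best v found → f ((a , b) ∷ rest) best v found ≡
             (if (m * b <ᵇ n * a) ∧ (not found ∨ ((n * a ∸ m * b) <ᵇ v))
              then f rest (a , b) (n * a ∸ m * b) true
              else f rest best v found)) where

      keep : ∀ L → f L (A , B) (excess A B) true ≡ (A , B)
      keep [] = f-[] _ _ _
      keep ((a , b) ∷ L) rewrite f-∷ a b L (A , B) (excess A B) true with m * b <ᵇ n * a in e
      ... | false = keep L
      ... | true rewrite <ᵇ-false {excess a b} {excess A B} (after (a , b) (<ᵇ-true⁻¹ _ _ e)) = keep L

      -- The invariant says that a best point found before the target has a larger excess, recorded
      -- in `v`; the target therefore replaces it, and `keep` takes over.
      search : ∀ L best v found → Minimal L → (found ≡ true → excess A B < v) → f L best v found ≡ (A , B)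
      search (_ ∷ L) best v true here h
        rewrite f-∷ A B L best v true | <ᵇ-true pos | <ᵇ-true (h refl) = keep L
      search (_ ∷ L) best v false here h
        rewrite f-∷ A B L best v false | <ᵇ-true pos = keep L
      search ((a , b) ∷ L) best v found (there before g) h rewrite f-∷ a b L best v found with m * b <ᵇ n * a in e
      ... | false = search L best v found g h
      ... | true with not found ∨ (excess a b <ᵇ v)
      ...   | true  = search L (a , b) (excess a b) true g (λ _ → before (<ᵇ-true⁻¹ _ _ e))
      ...   | false = search L best v found g h

    splitPt-minimal : m * B < n * A → (∀ x → After x) → Minimal (candidates m n) → splitPt m n ≡ (A , B)
    splitPt-minimal pos after good =
      trans (splitPt-pick m n)
        (search pos after (pick m n) (λ _ _ _ → refl) (λ _ _ _ _ _ _ → refl) (candidates m n) (0 , 0) 0 false good λ ())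

    row : ℕ → List (ℕ × ℕ)
    row a = L.map (λ b → (a , b)) (L.upTo (suc n))

    before-++ : ∀ {L L'} → All Before L → Minimal L' → Minimal (L ++ L')
    before-++ []       g = g
    before-++ (b ∷ bs) g = there b (before-++ bs g)

    minimal-++ : ∀ {L L'} → Minimal L → Minimal (L ++ L')
    minimal-++ here        = here
    minimal-++ (there b g) = there b (minimal-++ g)

    minimal-rows : ∀ k (g : ℕ → ℕ) i → i < k → (∀ i' → i' < i → All Before (row (g i'))) →
                   Minimal (row (g i)) → Minimal (L.concatMap row (L.applyUpTo g k))
    minimal-rows (suc k) g zero    _       _  good = minimal-++ good
    minimal-rows (suc k) g (suc i) (s≤s h) bs good =
      before-++ (bs 0 (s≤s z≤n)) (minimal-rows k (λ i → g (suc i)) i h (λ i' h' → bs (suc i') (s≤s h')) good)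

    splitPt-rows : m * B < n * A → (∀ x → After x) → A < m → (∀ a → a < A → All Before (row a)) →
                   Minimal (row A) → splitPt m n ≡ (A , B)
    splitPt-rows pos after A<m bs good = splitPt-minimal pos after (minimal-rows m (λ a → a) A A<m bs good)

    module _ (unit : n * A ≡ suc (m * B)) where

      excess-unit : excess A B ≡ 1
      excess-unit rewrite unit = m+n∸n≡m 1 (m * B)

      unit-after : ∀ x → After x
      unit-after (a , b) h rewrite excess-unit = m<n⇒0<n∸m h

      unit-before : ∀ a b → ¬ (n * a ≡ suc (m * b)) → Before (a , b)
      unit-before a b ne h rewrite excess-unit with n * a ∸ m * b in e | m<n⇒0<n∸m h
      ... | suc zero    | _ = contradiction (trans (sym (m∸n+n≡m (<⇒≤ h))) (cong (_+ m * b) e)) ne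
      ... | suc (suc _) | _ = s≤s (s≤s z≤n)

      -- An excess of 1 is the least positive value. It then suffices that no earlier point solves
      -- the equation n a = m b + 1.
      splitPt-unit : A < m → (∀ a → a < A → All (λ x → ¬ (n * proj₁ x ≡ suc (m * proj₂ x))) (row a)) →
                     Minimal (row A) → splitPt m n ≡ (A , B)
      splitPt-unit A<m bs good =
        splitPt-rows (≤-reflexive (sym unit)) unit-after A<m (λ a h → All.map (λ {x} → unit-before (proj₁ x) (proj₂ x)) (bs a h)) good

  -- No a ≤ A satisfies the congruence n a = m b + 1 with b ≤ n unless (a , b) = (A , B).
  split-1 : ∀ j → splitPt (2 + j) 1 ≡ (1 , 0)
  split-1 j = splitPt-unit (2 + j) 1 1 0 (sym (cong suc (*-zeroʳ j))) (s≤s (s≤s z≤n))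
    (λ { zero _ → (λ ()) ∷ (λ ()) ∷ [] ; (suc _) (s≤s ()) }) here

  split-2 : ∀ k → splitPt (3 + 2 * k) 2 ≡ (2 + k , 1)
  split-2 k = splitPt-unit (3 + 2 * k) 2 (2 + k) 1 eq (s≤s (s≤s (s≤s (m≤n*m k 2))))
    (λ a h → no0 a ∷ no1 a h ∷ no2 a h ∷ [])
    (there (unit-before (3 + 2 * k) 2 (2 + k) 1 eq (2 + k) 0 (no0 (2 + k))) here)
    where
    eq : 2 * (2 + k) ≡ suc ((3 + 2 * k) * 1)
    eq = lem k where
      lem : ∀ k → 2 * (2 + k) ≡ suc ((3 + 2 * k) * 1)
      lem = solve-∀
    no0 : ∀ a → ¬ (2 * a ≡ suc ((3 + 2 * k) * 0))
    no0 a e = contradiction (trans (sym (*-comm 2 a)) (trans e (cong suc (*-zeroʳ (3 + 2 * k))))) (odd a)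
      where
      odd : ∀ a → ¬ (a * 2 ≡ 1)
      odd zero ()
      odd (suc a) ()
    no1 : ∀ a → a < 2 + k → ¬ (2 * a ≡ suc ((3 + 2 * k) * 1))
    no1 a h e = <-irrefl (*-cancelˡ-≡ a (2 + k) 2 (trans e (sym eq))) h
    no2 : ∀ a → a < 2 + k → ¬ (2 * a ≡ suc ((3 + 2 * k) * 2))
    no2 a h e = <⇒≱ (*-monoʳ-< 2 h) (≤-trans (≤-reflexive eq) (≤-trans (s≤s (*-monoʳ-≤ (3 + 2 * k) (s≤s (z≤n {1})))) (≤-reflexive (sym e))))

  split-3₁ : ∀ k → splitPt (4 + 3 * k) 3 ≡ (3 + 2 * k , 2)
  split-3₁ k = splitPt-unit (4 + 3 * k) 3 (3 + 2 * k) 2 eq (s≤s (s≤s (s≤s (s≤s (*-monoˡ-≤ k (s≤s (s≤s (z≤n {1}))))))))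
    (λ a h → no0 a ∷ no1 a ∷ no2 a h ∷ no3 a h ∷ [])
    (there (unit-before (4 + 3 * k) 3 (3 + 2 * k) 2 eq (3 + 2 * k) 0 (no0 (3 + 2 * k)))
      (there (unit-before (4 + 3 * k) 3 (3 + 2 * k) 2 eq (3 + 2 * k) 1 (no1 (3 + 2 * k))) here))
    where
    eq : 3 * (3 + 2 * k) ≡ suc ((4 + 3 * k) * 2)
    eq = lem k where
      lem : ∀ k → 3 * (3 + 2 * k) ≡ suc ((4 + 3 * k) * 2)
      lem = solve-∀
    no0 : ∀ a → ¬ (3 * a ≡ suc ((4 + 3 * k) * 0))
    no0 a e = residue a 0 (trans e (lem k))
      where
      lem : ∀ k → suc ((4 + 3 * k) * 0) ≡ 1 + 3 * 0
      lem = solve-∀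
      residue : ∀ a b → ¬ (3 * a ≡ 1 + 3 * b)
      residue a b e = contradiction (trans (sym (m*n%n≡0 a 3)) (trans (cong (_% 3) (trans (*-comm a 3) (trans e (cong suc (*-comm 3 b))))) ([m+kn]%n≡m%n 1 b 3))) λ ()
    no1 : ∀ a → ¬ (3 * a ≡ suc ((4 + 3 * k) * 1))
    no1 a e = residue a (1 + k) (trans e (lem k))
      where
      lem : ∀ k → suc ((4 + 3 * k) * 1) ≡ 2 + 3 * (1 + k)
      lem = solve-∀
      residue : ∀ a b → ¬ (3 * a ≡ 2 + 3 * b)
      residue a b e = contradiction (trans (sym (m*n%n≡0 a 3)) (trans (cong (_% 3) (trans (*-comm a 3) (trans e (cong (2 +_) (*-comm 3 b))))) ([m+kn]%n≡m%n 2 b 3))) λ ()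
    no2 : ∀ a → a < 3 + 2 * k → ¬ (3 * a ≡ suc ((4 + 3 * k) * 2))
    no2 a h e = <-irrefl (*-cancelˡ-≡ a (3 + 2 * k) 3 (trans e (sym eq))) h
    no3 : ∀ a → a < 3 + 2 * k → ¬ (3 * a ≡ suc ((4 + 3 * k) * 3))
    no3 a h e = <⇒≱ (*-monoʳ-< 3 h) (≤-trans (≤-reflexive eq) (≤-trans (s≤s (*-monoʳ-≤ (4 + 3 * k) (s≤s (s≤s (z≤n {1}))))) (≤-reflexive (sym e))))

  split-3₂ : ∀ k → splitPt (2 + 3 * k) 3 ≡ (1 + k , 1)
  split-3₂ k = splitPt-unit (2 + 3 * k) 3 (1 + k) 1 eq (s≤s (s≤s (m≤n*m k 3)))
    (λ a h → no0 a ∷ no≥ 1 a h (s≤s z≤n) ∷ no≥ 2 a h (s≤s z≤n) ∷ no≥ 3 a h (s≤s z≤n) ∷ [])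
    (there (unit-before (2 + 3 * k) 3 (1 + k) 1 eq (1 + k) 0 (no0 (1 + k))) here)
    where
    eq : 3 * (1 + k) ≡ suc ((2 + 3 * k) * 1)
    eq = lem k where
      lem : ∀ k → 3 * (1 + k) ≡ suc ((2 + 3 * k) * 1)
      lem = solve-∀
    no0 : ∀ a → ¬ (3 * a ≡ suc ((2 + 3 * k) * 0))
    no0 a e = contradiction (trans (sym (m*n%n≡0 a 3)) (cong (_% 3) (trans (*-comm a 3) (trans e (cong suc (*-zeroʳ (2 + 3 * k))))))) λ ()
    no≥ : ∀ b a → a < 1 + k → 1 ≤ b → ¬ (3 * a ≡ suc ((2 + 3 * k) * b))
    no≥ b a h b≥1 e = <⇒≱ (*-monoʳ-< 3 h) (≤-trans (≤-reflexive eq) (≤-trans (s≤s (*-monoʳ-≤ (2 + 3 * k) b≥1)) (≤-reflexive (sym e))))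

  -- All excesses are now multiples of 3, so the least positive one is 3 and (1 , 0) attains it.
  -- Column 0 contains no point with positive excess.
  split-3₀ : ∀ k → splitPt (3 + 3 * k) 3 ≡ (1 , 0)
  split-3₀ k = splitPt-rows (3 + 3 * k) 3 1 0 pos after (s≤s (s≤s z≤n)) (λ { zero _ → none 0 ∷ none 1 ∷ none 2 ∷ none 3 ∷ [] ; (suc _) (s≤s ()) }) here
    where
    pos : (3 + 3 * k) * 0 < 3 * 1
    pos = subst (_< 3) (sym (*-zeroʳ (3 + 3 * k))) (s≤s z≤n)
    excess≡3 : excess (3 + 3 * k) 3 1 0 1 0 ≡ 3
    excess≡3 = cong (3 ∸_) (*-zeroʳ (3 + 3 * k))
    none : ∀ b → Before (3 + 3 * k) 3 1 0 (0 , b)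
    none b ()
    after : ∀ x → After (3 + 3 * k) 3 1 0 x
    after (a , b) h rewrite excess≡3 =
      subst (3 ≤_) (trans (*-distribˡ-∸ 3 a ((1 + k) * b)) (cong (3 * a ∸_) (lem k b)))
            (*-monoʳ-≤ 3 (m<n⇒0<n∸m (*-cancelˡ-< 3 ((1 + k) * b) a (subst (_< 3 * a) (sym (lem k b)) h))))
      where
      lem : ∀ k b → 3 * ((1 + k) * b) ≡ (3 + 3 * k) * b
      lem = solve-∀

-- The transposed operators in degrees up to three

module OperatorCalculus where
  open RingSolve
  open SplitPoints
  open import Data.Fin using (zero; suc)
  open import Data.Vec using (_∷_; [])
  open import Data.Nat using (s≤s)

  -- The operators of the theorem act on functionals φ on power-sum products
  -- by transposition; A is the ring of scalars and Eel n ψ the value of ψ at e_n.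
  module Transpose (R : CommutativeRing 0ℓ 0ℓ) (u : CommutativeRing.Carrier R)
    (pM sgn : ℕ → CommutativeRing.Carrier R)
    (Eel : ℕ → (List ℕ → CommutativeRing.Carrier R) → CommutativeRing.Carrier R) where

    open CommutativeRing R hiding (zero) renaming (Carrier to A)

    Functional : Set
    Functional = List ℕ → A

    -- Since p_a[X + M/z] = p_a[X] + p_a[M] z^(-a), each part `a` is either kept or traded for the
    -- scalar `pM a`; the second argument of `g` counts the powers of 1/z collected in this way.
    pleth : (List ℕ → ℕ → A) → List ℕ → A
    pleth g []       = g [] 0
    pleth g (a ∷ as) = pleth (λ μ j → g (a ∷ μ) j + pM a * g μ (j ℕ.+ a)) as

    kernel : ℕ → Functional → List ℕ → ℕ → A
    kernel k φ μ j = sgn (k ℕ.+ j) * Eel (k ℕ.+ j) (λ l → φ (μ ++ l))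

    Dᵗ : ℕ → Functional → Functional
    Dᵗ k φ = pleth (kernel k φ)

    Qᵗ : ℕ → ℕ → ℕ → Functional → Functional
    Qᵗ fuel zero n φ l = 0#
    Qᵗ fuel (suc zero) n φ l = sgn n * Dᵗ n φ l
    Qᵗ zero (suc (suc m)) n φ l = 0#
    Qᵗ (suc f) (suc (suc m)) n φ l =
      -- Transposition reverses products: for `Qop f c d` after `Qop f a b` the functional is hit by
      -- `Qᵗ f c d` first. The scalar `sgn 1` is the sign in `sfNeg`.
      u * (Qᵗ f a b (Qᵗ f c d φ) l + sgn 1 * Qᵗ f c d (Qᵗ f a b φ) l)
      where
      a = proj₁ (splitPt (suc (suc m)) n)
      b = proj₂ (splitPt (suc (suc m)) n)
      c = suc (suc m) ℕ.∸ a
      d = n ℕ.∸ b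

    Qᵗ-split : ∀ f m n {a b c d} → splitPt (suc (suc m)) n ≡ (a , b) → suc (suc m) ℕ.∸ a ≡ c → n ℕ.∸ b ≡ d → ∀ φ l →
               Qᵗ (suc f) (suc (suc m)) n φ l ≡ u * (Qᵗ f a b (Qᵗ f c d φ) l + sgn 1 * Qᵗ f c d (Qᵗ f a b φ) l)
    Qᵗ-split f m n e ≡.refl ≡.refl φ l rewrite e = ≡.refl

  module QAlgebra (R : CommutativeRing 0ℓ 0ℓ) (q t u h third : CommutativeRing.Carrier R)
    (pM sgn : ℕ → CommutativeRing.Carrier R)
    (Eel : ℕ → (List ℕ → CommutativeRing.Carrier R) → CommutativeRing.Carrier R) where

    open CommutativeRing R hiding (zero) renaming (Carrier to A)
    open Solver R
    open Transpose R u pM sgn Eel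
    open import Relation.Binary.Reasoning.Setoid setoid

    -- All that the calculation uses of the concrete coefficients. It keeps q, t and u = 1/M opaque,
    -- so that the solver can treat them as variables.
    record Hypotheses : Set where
      field
        M-unit  : u * ((1# - q) * (1# - t)) ≈ 1#
        half    : h * (1# + 1#) ≈ 1#
        third-3 : third * (1# + 1# + 1#) ≈ 1#
        pM₁     : pM 1 ≈ (1# - q) * (1# - t)
        pM₂     : pM 2 ≈ (1# - q * q) * (1# - t * t)
        pM₃     : pM 3 ≈ (1# - q * q * q) * (1# - t * t * t)
        sgn₀    : sgn 0 ≈ 1#
        sgn₁    : sgn 1 ≈ - 1#
        sgn₂    : sgn 2 ≈ 1#
        sgn₃    : sgn 3 ≈ - 1#
        e₀      : ∀ ψ → Eel 0 ψ ≈ ψ []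
        e₁      : ∀ ψ → Eel 1 ψ ≈ ψ (1 ∷ [])
        e₂      : ∀ ψ → Eel 2 ψ ≈ h * (ψ (1 ∷ 1 ∷ []) - ψ (2 ∷ []))
        -- This is Newton's recursion as `elem` unfolds it. The words 2 1 and 1 2 stay apart because
        -- power-sum products are unsorted lists.
        e₃      : ∀ ψ → Eel 3 ψ ≈ third * (h * (ψ (1 ∷ 1 ∷ 1 ∷ []) - ψ (2 ∷ 1 ∷ [])) - ψ (1 ∷ 2 ∷ []) + ψ (3 ∷ []))

    -- Functionals on degree 2 and 3 are coordinatised by their values on Schur functions.
    record Deg2 (ψ : Functional) (X Y : A) : Set where
      field
        at-11 : ψ (1 ∷ 1 ∷ []) ≈ X + Y
        at-2  : ψ (2 ∷ []) ≈ X - Y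

    record Deg3 (φ : Functional) (X Y Z : A) : Set where
      field
        at-111 : φ (1 ∷ 1 ∷ 1 ∷ []) ≈ X + Y + Y + Z
        at-21  : φ (2 ∷ 1 ∷ []) ≈ X - Z
        at-12  : φ (1 ∷ 2 ∷ []) ≈ X - Z
        at-3   : φ (3 ∷ []) ≈ X - Y + Z

    module Calculus (hyp : Hypotheses) where
      open Hypotheses hyp

      M : A
      M = (1# - q) * (1# - t)

      m₂ m₃ : A
      m₂ = (1# - q * q) * (1# - t * t)
      m₃ = (1# - q * q * q) * (1# - t * t * t)

      halve : ∀ {x y} → x ≈ y + y → h * x ≈ y
      halve {x} {y} e = trans (*-congˡ e) (trans (solve 2 (λ h y → h :* (y :+ y) := h :* (:1 :+ :1) :* y) ≡.refl h y) (trans (*-congʳ half) (*-identityˡ y)))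

      thirds : ∀ {x y} → x ≈ y + y + y → third * x ≈ y
      thirds {x} {y} e = trans (*-congˡ e) (trans (solve 2 (λ h y → h :* (y :+ y :+ y) := h :* (:1 :+ :1 :+ :1) :* y) ≡.refl third y) (trans (*-congʳ third-3) (*-identityˡ y)))

      module _ (g : List ℕ → ℕ → A) where
        pleth-1 : pleth g (1 ∷ []) ≈ g (1 ∷ []) 0 + M * g [] 1
        pleth-1 = +-congˡ (*-congʳ pM₁)

        pleth-11 : pleth g (1 ∷ 1 ∷ []) ≈ g (1 ∷ 1 ∷ []) 0 + M * (g (1 ∷ []) 1 + g (1 ∷ []) 1) + M * M * g [] 2
        pleth-11 = trans (+-cong (+-congˡ (*-congʳ pM₁)) (*-cong pM₁ (+-congˡ (*-congʳ pM₁))))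
          (solve 4 (λ a b c m → (a :+ m :* b) :+ m :* (b :+ m :* c) := a :+ m :* (b :+ b) :+ m :* m :* c) ≡.refl _ _ _ M)

        pleth-2 : pleth g (2 ∷ []) ≈ g (2 ∷ []) 0 + m₂ * g [] 2
        pleth-2 = +-congˡ (*-congʳ pM₂)

        pleth-111 : pleth g (1 ∷ 1 ∷ 1 ∷ []) ≈ g (1 ∷ 1 ∷ 1 ∷ []) 0 + M * (g (1 ∷ 1 ∷ []) 1 + g (1 ∷ 1 ∷ []) 1 + g (1 ∷ 1 ∷ []) 1)
                      + M * M * (g (1 ∷ []) 2 + g (1 ∷ []) 2 + g (1 ∷ []) 2) + M * M * M * g [] 3
        pleth-111 = trans (+-cong (+-cong (+-congˡ (*-congʳ pM₁)) (*-cong pM₁ (+-congˡ (*-congʳ pM₁))))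
                                  (*-cong pM₁ (+-cong (+-congˡ (*-congʳ pM₁)) (*-cong pM₁ (+-congˡ (*-congʳ pM₁))))))
          (solve 5 (λ a b c d m → ((a :+ m :* b) :+ m :* (b :+ m :* c)) :+ m :* ((b :+ m :* c) :+ m :* (c :+ m :* d))
                     := a :+ m :* (b :+ b :+ b) :+ m :* m :* (c :+ c :+ c) :+ m :* m :* m :* d) ≡.refl _ _ _ _ M)

        pleth-21 : pleth g (2 ∷ 1 ∷ []) ≈ g (2 ∷ 1 ∷ []) 0 + M * g (2 ∷ []) 1 + m₂ * g (1 ∷ []) 2 + M * m₂ * g [] 3
        pleth-21 = trans (+-cong (+-congˡ (*-congʳ pM₂)) (*-cong pM₁ (+-congˡ (*-congʳ pM₂))))
          (solve 6 (λ a b c d m n → (a :+ n :* c) :+ m :* (b :+ n :* d) := a :+ m :* b :+ n :* c :+ m :* n :* d) ≡.refl _ _ _ _ M m₂)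

        pleth-12 : pleth g (1 ∷ 2 ∷ []) ≈ g (1 ∷ 2 ∷ []) 0 + M * g (2 ∷ []) 1 + m₂ * g (1 ∷ []) 2 + M * m₂ * g [] 3
        pleth-12 = trans (+-cong (+-congˡ (*-congʳ pM₁)) (*-cong pM₂ (+-congˡ (*-congʳ pM₁))))
          (solve 6 (λ a b c d m n → (a :+ m :* b) :+ n :* (c :+ m :* d) := a :+ m :* b :+ n :* c :+ m :* n :* d) ≡.refl _ _ _ _ M m₂)

        pleth-3 : pleth g (3 ∷ []) ≈ g (3 ∷ []) 0 + m₃ * g [] 3
        pleth-3 = +-congˡ (*-congʳ pM₃)

      e₂-Deg2 : ∀ {ψ X Y} → Deg2 ψ X Y → Eel 2 ψ ≈ Y
      e₂-Deg2 {ψ} {X} {Y} d = trans (e₂ ψ) (halve (trans (+-cong at-11 (-‿cong at-2)) (solve 2 (λ X Y → (X :+ Y) :- (X :- Y) := Y :+ Y) ≡.refl X Y)))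
        where open Deg2 d

      module _ {φ X Y Z} (d : Deg3 φ X Y Z) where
        open Deg3 d

        e₂-after-1 : Eel 2 (λ l → φ (1 ∷ l)) ≈ Y + Z
        e₂-after-1 = trans (e₂ (λ l → φ (1 ∷ l))) (halve (trans (+-cong at-111 (-‿cong at-12))
          (solve 3 (λ X Y Z → (X :+ Y :+ Y :+ Z) :- (X :- Z) := (Y :+ Z) :+ (Y :+ Z)) ≡.refl X Y Z)))

        e₃-Deg3 : Eel 3 φ ≈ Z
        e₃-Deg3 = trans (e₃ φ) (thirds (trans (+-cong (+-cong (halve (trans (+-cong at-111 (-‿cong at-21))
          (solve 3 (λ X Y Z → (X :+ Y :+ Y :+ Z) :- (X :- Z) := (Y :+ Z) :+ (Y :+ Z)) ≡.refl X Y Z))) (-‿cong at-12)) at-3)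
          (solve 3 (λ X Y Z → (Y :+ Z) :- (X :- Z) :+ (X :- Y :+ Z) := Z :+ Z :+ Z) ≡.refl X Y Z)))

      -- Matrices of D_0 and Q_{1,1} in the Schur basis, and the pairings with the
      -- modified Macdonald polynomials H_2, H_11, H_3, H_21, H_111.
      module _ where
        eD₀X eD₀Y eD₀Z eQ₁X eQ₁Y eH₂₁ : ∀ {n} → Expr n → Expr n → Expr n → Expr n → Expr n → Expr n
        eD₀X q t X Y Z = (t :+ q :- q :* t) :* X :+ q :* t :* (:1 :- t) :* (:1 :- q) :* Y :- q :^ 2 :* t :^ 2 :* (:1 :- t) :* (:1 :- q) :* Z
        eD₀Y q t X Y Z = :- ((:1 :- t) :* (:1 :- q)) :* X
          :+ ((q :+ t) :^ 2 :- (q :+ q) :* t :^ 2 :- (t :+ t) :* q :^ 2 :+ q :^ 2 :* t :^ 2) :* Y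
          :+ (q :* t :^ 2 :- q :* t :^ 3 :+ q :^ 2 :* t :- (q :^ 2 :* t :^ 2 :+ q :^ 2 :* t :^ 2) :+ q :^ 2 :* t :^ 3 :- q :^ 3 :* t :+ q :^ 3 :* t :^ 2) :* Z
        eD₀Z q t X Y Z = (:- :1 :+ t :^ 2 :+ q :* t :- q :* t :^ 2 :+ q :^ 2 :- q :^ 2 :* t) :* Y
          :+ (t :^ 3 :+ q :* t :^ 2 :- q :* t :^ 3 :+ q :^ 2 :* t :- q :^ 2 :* t :^ 2 :+ q :^ 3 :- q :^ 3 :* t) :* Z
        eQ₁X q t X Y Z = X :+ (t :+ q :- q :* t) :* Y :+ q :* t :* (:1 :- t) :* (:1 :- q) :* Z
        eQ₁Y q t X Y Z = (t :+ q :- q :* t) :* Y :+ (t :^ 2 :+ q :* t :- q :* t :^ 2 :+ q :^ 2 :- q :^ 2 :* t) :* Z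
        eH₂₁ q t X Y Z = X :+ (q :+ t) :* Y :+ q :* t :* Z

        eD₀X₂ eD₀Y₂ : ∀ {n} → Expr n → Expr n → Expr n → Expr n → Expr n
        eD₀X₂ q t X Y = (t :+ q :- q :* t) :* X :+ q :* t :* (:1 :- t) :* (:1 :- q) :* Y
        eD₀Y₂ q t X Y = :- ((:1 :- t) :* (:1 :- q)) :* X :+ (t :^ 2 :+ q :* t :- q :* t :^ 2 :+ q :^ 2 :- q :^ 2 :* t) :* Y

        eH₃ : ∀ {n} → Expr n → Expr n → Expr n → Expr n → Expr n
        eH₃ q X Y Z = X :+ (q :+ q :^ 2) :* Y :+ q :^ 3 :* Z

        eM : ∀ {n} → Expr n → Expr n → Expr n
        eM q t = (:1 :- q) :* (:1 :- t)

        -- The coordinate formulas are written once, as syntax. Their values are interpretations of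
        -- that syntax, so an identity proved by `solve` for `eD₀X` applies to `D₀X` without
        -- conversion.
        of₃ : (∀ {n} → Expr n → Expr n → Expr n → Expr n → Expr n → Expr n) → A → A → A → A
        of₃ e X Y Z = ⟦ e (var zero) (var (suc zero)) (var (suc (suc zero))) (var (suc (suc (suc zero)))) (var (suc (suc (suc (suc zero))))) ⟧
                      (q ∷ t ∷ X ∷ Y ∷ Z ∷ [])
        of₂ : (∀ {n} → Expr n → Expr n → Expr n → Expr n → Expr n) → A → A → A
        of₂ e X Y = ⟦ e (var zero) (var (suc zero)) (var (suc (suc zero))) (var (suc (suc (suc zero)))) ⟧ (q ∷ t ∷ X ∷ Y ∷ [])

      D₀X D₀Y D₀Z Q₁X Q₁Y H₃ H₂₁ H₁₁₁ : A → A → A → A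
      D₀X  = of₃ eD₀X
      D₀Y  = of₃ eD₀Y
      D₀Z  = of₃ eD₀Z
      Q₁X  = of₃ eQ₁X
      Q₁Y  = of₃ eQ₁Y
      H₃   = of₃ (λ q t → eH₃ q)
      H₂₁  = of₃ eH₂₁
      H₁₁₁ = of₃ (λ q t → eH₃ t)

      D₀X₂ D₀Y₂ : A → A → A
      D₀X₂ = of₂ eD₀X₂
      D₀Y₂ = of₂ eD₀Y₂

      D₀-0 : ∀ f ψ → Qᵗ f 1 0 ψ [] ≈ ψ []
      D₀-0 f ψ = trans (*-cong sgn₀ (*-cong sgn₀ (e₀ ψ))) (trans (*-identityˡ _) (*-identityˡ _))

      D₀-1 : ∀ f ψ → Qᵗ f 1 0 ψ (1 ∷ []) ≈ ψ (1 ∷ []) - M * ψ (1 ∷ [])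
      D₀-1 f ψ = trans (*-cong sgn₀ (trans (pleth-1 (kernel 0 ψ)) (+-cong (*-cong sgn₀ (e₀ _)) (*-congˡ (*-cong sgn₁ (e₁ _))))))
        (solve 2 (λ m z → :1 :* (:1 :* z :+ m :* (:- :1 :* z)) := z :- m :* z) ≡.refl M _)

      Q₁-0 : ∀ f ψ → Qᵗ f 1 1 ψ [] ≈ ψ (1 ∷ [])
      Q₁-0 f ψ = trans (*-cong sgn₁ (*-cong sgn₁ (e₁ ψ))) (solve 1 (λ z → :- :1 :* (:- :1 :* z) := z) ≡.refl _)

      module _ {ψ X Y} (d : Deg2 ψ X Y) where
        open Deg2 d

        D₀-2 : ∀ f → Deg2 (Qᵗ f 1 0 ψ) (D₀X₂ X Y) (D₀Y₂ X Y)
        D₀-2 f = record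
          { at-11 = trans (*-cong sgn₀ (trans (pleth-11 (kernel 0 ψ)) (+-cong (+-cong (*-cong sgn₀ (trans (e₀ _) at-11))
                      (*-congˡ (+-cong s₁ s₁))) (*-congˡ (*-cong sgn₂ (e₂-Deg2 d))))))
              (solve 4 (λ q t X Y → :1 :* (:1 :* (X :+ Y) :+ eM q t :* (:- :1 :* (X :+ Y) :+ :- :1 :* (X :+ Y)) :+ eM q t :* eM q t :* (:1 :* Y))
                         := eD₀X₂ q t X Y :+ eD₀Y₂ q t X Y) ≡.refl q t X Y)
          ; at-2 = trans (*-cong sgn₀ (trans (pleth-2 (kernel 0 ψ)) (+-cong (*-cong sgn₀ (trans (e₀ _) at-2)) (*-congˡ (*-cong sgn₂ (e₂-Deg2 d))))))
              (solve 4 (λ q t X Y → :1 :* (:1 :* (X :- Y) :+ (:1 :- q :* q) :* (:1 :- t :* t) :* (:1 :* Y))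
                         := eD₀X₂ q t X Y :- eD₀Y₂ q t X Y) ≡.refl q t X Y)
          }
          where
          s₁ : sgn 1 * Eel 1 (λ l → ψ (1 ∷ l)) ≈ - 1# * (X + Y)
          s₁ = *-cong sgn₁ (trans (e₁ _) at-11)

        Q₁-1 : ∀ f → Qᵗ f 1 1 ψ (1 ∷ []) ≈ X + Y - M * Y
        Q₁-1 f = trans (*-cong sgn₁ (trans (pleth-1 (kernel 1 ψ)) (+-cong (*-cong sgn₁ (trans (e₁ _) at-11)) (*-congˡ (*-cong sgn₂ (e₂-Deg2 d))))))
          (solve 3 (λ m X Y → :- :1 :* (:- :1 :* (X :+ Y) :+ m :* (:1 :* Y)) := X :+ Y :- m :* Y) ≡.refl M X Y)

        E₂-0 : ∀ f → Qᵗ f 1 2 ψ [] ≈ Y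
        E₂-0 f = trans (*-cong sgn₂ (*-cong sgn₂ (e₂-Deg2 d))) (trans (*-identityˡ _) (*-identityˡ _))

      module _ {φ X Y Z} (d : Deg3 φ X Y Z) where
        open Deg3 d

        D₀-3 : ∀ f → Deg3 (Qᵗ f 1 0 φ) (D₀X X Y Z) (D₀Y X Y Z) (D₀Z X Y Z)
        D₀-3 f = record
          { at-111 = trans (*-cong sgn₀ (trans (pleth-111 (kernel 0 φ)) (+-cong (+-cong (+-cong (*-cong sgn₀ (trans (e₀ _) at-111))
                       (*-congˡ (+-cong (+-cong s₁ s₁) s₁))) (*-congˡ (+-cong (+-cong s₂ s₂) s₂))) (*-congˡ s₃))))
              (solve 5 (λ q t X Y Z → let p = :- :1 :* (X :+ Y :+ Y :+ Z); r = :1 :* (Y :+ Z) in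
                 :1 :* (:1 :* (X :+ Y :+ Y :+ Z) :+ eM q t :* (p :+ p :+ p) :+ eM q t :* eM q t :* (r :+ r :+ r) :+ eM q t :* eM q t :* eM q t :* (:- :1 :* Z))
                 := eD₀X q t X Y Z :+ eD₀Y q t X Y Z :+ eD₀Y q t X Y Z :+ eD₀Z q t X Y Z) ≡.refl q t X Y Z)
          ; at-21 = trans (*-cong sgn₀ (trans (pleth-21 (kernel 0 φ)) (+-cong (+-cong (+-cong (*-cong sgn₀ (trans (e₀ _) at-21))
                       (*-congˡ (*-cong sgn₁ (trans (e₁ _) at-21)))) (*-congˡ s₂)) (*-congˡ s₃))))
              (e21 q t X Y Z)
          ; at-12 = trans (*-cong sgn₀ (trans (pleth-12 (kernel 0 φ)) (+-cong (+-cong (+-cong (*-cong sgn₀ (trans (e₀ _) at-12))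
                       (*-congˡ (*-cong sgn₁ (trans (e₁ _) at-21)))) (*-congˡ s₂)) (*-congˡ s₃))))
              (e21 q t X Y Z)
          ; at-3 = trans (*-cong sgn₀ (trans (pleth-3 (kernel 0 φ)) (+-cong (*-cong sgn₀ (trans (e₀ _) at-3)) (*-congˡ s₃))))
              (solve 5 (λ q t X Y Z → :1 :* (:1 :* (X :- Y :+ Z) :+ (:1 :- q :* q :* q) :* (:1 :- t :* t :* t) :* (:- :1 :* Z))
                 := eD₀X q t X Y Z :- eD₀Y q t X Y Z :+ eD₀Z q t X Y Z) ≡.refl q t X Y Z)
          }
          where
          s₁ : sgn 1 * Eel 1 (λ l → φ (1 ∷ 1 ∷ l)) ≈ - 1# * (X + Y + Y + Z)
          s₁ = *-cong sgn₁ (trans (e₁ _) at-111)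
          s₂ : sgn 2 * Eel 2 (λ l → φ (1 ∷ l)) ≈ 1# * (Y + Z)
          s₂ = *-cong sgn₂ (e₂-after-1 d)
          s₃ : sgn 3 * Eel 3 φ ≈ - 1# * Z
          s₃ = *-cong sgn₃ (e₃-Deg3 d)
          e21 = solve 5 (λ q t X Y Z → let n = (:1 :- q :* q) :* (:1 :- t :* t) in
                 :1 :* (:1 :* (X :- Z) :+ eM q t :* (:- :1 :* (X :- Z)) :+ n :* (:1 :* (Y :+ Z)) :+ eM q t :* n :* (:- :1 :* Z))
                 := eD₀X q t X Y Z :- eD₀Z q t X Y Z) ≡.refl

        Q₁-2 : ∀ f → Deg2 (Qᵗ f 1 1 φ) (Q₁X X Y Z) (Q₁Y X Y Z)
        Q₁-2 f = record
          { at-11 = trans (*-cong sgn₁ (trans (pleth-11 (kernel 1 φ)) (+-cong (+-cong (*-cong sgn₁ (trans (e₁ _) at-111))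
                      (*-congˡ (+-cong s₂ s₂))) (*-congˡ s₃))))
              (solve 5 (λ q t X Y Z → :- :1 :* (:- :1 :* (X :+ Y :+ Y :+ Z) :+ eM q t :* (:1 :* (Y :+ Z) :+ :1 :* (Y :+ Z)) :+ eM q t :* eM q t :* (:- :1 :* Z))
                         := eQ₁X q t X Y Z :+ eQ₁Y q t X Y Z) ≡.refl q t X Y Z)
          ; at-2 = trans (*-cong sgn₁ (trans (pleth-2 (kernel 1 φ)) (+-cong (*-cong sgn₁ (trans (e₁ _) at-21)) (*-congˡ s₃))))
              (solve 5 (λ q t X Y Z → :- :1 :* (:- :1 :* (X :- Z) :+ (:1 :- q :* q) :* (:1 :- t :* t) :* (:- :1 :* Z))
                         := eQ₁X q t X Y Z :- eQ₁Y q t X Y Z) ≡.refl q t X Y Z)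
          }
          where
          s₂ : sgn 2 * Eel 2 (λ l → φ (1 ∷ l)) ≈ 1# * (Y + Z)
          s₂ = *-cong sgn₂ (e₂-after-1 d)
          s₃ : sgn 3 * Eel 3 φ ≈ - 1# * Z
          s₃ = *-cong sgn₃ (e₃-Deg3 d)

        E₂-1 : ∀ f → Qᵗ f 1 2 φ (1 ∷ []) ≈ Y + Z - M * Z
        E₂-1 f = trans (*-cong sgn₂ (trans (pleth-1 (kernel 2 φ)) (+-cong (*-cong sgn₂ (e₂-after-1 d)) (*-congˡ (*-cong sgn₃ (e₃-Deg3 d))))))
          (solve 3 (λ m Y Z → :1 :* (:1 :* (Y :+ Z) :+ m :* (:- :1 :* Z)) := Y :+ Z :- m :* Z) ≡.refl M Y Z)

        E₃-0 : ∀ f → Qᵗ f 1 3 φ [] ≈ Z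
        E₃-0 f = trans (*-cong sgn₃ (*-cong sgn₃ (e₃-Deg3 d))) (solve 1 (λ z → :- :1 :* (:- :1 :* z) := z) ≡.refl Z)

      private
        -- The eigenvalue 1 - M B of D_0 in degree two, where B = 1 + w: `w` is q for H_2 and t for
        -- H_11.
        eλ₂ : ∀ {n} → Expr n → Expr n → Expr n → Expr n
        eλ₂ q t w = :1 :- eM q t :* (:1 :+ w)

      -- Differences of the weights of the two cells that can be added to (1), to (2) and to (11).
      -- They are the denominators of the Pieri coefficients for multiplication by e_1.
      Δ δ₁ δ₂ δ₃ : A
      δ₁ = q - t
      δ₂ = q ^ 2 - t
      δ₃ = q - t ^ 2
      Δ = δ₁ * (δ₂ * δ₃)

      -- Pieri rule with weights, denominators cleared: going from H_2 to H_3 or H_21 adds a cell of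
      -- weight q^2 or t, going from H_11 to H_21 or H_111 one of weight q or t^2, and each term
      -- carries the j-th power of its weight.
      record Rises (φ : Functional) (X Y Z : A) (j : ℕ) (χ : Functional) : Set where
        constructor rises
        field
          {X′ Y′} : A
          deg2 : Deg2 χ X′ Y′
          on-H₂  : δ₂ * (X′ + q * Y′) ≈ (q ^ j) * (q ^ j) * (1# - t) * H₃ X Y Z - (t ^ j) * (1# - q ^ 2) * H₂₁ X Y Z
          on-H₁₁ : δ₃ * (X′ + t * Y′) ≈ (q ^ j) * (1# - t ^ 2) * H₂₁ X Y Z - (t ^ j) * (t ^ j) * (1# - q) * H₁₁₁ X Y Z

      unit-* : ∀ {x y} → x ≈ u * M * y → x ≈ y
      unit-* e = trans e (trans (*-congʳ M-unit) (*-identityˡ _))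

      commutator : ∀ f j φ l → Qᵗ (suc f) (2 ℕ.+ j) 1 φ l ≈ u * (Qᵗ f 1 0 (Qᵗ f (suc j) 1 φ) l + - 1# * Qᵗ f (suc j) 1 (Qᵗ f 1 0 φ) l)
      commutator f j φ l = trans (reflexive (Qᵗ-split f j 1 (split-1 j) ≡.refl ≡.refl φ l)) (*-congˡ (+-congˡ (*-congʳ sgn₁)))

      -- Induction by Q_{j+1,1} = (1/M) [Q_{j,1}, D_0]. In the commutator the component from mu to
      -- nu is multiplied by the eigenvalue at mu minus the eigenvalue at nu, which is M times the
      -- weight of the added cell; this raises the power of the weight by one.
      Q-rises : ∀ j f → j ℕ.≤ f → ∀ {φ X Y Z} → Deg3 φ X Y Z → Rises φ X Y Z (suc j) (Qᵗ f (suc j) 1 φ)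
      Q-rises zero f _ {X = X} {Y} {Z} d = rises (Q₁-2 d f)
        (solve 5 (λ q t X Y Z → (q :^ 2 :- t) :* (eQ₁X q t X Y Z :+ q :* eQ₁Y q t X Y Z)
          := (q :^ 1) :* (q :^ 1) :* (:1 :- t) :* eH₃ q X Y Z :- (t :^ 1) :* (:1 :- q :^ 2) :* eH₂₁ q t X Y Z) ≡.refl q t X Y Z)
        (solve 5 (λ q t X Y Z → (q :- t :^ 2) :* (eQ₁X q t X Y Z :+ t :* eQ₁Y q t X Y Z)
          := (q :^ 1) :* (:1 :- t :^ 2) :* eH₂₁ q t X Y Z :- (t :^ 1) :* (t :^ 1) :* (:1 :- q) :* eH₃ t X Y Z) ≡.refl q t X Y Z)
      Q-rises (suc j) (suc f) (s≤s j≤f) {φ} {X} {Y} {Z} d = rises {X′ = u * (D₀X₂ x y - x′)} {Y′ = u * (D₀Y₂ x y - y′)}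
        (record { at-11 = trans (commutator f j φ _) (trans (*-congˡ (+-cong (Deg2.at-11 (D₀-2 deg2 f)) (*-congˡ (Deg2.at-11 deg2′))))
                    (solve 5 (λ u a b c e → u :* ((a :+ b) :+ :- :1 :* (c :+ e)) := u :* (a :- c) :+ u :* (b :- e)) ≡.refl u _ _ x′ y′))
                ; at-2 = trans (commutator f j φ _) (trans (*-congˡ (+-cong (Deg2.at-2 (D₀-2 deg2 f)) (*-congˡ (Deg2.at-2 deg2′))))
                    (solve 5 (λ u a b c e → u :* ((a :- b) :+ :- :1 :* (c :- e)) := u :* (a :- c) :- u :* (b :- e)) ≡.refl u _ _ x′ y′)) })
        (trans (solve 7 (λ q t u x y x′ y′ → (q :^ 2 :- t) :* (u :* (eD₀X₂ q t x y :- x′) :+ q :* (u :* (eD₀Y₂ q t x y :- y′)))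
                  := u :* (eλ₂ q t q :* ((q :^ 2 :- t) :* (x :+ q :* y)) :- (q :^ 2 :- t) :* (x′ :+ q :* y′))) ≡.refl q t u x y x′ y′)
          (trans (*-congˡ (+-cong (*-congˡ on-H₂) (-‿cong on-H₂′)))
            (unit-* (solve 8 (λ q t u Q T X Y Z →
              u :* (eλ₂ q t q :* (Q :* Q :* (:1 :- t) :* eH₃ q X Y Z :- T :* (:1 :- q :^ 2) :* eH₂₁ q t X Y Z)
                    :- (Q :* Q :* (:1 :- t) :* eH₃ q (eD₀X q t X Y Z) (eD₀Y q t X Y Z) (eD₀Z q t X Y Z)
                        :- T :* (:1 :- q :^ 2) :* eH₂₁ q t (eD₀X q t X Y Z) (eD₀Y q t X Y Z) (eD₀Z q t X Y Z)))
              := u :* eM q t :* ((q :* Q) :* (q :* Q) :* (:1 :- t) :* eH₃ q X Y Z :- (t :* T) :* (:1 :- q :^ 2) :* eH₂₁ q t X Y Z))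
              ≡.refl q t u (q ^ suc j) (t ^ suc j) X Y Z))))
        (trans (solve 7 (λ q t u x y x′ y′ → (q :- t :^ 2) :* (u :* (eD₀X₂ q t x y :- x′) :+ t :* (u :* (eD₀Y₂ q t x y :- y′)))
                  := u :* (eλ₂ q t t :* ((q :- t :^ 2) :* (x :+ t :* y)) :- (q :- t :^ 2) :* (x′ :+ t :* y′))) ≡.refl q t u x y x′ y′)
          (trans (*-congˡ (+-cong (*-congˡ on-H₁₁) (-‿cong on-H₁₁′)))
            (unit-* (solve 8 (λ q t u Q T X Y Z →
              u :* (eλ₂ q t t :* (Q :* (:1 :- t :^ 2) :* eH₂₁ q t X Y Z :- T :* T :* (:1 :- q) :* eH₃ t X Y Z)
                    :- (Q :* (:1 :- t :^ 2) :* eH₂₁ q t (eD₀X q t X Y Z) (eD₀Y q t X Y Z) (eD₀Z q t X Y Z)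
                        :- T :* T :* (:1 :- q) :* eH₃ t (eD₀X q t X Y Z) (eD₀Y q t X Y Z) (eD₀Z q t X Y Z)))
              := u :* eM q t :* ((q :* Q) :* (:1 :- t :^ 2) :* eH₂₁ q t X Y Z :- (t :* T) :* (t :* T) :* (:1 :- q) :* eH₃ t X Y Z))
              ≡.refl q t u (q ^ suc j) (t ^ suc j) X Y Z))))
        where
        open Rises (Q-rises j f j≤f d) renaming (X′ to x; Y′ to y)
        open Rises (Q-rises j f j≤f (D₀-3 d f)) renaming (X′ to x′; Y′ to y′; deg2 to deg2′; on-H₂ to on-H₂′; on-H₁₁ to on-H₁₁′)

      -- The same argument one degree lower: a cell of weight q or t is added to (1).
      Q-1 : ∀ j f → j ℕ.≤ f → ∀ {ψ X Y} → Deg2 ψ X Y →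
            δ₁ * Qᵗ f (suc j) 1 ψ (1 ∷ []) ≈ (q ^ suc j) * (1# - t) * (X + q * Y) - (t ^ suc j) * (1# - q) * (X + t * Y)
      Q-1 zero f _ {ψ} {X} {Y} d = trans (*-congˡ (Q₁-1 d f))
        (solve 4 (λ q t X Y → (q :- t) :* (X :+ Y :- eM q t :* Y)
          := (q :^ 1) :* (:1 :- t) :* (X :+ q :* Y) :- (t :^ 1) :* (:1 :- q) :* (X :+ t :* Y)) ≡.refl q t X Y)
      Q-1 (suc j) (suc f) (s≤s j≤f) {ψ} {X} {Y} d = trans (*-congˡ (trans (commutator f j ψ _) (*-congˡ (+-congʳ (D₀-1 f _)))))
        (trans (solve 5 (λ q t u z z′ → (q :- t) :* (u :* ((z :- eM q t :* z) :+ :- :1 :* z′))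
                 := u :* ((:1 :- eM q t) :* ((q :- t) :* z) :- (q :- t) :* z′)) ≡.refl q t u _ _)
          (trans (*-congˡ (+-cong (*-congˡ (Q-1 j f j≤f d)) (-‿cong (Q-1 j f j≤f (D₀-2 d f)))))
            (unit-* (solve 7 (λ q t u Q T X Y →
              u :* ((:1 :- eM q t) :* (Q :* (:1 :- t) :* (X :+ q :* Y) :- T :* (:1 :- q) :* (X :+ t :* Y))
                    :- (Q :* (:1 :- t) :* (eD₀X₂ q t X Y :+ q :* eD₀Y₂ q t X Y) :- T :* (:1 :- q) :* (eD₀X₂ q t X Y :+ t :* eD₀Y₂ q t X Y)))
              := u :* eM q t :* ((q :* Q) :* (:1 :- t) :* (X :+ q :* Y) :- (t :* T) :* (:1 :- q) :* (X :+ t :* Y)))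
              ≡.refl q t u (q ^ suc j) (t ^ suc j) X Y))))

      -- The first cell has weight 1, so the value does not depend on j.
      Q-0 : ∀ j f → j ℕ.≤ f → ∀ ψ → Qᵗ f (suc j) 1 ψ [] ≈ ψ (1 ∷ [])
      Q-0 zero f _ ψ = Q₁-0 f ψ
      Q-0 (suc j) (suc f) (s≤s j≤f) ψ = trans (commutator f j ψ [])
        (trans (*-congˡ (+-cong (trans (D₀-0 f _) (Q-0 j f j≤f ψ)) (*-congˡ (trans (Q-0 j f j≤f _) (D₀-1 f ψ)))))
          (unit-* (solve 3 (λ u m z → u :* (z :+ :- :1 :* (z :- m :* z)) := u :* m :* z) ≡.refl u M _)))

      private
        eB : ∀ {n} → Expr n → Expr n → Expr n → Expr n → Expr n → Expr n → Expr n → Expr n → Expr n → Expr n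
        eB q t Qi Ti Qj Tj a b c = (q :- t :^ 2) :* Qj :* (:1 :- t) :* (Qi :* Qi :* (:1 :- t) :* a :- Ti :* (:1 :- q :^ 2) :* b)
          :- (q :^ 2 :- t) :* Tj :* (:1 :- q) :* (Qi :* (:1 :- t :^ 2) :* b :- Ti :* Ti :* (:1 :- q) :* c)

        eΔ : ∀ {n} → Expr n → Expr n → Expr n
        eΔ q t = (q :- t) :* ((q :^ 2 :- t) :* (q :- t :^ 2))

      -- One term for each standard tableau with three cells. The second cell contributes `Qj` or
      -- `Tj`; the third contributes `Qi * Qi` or `Ti` after the row (2), and `Qi` or `Ti * Ti`
      -- after the column (11).
      B : A → A → A → A → A → A → A → A
      B Qi Ti Qj Tj a b c = δ₃ * Qj * (1# - t) * (Qi * Qi * (1# - t) * a - Ti * (1# - q ^ 2) * b)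
          - δ₂ * Tj * (1# - q) * (Qi * (1# - t ^ 2) * b - Ti * Ti * (1# - q) * c)

      Q-Q-1 : ∀ i j f f′ → i ℕ.≤ f′ → j ℕ.≤ f → ∀ {φ X Y Z} → Deg3 φ X Y Z →
              Δ * Qᵗ f (suc j) 1 (Qᵗ f′ (suc i) 1 φ) (1 ∷ [])
                ≈ B (q ^ suc i) (t ^ suc i) (q ^ suc j) (t ^ suc j) (H₃ X Y Z) (H₂₁ X Y Z) (H₁₁₁ X Y Z)
      Q-Q-1 i j f f′ i≤ j≤ {φ} {X} {Y} {Z} d =
        trans (solve 4 (λ a b c z → (a :* (b :* c)) :* z := b :* c :* (a :* z)) ≡.refl δ₁ δ₂ δ₃ _)
          (trans (*-congˡ (Q-1 j f j≤ deg2))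
            (trans (solve 8 (λ q t b c Q T x y → b :* c :* (Q :* (:1 :- t) :* x :- T :* (:1 :- q) :* y)
                     := c :* Q :* (:1 :- t) :* (b :* x) :- b :* T :* (:1 :- q) :* (c :* y)) ≡.refl q t δ₂ δ₃ (q ^ suc j) (t ^ suc j) _ _)
              (+-cong (*-congˡ on-H₂) (-‿cong (*-congˡ on-H₁₁)))))
        where open Rises (Q-rises i f′ i≤ d)

      Q₂-split : ∀ f k φ l → Qᵗ (suc f) (3 ℕ.+ 2 ℕ.* k) 2 φ l ≈
        u * (Qᵗ f (2 ℕ.+ k) 1 (Qᵗ f (1 ℕ.+ k) 1 φ) l - Qᵗ f (1 ℕ.+ k) 1 (Qᵗ f (2 ℕ.+ k) 1 φ) l)
      Q₂-split f k φ l = trans (reflexive (Qᵗ-split f (1 ℕ.+ 2 ℕ.* k) 2 (split-2 k) c ≡.refl φ l))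
        (*-congˡ (+-congˡ (trans (*-congʳ sgn₁) (solve 1 (λ z → :- :1 :* z := :- z) ≡.refl _))))
        where
        c : (3 ℕ.+ 2 ℕ.* k) ℕ.∸ (2 ℕ.+ k) ≡ 1 ℕ.+ k
        c = ≡.trans (≡.cong (ℕ._∸ (2 ℕ.+ k)) (lem k)) (ℕP.m+n∸n≡m (1 ℕ.+ k) (2 ℕ.+ k))
          where
          lem : ∀ k → 3 ℕ.+ 2 ℕ.* k ≡ (1 ℕ.+ k) ℕ.+ (2 ℕ.+ k)
          lem = solve-∀

      -- A combination of H_3, H_111 and H_21 multiplied by Δ. In the uses below Q = q^k and T =
      -- t^k, and the coefficients contain Q^3, T^3 and Q T, the k-th powers of the eigenvalues q^3,
      -- t^3, qt of the operator nabla.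
      G : (α β γ Q T : A) → A → A → A → A
      G α β γ Q T X Y Z = δ₃ * α * H₃ X Y Z + δ₂ * β * H₁₁₁ X Y Z - Q * T * δ₁ * γ * H₂₁ X Y Z

      module _ (k : ℕ) where
        private
          Q T : A
          Q = q ^ k
          T = t ^ k

        G₁ G₂ G₀ : A → A → A → A
        G₁ = G (Q * Q * Q) (T * T * T) (1# + q + t) Q T
        G₂ = G (q * (Q * Q * Q)) (t * (T * T * T)) (q + t + q * t) Q T
        G₀ = G (q * (Q * Q * Q) * (1# + q + q ^ 2)) (t * (T * T * T) * (1# + t + t ^ 2)) ((q + t + q * t) * (1# + q + t)) Q T

      commutator² : ∀ {x y} → x ≈ u * M * (u * M * y) → x ≈ y
      commutator² e = unit-* (trans e (*-congˡ (trans (*-congʳ M-unit) (*-identityˡ _))))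

      module _ {φ X Y Z} (d : Deg3 φ X Y Z) where

        -- The operator with n = 2 is itself a commutator, so three operators Q_{j,1} act in a row
        -- on 1. The first of them contributes nothing by `Q-0`, and four values of `B` remain.
        Q₃₁-suc : ∀ k f → k ℕ.< f → Δ * Qᵗ (suc (suc f)) (4 ℕ.+ 3 ℕ.* k) 3 φ [] ≈ G₁ (suc k) X Y Z
        Q₃₁-suc k f k<f = begin
          Δ * Qᵗ (suc (suc f)) (4 ℕ.+ 3 ℕ.* k) 3 φ []
            ≈⟨ *-congˡ (trans (reflexive (Qᵗ-split (suc f) (2 ℕ.+ 3 ℕ.* k) 3 (split-3₁ k) c ≡.refl φ [])) (*-congˡ (+-cong left (*-cong sgn₁ right)))) ⟩
          Δ * (u * (u * (b₁₁ - b₁₂) + - 1# * (u * (b₁₂′ - b₂₁))))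
            ≈⟨ solve 6 (λ D u a b b′ c → D :* (u :* (u :* (a :- b) :+ :- :1 :* (u :* (b′ :- c)))) := u :* u :* (D :* a :- D :* b :- D :* b′ :+ D :* c)) ≡.refl Δ u b₁₁ b₁₂ b₁₂′ b₂₁ ⟩
          u * u * (Δ * b₁₁ - Δ * b₁₂ - Δ * b₁₂′ + Δ * b₂₁)
            ≈⟨ *-congˡ (+-cong (+-cong (+-cong (Q-Q-1 k k f (suc f) k≤ₛf k≤f d) (-‿cong (Q-Q-1 k (suc k) f (suc f) k≤ₛf k<f d))) (-‿cong (Q-Q-1 k (suc k) f f k≤f k<f d))) (Q-Q-1 (suc k) k f f k<f k≤f d)) ⟩
          _ ≈⟨ commutator² (solve 8 (λ q t u Q T a b c →
                 u :* u :* (eB q t Q T Q T a b c :- eB q t Q T (q :* Q) (t :* T) a b c :- eB q t Q T (q :* Q) (t :* T) a b c :+ eB q t (q :* Q) (t :* T) Q T a b c)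
                 := u :* eM q t :* (u :* eM q t :* ((q :- t :^ 2) :* (Q :* Q :* Q) :* a :+ (q :^ 2 :- t) :* (T :* T :* T) :* c :- Q :* T :* (q :- t) :* (:1 :+ q :+ t) :* b)))
                 ≡.refl q t u (q ^ suc k) (t ^ suc k) _ _ _) ⟩
          _ ∎
          where
          k≤f = ℕP.<⇒≤ k<f
          k≤ₛf = ℕP.m≤n⇒m≤1+n k≤f
          b₁₁ b₁₂ b₁₂′ b₂₁ : A
          b₁₁ = Qᵗ f (1 ℕ.+ k) 1 (Qᵗ (suc f) (1 ℕ.+ k) 1 φ) (1 ∷ [])
          b₁₂ = Qᵗ f (2 ℕ.+ k) 1 (Qᵗ (suc f) (1 ℕ.+ k) 1 φ) (1 ∷ [])
          b₁₂′ = Qᵗ f (2 ℕ.+ k) 1 (Qᵗ f (1 ℕ.+ k) 1 φ) (1 ∷ [])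
          b₂₁ = Qᵗ f (1 ℕ.+ k) 1 (Qᵗ f (2 ℕ.+ k) 1 φ) (1 ∷ [])
          c : (4 ℕ.+ 3 ℕ.* k) ℕ.∸ (3 ℕ.+ 2 ℕ.* k) ≡ 1 ℕ.+ k
          c = ≡.trans (≡.cong (ℕ._∸ (3 ℕ.+ 2 ℕ.* k)) (lem k)) (ℕP.m+n∸n≡m (1 ℕ.+ k) (3 ℕ.+ 2 ℕ.* k))
            where
            lem : ∀ k → 4 ℕ.+ 3 ℕ.* k ≡ (1 ℕ.+ k) ℕ.+ (3 ℕ.+ 2 ℕ.* k)
            lem = solve-∀
          left : Qᵗ (suc f) (3 ℕ.+ 2 ℕ.* k) 2 (Qᵗ (suc f) (1 ℕ.+ k) 1 φ) [] ≈ u * (b₁₁ - b₁₂)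
          left = trans (Q₂-split f k _ []) (*-congˡ (+-cong (Q-0 (suc k) f k<f _) (-‿cong (Q-0 k f k≤f _))))
          right : Qᵗ (suc f) (1 ℕ.+ k) 1 (Qᵗ (suc f) (3 ℕ.+ 2 ℕ.* k) 2 φ) [] ≈ u * (b₁₂′ - b₂₁)
          right = trans (Q-0 k (suc f) k≤ₛf _) (Q₂-split f k φ (1 ∷ []))

        Q₃₁-zero : ∀ f → Δ * Qᵗ f 1 3 φ [] ≈ G₁ 0 X Y Z
        Q₃₁-zero f = trans (*-congˡ (E₃-0 d f)) (solve 5 (λ q t X Y Z → eΔ q t :* Z :=
          (q :- t :^ 2) :* (:1 :* :1 :* :1) :* eH₃ q X Y Z :+ (q :^ 2 :- t) :* (:1 :* :1 :* :1) :* eH₃ t X Y Z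
            :- :1 :* :1 :* (q :- t) :* (:1 :+ q :+ t) :* eH₂₁ q t X Y Z) ≡.refl q t X Y Z)

        -- The case m = 2 splits into (1 , 1) and (1 , 2). Both factors are single operators D_n up
        -- to sign, so the pattern of nested commutators starts only at the next k.
        Q₃₂-zero : ∀ f → Δ * Qᵗ (suc f) 2 3 φ [] ≈ G₂ 0 X Y Z
        Q₃₂-zero f = trans (*-congˡ (trans (reflexive (Qᵗ-split f 0 3 (split-3₂ 0) ≡.refl ≡.refl φ []))
            (*-congˡ (+-cong (trans (Q₁-0 f _) (E₂-1 d f)) (*-cong sgn₁ (E₂-0 (Q₁-2 d f) f))))))
          (unit-* (solve 6 (λ q t u X Y Z → eΔ q t :* (u :* ((Y :+ Z :- eM q t :* Z) :+ :- :1 :* eQ₁Y q t X Y Z)) :=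
            u :* eM q t :* ((q :- t :^ 2) :* (q :* (:1 :* :1 :* :1)) :* eH₃ q X Y Z :+ (q :^ 2 :- t) :* (t :* (:1 :* :1 :* :1)) :* eH₃ t X Y Z
              :- :1 :* :1 :* (q :- t) :* (q :+ t :+ q :* t) :* eH₂₁ q t X Y Z)) ≡.refl q t u X Y Z))

        Q₃₂-suc : ∀ k f → k ℕ.< f → Δ * Qᵗ (suc (suc f)) (2 ℕ.+ 3 ℕ.* suc k) 3 φ [] ≈ G₂ (suc k) X Y Z
        Q₃₂-suc k f k<f = begin
          Δ * Qᵗ (suc (suc f)) (2 ℕ.+ 3 ℕ.* suc k) 3 φ []
            ≈⟨ *-congˡ (trans (reflexive (Qᵗ-split (suc f) (3 ℕ.* suc k) 3 (split-3₂ (suc k)) c ≡.refl φ [])) (*-congˡ (+-cong left (*-cong sgn₁ right)))) ⟩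
          Δ * (u * (u * (b₁₂ - b₂₁) + - 1# * (u * (b₂₁′ - b₂₂))))
            ≈⟨ solve 6 (λ D u a b b′ c → D :* (u :* (u :* (a :- b) :+ :- :1 :* (u :* (b′ :- c)))) := u :* u :* (D :* a :- D :* b :- D :* b′ :+ D :* c)) ≡.refl Δ u b₁₂ b₂₁ b₂₁′ b₂₂ ⟩
          u * u * (Δ * b₁₂ - Δ * b₂₁ - Δ * b₂₁′ + Δ * b₂₂)
            ≈⟨ *-congˡ (+-cong (+-cong (+-cong (Q-Q-1 k (suc k) f f k≤f k<f d) (-‿cong (Q-Q-1 (suc k) k f f k<f k≤f d)))
                 (-‿cong (Q-Q-1 (suc k) k f (suc f) k<ₛf k≤f d))) (Q-Q-1 (suc k) (suc k) f (suc f) k<ₛf k<f d)) ⟩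
          _ ≈⟨ commutator² (solve 8 (λ q t u Q T a b c →
                 u :* u :* (eB q t Q T (q :* Q) (t :* T) a b c :- eB q t (q :* Q) (t :* T) Q T a b c :- eB q t (q :* Q) (t :* T) Q T a b c
                            :+ eB q t (q :* Q) (t :* T) (q :* Q) (t :* T) a b c)
                 := u :* eM q t :* (u :* eM q t :* ((q :- t :^ 2) :* (q :* (Q :* Q :* Q)) :* a :+ (q :^ 2 :- t) :* (t :* (T :* T :* T)) :* c
                      :- Q :* T :* (q :- t) :* (q :+ t :+ q :* t) :* b)))
                 ≡.refl q t u (q ^ suc k) (t ^ suc k) _ _ _) ⟩
          _ ∎
          where
          k≤f = ℕP.<⇒≤ k<f
          k<ₛf = ℕP.m≤n⇒m≤1+n k<f
          b₁₂ b₂₁ b₂₁′ b₂₂ : A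
          b₁₂ = Qᵗ f (2 ℕ.+ k) 1 (Qᵗ f (1 ℕ.+ k) 1 φ) (1 ∷ [])
          b₂₁ = Qᵗ f (1 ℕ.+ k) 1 (Qᵗ f (2 ℕ.+ k) 1 φ) (1 ∷ [])
          b₂₁′ = Qᵗ f (1 ℕ.+ k) 1 (Qᵗ (suc f) (2 ℕ.+ k) 1 φ) (1 ∷ [])
          b₂₂ = Qᵗ f (2 ℕ.+ k) 1 (Qᵗ (suc f) (2 ℕ.+ k) 1 φ) (1 ∷ [])
          c : (2 ℕ.+ 3 ℕ.* suc k) ℕ.∸ (2 ℕ.+ k) ≡ 3 ℕ.+ 2 ℕ.* k
          c = ≡.trans (≡.cong (ℕ._∸ (2 ℕ.+ k)) (lem k)) (ℕP.m+n∸n≡m (3 ℕ.+ 2 ℕ.* k) (2 ℕ.+ k))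
            where
            lem : ∀ k → 2 ℕ.+ 3 ℕ.* suc k ≡ (3 ℕ.+ 2 ℕ.* k) ℕ.+ (2 ℕ.+ k)
            lem = solve-∀
          left : Qᵗ (suc f) (2 ℕ.+ k) 1 (Qᵗ (suc f) (3 ℕ.+ 2 ℕ.* k) 2 φ) [] ≈ u * (b₁₂ - b₂₁)
          left = trans (Q-0 (suc k) (suc f) k<ₛf _) (Q₂-split f k φ (1 ∷ []))
          right : Qᵗ (suc f) (3 ℕ.+ 2 ℕ.* k) 2 (Qᵗ (suc f) (2 ℕ.+ k) 1 φ) [] ≈ u * (b₂₁′ - b₂₂)
          right = trans (Q₂-split f k _ []) (*-congˡ (+-cong (Q-0 (suc k) f k<f _) (-‿cong (Q-0 k f k≤f _))))

      Q₃₂ : ∀ k f → k ℕ.< f → ∀ {φ X Y Z} → Deg3 φ X Y Z → Δ * Qᵗ (suc f) (2 ℕ.+ 3 ℕ.* k) 3 φ [] ≈ G₂ k X Y Z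
      Q₃₂ zero    f       _         d = Q₃₂-zero d f
      Q₃₂ (suc k) (suc f) (s≤s k<f) d = Q₃₂-suc d k f k<f

      -- For positive k the bound leaves two units of fuel for the nested commutators and still
      -- enough for the operators Q_{j,1} below them.
      Q₃₁ : ∀ k f → k ℕ.+ k ℕ.< f → ∀ {φ X Y Z} → Deg3 φ X Y Z → Δ * Qᵗ f (1 ℕ.+ 3 ℕ.* k) 3 φ [] ≈ G₁ k X Y Z
      Q₃₁ zero    f       _         d = Q₃₁-zero d f
      Q₃₁ (suc k) (suc (suc f)) (s≤s (s≤s k<f)) {φ} d =
        trans (reflexive (≡.cong (λ m → Δ * Qᵗ (suc (suc f)) m 3 φ []) (≡.cong suc (ℕP.*-suc 3 k)))) (Q₃₁-suc d k f (ℕP.≤-trans (s≤s (ℕP.m≤m+n k k)) (ℕP.≤-trans (ℕP.≤-reflexive (≡.sym (ℕP.+-suc k k))) k<f)))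

      -- The split at (1 , 0) gives a commutator of Q_{3k+2,3} with D_0. As D_0 fixes 1, the
      -- coefficient of each H_mu is multiplied by one minus the eigenvalue, divided by M, that is
      -- by B_mu. This turns the coefficients of `G₂` into those of `G₀`.
      Q₃₀ : ∀ k f → k ℕ.< f → ∀ {φ X Y Z} → Deg3 φ X Y Z → Δ * Qᵗ (suc (suc f)) (3 ℕ.+ 3 ℕ.* k) 3 φ [] ≈ G₀ k X Y Z
      Q₃₀ k f k<f {φ} {X} {Y} {Z} d =
        trans (*-congˡ (trans (reflexive (Qᵗ-split (suc f) (1 ℕ.+ 3 ℕ.* k) 3 (split-3₀ k) ≡.refl ≡.refl φ [])) (*-congˡ (+-cong (D₀-0 (suc f) _) (*-congʳ sgn₁)))))
          (trans (solve 4 (λ D u a b → D :* (u :* (a :+ :- :1 :* b)) := u :* (D :* a :- D :* b)) ≡.refl Δ u _ _)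
            (trans (*-congˡ (+-cong (Q₃₂ k f k<f d) (-‿cong (Q₃₂ k f k<f (D₀-3 d (suc f))))))
              (unit-* (solve 8 (λ q t u Q T X Y Z →
                let g : Expr 8 → Expr 8 → Expr 8 → Expr 8
                    g X Y Z = (q :- t :^ 2) :* (q :* (Q :* Q :* Q)) :* eH₃ q X Y Z :+ (q :^ 2 :- t) :* (t :* (T :* T :* T)) :* eH₃ t X Y Z
                                :- Q :* T :* (q :- t) :* (q :+ t :+ q :* t) :* eH₂₁ q t X Y Z in
                u :* (g X Y Z :- g (eD₀X q t X Y Z) (eD₀Y q t X Y Z) (eD₀Z q t X Y Z))
                := u :* eM q t :* ((q :- t :^ 2) :* (q :* (Q :* Q :* Q) :* (:1 :+ q :+ q :^ 2)) :* eH₃ q X Y Z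
                     :+ (q :^ 2 :- t) :* (t :* (T :* T :* T) :* (:1 :+ t :+ t :^ 2)) :* eH₃ t X Y Z
                     :- Q :* T :* (q :- t) :* ((q :+ t :+ q :* t) :* (:1 :+ q :+ t)) :* eH₂₁ q t X Y Z))
                ≡.refl q t u (q ^ k) (t ^ k) X Y Z))))

-- Correctness of the transposition, and the concrete coefficient ring

module Operators where
  open RingSolve
  open PolynomialRing
  open Localisation
  open CoefficientRing
  open OperatorCalculus
  open import Data.Integer using (+_)

  module Linear (R : CommutativeRing 0ℓ 0ℓ) where
    open CommutativeRing R hiding (zero) renaming (Carrier to A)
    open Solver R using (solve)

    E : {X : Set} → (X → A) → List (A × X) → A
    E φ []            = 0#
    E φ ((c , x) ∷ F) = c * φ x + E φ F

    E-++ : ∀ {X : Set} (φ : X → A) F G → E φ (F ++ G) ≈ E φ F + E φ G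
    E-++ φ []            G = sym (+-identityˡ _)
    E-++ φ ((c , x) ∷ F) G = trans (+-congˡ (E-++ φ F G)) (sym (+-assoc _ _ _))

    module _ {X : Set} where

      E-zero : ∀ (F : List (A × X)) → E (λ _ → 0#) F ≈ 0#
      E-zero []            = refl
      E-zero ((c , x) ∷ F) = trans (+-cong (zeroʳ c) (E-zero F)) (+-identityˡ _)

      E-scale : ∀ u (φ : X → A) F → E (λ x → u * φ x) F ≈ u * E φ F
      E-scale u φ []            = sym (zeroʳ u)
      E-scale u φ ((c , x) ∷ F) = trans (+-congˡ (E-scale u φ F))
        (solve 4 (λ u c a e → c :* (u :* a) :+ u :* e := u :* (c :* a :+ e)) ≡.refl u c (φ x) (E φ F))

      E-add : ∀ (φ ψ : X → A) F → E (λ x → φ x + ψ x) F ≈ E φ F + E ψ F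
      E-add φ ψ []            = sym (+-identityˡ _)
      E-add φ ψ ((c , x) ∷ F) = trans (+-congˡ (E-add φ ψ F))
        (solve 5 (λ c a b e f → c :* (a :+ b) :+ (e :+ f) := (c :* a :+ e) :+ (c :* b :+ f)) ≡.refl c (φ x) (ψ x) (E φ F) (E ψ F))

      E-map : ∀ {Y : Set} u (h : A × X → A × Y) (f : X → Y) (φ : Y → A) →
              (∀ c x → proj₁ (h (c , x)) ≈ u * c) → (∀ c x → proj₂ (h (c , x)) ≡ f x) →
              ∀ F → E φ (L.map h F) ≈ u * E (λ x → φ (f x)) F
      E-map u h f φ e₁ e₂ []            = sym (zeroʳ u)
      E-map u h f φ e₁ e₂ ((c , x) ∷ F) = trans
        (+-cong (*-cong (e₁ c x) (reflexive (≡.cong φ (e₂ c x)))) (E-map u h f φ e₁ e₂ F))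
        (solve 4 (λ u c a e → u :* c :* a :+ u :* e := u :* (c :* a :+ e)) ≡.refl u c (φ (f x)) (E (λ x → φ (f x)) F))

      -- An operator given term by term has transpose `ψ` as soon as this holds on every single
      -- term.
      E-concatMap : ∀ {Y : Set} (g : A × X → List (A × Y)) (φ : Y → A) (ψ : X → A) →
                    (∀ c x → E φ (g (c , x)) ≈ c * ψ x) → ∀ F → E φ (L.concatMap g F) ≈ E ψ F
      E-concatMap g φ ψ e []            = refl
      E-concatMap g φ ψ e ((c , x) ∷ F) =
        trans (E-++ φ (g (c , x)) (L.concatMap g F)) (+-cong (e c x) (E-concatMap g φ ψ e F))

    E-bracket : ∀ {X : Set} u s (α β : X → A) F x y z₁ z₂ → x ≈ u * y → y ≈ z₁ + s * z₂ → z₁ ≈ E α F → z₂ ≈ E β F →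
                x ≈ E (λ l → u * (α l + s * β l)) F
    E-bracket u s α β F x y z₁ z₂ e e′ e₁ e₂ = trans e (trans (*-congˡ (trans e′ (trans (+-cong e₁ (*-congˡ e₂))
      (sym (trans (E-add α (λ l → s * β l) F) (+-congˡ (E-scale s β F))))))) (sym (E-scale u (λ l → α l + s * β l) F)))

  module Concrete (N : ℕ) where
    Kr : CommutativeRing 0ℓ 0ℓ
    Kr = Fractions.fractionRing {N}

    private
      module F = CommutativeRing Kr
      module P = CommutativeRing (polyRing {N})
    open F using (_≈_) renaming (Carrier to A)
    open Solver Kr using (solve)
    open Linear Kr

    Minv : A
    Minv = (constP 1ℚ , 1)

    Eel : ℕ → (List ℕ → A) → A
    Eel n ψ = E ψ (elem n)

    open Transpose Kr Minv pM signK Eel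

    E-sfMul : ∀ φ (G H : SF N) → E φ (sfMul G H) ≈ E (λ l → E (λ l' → φ (l ++ l')) H) G
    E-sfMul φ G H = E-concatMap _ φ _ (λ c l → E-map c _ (l ++_) φ (λ _ _ → F.refl) (λ _ _ → ≡.refl) H) G

    E-pleth : ∀ (g : List ℕ → ℕ → A) c l → E (λ x → g (proj₁ x) (proj₂ x)) (plethExpand c l) ≈ c F.* pleth g l
    E-pleth g c []       = F.+-identityʳ _
    E-pleth g c (a ∷ as) = F.trans
      (E-concatMap _ (λ x → g (proj₁ x) (proj₂ x)) (λ x → g (a ∷ proj₁ x) (proj₂ x) F.+ pM a F.* g (proj₁ x) (proj₂ x ℕ.+ a))
        (λ { d (μ , j) → solve 4 (λ d x m y → d :* x :+ (d :* m :* y :+ :0) := d :* (x :+ m :* y)) ≡.refl d (g (a ∷ μ) j) (pM a) (g μ (j ℕ.+ a)) })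
        (plethExpand c as))
      (E-pleth (λ μ j → g (a ∷ μ) j F.+ pM a F.* g μ (j ℕ.+ a)) c as)

    E-Dop : ∀ k φ F → E φ (Dop k F) ≈ E (Dᵗ k φ) F
    E-Dop k φ F = E-concatMap _ φ (Dᵗ k φ) (λ c l → F.trans
      (E-concatMap _ φ (λ x → kernel k φ (proj₁ x) (proj₂ x))
        (λ { d (μ , j) → F.trans (E-sfMul φ ((signK (k ℕ.+ j) F.* d , μ) ∷ []) (elem (k ℕ.+ j)))
               (solve 3 (λ s d e → s :* d :* e :+ :0 := d :* (s :* e)) ≡.refl (signK (k ℕ.+ j)) d (Eel (k ℕ.+ j) (λ l' → φ (μ ++ l')))) })
        (plethExpand c l))
      (E-pleth (kernel k φ) c l)) F

    E-sfScale : ∀ k φ F → E φ (sfScale k F) ≈ k F.* E φ F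
    E-sfScale k φ F = E-map k _ (λ l → l) φ (λ _ _ → F.refl) (λ _ _ → ≡.refl) F

    E-sfDivM : ∀ φ F → E φ (sfDivM F) ≈ Minv F.* E φ F
    E-sfDivM φ F = E-map Minv _ (λ l → l) φ (λ { (p , e) _ → Fractions.mkᴸ (P.*-congʳ (P.sym (P.*-identityˡ p))) }) (λ _ _ → ≡.refl) F

    -- Induction on the fuel. The empty list that `Qop` returns for m = 0 or exhausted fuel
    -- corresponds to the zero functional, so no bound on the fuel enters.
    E-Qop : ∀ f m n φ F → E φ (Qop f m n F) ≈ E (Qᵗ f m n φ) F
    E-Qop f       zero          n φ F = F.sym (E-zero F)
    E-Qop f       (suc zero)    n φ F = F.trans (E-sfScale (signK n) φ (Dop n F))
      (F.trans (F.*-congˡ {signK n} {E φ (Dop n F)} {E (Dᵗ n φ) F} (E-Dop n φ F)) (F.sym (E-scale (signK n) (Dᵗ n φ) F)))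
    E-Qop zero    (suc (suc m)) n φ F = F.sym (E-zero F)
    E-Qop (suc f) (suc (suc m)) n φ F =
      E-bracket Minv (signK 1) α β F (E φ (sfDivM (QQ ++ sfNeg QQ′))) (E φ (QQ ++ sfNeg QQ′)) (E φ QQ) (E φ QQ′)
        (E-sfDivM φ (QQ ++ sfNeg QQ′))
        (F.trans {E φ (QQ ++ sfNeg QQ′)} {E φ QQ F.+ E φ (sfNeg QQ′)} {E φ QQ F.+ signK 1 F.* E φ QQ′}
          (E-++ φ QQ (sfNeg QQ′)) (F.+-congˡ {E φ QQ} {E φ (sfNeg QQ′)} {signK 1 F.* E φ QQ′} (E-sfScale (signK 1) φ QQ′)))
        (F.trans {E φ QQ} {E (Qᵗ f c d φ) (Qop f a b F)} {E α F} (E-Qop f c d φ (Qop f a b F)) (E-Qop f a b (Qᵗ f c d φ) F))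
        (F.trans {E φ QQ′} {E (Qᵗ f a b φ) (Qop f c d F)} {E β F} (E-Qop f a b φ (Qop f c d F)) (E-Qop f c d (Qᵗ f a b φ) F))
      where
      a = proj₁ (splitPt (suc (suc m)) n)
      b = proj₂ (splitPt (suc (suc m)) n)
      c = suc (suc m) ℕ.∸ a
      d = n ℕ.∸ b
      QQ = Qop f c d (Qop f a b F)
      QQ′ = Qop f a b (Qop f c d F)
      α = Qᵗ f a b (Qᵗ f c d φ)
      β = Qᵗ f c d (Qᵗ f a b φ)

    powersum : List ℕ → A
    powersum l = polyK (prodP (L.map pEval l))

    evalSF-E : ∀ F → evalSF F ≡ E powersum F
    evalSF-E []            = ≡.refl
    evalSF-E ((c , l) ∷ F) = ≡.cong ((c *K powersum l) +K_) (evalSF-E F)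

    Q1-transpose : ∀ m n → Q1 N m n ≈ Qᵗ m m n powersum []
    Q1-transpose m n = F.trans (F.reflexive (evalSF-E (Qop m m n oneSF))) (F.trans (E-Qop m m n powersum oneSF)
      (solve 1 (λ x → :1 :* x :+ :0 := x) ≡.refl (Qᵗ m m n powersum [])))

    q t half third : A
    q = polyK (qtP (+ 1) (+ 0))
    t = polyK (qtP (+ 0) (+ 1))
    half = constK (+ 1 ℚ./ 2)
    third = constK (+ 1 ℚ./ 3)

    open QAlgebra Kr q t Minv half third pM signK Eel using (Hypotheses)

    polyK-cong : ∀ {p r} → p ≋ r → polyK p ≈ polyK r
    polyK-cong {p} {r} h = Fractions.mkᴸ (P.*-congʳ {constP 1ℚ} {p} {r} h)

    polyK-+ : ∀ p r → polyK (p ⊕ r) ≈ polyK p F.+ polyK r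
    polyK-+ p r = Fractions.mkᴸ (P.*-congʳ {constP 1ℚ} {p ⊕ r} {p ⊗ constP 1ℚ ⊕ r ⊗ constP 1ℚ}
      (P.sym (P.+-cong {p ⊗ constP 1ℚ} {p} {r ⊗ constP 1ℚ} {r} (P.*-identityʳ p) (P.*-identityʳ r))))

    polyK-sub : ∀ p r → polyK (p P.- r) ≈ polyK p F.- polyK r
    polyK-sub p r = polyK-+ p (P.- r)

    qtP-* : ∀ i j i' j' → qtP {N} i j ⊗ qtP i' j' ≡ qtP (i ℤ.+ i') (j ℤ.+ j')
    qtP-* i j i' j' = ≡.cong (λ v → (1ℚ , (i ℤ.+ i' , j ℤ.+ j' , v)) ∷ []) (VP.zipWith-replicate ℕ._+_ 0 0)

    polyK-1-sub : ∀ p x → polyK p ≈ x → polyK (constP 1ℚ P.- p) ≈ F.1# F.- x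
    polyK-1-sub p x e = F.trans {polyK (constP 1ℚ P.- p)} {F.1# F.- polyK p} {F.1# F.- x}
      (polyK-sub (constP 1ℚ) p) (F.+-congˡ {F.1#} {F.- polyK p} {F.- x} (F.-‿cong {polyK p} {x} e))

    polyK-1-sub² : ∀ p r x y → polyK p ≈ x → polyK r ≈ y →
                   polyK ((constP 1ℚ P.- p) ⊗ (constP 1ℚ P.- r)) ≈ (F.1# F.- x) F.* (F.1# F.- y)
    polyK-1-sub² p r x y e e′ = F.*-cong {polyK (constP 1ℚ P.- p)} {F.1# F.- x} {polyK (constP 1ℚ P.- r)} {F.1# F.- y}
      (polyK-1-sub p x e) (polyK-1-sub r y e′)

    constP-+ : ∀ a b → constP {N} a ⊕ constP b ≋ constP (a ℚ.+ b)
    constP-+ a b = ∫-≋ λ g → ℚS.solve 3 (λ a b x → a :* x :+ (b :* x :+ :0) := (a :+ b) :* x :+ :0) ≡.refl a b (g mono1)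
      where module ℚS = Solver ℚP.+-*-commutativeRing

    constP-twice : ∀ a → constP a ⊗ (constP 1ℚ ⊕ constP 1ℚ) ≋ constP (a ℚ.+ a)
    constP-twice a = P.trans (PS.solve 1 (λ a → a :* (:1 :+ :1) := a :+ a) ≡.refl (constP a)) (constP-+ a a)
      where module PS = Solver (polyRing {N})

    constP-thrice : ∀ a → constP a ⊗ ((constP 1ℚ ⊕ constP 1ℚ) ⊕ constP 1ℚ) ≋ constP ((a ℚ.+ a) ℚ.+ a)
    constP-thrice a = P.trans (PS.solve 1 (λ a → a :* ((:1 :+ :1) :+ :1) := (a :+ a) :+ a) ≡.refl (constP a))
      (P.trans (P.+-congʳ {constP a} {constP a ⊕ constP a} {constP (a ℚ.+ a)} (constP-+ a a)) (constP-+ (a ℚ.+ a) a))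
      where module PS = Solver (polyRing {N})

    private
      M-unit : Minv F.* ((F.1# F.- q) F.* (F.1# F.- t)) ≈ F.1#
      M-unit = F.trans {Minv F.* ((F.1# F.- q) F.* (F.1# F.- t))} {Minv F.* polyK Mpoly} {F.1#}
        (F.*-congˡ {Minv} {(F.1# F.- q) F.* (F.1# F.- t)} {polyK Mpoly}
          (F.sym {polyK Mpoly} {(F.1# F.- q) F.* (F.1# F.- t)}
            (polyK-1-sub² (qtP (+ 1) (+ 0)) (qtP (+ 0) (+ 1)) q t (F.refl {q}) (F.refl {t}))))
        (Fractions.mkᴸ (PS.solve 1 (λ m → :1 :* m :* :1 := :1 :* (m :* :1)) ≡.refl Mpoly))
        where module PS = Solver (polyRing {N})

      half-2 : half F.* (F.1# F.+ F.1#) ≈ F.1#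
      half-2 = F.trans {half F.* (F.1# F.+ F.1#)} {half F.* polyK (constP 1ℚ ⊕ constP 1ℚ)} {F.1#}
        (F.*-congˡ {half} {F.1# F.+ F.1#} {polyK (constP 1ℚ ⊕ constP 1ℚ)}
          (F.sym {polyK (constP 1ℚ ⊕ constP 1ℚ)} {F.1# F.+ F.1#} (polyK-+ (constP 1ℚ) (constP 1ℚ))))
        (polyK-cong (constP-twice (+ 1 ℚ./ 2)))

      third-3 : third F.* ((F.1# F.+ F.1#) F.+ F.1#) ≈ F.1#
      third-3 = F.trans {third F.* ((F.1# F.+ F.1#) F.+ F.1#)} {third F.* polyK ((constP 1ℚ ⊕ constP 1ℚ) ⊕ constP 1ℚ)} {F.1#}
        (F.*-congˡ {third} {(F.1# F.+ F.1#) F.+ F.1#} {polyK ((constP 1ℚ ⊕ constP 1ℚ) ⊕ constP 1ℚ)}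
          (F.sym {polyK ((constP 1ℚ ⊕ constP 1ℚ) ⊕ constP 1ℚ)} {(F.1# F.+ F.1#) F.+ F.1#}
            (F.trans {polyK ((constP 1ℚ ⊕ constP 1ℚ) ⊕ constP 1ℚ)} {polyK (constP 1ℚ ⊕ constP 1ℚ) F.+ F.1#} {(F.1# F.+ F.1#) F.+ F.1#}
              (polyK-+ (constP 1ℚ ⊕ constP 1ℚ) (constP 1ℚ))
              (F.+-congʳ {F.1#} {polyK (constP 1ℚ ⊕ constP 1ℚ)} {F.1# F.+ F.1#} (polyK-+ (constP 1ℚ) (constP 1ℚ))))))
        (polyK-cong (constP-thrice (+ 1 ℚ./ 3)))

      q² : polyK (qtP (+ 2) (+ 0)) ≈ q F.* q
      q² = F.reflexive (≡.cong polyK (≡.sym (qtP-* (+ 1) (+ 0) (+ 1) (+ 0))))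

      t² : polyK (qtP (+ 0) (+ 2)) ≈ t F.* t
      t² = F.reflexive (≡.cong polyK (≡.sym (qtP-* (+ 0) (+ 1) (+ 0) (+ 1))))

      q³ : polyK (qtP (+ 3) (+ 0)) ≈ q F.* q F.* q
      q³ = F.trans {polyK (qtP (+ 3) (+ 0))} {polyK (qtP (+ 2) (+ 0)) F.* q} {q F.* q F.* q}
        (F.reflexive (≡.cong polyK (≡.sym (qtP-* (+ 2) (+ 0) (+ 1) (+ 0))))) (F.*-congʳ {q} {polyK (qtP (+ 2) (+ 0))} {q F.* q} q²)

      t³ : polyK (qtP (+ 0) (+ 3)) ≈ t F.* t F.* t
      t³ = F.trans {polyK (qtP (+ 0) (+ 3))} {polyK (qtP (+ 0) (+ 2)) F.* t} {t F.* t F.* t}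
        (F.reflexive (≡.cong polyK (≡.sym (qtP-* (+ 0) (+ 2) (+ 0) (+ 1))))) (F.*-congʳ {t} {polyK (qtP (+ 0) (+ 2))} {t F.* t} t²)

    hypotheses : Hypotheses
    hypotheses = record
      { M-unit = M-unit
      ; half = half-2
      ; third-3 = third-3
      ; pM₁ = polyK-1-sub² (qtP (+ 1) (+ 0)) (qtP (+ 0) (+ 1)) q t (F.refl {q}) (F.refl {t})
      ; pM₂ = polyK-1-sub² (qtP (+ 2) (+ 0)) (qtP (+ 0) (+ 2)) (q F.* q) (t F.* t) q² t²
      ; pM₃ = polyK-1-sub² (qtP (+ 3) (+ 0)) (qtP (+ 0) (+ 3)) (q F.* q F.* q) (t F.* t F.* t) q³ t³
      ; sgn₀ = F.refl {F.1#}
      ; sgn₁ = F.refl {F.- F.1#}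
      ; sgn₂ = F.refl {F.1#}
      ; sgn₃ = F.refl {F.- F.1#}
      -- The left-hand sides here and in the next three fields copy the coefficients of `elem`
      -- exactly as they unfold, unit factors included.
      ; e₀ = λ ψ → solve 1 (λ x → :1 :* x :+ :0 := x) ≡.refl (ψ [])
      ; e₁ = λ ψ → solve 1 (λ x → (:1 :* (:1 :* (:1 :* :1))) :* x :+ :0 := x) ≡.refl (ψ (1 ∷ []))
      ; e₂ = λ ψ → solve 3 (λ h x y → (h :* (:1 :* ((:1 :* (:1 :* (:1 :* :1))) :* :1))) :* x :+ ((h :* (:- :1 :* (:1 :* :1))) :* y :+ :0)
                                    := h :* (x :- y)) ≡.refl half (ψ (1 ∷ 1 ∷ [])) (ψ (2 ∷ []))
      ; e₃ = λ ψ → solve 6 (λ h c x y z w →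
          (c :* (:1 :* ((h :* (:1 :* ((:1 :* (:1 :* (:1 :* :1))) :* :1))) :* :1))) :* x
          :+ ((c :* (:1 :* ((h :* (:- :1 :* (:1 :* :1))) :* :1))) :* y
          :+ ((c :* (:- :1 :* ((:1 :* (:1 :* (:1 :* :1))) :* :1))) :* z
          :+ ((c :* (:1 :* (:1 :* :1))) :* w :+ :0)))
          := c :* (h :* (x :- y) :- z :+ w)) ≡.refl half third (ψ (1 ∷ 1 ∷ 1 ∷ [])) (ψ (2 ∷ 1 ∷ [])) (ψ (1 ∷ 2 ∷ [])) (ψ (3 ∷ []))
      }

-- Sums over triples of variables, sorted by order type

module SymmetricSums where
  open RingSolve
  open import Data.Bool using (T)
  open import Data.Fin using (toℕ)

  module Sums (R : CommutativeRing 0ℓ 0ℓ) where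
    open CommutativeRing R hiding (zero) renaming (Carrier to A)
    open import Algebra.Properties.CommutativeSemigroup +-commutativeSemigroup using () renaming (interchange to +-interchange)

    S : {X : Set} → List X → (X → A) → A
    S xs f = L.foldr _+_ 0# (L.map f xs)

    S-cong : ∀ {X : Set} (xs : List X) {f g : X → A} → (∀ x → f x ≈ g x) → S xs f ≈ S xs g
    S-cong []       e = refl
    S-cong (x ∷ xs) e = +-cong (e x) (S-cong xs e)

    S-zero : ∀ {X : Set} (xs : List X) → S xs (λ _ → 0#) ≈ 0#
    S-zero []       = refl
    S-zero (x ∷ xs) = trans (+-identityˡ _) (S-zero xs)

    S-add : ∀ {X : Set} (xs : List X) (f g : X → A) → S xs (λ x → f x + g x) ≈ S xs f + S xs g
    S-add []       f g = sym (+-identityˡ _)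
    S-add (x ∷ xs) f g = trans (+-congˡ (S-add xs f g)) (+-interchange _ _ _ _)

    S-*ˡ : ∀ {X : Set} (xs : List X) a (f : X → A) → S xs (λ x → a * f x) ≈ a * S xs f
    S-*ˡ []       a f = sym (zeroʳ a)
    S-*ˡ (x ∷ xs) a f = trans (+-congˡ (S-*ˡ xs a f)) (sym (distribˡ a _ _))

    S-*ʳ : ∀ {X : Set} (xs : List X) a (f : X → A) → S xs (λ x → f x * a) ≈ S xs f * a
    S-*ʳ []       a f = sym (zeroˡ a)
    S-*ʳ (x ∷ xs) a f = trans (+-congˡ (S-*ʳ xs a f)) (sym (distribʳ a _ _))

    S-++ : ∀ {X : Set} (xs ys : List X) f → S (xs ++ ys) f ≈ S xs f + S ys f
    S-++ []       ys f = sym (+-identityˡ _)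
    S-++ (x ∷ xs) ys f = trans (+-congˡ (S-++ xs ys f)) (sym (+-assoc _ _ _))

    S-map : ∀ {X Y : Set} (h : X → Y) xs f → S (L.map h xs) f ≡ S xs (λ x → f (h x))
    S-map h []       f = ≡.refl
    S-map h (x ∷ xs) f = ≡.cong (f (h x) +_) (S-map h xs f)

    S-concatMap : ∀ {X Y : Set} (h : X → List Y) xs f → S (L.concatMap h xs) f ≈ S xs (λ x → S (h x) f)
    S-concatMap h []       f = refl
    S-concatMap h (x ∷ xs) f = trans (S-++ (h x) (L.concatMap h xs) f) (+-congˡ (S-concatMap h xs f))

    S-swap : ∀ {X Y : Set} (xs : List X) (ys : List Y) (f : X → Y → A) →
             S xs (λ x → S ys (f x)) ≈ S ys (λ y → S xs (λ x → f x y))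
    S-swap []       ys f = sym (S-zero ys)
    S-swap (x ∷ xs) ys f = trans (+-congˡ (S-swap xs ys f)) (sym (S-add ys (f x) _))

    [_]·_ : Bool → A → A
    [ b ]· a = if b then a else 0#

    S-filterᵇ : ∀ {X : Set} (p : X → Bool) xs f → S (L.filterᵇ p xs) f ≈ S xs (λ x → [ p x ]· f x)
    S-filterᵇ p []       f = refl
    S-filterᵇ p (x ∷ xs) f with p x
    ... | true  = +-congˡ (S-filterᵇ p xs f)
    ... | false = trans (S-filterᵇ p xs f) (sym (+-identityˡ _))

    []·-cong : ∀ b {x y} → x ≈ y → [ b ]· x ≈ [ b ]· y
    []·-cong true  e = e
    []·-cong false e = refl

  data Order : Set where
    lt eq gt : Order

  module Codes where
    isLt isLe isEq : Order → Bool
    isLt lt = true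
    isLt _  = false
    isLe gt = false
    isLe _  = true
    isEq eq = true
    isEq _  = false

    flip : Order → Order
    flip lt = gt
    flip eq = eq
    flip gt = lt

    order : ℕ → ℕ → Order
    order zero    zero    = eq
    order zero    (suc n) = lt
    order (suc m) zero    = gt
    order (suc m) (suc n) = order m n

    flip-order : ∀ m n → order n m ≡ flip (order m n)
    flip-order zero    zero    = ≡.refl
    flip-order zero    (suc n) = ≡.refl
    flip-order (suc m) zero    = ≡.refl
    flip-order (suc m) (suc n) = flip-order m n

    order-< : ∀ m n → (m ℕ.<ᵇ n) ≡ isLt (order m n)
    order-< zero    zero    = ≡.refl
    order-< zero    (suc n) = ≡.refl
    order-< (suc m) zero    = ≡.refl
    order-< (suc m) (suc n) = order-< m n

    order-≤ : ∀ m n → (m ℕ.≤ᵇ n) ≡ isLe (order m n)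
    order-≤ zero    zero    = ≡.refl
    order-≤ zero    (suc n) = ≡.refl
    order-≤ (suc m) zero    = ≡.refl
    order-≤ (suc m) (suc n) = ≡.trans (lem m n) (order-≤ m n)
      where
      lem : ∀ m n → (suc m ℕ.≤ᵇ suc n) ≡ (m ℕ.≤ᵇ n)
      lem zero    n = ≡.refl
      lem (suc m) n = ≡.refl

    -- Which triples (order a b, order b c, order a c) can occur.
    consistent : Order → Order → Order → Bool
    consistent lt gt z = true
    consistent gt lt z = true
    consistent eq y  z = same y z
      where
      same : Order → Order → Bool
      same lt lt = true
      same eq eq = true
      same gt gt = true
      same _  _  = false
    consistent lt _ lt = true
    consistent gt _ gt = true
    consistent _  _ _  = false

    consistent-order : ∀ a b c → consistent (order a b) (order b c) (order a c) ≡ true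
    consistent-order zero zero zero = ≡.refl
    consistent-order zero zero (suc c) = ≡.refl
    consistent-order zero (suc b) zero = ≡.refl
    consistent-order zero (suc b) (suc c) with order b c
    ... | lt = ≡.refl
    ... | eq = ≡.refl
    ... | gt = ≡.refl
    consistent-order (suc a) zero zero = ≡.refl
    consistent-order (suc a) zero (suc c) = ≡.refl
    consistent-order (suc a) (suc b) zero with order a b
    ... | lt = ≡.refl
    ... | eq = ≡.refl
    ... | gt = ≡.refl
    consistent-order (suc a) (suc b) (suc c) = consistent-order a b c

    Pred : Set
    Pred = Order → Order → Order → Bool

    count : List Bool → ℕ
    count []           = 0
    count (true ∷ bs)  = suc (count bs)
    count (false ∷ bs) = count bs

    evals : List Pred → Order → Order → Order → List Bool
    evals Ps x y z = L.map (λ P → P x y z) Ps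

    agree : List Pred → List Pred → Order → Order → Order → Bool
    agree Ps Qs x y z = if consistent x y z then count (evals Ps x y z) ℕ.≡ᵇ count (evals Qs x y z) else true

    everyOrder : (Order → Bool) → Bool
    everyOrder p = p lt ∧ p eq ∧ p gt

    everyOrder-sound : ∀ p → everyOrder p ≡ true → ∀ o → p o ≡ true
    everyOrder-sound p h o with p lt in e₁ | p eq in e₂ | p gt in e₃
    everyOrder-sound p h lt | true | true | true = e₁
    everyOrder-sound p h eq | true | true | true = e₂
    everyOrder-sound p h gt | true | true | true = e₃

    agrees : List Pred → List Pred → Bool
    agrees Ps Qs = everyOrder (λ x → everyOrder (λ y → everyOrder (agree Ps Qs x y)))

    -- The predicate read on the triple with two entries exchanged. The sum `τ` is unchanged,
    -- because the monomial is symmetric in its three entries.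
    swapBC swapAB : Pred → Pred
    swapBC P x y z = P z (flip y) x
    swapAB P x y z = P (flip x) z y

    -- The first four are the conditions of the fundamental functions of degree three. `hook` is the
    -- tableau with first row a b and c below a; `pair` and `triple` give the power sums p_2 p_1 and
    -- p_3.
    weak weakStrict strictWeak strict hook pair triple all : Pred
    weak       x y z = isLe x ∧ isLe y
    weakStrict x y z = isLe x ∧ isLt y
    strictWeak x y z = isLt x ∧ isLe y
    strict     x y z = isLt x ∧ isLt y
    hook       x y z = isLe x ∧ isLt z
    pair       x y z = isEq x
    triple     x y z = isEq x ∧ isEq y
    all        x y z = true

  open Codes

  module Triples (R : CommutativeRing 0ℓ 0ℓ) (N : ℕ) (v : Fin N → CommutativeRing.Carrier R) where
    open CommutativeRing R hiding (zero) renaming (Carrier to A)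
    open Solver R using (solve)
    open Sums R

    -- The last entry is summed outermost, the order in which `tuples` enumerates words.
    Σ³ : (Fin N → Fin N → Fin N → A) → A
    Σ³ f = S (L.allFin N) (λ c → S (L.allFin N) (λ b → S (L.allFin N) (λ a → f a b c)))

    Σ³-cong : ∀ {f g : Fin N → Fin N → Fin N → A} → (∀ a b c → f a b c ≈ g a b c) → Σ³ f ≈ Σ³ g
    Σ³-cong e = S-cong (L.allFin N) λ c → S-cong (L.allFin N) λ b → S-cong (L.allFin N) λ a → e a b c

    Σ³-add : ∀ f g → Σ³ (λ a b c → f a b c + g a b c) ≈ Σ³ f + Σ³ g
    Σ³-add f g = trans (S-cong (L.allFin N) λ c → trans (S-cong (L.allFin N) λ b → S-add (L.allFin N) _ _) (S-add (L.allFin N) _ _)) (S-add (L.allFin N) _ _)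

    Σ³-zero : Σ³ (λ _ _ _ → 0#) ≈ 0#
    Σ³-zero = trans (S-cong (L.allFin N) λ c → trans (S-cong (L.allFin N) λ b → S-zero (L.allFin N)) (S-zero (L.allFin N))) (S-zero (L.allFin N))

    w : Fin N → Fin N → Fin N → A
    w a b c = v a * v b * v c

    ord : Fin N → Fin N → Order
    ord a b = order (toℕ a) (toℕ b)

    τ : Pred → A
    τ P = Σ³ (λ a b c → [ P (ord a b) (ord b c) (ord a c) ]· w a b c)

    τ-swapAB : ∀ P → τ (swapAB P) ≈ τ P
    τ-swapAB P = S-cong (L.allFin N) λ c → trans (S-swap (L.allFin N) (L.allFin N) _)
      (S-cong (L.allFin N) λ b → S-cong (L.allFin N) λ a → step b a c)
      where
      step : ∀ b a c → [ swapAB P (ord b a) (ord a c) (ord b c) ]· w b a c ≈ [ P (ord a b) (ord b c) (ord a c) ]· w a b c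
      step b a c rewrite flip-order (toℕ b) (toℕ a) = []·-cong (P (flip (ord b a)) (ord b c) (ord a c)) (*-congʳ (*-comm _ _))

    τ-swapBC : ∀ P → τ (swapBC P) ≈ τ P
    τ-swapBC P = trans (S-swap (L.allFin N) (L.allFin N) _)
      (S-cong (L.allFin N) λ c → S-cong (L.allFin N) λ b → S-cong (L.allFin N) λ a → step a c b)
      where
      step : ∀ a c b → [ swapBC P (ord a c) (ord c b) (ord a b) ]· w a c b ≈ [ P (ord a b) (ord b c) (ord a c) ]· w a b c
      step a c b rewrite flip-order (toℕ c) (toℕ b) =
        []·-cong (P (ord a b) (flip (ord c b)) (ord a c)) (solve 3 (λ a b c → a :* c :* b := a :* b :* c) ≡.refl (v a) (v b) (v c))

    τs : List Pred → A
    τs []       = 0#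
    τs (P ∷ Ps) = τ P + τs Ps

    private
      ind : List Bool → A → A
      ind []       y = 0#
      ind (b ∷ bs) y = [ b ]· y + ind bs y

      ind-count : ∀ bs y → ind bs y ≈ ind (L.replicate (count bs) true) y
      ind-count []           y = refl
      ind-count (true ∷ bs)  y = +-congˡ (ind-count bs y)
      ind-count (false ∷ bs) y = trans (+-identityˡ _) (ind-count bs y)

      τs-ind : ∀ Ps → τs Ps ≈ Σ³ (λ a b c → ind (evals Ps (ord a b) (ord b c) (ord a c)) (w a b c))
      τs-ind []       = sym Σ³-zero
      τs-ind (P ∷ Ps) = trans (+-congˡ (τs-ind Ps)) (sym (Σ³-add _ _))

    -- Two sums of indicators agree as soon as every admissible order type is
    -- counted equally often by both, which is a finite check.
    τs-agree : ∀ Ps Qs → agrees Ps Qs ≡ true → τs Ps ≈ τs Qs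
    τs-agree Ps Qs h = trans (τs-ind Ps) (trans (Σ³-cong step) (sym (τs-ind Qs)))
      where
      step : ∀ a b c → ind (evals Ps (ord a b) (ord b c) (ord a c)) (w a b c) ≈ ind (evals Qs (ord a b) (ord b c) (ord a c)) (w a b c)
      step a b c = trans (ind-count (evals Ps _ _ _) _) (trans (reflexive (≡.cong (λ n → ind (L.replicate n true) (w a b c)) counts)) (sym (ind-count (evals Qs _ _ _) _)))
        where
        x = ord a b
        y = ord b c
        z = ord a c
        agree-xyz : agree Ps Qs x y z ≡ true
        agree-xyz = everyOrder-sound (agree Ps Qs x y) (everyOrder-sound (λ y → everyOrder (agree Ps Qs x y))
          (everyOrder-sound (λ x → everyOrder (λ y → everyOrder (agree Ps Qs x y))) h x) y) z
        counts : count (evals Ps x y z) ≡ count (evals Qs x y z)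
        counts with consistent x y z | consistent-order (toℕ a) (toℕ b) (toℕ c) | agree-xyz
        ... | true | _ | e = ℕP.≡ᵇ⇒≡ _ _ (≡.subst T (≡.sym e) tt)

    -- A hook tableau has either a ≤ b < c, or a < c ≤ b, which becomes `strictWeak` after
    -- exchanging b and c. Hence s21 is the sum of two fundamental functions.
    hook-split : τ hook ≈ τ weakStrict + τ strictWeak
    hook-split = begin
      τ hook                                            ≈⟨ +-identityʳ _ ⟨
      τs (hook ∷ [])                                    ≈⟨ τs-agree (hook ∷ []) (weakStrict ∷ swapBC strictWeak ∷ []) ≡.refl ⟩
      τ weakStrict + (τ (swapBC strictWeak) + 0#)       ≈⟨ +-congˡ (trans (+-identityʳ _) (τ-swapBC strictWeak)) ⟩
      τ weakStrict + τ strictWeak                       ∎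
      where open import Relation.Binary.Reasoning.Setoid setoid

    -- The six summands are the triples with a given standardisation.
    all-split : τ all ≈ τ weak + τ hook + τ hook + τ strict
    all-split = begin
      τ all                        ≈⟨ +-identityʳ _ ⟨
      τs (all ∷ [])                ≈⟨ τs-agree (all ∷ []) (weak ∷ swapBC weakStrict ∷ swapAB strictWeak ∷ swapAB (swapBC weakStrict) ∷ swapBC (swapAB strictWeak) ∷ swapAB (swapBC (swapAB strict)) ∷ []) ≡.refl ⟩
      τ weak + (τ (swapBC weakStrict) + (τ (swapAB strictWeak) + (τ (swapAB (swapBC weakStrict)) + (τ (swapBC (swapAB strictWeak)) + (τ (swapAB (swapBC (swapAB strict))) + 0#)))))
        ≈⟨ +-congˡ (+-cong (τ-swapBC weakStrict) (+-cong (τ-swapAB strictWeak)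
             (+-cong (trans (τ-swapAB (swapBC weakStrict)) (τ-swapBC weakStrict)) (+-cong (trans (τ-swapBC (swapAB strictWeak)) (τ-swapAB strictWeak))
             (+-congʳ (trans (τ-swapAB (swapBC (swapAB strict))) (trans (τ-swapBC (swapAB strict)) (τ-swapAB strict)))))))) ⟩
      τ weak + (τ weakStrict + (τ strictWeak + (τ weakStrict + (τ strictWeak + (τ strict + 0#)))))
        ≈⟨ solve 4 (λ a b c d → a :+ (b :+ (c :+ (b :+ (c :+ (d :+ :0))))) := a :+ (b :+ c) :+ (b :+ c) :+ d) ≡.refl _ _ _ _ ⟩
      τ weak + (τ weakStrict + τ strictWeak) + (τ weakStrict + τ strictWeak) + τ strict
        ≈⟨ +-congʳ (+-cong (+-congˡ hook-split) hook-split) ⟨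
      τ weak + τ hook + τ hook + τ strict ∎
      where open import Relation.Binary.Reasoning.Setoid setoid

    -- The triples with a = b fall into a = b ≤ c and c < a = b; by symmetry the second set counts
    -- like a < b = c. Together with a < b < c these make up all weakly increasing triples.
    pair-split : τ pair ≈ τ weak - τ strict
    pair-split = begin
      τ pair                            ≈⟨ solve 2 (λ a b → a := (a :+ (b :+ :0)) :- b) ≡.refl (τ pair) (τ strict) ⟩
      τs (pair ∷ strict ∷ []) - τ strict ≈⟨ +-congʳ (τs-agree (pair ∷ strict ∷ []) (pairWeak ∷ swapBC (swapAB strictPair) ∷ strict ∷ []) ≡.refl) ⟩
      (τ pairWeak + (τ (swapBC (swapAB strictPair)) + (τ strict + 0#))) - τ strict
        ≈⟨ +-congʳ (+-congˡ (+-congʳ (trans (τ-swapBC (swapAB strictPair)) (τ-swapAB strictPair)))) ⟩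
      τs (pairWeak ∷ strictPair ∷ strict ∷ []) - τ strict ≈⟨ +-congʳ (τs-agree (pairWeak ∷ strictPair ∷ strict ∷ []) (weak ∷ []) ≡.refl) ⟩
      (τ weak + 0#) - τ strict          ≈⟨ +-congʳ (+-identityʳ _) ⟩
      τ weak - τ strict ∎
      where
      open import Relation.Binary.Reasoning.Setoid setoid
      pairWeak strictPair : Pred
      pairWeak   x y z = isEq x ∧ isLe y
      strictPair x y z = isLt x ∧ isEq y

    -- Among the triples a ≤ b ≤ c, those with a < b < c satisfy both `weakStrict` and `strictWeak`,
    -- the others exactly one of these and `triple`. Adding `strict` to `weak` balances the double
    -- count.
    triple-split : τ triple ≈ τ weak - τ hook + τ strict
    triple-split = begin
      τ triple ≈⟨ solve 3 (λ a b c → a := (a :+ (b :+ (c :+ :0))) :- (b :+ c)) ≡.refl (τ triple) (τ weakStrict) (τ strictWeak) ⟩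
      τs (triple ∷ weakStrict ∷ strictWeak ∷ []) - (τ weakStrict + τ strictWeak)
        ≈⟨ +-cong (τs-agree (triple ∷ weakStrict ∷ strictWeak ∷ []) (weak ∷ strict ∷ []) ≡.refl) (-‿cong (sym hook-split)) ⟩
      (τ weak + (τ strict + 0#)) - τ hook
        ≈⟨ solve 3 (λ a b c → (a :+ (c :+ :0)) :- b := a :- b :+ c) ≡.refl _ _ _ ⟩
      τ weak - τ hook + τ strict ∎
      where open import Relation.Binary.Reasoning.Setoid setoid

    private
      F = L.allFin N

      S-tabulate-zero : ∀ {X : Set} n (h : Fin n → X) f → (∀ i → f (h i) ≈ 0#) → S (L.tabulate h) f ≈ 0#
      S-tabulate-zero zero    h f e = refl
      S-tabulate-zero (suc n) h f e = trans (+-cong (e Fin.zero) (S-tabulate-zero n (λ i → h (Fin.suc i)) f (λ i → e (Fin.suc i)))) (+-identityˡ _)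

      S-tabulate-diagonal : ∀ {X : Set} n (h : Fin n → X) f (g : Fin n → A) b →
        (∀ i → f (h i) ≈ [ isEq (order (toℕ i) (toℕ b)) ]· g i) → S (L.tabulate h) f ≈ g b
      S-tabulate-diagonal (suc n) h f g Fin.zero e =
        trans (+-cong (e Fin.zero) (S-tabulate-zero n (λ i → h (Fin.suc i)) f (λ i → e (Fin.suc i)))) (+-identityʳ _)
      S-tabulate-diagonal (suc n) h f g (Fin.suc b) e =
        trans (+-cong (e Fin.zero) (S-tabulate-diagonal n (λ i → h (Fin.suc i)) f (λ i → g (Fin.suc i)) b (λ i → e (Fin.suc i)))) (+-identityˡ _)

    S-diagonal : ∀ (g : Fin N → A) b → S F (λ a → [ isEq (ord a b) ]· g a) ≈ g b
    S-diagonal g b = S-tabulate-diagonal N (λ i → i) _ g b (λ i → refl)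

    p₁ p₂ p₃ : A
    p₁ = S F v
    p₂ = S F (λ a → v a * v a)
    p₃ = S F (λ a → v a * v a * v a)

    τ-all : τ all ≈ p₁ * (p₁ * p₁)
    τ-all = trans (S-cong F λ c → trans (S-cong F λ b → trans (S-cong F λ a → solve 3 (λ a b c → a :* b :* c := b :* c :* a) ≡.refl (v a) (v b) (v c))
        (trans (S-*ˡ F (v b * v c) v) (solve 3 (λ b c p → b :* c :* p := c :* p :* b) ≡.refl (v b) (v c) p₁))) (S-*ˡ F (v c * p₁) v))
      (trans (S-cong F λ c → solve 2 (λ c p → c :* p :* p := p :* p :* c) ≡.refl (v c) p₁) (trans (S-*ˡ F (p₁ * p₁) v) (*-assoc _ _ _)))

    τ-pair : τ pair ≈ p₂ * p₁
    τ-pair = trans (S-cong F λ c → trans (S-cong F λ b → S-diagonal (λ a → v a * v b * v c) b) (S-*ʳ F (v c) (λ b → v b * v b)))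
      (S-*ˡ F p₂ v)

    τ-triple : τ triple ≈ p₃
    τ-triple = S-cong F λ c → trans (S-cong F λ b → trans (S-cong F (λ a → swap∧ (isEq (ord a b)) (isEq (ord b c))))
        (trans (S-diagonal (λ a → [ isEq (ord b c) ]· w a b c) b) refl)) (S-diagonal (λ b → w b b c) c)
      where
      swap∧ : ∀ x y {z} → [ x ∧ y ]· z ≈ [ x ]· ([ y ]· z)
      swap∧ true  y = refl
      swap∧ false y = refl

    p₁³ : p₁ * (p₁ * p₁) ≈ τ weak + τ hook + τ hook + τ strict
    p₁³ = trans (sym τ-all) all-split

    p₂p₁ : p₂ * p₁ ≈ τ weak - τ strict
    p₂p₁ = trans (sym τ-pair) pair-split

    p₃-schur : p₃ ≈ τ weak - τ hook + τ strict
    p₃-schur = trans (sym τ-triple) triple-split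

-- Schur functions, fundamental functions and power sums in degree three

module SchurExpansions where
  open PolynomialRing
  open SymmetricSums
  open import Data.Fin using (toℕ)
  open import Data.Integer using (+_)
  open import Relation.Nullary.Decidable using (⌊_⌋)

  module TupleSums (R : CommutativeRing 0ℓ 0ℓ) where
    open CommutativeRing R hiding (zero) renaming (Carrier to A)
    open Sums R

    S-extend : ∀ {X : Set} (xs : List X) k (f : List X → A) →
               S (tuples xs (suc k)) f ≈ S (tuples xs k) (λ t → S xs (λ x → f (x ∷ t)))
    S-extend xs k f = trans (S-concatMap (λ t → L.map (λ x → x ∷ t) xs) (tuples xs k) f)
      (S-cong (tuples xs k) (λ t → reflexive (S-map (λ x → x ∷ t) xs f)))

    S-tuples₃ : ∀ {X : Set} (xs : List X) (f : List X → A) →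
                S (tuples xs 3) f ≈ S xs (λ c → S xs (λ b → S xs (λ a → f (a ∷ b ∷ c ∷ []))))
    S-tuples₃ xs f = trans (S-extend xs 2 f) (trans (S-extend xs 1 _) (trans (S-extend xs 0 _) (+-identityʳ _)))

    S-filter-tuples₃ : ∀ {X : Set} (p : List X → Bool) (xs : List X) (f : List X → A) →
      S (L.filterᵇ p (tuples xs 3)) f ≈
      S xs (λ c → S xs (λ b → S xs (λ a → [ p (a ∷ b ∷ c ∷ []) ]· f (a ∷ b ∷ c ∷ []))))
    S-filter-tuples₃ p xs f = trans (S-filterᵇ p (tuples xs 3) f) (S-tuples₃ xs (λ t → [ p t ]· f t))

  module Expansions (N : ℕ) where
    private
      module P = CommutativeRing (polyRing {N})
    open Sums (polyRing {N}) using (S; []·-cong; [_]·_)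
    open TupleSums (polyRing {N})

    x : Fin N → Poly N
    x i = xMono (i ∷ [])

    open Triples (polyRing {N}) N x public

    private
      multiplicity : List (Fin N) → Fin N → ℕ
      multiplicity is j = L.length (L.filter (λ i → i Fin.≟ j) is)

      multiplicity-∷ : ∀ i is j → multiplicity (i ∷ is) j ≡ multiplicity (i ∷ []) j ℕ.+ multiplicity is j
      multiplicity-∷ i is j with i Fin.≟ j
      ... | yes _ = ≡.refl
      ... | no  _ = ≡.refl

      monomial : (Fin N → ℕ) → Poly N
      monomial e = (1ℚ , (+ 0 , + 0 , V.tabulate e)) ∷ []

      monomial-cong : ∀ {e e′} → (∀ j → e j ≡ e′ j) → monomial e ≡ monomial e′
      monomial-cong h = ≡.cong (λ v → (1ℚ , (+ 0 , + 0 , v)) ∷ []) (VP.tabulate-cong h)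

      zipWith-tabulate : ∀ {n} (e e′ : Fin n → ℕ) → V.zipWith ℕ._+_ (V.tabulate e) (V.tabulate e′) ≡ V.tabulate (λ j → e j ℕ.+ e′ j)
      zipWith-tabulate {zero}  e e′ = ≡.refl
      zipWith-tabulate {suc n} e e′ = ≡.cong ((e Fin.zero ℕ.+ e′ Fin.zero) V.∷_) (zipWith-tabulate (λ j → e (Fin.suc j)) (λ j → e′ (Fin.suc j)))

      monomial-* : ∀ e e′ → monomial e ⊗ monomial e′ ≡ monomial (λ j → e j ℕ.+ e′ j)
      monomial-* e e′ = ≡.cong (λ v → (1ℚ , (+ 0 , + 0 , v)) ∷ []) (zipWith-tabulate e e′)

    xMono₃ : ∀ a b c → xMono (a ∷ b ∷ c ∷ []) ≡ w a b c
    xMono₃ a b c = ≡.sym (≡.trans (≡.cong (_⊗ x c) (monomial-* (multiplicity (a ∷ [])) (multiplicity (b ∷ []))))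
      (≡.trans (monomial-* (λ j → multiplicity (a ∷ []) j ℕ.+ multiplicity (b ∷ []) j) (multiplicity (c ∷ [])))
        (monomial-cong λ j → ≡.trans (ℕP.+-assoc (multiplicity (a ∷ []) j) _ _)
          (≡.sym (≡.trans (multiplicity-∷ a (b ∷ c ∷ []) j) (≡.cong (multiplicity (a ∷ []) j ℕ.+_) (multiplicity-∷ b (c ∷ []) j)))))))
      where import Data.Nat.Properties as ℕP

    private
      power : ℕ → Fin N → Poly N
      power a i = monomial (λ j → if ⌊ i Fin.≟ j ⌋ then a else 0)

      x-power : ∀ i → x i ≡ power 1 i
      x-power i = monomial-cong λ j → lem j
        where
        lem : ∀ j → multiplicity (i ∷ []) j ≡ (if ⌊ i Fin.≟ j ⌋ then 1 else 0)
        lem j with i Fin.≟ j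
        ... | yes _ = ≡.refl
        ... | no  _ = ≡.refl

      power-* : ∀ a b i → power a i ⊗ power b i ≡ power (a ℕ.+ b) i
      power-* a b i = ≡.trans (monomial-* (λ j → if ⌊ i Fin.≟ j ⌋ then a else 0) (λ j → if ⌊ i Fin.≟ j ⌋ then b else 0)) (monomial-cong lem)
        where
        lem : ∀ j → (if ⌊ i Fin.≟ j ⌋ then a else 0) ℕ.+ (if ⌊ i Fin.≟ j ⌋ then b else 0) ≡ (if ⌊ i Fin.≟ j ⌋ then a ℕ.+ b else 0)
        lem j with ⌊ i Fin.≟ j ⌋
        ... | true  = ≡.refl
        ... | false = ≡.refl

      pEval-S : ∀ a → pEval {N} a ≡ S (L.allFin N) (power a)
      pEval-S a = go (L.allFin N)
        where
        go : ∀ is → L.map (λ i → (1ℚ , (+ 0 , + 0 , V.tabulate (λ j → if ⌊ i Fin.≟ j ⌋ then a else 0)))) is ≡ S is (power a)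
        go []       = ≡.refl
        go (i ∷ is) = ≡.cong (_ ∷_) (go is)

      S-≡ : ∀ is {f g : Fin N → Poly N} → (∀ i → f i ≡ g i) → S is f ≡ S is g
      S-≡ []       h = ≡.refl
      S-≡ (i ∷ is) h = ≡.cong₂ _++_ (h i) (S-≡ is h)

    pEval-1 : pEval 1 ≡ p₁
    pEval-1 = ≡.trans (pEval-S 1) (S-≡ (L.allFin N) λ i → ≡.sym (x-power i))

    pEval-2 : pEval 2 ≡ p₂
    pEval-2 = ≡.trans (pEval-S 2) (S-≡ (L.allFin N) λ i →
      ≡.sym (≡.trans (≡.cong₂ _⊗_ (x-power i) (x-power i)) (power-* 1 1 i)))

    pEval-3 : pEval 3 ≡ p₃
    pEval-3 = ≡.trans (pEval-S 3) (S-≡ (L.allFin N) λ i →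
      ≡.sym (≡.trans (≡.cong₂ _⊗_ (≡.trans (≡.cong₂ _⊗_ (x-power i) (x-power i)) (power-* 1 1 i)) (x-power i)) (power-* 2 1 i)))

    sum-τ : ∀ (p : List (Fin N) → Bool) P → (∀ a b c → p (a ∷ b ∷ c ∷ []) ≡ P (ord a b) (ord b c) (ord a c)) →
            sumP (L.map xMono (L.filterᵇ p (tuples (L.allFin N) 3))) ≋ τ P
    sum-τ p P h = P.trans (S-filter-tuples₃ p (L.allFin N) xMono)
      (Σ³-cong λ a b c → P.trans (P.reflexive (≡.cong (λ z → [ z ]· xMono (a ∷ b ∷ c ∷ [])) (h a b c)))
        ([]·-cong (P (ord a b) (ord b c) (ord a c)) (P.reflexive (xMono₃ a b c))))

    private
      -- Removes the trailing `true` that the list recursions for rows, columns and descents leave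
      -- behind.
      bool₁ : ∀ {a b : Bool} → a ≡ b → a ∧ true ≡ b
      bool₁ {true}  e = e
      bool₁ {false} e = e

      open Codes

      ≤-code : ∀ (a b : Fin N) → (toℕ a ℕ.≤ᵇ toℕ b) ≡ isLe (ord a b)
      ≤-code a b = order-≤ (toℕ a) (toℕ b)

      <-code : ∀ (a b : Fin N) → (toℕ a ℕ.<ᵇ toℕ b) ≡ isLt (ord a b)
      <-code a b = order-< (toℕ a) (toℕ b)

    open Codes

    s3-τ : s3 N ≋ τ weak
    s3-τ = sum-τ _ weak λ a b c → ≡.cong₂ _∧_ (≤-code a b) (bool₁ (≤-code b c))

    s21-τ : s21 N ≋ τ hook
    s21-τ = sum-τ _ hook λ a b c → ≡.cong₂ _∧_ (bool₁ (≤-code a b)) (bool₁ (bool₁ (<-code a c)))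

    s111-τ : s111 N ≋ τ strict
    s111-τ = sum-τ _ strict λ a b c → ≡.cong₂ _∧_ (bool₁ (<-code a b)) (bool₁ (bool₁ (<-code b c)))

    F3-τ : Fund N (3 ∷ []) ≋ τ weak
    F3-τ = sum-τ _ weak λ a b c → ≡.cong₂ _∧_ (≤-code a b) (bool₁ (≤-code b c))

    F21-τ : Fund N (2 ∷ 1 ∷ []) ≋ τ weakStrict
    F21-τ = sum-τ _ weakStrict λ a b c → ≡.cong₂ _∧_ (≤-code a b) (bool₁ (<-code b c))

    F12-τ : Fund N (1 ∷ 2 ∷ []) ≋ τ strictWeak
    F12-τ = sum-τ _ strictWeak λ a b c → ≡.cong₂ _∧_ (<-code a b) (bool₁ (≤-code b c))

    F111-τ : Fund N (1 ∷ 1 ∷ 1 ∷ []) ≋ τ strict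
    F111-τ = sum-τ _ strict λ a b c → ≡.cong₂ _∧_ (<-code a b) (bool₁ (<-code b c))

-- Labellings of three north steps

module Labels where
  open import Data.Integer using (+_)
  open import Data.List.Relation.Unary.All as All using (All; []; _∷_)
  open import Relation.Binary.PropositionalEquality using (refl; cong; cong₂; trans)

  -- The three north steps, bottom-up.
  data Pos : Set where
    p₀ p₁ p₂ : Pos

  -- Any car that is not on the first two steps is placed on the third, which is right for the cars
  -- of the permutations read below.
  locate : List ℕ → ℕ → Pos
  locate (a ∷ b ∷ _) c = if c ℕ.≡ᵇ a then p₀ else if c ℕ.≡ᵇ b then p₁ else p₂
  locate _           c = p₀

  -- `tdinv` and `ides` see the ranks only through two relations between north steps: having smaller
  -- rank, and attacking. Once both relations are closed tables, the statistics of all labellings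
  -- can be computed.
  Table : Set
  Table = Pos → Pos → Bool

  tdinvᵗ : Table → List ℕ → ℕ
  tdinvᵗ att w = countᵇ (λ { (i , j) → (i ℕ.<ᵇ j) ∧ att (locate w i) (locate w j) }) (L.cartesianProduct (oneTo 3) (oneTo 3))

  idesᵗ : Table → List ℕ → List ℕ
  idesᵗ less w = L.filterᵇ (λ i → less (locate w i) (locate w (suc i))) (oneTo 2)

  colOK : Bool → Bool → List ℕ → Bool
  colOK b₁ b₂ (a ∷ b ∷ c ∷ _) = (not b₁ ∨ (a ℕ.<ᵇ b)) ∧ ((not b₂ ∨ (b ℕ.<ᵇ c)) ∧ true)
  colOK b₁ b₂ _ = true

  labs : Bool → Bool → List (List ℕ)
  labs b₁ b₂ = L.filterᵇ (λ w → distinctᵇ w ∧ colOK b₁ b₂ w) (tuples (oneTo 3) 3)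

  filterᵇ-cong : ∀ {X : Set} (p p′ : X → Bool) xs → All (λ x → p x ≡ p′ x) xs → L.filterᵇ p xs ≡ L.filterᵇ p′ xs
  filterᵇ-cong p p′ []       []       = refl
  filterᵇ-cong p p′ (x ∷ xs) (e ∷ es) with p x | p′ x | e
  ... | true  | true  | refl = cong (x ∷_) (filterᵇ-cong p p′ xs es)
  ... | false | false | refl = filterᵇ-cong p p′ xs es

  module _ (m : ℕ) (P : List Bool) (x y : ℕ) (nx : northXs P ≡ 0 ∷ x ∷ y ∷ []) where

    R : Pos → ℤ
    R p₀ = rank m 3 0 0
    R p₁ = rank m 3 x 1
    R p₂ = rank m 3 y 2

    ltR attR : Table
    ltR p p′ = R p <ℤᵇ R p′
    attR p p′ = (R p <ℤᵇ R p′) ∧ (R p′ <ℤᵇ (R p ℤ.+ + m))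

    labellings-labs : labellings 3 P ≡ labs (0 ℕ.≡ᵇ x) (x ℕ.≡ᵇ y)
    labellings-labs rewrite nx = filterᵇ-cong (λ w → distinctᵇ w ∧ colIncr (0 ∷ x ∷ y ∷ []) w)
      (λ w → distinctᵇ w ∧ colOK (0 ℕ.≡ᵇ x) (x ℕ.≡ᵇ y) w) (tuples (oneTo 3) 3)
      -- One entry for each of the 27 words of length three over the cars 1, 2, 3; once the word is
      -- known, both tests agree by computation.
      (refl ∷ refl ∷ refl ∷ refl ∷ refl ∷ refl ∷ refl ∷ refl ∷ refl ∷ refl ∷ refl ∷ refl ∷ refl ∷ refl ∷ refl ∷ refl ∷ refl ∷ refl ∷ refl ∷ refl ∷ refl ∷ refl ∷ refl ∷ refl ∷ refl ∷ refl ∷ refl ∷ [])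

    Reads : List ℕ → Set
    Reads w = tdinv m 3 P w ≡ tdinvᵗ attR w × pides m 3 P w ≡ compOfSet 3 (idesᵗ ltR w)

    carRanks-≡ : ∀ a b c → carRanks m 3 P (a ∷ b ∷ c ∷ []) ≡ (a , R p₀) ∷ (b , R p₁) ∷ (c , R p₂) ∷ []
    carRanks-≡ a b c = cong (λ xs → L.zipWith (λ c xy → (c , rank m 3 (proj₁ xy) (proj₂ xy))) (a ∷ b ∷ c ∷ []) (L.zipWith _,_ xs (L.upTo 3))) nx

    rankOf-locate : ∀ a b c i → (i ℕ.≡ᵇ a) ∨ ((i ℕ.≡ᵇ b) ∨ (i ℕ.≡ᵇ c)) ≡ true →
                    rankOf (carRanks m 3 P (a ∷ b ∷ c ∷ [])) i ≡ R (locate (a ∷ b ∷ c ∷ []) i)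
    rankOf-locate a b c i h rewrite carRanks-≡ a b c with i ℕ.≡ᵇ a | i ℕ.≡ᵇ b | i ℕ.≡ᵇ c
    ... | true  | _     | _    = refl
    ... | false | true  | _    = refl
    ... | false | false | true = refl

    module _ (a b c : ℕ) where
      private
        w : List ℕ
        w = a ∷ b ∷ c ∷ []
        Has : ℕ → Set
        Has i = (i ℕ.≡ᵇ a) ∨ ((i ℕ.≡ᵇ b) ∨ (i ℕ.≡ᵇ c)) ≡ true
        r : ℕ → ℤ
        r = rankOf (carRanks m 3 P w)
        pair : ∀ i j → Has i → Has j → (i ℕ.<ᵇ j) ∧ ((r i <ℤᵇ r j) ∧ (r j <ℤᵇ (r i ℤ.+ + m)))
                                       ≡ (i ℕ.<ᵇ j) ∧ attR (locate w i) (locate w j)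
        pair i j e e′ = cong₂ (λ r r′ → (i ℕ.<ᵇ j) ∧ ((r <ℤᵇ r′) ∧ (r′ <ℤᵇ (r ℤ.+ + m)))) (rankOf-locate a b c i e) (rankOf-locate a b c j e′)

      read : Has 1 → Has 2 → Has 3 → Reads w
      read h₁ h₂ h₃ =
        cong L.length (filterᵇ-cong (λ { (i , j) → (i ℕ.<ᵇ j) ∧ ((r i <ℤᵇ r j) ∧ (r j <ℤᵇ (r i ℤ.+ + m))) })
          (λ { (i , j) → (i ℕ.<ᵇ j) ∧ attR (locate w i) (locate w j) }) (L.cartesianProduct (oneTo 3) (oneTo 3))
          (pair 1 1 h₁ h₁ ∷ pair 1 2 h₁ h₂ ∷ pair 1 3 h₁ h₃ ∷ pair 2 1 h₂ h₁ ∷ pair 2 2 h₂ h₂ ∷ pair 2 3 h₂ h₃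
            ∷ pair 3 1 h₃ h₁ ∷ pair 3 2 h₃ h₂ ∷ pair 3 3 h₃ h₃ ∷ []))
        , cong (compOfSet 3) (filterᵇ-cong (λ i → r i <ℤᵇ r (suc i)) (λ i → ltR (locate w i) (locate w (suc i))) (oneTo 2)
          (cong₂ _<ℤᵇ_ (rankOf-locate a b c 1 h₁) (rankOf-locate a b c 2 h₂) ∷ cong₂ _<ℤᵇ_ (rankOf-locate a b c 2 h₂) (rankOf-locate a b c 3 h₃) ∷ []))

    reads : ∀ b₁ b₂ → All Reads (labs b₁ b₂)
    reads true  true  = read 1 2 3 refl refl refl ∷ []
    reads true  false = read 2 3 1 refl refl refl ∷ read 1 3 2 refl refl refl ∷ read 1 2 3 refl refl refl ∷ []
    reads false true  = read 3 1 2 refl refl refl ∷ read 2 1 3 refl refl refl ∷ read 1 2 3 refl refl refl ∷ []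
    reads false false = read 3 2 1 refl refl refl ∷ read 2 3 1 refl refl refl ∷ read 3 1 2 refl refl refl
                      ∷ read 1 3 2 refl refl refl ∷ read 2 1 3 refl refl refl ∷ read 1 2 3 refl refl refl ∷ []

    module _ (less att : Table) (less-≡ : ∀ p p′ → ltR p p′ ≡ less p p′) (att-≡ : ∀ p p′ → attR p p′ ≡ att p p′) where

      tdinvᵗ-≡ : ∀ w → tdinvᵗ attR w ≡ tdinvᵗ att w
      tdinvᵗ-≡ w = cong L.length (filterᵇ-cong (λ { (i , j) → (i ℕ.<ᵇ j) ∧ attR (locate w i) (locate w j) })
        (λ { (i , j) → (i ℕ.<ᵇ j) ∧ att (locate w i) (locate w j) }) (L.cartesianProduct (oneTo 3) (oneTo 3))
        (All.universal (λ { (i , j) → cong ((i ℕ.<ᵇ j) ∧_) (att-≡ (locate w i) (locate w j)) }) _))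

      idesᵗ-≡ : ∀ w → idesᵗ ltR w ≡ idesᵗ less w
      idesᵗ-≡ w = filterᵇ-cong (λ i → ltR (locate w i) (locate w (suc i))) (λ i → less (locate w i) (locate w (suc i))) (oneTo 2)
        (All.universal (λ i → less-≡ (locate w i) (locate w (suc i))) _)

      module _ (b₁ b₂ : Bool) (e₁ : (0 ℕ.≡ᵇ x) ≡ b₁) (e₂ : (x ℕ.≡ᵇ y) ≡ b₂) where

        labellings-≡ : labellings 3 P ≡ labs b₁ b₂
        labellings-≡ = trans labellings-labs (cong₂ labs e₁ e₂)

        maxdinv-≡ : maxdinv m 3 P ≡ L.foldr ℕ._⊔_ 0 (L.map (tdinvᵗ att) (labs b₁ b₂))
        maxdinv-≡ = trans (cong (λ ws → L.foldr ℕ._⊔_ 0 (L.map (tdinv m 3 P) ws)) labellings-≡)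
          (cong (L.foldr ℕ._⊔_ 0) (map-All (All.map (λ {w} h → trans (proj₁ h) (tdinvᵗ-≡ w)) (reads b₁ b₂))))
          where
          map-All : ∀ {X Y : Set} {f g : X → Y} {xs} → All (λ x → f x ≡ g x) xs → L.map f xs ≡ L.map g xs
          map-All []       = refl
          map-All (h ∷ hs) = cong₂ _∷_ h (map-All hs)

-- The generating function of the labellings of one path

module PathShapes where
  open RingSolve
  open PolynomialRing
  open SymmetricSums using (module Sums)
  open SchurExpansions
  open Labels
  open import Data.Integer using (+_)
  open import Data.List.Relation.Unary.All as All using (All; []; _∷_)
  open import Relation.Binary.PropositionalEquality using (refl; cong; cong₂; sym; trans)

  -- The bottom step always has the least rank; `s` says whether the middle step lies below the top
  -- one in rank.
  lessT : Bool → Table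
  lessT s p₀ p₁ = true
  lessT s p₀ p₂ = true
  lessT s p₁ p₂ = s
  lessT s p₂ p₁ = not s
  lessT s _  _  = false

  -- The entries are the four possible attacks: bottom on middle, bottom on top, middle on top, and
  -- top on middle.
  attT : Bool → Bool → Bool → Bool → Table
  attT a b c d p₀ p₁ = a
  attT a b c d p₀ p₂ = b
  attT a b c d p₁ p₂ = c
  attT a b c d p₂ p₁ = d
  attT a b c d _  _  = false

  module Shapes (N : ℕ) where
    private
      module P = CommutativeRing (polyRing {N})
      module PS = Solver (polyRing {N})
    open Sums (polyRing {N})
    open Expansions N

    z : ℤ → Poly N
    z i = qtP i (+ 0)

    qtP-⊗ : ∀ i j i′ j′ → qtP {N} i j ⊗ qtP i′ j′ ≡ qtP (i ℤ.+ i′) (j ℤ.+ j′)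
    qtP-⊗ i j i′ j′ = cong (λ v → (1ℚ , (i ℤ.+ i′ , j ℤ.+ j′ , v)) ∷ []) (VP.zipWith-replicate ℕ._+_ 0 0)

    -- `corner` has all three north steps in one column, `edge` exactly two. For three distinct
    -- columns the graph of attacks is a path (`inner`: bottom and top do not attack each other) or
    -- a triangle (`outer`).
    data Kind : Set where
      corner edge inner outer : Kind

    -- The generating function of the labellings of one path, normalised so that
    -- its s111 coefficient is 1.
    llt : Kind → Poly N
    llt corner = s111 N
    llt edge   = s111 N ⊕ (z (ℤ.- + 1) ⊗ s21 N)
    llt inner  = s111 N ⊕ (z (ℤ.- + 1) ⊗ (s21 N ⊕ s21 N) ⊕ z (ℤ.- + 2) ⊗ s3 N)
    llt outer  = s111 N ⊕ (z (ℤ.- + 1) ⊗ s21 N ⊕ (z (ℤ.- + 2) ⊗ s21 N ⊕ z (ℤ.- + 3) ⊗ s3 N))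

    labelSum : (less att : Table) (b₁ b₂ : Bool) → Poly N → Poly N
    labelSum less att b₁ b₂ R = S (labs b₁ b₂) λ w →
      (z (+ tdinvᵗ att w ℤ.- + L.foldr ℕ._⊔_ 0 (L.map (tdinvᵗ att) (labs b₁ b₂))) ⊗ R) ⊗ Fund N (compOfSet 3 (idesᵗ less w))

    private
      F3 F21 F12 F111 z1 z2 z3 : Poly N
      F3 = Fund N (3 ∷ [])
      F21 = Fund N (2 ∷ 1 ∷ [])
      F12 = Fund N (1 ∷ 2 ∷ [])
      F111 = Fund N (1 ∷ 1 ∷ 1 ∷ [])
      z1 = z (ℤ.- + 1)
      z2 = z (ℤ.- + 2)
      z3 = z (ℤ.- + 3)

      e3 : F3 ≋ s3 N
      e3 = P.trans F3-τ (P.sym s3-τ)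

      e111 : F111 ≋ s111 N
      e111 = P.trans F111-τ (P.sym s111-τ)

      e21 : F21 ⊕ F12 ≋ s21 N
      e21 = P.trans (⊕-cong F21-τ F12-τ) (P.sym (P.trans s21-τ hook-split))

      edge-≋ : ∀ R → R ⊗ (F111 ⊕ z1 ⊗ (F21 ⊕ F12)) ≋ R ⊗ llt edge
      edge-≋ R = ⊗-cong (P.refl {R}) (⊕-cong e111 (⊗-cong (P.refl {z1}) e21))

      inner-≋ : ∀ R → R ⊗ (F111 ⊕ (z1 ⊗ ((F21 ⊕ F12) ⊕ (F21 ⊕ F12)) ⊕ z2 ⊗ F3)) ≋ R ⊗ llt inner
      inner-≋ R = ⊗-cong (P.refl {R}) (⊕-cong e111 (⊕-cong (⊗-cong (P.refl {z1}) (⊕-cong e21 e21)) (⊗-cong (P.refl {z2}) e3)))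

      outer-≋ : ∀ R → R ⊗ (F111 ⊕ (z1 ⊗ (F21 ⊕ F12) ⊕ (z2 ⊗ (F21 ⊕ F12) ⊕ z3 ⊗ F3))) ≋ R ⊗ llt outer
      outer-≋ R = ⊗-cong (P.refl {R}) (⊕-cong e111 (⊕-cong (⊗-cong (P.refl {z1}) e21)
                    (⊕-cong (⊗-cong (P.refl {z2}) e21) (⊗-cong (P.refl {z3}) e3))))

    -- Here and in the following lemmas all tables are closed, so the labellings, their statistics
    -- and the maximal `tdinv` are found by computation. What remains is to collect the fundamental
    -- functions into Schur functions.
    shape-A : ∀ R → labelSum (lessT true) (attT false false false false) true true R ≋ R ⊗ llt corner
    shape-A R = P.trans (PS.solve 2 (λ R f → :1 :* R :* f :+ :0 := R :* f) refl R F111) (⊗-cong (P.refl {R}) e111)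

    shape-B₁ : ∀ R → labelSum (lessT true) (attT false false true false) true false R ≋ R ⊗ llt edge
    shape-B₁ R = P.trans (PS.solve 5 (λ R f g h y → y :* R :* g :+ (y :* R :* h :+ (:1 :* R :* f :+ :0)) := R :* (f :+ y :* (g :+ h)))
      refl R F111 F21 F12 z1) (edge-≋ R)

    -- The middle and top steps have exchanged their order in rank compared with `shape-B₁`. The
    -- statistics of single labellings change, their sum does not; the same holds for `shape-D₂` and
    -- `shape-D₂′`.
    shape-B₂ : ∀ R → labelSum (lessT false) (attT false true false true) true false R ≋ R ⊗ llt edge
    shape-B₂ R = P.trans (PS.solve 5 (λ R f g h y → y :* R :* g :+ (:1 :* R :* f :+ (y :* R :* h :+ :0)) := R :* (f :+ y :* (g :+ h)))
      refl R F111 F21 F12 z1) (edge-≋ R)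

    shape-C : ∀ R → labelSum (lessT true) (attT true false false false) false true R ≋ R ⊗ llt edge
    shape-C R = P.trans (PS.solve 5 (λ R f g h y → y :* R :* h :+ (y :* R :* g :+ (:1 :* R :* f :+ :0)) := R :* (f :+ y :* (g :+ h)))
      refl R F111 F21 F12 z1) (edge-≋ R)

    shape-D₁ : ∀ R → labelSum (lessT true) (attT true false true false) false false R ≋ R ⊗ llt inner
    shape-D₁ R = P.trans (PS.solve 7 (λ R f g h s y x →
        x :* R :* s :+ (y :* R :* g :+ (y :* R :* h :+ (y :* R :* h :+ (y :* R :* g :+ (:1 :* R :* f :+ :0)))))
        := R :* (f :+ (y :* ((g :+ h) :+ (g :+ h)) :+ x :* s))) refl R F111 F21 F12 F3 z1 z2) (inner-≋ R)

    shape-D₂ : ∀ R → labelSum (lessT true) (attT true true true false) false false R ≋ R ⊗ llt outer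
    shape-D₂ R = P.trans (PS.solve 8 (λ R f g h s y x v →
        v :* R :* s :+ (x :* R :* g :+ (x :* R :* h :+ (y :* R :* h :+ (y :* R :* g :+ (:1 :* R :* f :+ :0)))))
        := R :* (f :+ (y :* (g :+ h) :+ (x :* (g :+ h) :+ v :* s)))) refl R F111 F21 F12 F3 z1 z2 z3) (outer-≋ R)

    shape-D₂′ : ∀ R → labelSum (lessT false) (attT true true false true) false false R ≋ R ⊗ llt outer
    shape-D₂′ R = P.trans (PS.solve 8 (λ R f g h s y x v →
        x :* R :* h :+ (y :* R :* g :+ (v :* R :* s :+ (:1 :* R :* f :+ (x :* R :* g :+ (y :* R :* h :+ :0)))))
        := R :* (f :+ (y :* (g :+ h) :+ (x :* (g :+ h) :+ v :* s)))) refl R F111 F21 F12 F3 z1 z2 z3) (outer-≋ R)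

    pathWeight : ℕ → List Bool → Poly N
    pathWeight m P = S (L.upTo (ret m 3 P)) (λ j → qtP (+ pdinv m 3 P) (+ area m 3 P ℤ.- + j))

    pathSum : ℕ → List Bool → Poly N
    pathSum m P = S (labellings 3 P) (λ w → weight m 3 P w ⊗ Fund N (pides m 3 P w))

    -- In `dinv` only the difference of `tdinv` and `maxdinv` involves the individual labelling;
    -- pdinv, area and ret belong to the path and factor out.
    weight-split : ∀ m P w → weight m 3 P w ≋ z (+ tdinv m 3 P w ℤ.- + maxdinv m 3 P) ⊗ pathWeight m P
    weight-split m P w = P.trans (S-cong (L.upTo (ret m 3 P)) λ j → P.reflexive (sym (trans
        (qtP-⊗ (+ td ℤ.- + mx) (+ 0) (+ pd) (+ ar ℤ.- + j))
        (cong₂ qtP (exponent (+ td) (+ pd) (+ mx)) (ℤP.+-identityˡ (+ ar ℤ.- + j))))))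
      (S-*ˡ (L.upTo (ret m 3 P)) (z (+ td ℤ.- + mx)) (λ j → qtP (+ pd) (+ ar ℤ.- + j)))
      where
      td = tdinv m 3 P w
      mx = maxdinv m 3 P
      pd = pdinv m 3 P
      ar = area m 3 P
      exponent : ∀ a b c → (a ℤ.- c) ℤ.+ b ≡ (a ℤ.+ b) ℤ.- c
      exponent a b c = trans (ℤP.+-assoc a (ℤ.- c) b) (trans (cong (λ r → a ℤ.+ r) (ℤP.+-comm (ℤ.- c) b)) (sym (ℤP.+-assoc a b (ℤ.- c))))

    S-cong-All : ∀ {X : Set} {xs : List X} {f g : X → Poly N} → All (λ x → f x ≋ g x) xs → S xs f ≋ S xs g
    S-cong-All []       = P.refl
    S-cong-All (e ∷ es) = ⊕-cong e (S-cong-All es)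

    pathSum-labels : ∀ m P x y (nx : northXs P ≡ 0 ∷ x ∷ y ∷ []) (less att : Table) →
      (∀ p p′ → ltR m P x y nx p p′ ≡ less p p′) → (∀ p p′ → attR m P x y nx p p′ ≡ att p p′) →
      ∀ b₁ b₂ → (0 ℕ.≡ᵇ x) ≡ b₁ → (x ℕ.≡ᵇ y) ≡ b₂ → pathSum m P ≋ labelSum less att b₁ b₂ (pathWeight m P)
    pathSum-labels m P x y nx less att less-≡ att-≡ b₁ b₂ e₁ e₂ =
      P.trans (P.reflexive (cong (λ ws → S ws (λ w → weight m 3 P w ⊗ Fund N (pides m 3 P w))) (labellings-≡ m P x y nx less att less-≡ att-≡ b₁ b₂ e₁ e₂)))
        (S-cong-All (All.map (λ {w} h → ⊗-cong
            (P.trans (weight-split m P w) (⊗-cong (P.reflexive (cong z (cong₂ (λ a b → + a ℤ.- + b)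
              (trans (proj₁ h) (tdinvᵗ-≡ m P x y nx less att less-≡ att-≡ w)) (maxdinv-≡ m P x y nx less att less-≡ att-≡ b₁ b₂ e₁ e₂)))) (P.refl {pathWeight m P})))
            (P.reflexive (cong (Fund N) (trans (proj₂ h) (cong (compOfSet 3) (idesᵗ-≡ m P x y nx less att less-≡ att-≡ w))))))
          (reads m P x y nx b₁ b₂)))

-- Dyck paths with three north steps

module Paths where
  open SymmetricSums using (module Sums)
  open import Data.Bool using (T)
  open import Data.Bool.Properties using (∧-identityʳ)
  open import Data.Bool.ListAction using () renaming (all to allᵇ)
  open import Data.Nat using (_≤_; _<_; z≤n; s≤s)

  ≤ᵇ-true : ∀ {a b} → a ≤ b → (a ℕ.≤ᵇ b) ≡ true
  ≤ᵇ-true {a} {b} h with a ℕ.≤ᵇ b | ℕP.≤⇒≤ᵇ h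
  ... | true | _ = ≡.refl

  ≤ᵇ-false : ∀ {a b} → b < a → (a ℕ.≤ᵇ b) ≡ false
  ≤ᵇ-false {a} {b} h with a ℕ.≤ᵇ b in e
  ... | false = ≡.refl
  ... | true  = contradiction (ℕP.≤ᵇ⇒≤ a b (≡.subst T (≡.sym e) tt)) (ℕP.<⇒≱ h)

  ≤ᵇ-true⁻¹ : ∀ a b → (a ℕ.≤ᵇ b) ≡ true → a ≤ b
  ≤ᵇ-true⁻¹ a b e = ℕP.≤ᵇ⇒≤ a b (≡.subst T (≡.sym e) tt)

  <∸⇒+< : ∀ n x {c} → c < n ℕ.∸ x → x ℕ.+ c < n
  <∸⇒+< n       zero    h = h
  <∸⇒+< (suc n) (suc x) h = s≤s (<∸⇒+< n x h)

  east : ℕ → List Bool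
  east i = L.replicate i false

  path : ℕ → ℕ → ℕ → List Bool
  path x c d = true ∷ east x ++ true ∷ east c ++ true ∷ east d

  -- The loop of northXs, recovered by unification.
  mutual
    northFrom : ℕ → List Bool → List ℕ
    northFrom = _

    northXs-from : ∀ P → northXs P ≡ northFrom 0 P
    northXs-from P with 0
    ... | x = ≡.refl

  northFrom-run : ∀ i x P → northFrom x (east i ++ true ∷ P) ≡ (x ℕ.+ i) ∷ northFrom (x ℕ.+ i) P
  northFrom-run zero    x P rewrite ℕP.+-identityʳ x = ≡.refl
  northFrom-run (suc i) x P rewrite ℕP.+-suc x i = northFrom-run i (suc x) P

  northFrom-end : ∀ i x → northFrom x (east i) ≡ []
  northFrom-end zero    x = ≡.refl
  northFrom-end (suc i) x = northFrom-end i (suc x)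

  northXs-path : ∀ x c d → northXs (path x c d) ≡ 0 ∷ x ∷ (x ℕ.+ c) ∷ []
  northXs-path x c d = ≡.trans (northXs-from (path x c d)) (≡.cong (0 ∷_)
    (≡.trans (northFrom-run x 0 (east c ++ true ∷ east d)) (≡.cong (x ∷_)
      (≡.trans (northFrom-run c x (east d)) (≡.cong ((x ℕ.+ c) ∷_) (northFrom-end d (x ℕ.+ c)))))))

  module _ (m : ℕ) where
    private
      ok : ℕ × ℕ → Bool
      ok (x , y) = 3 ℕ.* x ℕ.≤ᵇ m ℕ.* y

      absorb : ∀ {a b} → (b ≡ true → a ≡ true) → ∀ r → a ∧ (b ∧ r) ≡ b ∧ r
      absorb {true}  {b}     h r = ≡.refl
      absorb {false} {false} h r = ≡.refl
      absorb {false} {true}  h r = contradiction (h ≡.refl) λ ()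

      ok-mono : ∀ x i y → ok (suc x ℕ.+ i , y) ≡ true → ok (x , y) ≡ true
      ok-mono x i y h = ≤ᵇ-true (ℕP.≤-trans (ℕP.*-monoʳ-≤ 3 (ℕP.≤-trans (ℕP.m≤m+n x (suc i)) (ℕP.≤-reflexive (ℕP.+-suc x i)))) (≤ᵇ-true⁻¹ _ _ h))

    -- Along a run of east steps the condition gets stronger, so the last point of the run decides
    -- for all of them.
    above-run : ∀ i x y P → allᵇ ok (points x y (east i ++ true ∷ P)) ≡ ok (x ℕ.+ i , y) ∧ allᵇ ok (points (x ℕ.+ i) (suc y) P)
    above-run zero    x y P = ≡.cong (λ a → ok (a , y) ∧ allᵇ ok (points a (suc y) P)) (≡.sym (ℕP.+-identityʳ x))
    above-run (suc i) x y P rewrite ℕP.+-suc x i =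
      ≡.trans (≡.cong (ok (x , y) ∧_) (above-run i (suc x) y P)) (absorb (ok-mono x i y) _)

    above-end : ∀ i x y → allᵇ ok (points x y (east i)) ≡ ok (x ℕ.+ i , y)
    above-end zero    x y = ≡.trans (∧-identityʳ _) (≡.cong (λ a → ok (a , y)) (≡.sym (ℕP.+-identityʳ x)))
    above-end (suc i) x y rewrite ℕP.+-suc x i =
      ≡.trans (≡.cong (ok (x , y) ∧_) (≡.trans (above-end i (suc x) y) (≡.sym (∧-identityʳ _))))
        (≡.trans (absorb (ok-mono x i y) true) (∧-identityʳ _))

    above-path : ∀ z x c d → aboveDiag m 3 (east z ++ true ∷ east x ++ true ∷ east c ++ true ∷ east d)
                 ≡ ok (z , 0) ∧ (ok (z ℕ.+ x , 1) ∧ (ok (z ℕ.+ x ℕ.+ c , 2) ∧ ok (z ℕ.+ x ℕ.+ c ℕ.+ d , 3)))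
    above-path z x c d =
      ≡.trans (above-run z 0 0 (east x ++ true ∷ east c ++ true ∷ east d))
        (≡.cong (ok (z , 0) ∧_) (≡.trans (above-run x z 1 (east c ++ true ∷ east d))
          (≡.cong (ok (z ℕ.+ x , 1) ∧_) (≡.trans (above-run c (z ℕ.+ x) 2 (east d))
            (≡.cong (ok (z ℕ.+ x ℕ.+ c , 2) ∧_) (above-end d (z ℕ.+ x ℕ.+ c) 3))))))

  module Ranges (R : CommutativeRing 0ℓ 0ℓ) where
    open CommutativeRing R hiding (zero) renaming (Carrier to A)
    open Sums R
    open import Algebra.Properties.CommutativeSemigroup +-commutativeSemigroup using () renaming (interchange to +-interchange)

    Σ< : ℕ → (ℕ → A) → A
    Σ< zero    f = 0#
    Σ< (suc n) f = f 0 + Σ< n (λ i → f (suc i))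

    Σ<-cong : ∀ n {f g : ℕ → A} → (∀ i → i < n → f i ≈ g i) → Σ< n f ≈ Σ< n g
    Σ<-cong zero    e = refl
    Σ<-cong (suc n) e = +-cong (e 0 (s≤s z≤n)) (Σ<-cong n λ i h → e (suc i) (s≤s h))

    Σ<-zero : ∀ n {f : ℕ → A} → (∀ i → f i ≈ 0#) → Σ< n f ≈ 0#
    Σ<-zero zero    e = refl
    Σ<-zero (suc n) e = trans (+-cong (e 0) (Σ<-zero n λ i → e (suc i))) (+-identityˡ _)

    Σ<-add : ∀ n (f g : ℕ → A) → Σ< n (λ i → f i + g i) ≈ Σ< n f + Σ< n g
    Σ<-add zero    f g = sym (+-identityˡ _)
    Σ<-add (suc n) f g = trans (+-congˡ (Σ<-add n (λ i → f (suc i)) (λ i → g (suc i)))) (+-interchange _ _ _ _)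

    Σ<-*ˡ : ∀ n a (f : ℕ → A) → Σ< n (λ i → a * f i) ≈ a * Σ< n f
    Σ<-*ˡ zero    a f = sym (zeroʳ a)
    Σ<-*ˡ (suc n) a f = trans (+-congˡ (Σ<-*ˡ n a (λ i → f (suc i)))) (sym (distribˡ a _ _))

    Σ<-+ : ∀ n n′ (f : ℕ → A) → Σ< (n ℕ.+ n′) f ≈ Σ< n f + Σ< n′ (λ i → f (n ℕ.+ i))
    Σ<-+ zero    n′ f = sym (+-identityˡ _)
    Σ<-+ (suc n) n′ f = trans (+-congˡ (Σ<-+ n n′ (λ i → f (suc i)))) (sym (+-assoc _ _ _))

    Σ<-last : ∀ n (f : ℕ → A) → Σ< (suc n) f ≈ Σ< n f + f n
    Σ<-last zero    f = +-comm _ _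
    Σ<-last (suc n) f = trans (+-congˡ (Σ<-last n (λ i → f (suc i)))) (sym (+-assoc _ _ _))

    Σ<-restrict : ∀ {n n′} (f : ℕ → A) → n′ ≤ n → (∀ i → n′ ≤ i → f i ≈ 0#) → Σ< n f ≈ Σ< n′ f
    Σ<-restrict {n} {zero} f z≤n h = Σ<-zero n λ i → h i z≤n
    Σ<-restrict {suc n} {suc n′} f (s≤s l) h = +-congˡ (Σ<-restrict (λ i → f (suc i)) l λ i g → h (suc i) (s≤s g))

    private
      norths : List Bool → ℕ
      norths = countᵇ (λ s → s)

      W : ℕ → ℕ → (List Bool → A) → A
      W j n g = S (allPaths n) (λ P → [ norths P ℕ.≡ᵇ j ]· g P)

      W-expand : ∀ j n g → W j (suc n) g ≈ S (allPaths n) (λ P → [ norths (true ∷ P) ℕ.≡ᵇ j ]· g (true ∷ P) + [ norths P ℕ.≡ᵇ j ]· g (false ∷ P))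
      W-expand j n g = trans (S-concatMap _ (allPaths n) _) (S-cong (allPaths n) λ P → +-congˡ (+-identityʳ _))

      W-suc : ∀ j n g → W (suc j) (suc n) g ≈ W j n (λ P → g (true ∷ P)) + W (suc j) n (λ P → g (false ∷ P))
      W-suc j n g = trans (W-expand (suc j) n g) (S-add (allPaths n) _ _)

      W-0 : ∀ n g → W 0 (suc n) g ≈ W 0 n (λ P → g (false ∷ P))
      W-0 n g = trans (W-expand 0 n g) (S-cong (allPaths n) λ P → +-identityˡ _)

      W-few : ∀ j n g → n < j → W j n g ≈ 0#
      W-few (suc j) zero    g _       = +-identityˡ _
      W-few (suc j) (suc n) g (s≤s h) = trans (W-suc j n g) (trans (+-cong (W-few j n _ h) (W-few (suc j) n _ (ℕP.m≤n⇒m≤1+n h))) (+-identityˡ _))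

    -- Filtering `allPaths` by the number of north steps hides the form of the paths. This recursion
    -- on the first step exposes it, and `pathsSum-runs` then groups the paths by their runs of east
    -- steps.
    pathsSum : ℕ → ℕ → (List Bool → A) → A
    pathsSum zero    e       g = g (east e)
    pathsSum (suc j) zero    g = pathsSum j zero (λ P → g (true ∷ P))
    pathsSum (suc j) (suc e) g = pathsSum j (suc e) (λ P → g (true ∷ P)) + pathsSum (suc j) e (λ P → g (false ∷ P))

    allPaths-sum : ∀ j e g → S (allPaths (e ℕ.+ j)) (λ P → [ countᵇ (λ s → s) P ℕ.≡ᵇ j ]· g P) ≈ pathsSum j e g
    allPaths-sum zero    zero    g = +-identityʳ _
    allPaths-sum zero    (suc e) g = trans (W-0 (e ℕ.+ 0) g) (allPaths-sum zero e (λ P → g (false ∷ P)))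
    allPaths-sum (suc j) zero    g = trans (W-suc j j g) (trans (+-cong (allPaths-sum j zero _) (W-few (suc j) j _ (s≤s ℕP.≤-refl))) (+-identityʳ _))
    allPaths-sum (suc j) (suc e) g = trans (W-suc j (e ℕ.+ suc j) g)
      (+-cong (trans (reflexive (≡.cong (λ n → W j n (λ P → g (true ∷ P))) (ℕP.+-suc e j))) (allPaths-sum j (suc e) _)) (allPaths-sum (suc j) e _))

    pathsSum-runs : ∀ j e g → pathsSum (suc j) e g ≈ Σ< (suc e) (λ i → pathsSum j (e ℕ.∸ i) (λ P → g (east i ++ true ∷ P)))
    pathsSum-runs j zero    g = sym (+-identityʳ _)
    pathsSum-runs j (suc e) g = +-congˡ (pathsSum-runs j e (λ P → g (false ∷ P)))

    module _ (m k Y : ℕ) (k-lo : 3 ℕ.* k ≤ m) (k-hi : m < 3 ℕ.* suc k) (Y-lo : 3 ℕ.* Y ≤ m ℕ.* 2) (Y-hi : m ℕ.* 2 < 3 ℕ.* suc Y) (Y≤m : Y ≤ m) (k≤m : k ≤ m) where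

      -- The bounds make k and Y the floors of m/3 and 2m/3, the last columns allowed at heights 1
      -- and 2. The three nested sums over runs are cut down to these columns because all other
      -- paths fall below the diagonal.
      Dyck-sum : ∀ f → S (Dyck m 3) f ≈ Σ< (suc k) (λ x → Σ< (suc Y ℕ.∸ x) (λ c → f (path x c (m ℕ.∸ x ℕ.∸ c))))
      Dyck-sum f = begin
        S (Dyck m 3) f
          ≈⟨ trans (S-filterᵇ _ (allPaths (m ℕ.+ 3)) f) (S-cong (allPaths (m ℕ.+ 3)) λ P → split (norths P ℕ.≡ᵇ 3) (aboveDiag m 3 P)) ⟩
        S (allPaths (m ℕ.+ 3)) (λ P → [ norths P ℕ.≡ᵇ 3 ]· g P)
          ≈⟨ trans (allPaths-sum 3 m g) (pathsSum-runs 2 m g) ⟩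
        Σ< (suc m) g₁
          ≈⟨ Σ<-cong (suc m) {g₁} {H₁} (λ z _ → trans (pathsSum-runs 1 (m ℕ.∸ z) (λ P → g (east z ++ true ∷ P)))
               (Σ<-cong (suc (m ℕ.∸ z)) {g₂ z} {H₂ z} λ x _ → pathsSum-runs 0 (m ℕ.∸ z ℕ.∸ x) (λ P → g (east z ++ true ∷ east x ++ true ∷ P)))) ⟩
        Σ< (suc m) H₁
          -- At height 0 only the origin is weakly above the diagonal, so a path has to begin with a
          -- north step.
          ≈⟨ Σ<-restrict {suc m} {1} H₁ (s≤s z≤n) (λ z z>0 → Σ<-zero (suc (m ℕ.∸ z)) {H₂ z} λ x → Σ<-zero (suc (m ℕ.∸ z ℕ.∸ x)) {h z x} λ c → h-zero z x c (λ r → low z x c r z>0)) ⟩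
        Σ< 1 H₁
          ≈⟨ +-identityʳ (H₁ 0) ⟩
        Σ< (suc m) (H₂ 0)
          ≈⟨ Σ<-restrict {suc m} {suc k} (H₂ 0) (s≤s k≤m) (λ x x>k → Σ<-zero (suc (m ℕ.∸ x)) {h 0 x} λ c → h-zero 0 x c (λ r → mid x c r x>k)) ⟩
        Σ< (suc k) (H₂ 0)
          ≈⟨ Σ<-cong (suc k) {H₂ 0} {λ x → Σ< (suc Y ℕ.∸ x) (λ c → f (path x c (m ℕ.∸ x ℕ.∸ c)))} (λ x x≤k →
               trans (Σ<-restrict {suc (m ℕ.∸ x)} {suc Y ℕ.∸ x} (h 0 x) (bound x) (λ c c> → h-zero 0 x c (λ r → high x c r c>)))
                 (Σ<-cong (suc Y ℕ.∸ x) {h 0 x} {λ c → f (path x c (m ℕ.∸ x ℕ.∸ c))} λ c c≤ → h-one x c x≤k c≤)) ⟩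
        Σ< (suc k) (λ x → Σ< (suc Y ℕ.∸ x) (λ c → f (path x c (m ℕ.∸ x ℕ.∸ c)))) ∎
        where
        open import Relation.Binary.Reasoning.Setoid setoid
        g : List Bool → A
        g P = [ aboveDiag m 3 P ]· f P
        h : ℕ → ℕ → ℕ → A
        h z x c = g (east z ++ true ∷ east x ++ true ∷ east c ++ true ∷ east (m ℕ.∸ z ℕ.∸ x ℕ.∸ c))
        g₁ : ℕ → A
        g₁ z = pathsSum 2 (m ℕ.∸ z) (λ P → g (east z ++ true ∷ P))
        g₂ H₂ : ℕ → ℕ → A
        g₂ z x = pathsSum 1 (m ℕ.∸ z ℕ.∸ x) (λ P → g (east z ++ true ∷ east x ++ true ∷ P))
        H₂ z x = Σ< (suc (m ℕ.∸ z ℕ.∸ x)) (h z x)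
        H₁ : ℕ → A
        H₁ z = Σ< (suc (m ℕ.∸ z)) (H₂ z)
        split : ∀ a b {y} → [ a ∧ b ]· y ≈ [ a ]· ([ b ]· y)
        split true  b = refl
        split false b = refl
        ok : ℕ → ℕ → Bool
        ok x y = 3 ℕ.* x ℕ.≤ᵇ m ℕ.* y
        h-zero : ∀ z x c → (∀ r → ok z 0 ∧ (ok (z ℕ.+ x) 1 ∧ (ok (z ℕ.+ x ℕ.+ c) 2 ∧ r)) ≡ false) → h z x c ≈ 0#
        h-zero z x c e rewrite above-path m z x c (m ℕ.∸ z ℕ.∸ x ℕ.∸ c) | e (ok (z ℕ.+ x ℕ.+ c ℕ.+ (m ℕ.∸ z ℕ.∸ x ℕ.∸ c)) 3) = refl
        low : ∀ z x c r → 0 < z → ok z 0 ∧ (ok (z ℕ.+ x) 1 ∧ (ok (z ℕ.+ x ℕ.+ c) 2 ∧ r)) ≡ false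
        low (suc z) x c r _ rewrite ℕP.*-zeroʳ m = ≡.refl
        mid : ∀ x c r → k < x → ok 0 0 ∧ (ok x 1 ∧ (ok (x ℕ.+ c) 2 ∧ r)) ≡ false
        mid x c r h rewrite ≤ᵇ-false {3 ℕ.* x} {m ℕ.* 1} (ℕP.≤-<-trans (ℕP.≤-reflexive (ℕP.*-identityʳ m)) (ℕP.<-≤-trans k-hi (ℕP.*-monoʳ-≤ 3 h))) = ≡.refl
        bound : ∀ x → suc Y ℕ.∸ x ≤ suc (m ℕ.∸ x)
        bound x = ℕP.≤-trans (ℕP.∸-monoˡ-≤ x (s≤s Y≤m)) (lem m x)
          where
          lem : ∀ m x → suc m ℕ.∸ x ≤ suc (m ℕ.∸ x)
          lem m       zero    = ℕP.≤-refl
          lem zero    (suc x) = ℕP.≤-trans (ℕP.m∸n≤m 0 x) z≤n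
          lem (suc m) (suc x) = lem m x
        high : ∀ x c r → suc Y ℕ.∸ x ≤ c → ok 0 0 ∧ (ok x 1 ∧ (ok (x ℕ.+ c) 2 ∧ r)) ≡ false
        high x c r h with ok x 1
        ... | false = ≡.refl
        ... | true rewrite ≤ᵇ-false {3 ℕ.* (x ℕ.+ c)} {m ℕ.* 2} (ℕP.<-≤-trans Y-hi (ℕP.*-monoʳ-≤ 3 (ℕP.≤-trans (ℕP.m≤n+m∸n (suc Y) x) (ℕP.+-monoʳ-≤ x h)))) = ≡.refl
        fits : ∀ x c → c < suc Y ℕ.∸ x → x ℕ.+ c ≤ Y
        fits x c c< = ℕP.≤-pred (<∸⇒+< (suc Y) x c<)
        whole : ∀ x c → c < suc Y ℕ.∸ x → x ℕ.+ c ℕ.+ (m ℕ.∸ x ℕ.∸ c) ≡ m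
        whole x c c< = ≡.trans (≡.cong (x ℕ.+ c ℕ.+_) (ℕP.∸-+-assoc m x c)) (ℕP.m+[n∸m]≡n (ℕP.≤-trans (fits x c c<) Y≤m))
        h-one : ∀ x c → x < suc k → c < suc Y ℕ.∸ x → h 0 x c ≈ f (path x c (m ℕ.∸ x ℕ.∸ c))
        h-one x c (s≤s x≤k) c<
          rewrite above-path m 0 x c (m ℕ.∸ x ℕ.∸ c) 
                | ≤ᵇ-true {3 ℕ.* x} {m ℕ.* 1} (ℕP.≤-trans (ℕP.*-monoʳ-≤ 3 x≤k) (ℕP.≤-trans k-lo (ℕP.≤-reflexive (≡.sym (ℕP.*-identityʳ m)))))
                | ≤ᵇ-true {3 ℕ.* (x ℕ.+ c)} {m ℕ.* 2} (ℕP.≤-trans (ℕP.*-monoʳ-≤ 3 (fits x c c<)) Y-lo)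
                | ≤ᵇ-true {3 ℕ.* (x ℕ.+ c ℕ.+ (m ℕ.∸ x ℕ.∸ c))} {m ℕ.* 3} (ℕP.≤-reflexive (≡.trans (≡.cong (3 ℕ.*_) (whole x c c<)) (ℕP.*-comm 3 m))) = refl

-- Comparison of ranks and the kind of a path

module RankOrder where
  open SplitPoints using (<ᵇ-true; <ᵇ-false)
  open PolynomialRing
  open Labels
  open PathShapes
  open Paths
  open import Data.Integer using (+_)
  open import Data.Integer.Tactic.RingSolver using () renaming (solve-∀ to solveℤ)
  open import Data.Empty using (⊥-elim)
  open import Data.Nat
  open import Data.Nat.GCD using (gcd)
  open import Data.Nat.Properties
  open import Relation.Binary.PropositionalEquality
  open import Relation.Binary.Definitions using (Tri; tri<; tri≈; tri>)

  <ℤᵇ-true : ∀ {i j} → i ℤ.< j → (i <ℤᵇ j) ≡ true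
  <ℤᵇ-true {i} {j} h with i ℤP.<? j
  ... | yes _ = refl
  ... | no ¬h = contradiction h ¬h

  <ℤᵇ-false : ∀ {i j} → ¬ (i ℤ.< j) → (i <ℤᵇ j) ≡ false
  <ℤᵇ-false {i} {j} h with i ℤP.<? j
  ... | yes p = contradiction p h
  ... | no _ = refl

  -- Ranks are integers that may involve negative terms; moving these across turns every comparison
  -- of ranks into one of natural numbers.
  <ℤᵇ-sub : ∀ a b c d → ((+ a ℤ.- + b) <ℤᵇ (+ c ℤ.- + d)) ≡ ((a + d) <ᵇ (c + b))
  <ℤᵇ-sub a b c d with (a + d) <? (c + b)
  ... | yes h = trans (<ℤᵇ-true up) (sym (<ᵇ-true h))
    where
    shuffle : ∀ a b d → a ℤ.- b ≡ (a ℤ.+ d) ℤ.+ (ℤ.- b ℤ.- d)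
    shuffle = solveℤ
    shuffle′ : ∀ c b d → c ℤ.- d ≡ (c ℤ.+ b) ℤ.+ (ℤ.- b ℤ.- d)
    shuffle′ = solveℤ
    up : (+ a ℤ.- + b) ℤ.< (+ c ℤ.- + d)
    up = subst₂ ℤ._<_ (sym (shuffle (+ a) (+ b) (+ d))) (sym (shuffle′ (+ c) (+ b) (+ d)))
           (ℤP.+-monoˡ-< (ℤ.- + b ℤ.- + d) (ℤ.+<+ h))
  ... | no ¬h = trans (<ℤᵇ-false down) (sym (<ᵇ-false (≮⇒≥ ¬h)))
    where
    shuffle : ∀ a b d → (a ℤ.- b) ℤ.+ (b ℤ.+ d) ≡ a ℤ.+ d
    shuffle = solveℤ
    shuffle′ : ∀ c b d → (c ℤ.- d) ℤ.+ (b ℤ.+ d) ≡ c ℤ.+ b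
    shuffle′ = solveℤ
    down : ¬ ((+ a ℤ.- + b) ℤ.< (+ c ℤ.- + d))
    down h = ¬h (ℤP.drop‿+<+ (subst₂ ℤ._<_ (shuffle (+ a) (+ b) (+ d)) (shuffle′ (+ c) (+ b) (+ d)) (ℤP.+-monoˡ-< (+ b ℤ.+ + d) h)))

  ∧-falseˡ : ∀ {a b} → a ≡ false → a ∧ b ≡ false
  ∧-falseˡ refl = refl

  ≢-code : ∀ {x y} → x < y → (x ≡ᵇ y) ≡ false
  ≢-code {zero}  {suc y} _       = refl
  ≢-code {suc x} {suc y} (s≤s h) = ≢-code h

  module _ (m : ℕ) where

    fl : ℕ → ℕ
    fl x = fdiv (x * gcd m 3) m

    rank-sub : ∀ x h → rank m 3 x h ≡ + (m * h + fl x) ℤ.- + (3 * x)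
    rank-sub x h = lem (+ (m * h)) (+ (3 * x)) (+ fl x)
      where
      lem : ∀ a b c → (a ℤ.- b) ℤ.+ c ≡ (a ℤ.+ c) ℤ.- b
      lem = solveℤ

    rank-sub-m : ∀ x h → rank m 3 x h ℤ.+ + m ≡ + (m * h + fl x + m) ℤ.- + (3 * x)
    rank-sub-m x h = trans (cong (ℤ._+ + m) (rank-sub x h)) (lem (+ (m * h + fl x)) (+ (3 * x)) (+ m))
      where
      lem : ∀ a b c → (a ℤ.- b) ℤ.+ c ≡ (a ℤ.+ c) ℤ.- b
      lem = solveℤ

    rank-< : ∀ x h x′ h′ → (rank m 3 x h <ℤᵇ rank m 3 x′ h′) ≡ ((m * h + fl x + 3 * x′) <ᵇ (m * h′ + fl x′ + 3 * x))
    rank-< x h x′ h′ = trans (cong₂ _<ℤᵇ_ (rank-sub x h) (rank-sub x′ h′)) (<ℤᵇ-sub (m * h + fl x) (3 * x) (m * h′ + fl x′) (3 * x′))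

    rank-<-m : ∀ x h x′ h′ → (rank m 3 x′ h′ <ℤᵇ (rank m 3 x h ℤ.+ + m)) ≡ ((m * h′ + fl x′ + 3 * x) <ᵇ (m * h + fl x + m + 3 * x′))
    rank-<-m x h x′ h′ = trans (cong₂ _<ℤᵇ_ (rank-sub x′ h′) (rank-sub-m x h)) (<ℤᵇ-sub (m * h′ + fl x′) (3 * x′) (m * h + fl x + m) (3 * x))

    -- The facts about ranks that hold alike for m coprime to 3 and for multiples of 3. By `row₁`
    -- and `row₂` the upper steps rank above the bottom one, by `past` a top step beyond column k is
    -- within m of it, by `slope` ranks fall to the right within a row, and by `noTie` the upper two
    -- steps have different ranks when the top one lies beyond column k.
    record RankBounds (k Y : ℕ) : Set where
      field
        m>0   : 0 < m
        fl-0  : fl 0 ≡ 0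
        row₁  : ∀ x → x ≤ k → 3 * x < m + fl x
        row₂  : ∀ y → y ≤ Y → 3 * y < m + m + fl y
        past  : ∀ y → k < y → y ≤ Y → m + fl y < 3 * y
        slope : ∀ x y → x < y → y ≤ Y → fl y + 3 * x < fl x + 3 * y
        noTie : ∀ x y → x < y → k < y → y ≤ Y → ¬ (fl x + 3 * y ≡ m + fl y + 3 * x)

  module PathKinds (N m k Y : ℕ) (k≤Y : k ≤ Y) (bounds : RankBounds m k Y) where
    open RankBounds bounds
    open Shapes N

    kind : ℕ → ℕ → Kind
    kind zero    zero    = corner
    kind zero    (suc c) = edge
    kind (suc x) zero    = edge
    kind (suc x) (suc c) = if suc x + suc c ≤ᵇ k then inner else outer

    private
      f : ℕ → ℕ
      f = fl m

      module Tables (x y : ℕ) (P : List Bool) (nx : northXs P ≡ 0 ∷ x ∷ y ∷ []) (x≤k : x ≤ k) (x≤y : x ≤ y) (y≤Y : y ≤ Y) where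

        ltab atab : Table
        ltab = ltR m P x y nx
        atab = attR m P x y nx

        irrefl : ∀ p → ltab p p ≡ false
        irrefl p = <ℤᵇ-false (ℤP.<-irrefl refl)

        expand₁ : m * 1 ≡ m
        expand₁ = *-identityʳ m

        expand₂ : m * 2 ≡ m + m
        expand₂ = trans (*-comm m 2) (cong (λ a → m + a) (+-identityʳ m))

        lt01 : ltab p₀ p₁ ≡ true
        lt01 = trans (rank-< m 0 0 x 1) (<ᵇ-true (subst₂ _<_ (sym (cong₂ (λ a b → a + b + 3 * x) (*-zeroʳ m) fl-0)) (sym (trans (+-identityʳ _) (cong (_+ f x) expand₁))) (row₁ x x≤k)))

        lt10 : ltab p₁ p₀ ≡ false
        lt10 = trans (rank-< m x 1 0 0) (<ᵇ-false (subst₂ _≤_ (sym (cong₂ (λ a b → a + b + 3 * x) (*-zeroʳ m) fl-0)) (sym (trans (+-identityʳ _) (cong (_+ f x) expand₁))) (<⇒≤ (row₁ x x≤k))))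

        lt02 : ltab p₀ p₂ ≡ true
        lt02 = trans (rank-< m 0 0 y 2) (<ᵇ-true (subst₂ _<_ (sym (cong₂ (λ a b → a + b + 3 * y) (*-zeroʳ m) fl-0)) (sym (trans (+-identityʳ _) (cong (_+ f y) expand₂))) (row₂ y y≤Y)))

        lt20 : ltab p₂ p₀ ≡ false
        lt20 = trans (rank-< m y 2 0 0) (<ᵇ-false (subst₂ _≤_ (sym (cong₂ (λ a b → a + b + 3 * y) (*-zeroʳ m) fl-0)) (sym (trans (+-identityʳ _) (cong (_+ f y) expand₂))) (<⇒≤ (row₂ y y≤Y))))

        Left Right : ℕ
        Left  = f x + 3 * y
        Right = m + f y + 3 * x

        shape12 : m * 1 + f x + 3 * y ≡ m + Left
        shape12 = trans (cong (λ a → a + f x + 3 * y) expand₁) (+-assoc m (f x) (3 * y))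

        shape21 : m * 2 + f y + 3 * x ≡ m + Right
        shape21 = trans (cong (λ a → a + f y + 3 * x) expand₂) (lem m (f y) (3 * x))
          where
          lem : ∀ a b c → a + a + b + c ≡ a + (a + b + c)
          lem = solve-∀

        lt12 : ltab p₁ p₂ ≡ (m + Left <ᵇ m + Right)
        lt12 = trans (rank-< m x 1 y 2) (cong₂ _<ᵇ_ shape12 shape21)

        lt21 : ltab p₂ p₁ ≡ (m + Right <ᵇ m + Left)
        lt21 = trans (rank-< m y 2 x 1) (cong₂ _<ᵇ_ shape21 shape12)

        less-true : Left < Right → ∀ p p′ → ltab p p′ ≡ lessT true p p′
        less-true h p₀ p₀ = irrefl p₀
        less-true h p₀ p₁ = lt01
        less-true h p₀ p₂ = lt02
        less-true h p₁ p₀ = lt10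
        less-true h p₁ p₁ = irrefl p₁
        less-true h p₁ p₂ = trans lt12 (<ᵇ-true (+-monoʳ-< m h))
        less-true h p₂ p₀ = lt20
        less-true h p₂ p₁ = trans lt21 (<ᵇ-false (+-monoʳ-≤ m (<⇒≤ h)))
        less-true h p₂ p₂ = irrefl p₂

        less-false : Right < Left → ∀ p p′ → ltab p p′ ≡ lessT false p p′
        less-false h p₀ p₀ = irrefl p₀
        less-false h p₀ p₁ = lt01
        less-false h p₀ p₂ = lt02
        less-false h p₁ p₀ = lt10
        less-false h p₁ p₁ = irrefl p₁
        less-false h p₁ p₂ = trans lt12 (<ᵇ-false (+-monoʳ-≤ m (<⇒≤ h)))
        less-false h p₂ p₀ = lt20
        less-false h p₂ p₁ = trans lt21 (<ᵇ-true (+-monoʳ-< m h))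
        less-false h p₂ p₂ = irrefl p₂

        near01-≡ : (rank m 3 x 1 <ℤᵇ (rank m 3 0 0 ℤ.+ + m)) ≡ (m + f x <ᵇ m + 3 * x)
        near01-≡ = trans (rank-<-m m 0 0 x 1) (cong₂ _<ᵇ_ (trans (+-identityʳ _) (cong (_+ f x) expand₁))
          (cong₂ (λ a b → a + b + m + 3 * x) (*-zeroʳ m) fl-0))

        near02-≡ : (rank m 3 y 2 <ℤᵇ (rank m 3 0 0 ℤ.+ + m)) ≡ (m + (m + f y) <ᵇ m + 3 * y)
        near02-≡ = trans (rank-<-m m 0 0 y 2) (cong₂ _<ᵇ_ (trans (+-identityʳ _) (trans (cong (_+ f y) expand₂) (+-assoc m m (f y))))
          (cong₂ (λ a b → a + b + m + 3 * y) (*-zeroʳ m) fl-0))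

        near12-≡ : (rank m 3 y 2 <ℤᵇ (rank m 3 x 1 ℤ.+ + m)) ≡ ((m + m) + (f y + 3 * x) <ᵇ (m + m) + (f x + 3 * y))
        near12-≡ = trans (rank-<-m m x 1 y 2) (cong₂ _<ᵇ_ (trans (cong (λ a → a + f y + 3 * x) expand₂) (+-assoc (m + m) (f y) (3 * x)))
          (trans (cong (λ a → a + f x + m + 3 * y) expand₁) (lem m (f x) (3 * y))))
          where
          lem : ∀ a b c → a + b + a + c ≡ (a + a) + (b + c)
          lem = solve-∀

        -- The middle step always stays within reach of the top one, so the top step attacks it
        -- exactly when it has the smaller rank.
        near21 : (rank m 3 x 1 <ℤᵇ (rank m 3 y 2 ℤ.+ + m)) ≡ true
        near21 = trans (rank-<-m m y 2 x 1) (<ᵇ-true (subst₂ _<_ (sym (cong (λ a → a + f x + 3 * y) expand₁)) (sym (trans (cong (λ a → a + f y + m + 3 * x) expand₂) (lem m (f y) (3 * x))))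
          (subst (_< m + (m + m + f y + 3 * x)) (sym (+-assoc m (f x) (3 * y))) (+-monoʳ-< m
            (≤-<-trans (≤-reflexive (+-comm (f x) (3 * y))) (<-≤-trans (+-monoˡ-< (f x) (row₂ y y≤Y)) (+-monoʳ-≤ (m + m + f y) (f≤ x x≤k))))))))
          where
          lem : ∀ a b c → a + a + b + a + c ≡ a + (a + a + b + c)
          lem = solve-∀
          f≤ : ∀ x → x ≤ k → f x ≤ 3 * x
          f≤ zero    _ = ≤-reflexive fl-0
          f≤ (suc x) h = <⇒≤ (subst₂ _<_ (+-identityʳ (f (suc x))) (cong (_+ 3 * suc x) fl-0) (slope 0 (suc x) (s≤s z≤n) (≤-trans h k≤Y)))

        att-table : ∀ {a b c d} → (rank m 3 x 1 <ℤᵇ (rank m 3 0 0 ℤ.+ + m)) ≡ a → (rank m 3 y 2 <ℤᵇ (rank m 3 0 0 ℤ.+ + m)) ≡ b →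
          ltab p₁ p₂ ∧ (rank m 3 y 2 <ℤᵇ (rank m 3 x 1 ℤ.+ + m)) ≡ c → ltab p₂ p₁ ≡ d →
          ∀ p p′ → atab p p′ ≡ attT a b c d p p′
        att-table ea eb ec ed p₀ p₀ = ∧-falseˡ (irrefl p₀)
        att-table ea eb ec ed p₀ p₁ = cong₂ _∧_ lt01 ea
        att-table ea eb ec ed p₀ p₂ = cong₂ _∧_ lt02 eb
        att-table ea eb ec ed p₁ p₀ = ∧-falseˡ lt10
        att-table ea eb ec ed p₁ p₁ = ∧-falseˡ (irrefl p₁)
        att-table ea eb ec ed p₁ p₂ = ec
        att-table ea eb ec ed p₂ p₀ = ∧-falseˡ lt20
        att-table ea eb ec ed p₂ p₁ = trans (cong₂ _∧_ ed near21) (∧-identityʳ _)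
          where open import Data.Bool.Properties using (∧-identityʳ)
        att-table ea eb ec ed p₂ p₂ = ∧-falseˡ (irrefl p₂)

        a01-true : 0 < x → (rank m 3 x 1 <ℤᵇ (rank m 3 0 0 ℤ.+ + m)) ≡ true
        a01-true h = trans near01-≡ (<ᵇ-true (+-monoʳ-< m (subst₂ _<_ (+-identityʳ (f x)) (cong (_+ 3 * x) fl-0) (slope 0 x h (≤-trans x≤k k≤Y)))))

        a02-true : k < y → (rank m 3 y 2 <ℤᵇ (rank m 3 0 0 ℤ.+ + m)) ≡ true
        a02-true h = trans near02-≡ (<ᵇ-true (+-monoʳ-< m (past y h y≤Y)))

        a02-false : y ≤ k → (rank m 3 y 2 <ℤᵇ (rank m 3 0 0 ℤ.+ + m)) ≡ false
        a02-false h = trans near02-≡ (<ᵇ-false (+-monoʳ-≤ m (<⇒≤ (row₁ y h))))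

        near12-true : x < y → (rank m 3 y 2 <ℤᵇ (rank m 3 x 1 ℤ.+ + m)) ≡ true
        near12-true h = trans near12-≡ (<ᵇ-true (+-monoʳ-< (m + m) (slope x y h y≤Y)))

        near12-false : x ≡ y → (rank m 3 y 2 <ℤᵇ (rank m 3 x 1 ℤ.+ + m)) ≡ false
        near12-false refl = trans near12-≡ (<ᵇ-false (≤-refl {m + m + (f x + 3 * x)}))

        Left<Right : y ≤ k → Left < Right
        Left<Right h = ≤-<-trans (≤-reflexive (+-comm (f x) (3 * y))) (<-≤-trans (+-monoˡ-< (f x) (row₁ y h)) (+-monoʳ-≤ (m + f y) (f≤ x x≤k)))
          where
          f≤ : ∀ x → x ≤ k → f x ≤ 3 * x
          f≤ zero    _ = ≤-reflexive fl-0
          f≤ (suc x) h = <⇒≤ (subst₂ _<_ (+-identityʳ (f (suc x))) (cong (_+ 3 * suc x) fl-0) (slope 0 (suc x) (s≤s z≤n) (≤-trans h k≤Y)))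

    pathSum-kind : ∀ x c P → northXs P ≡ 0 ∷ x ∷ (x + c) ∷ [] → x ≤ k → x + c ≤ Y →
                   pathSum m P ≋ pathWeight m P ⊗ llt (kind x c)
    pathSum-kind x c P nx x≤k y≤Y = go x c nx x≤k y≤Y
      where
      W = pathWeight m P
      via : ∀ {A B : Poly N} {C} → A ≋ B → B ≋ C → A ≋ C
      via e f = mk (λ i → trans (at e i) (at f i))
      labels = pathSum-labels m P
      go : ∀ x c (nx : northXs P ≡ 0 ∷ x ∷ (x + c) ∷ []) → x ≤ k → x + c ≤ Y → pathSum m P ≋ W ⊗ llt (kind x c)
      go zero zero nx x≤k y≤Y = via
        (labels 0 0 nx _ _ (less-true (Left<Right z≤n)) (att-table a01 (a02-false z≤n) (trans (cong (ltab p₁ p₂ ∧_) (near12-false refl)) (∧-zeroʳ _)) (less-true (Left<Right z≤n) p₂ p₁)) true true refl refl)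
        (shape-A W)
        where
        open Tables 0 0 P nx x≤k z≤n y≤Y
        open import Data.Bool.Properties using (∧-zeroʳ)
        a01 : (rank m 3 0 1 <ℤᵇ (rank m 3 0 0 ℤ.+ + m)) ≡ false
        a01 = trans near01-≡ (<ᵇ-false (≤-reflexive (cong (λ a → m + a) (sym fl-0))))
      -- With two steps in column 0, the top step ranks above the middle one exactly when its column
      -- is at most k.
      go zero (suc c) nx x≤k y≤Y with suc c ≤? k
      ... | yes h = via
        (labels 0 (suc c) nx _ _ (less-true (Left<Right h)) (att-table a01 (a02-false h) (cong₂ _∧_ (less-true (Left<Right h) p₁ p₂) (near12-true (s≤s z≤n))) (less-true (Left<Right h) p₂ p₁)) true false refl refl)
        (shape-B₁ W)
        where
        open Tables 0 (suc c) P nx x≤k z≤n y≤Y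
        a01 : (rank m 3 0 1 <ℤᵇ (rank m 3 0 0 ℤ.+ + m)) ≡ false
        a01 = trans near01-≡ (<ᵇ-false (≤-reflexive (cong (λ a → m + a) (sym fl-0))))
      ... | no ¬h = via
        (labels 0 (suc c) nx _ _ (less-false gap) (att-table a01 (a02-true (≰⇒> ¬h)) (∧-falseˡ (less-false gap p₁ p₂)) (less-false gap p₂ p₁)) true false refl refl)
        (shape-B₂ W)
        where
        open Tables 0 (suc c) P nx x≤k z≤n y≤Y
        a01 : (rank m 3 0 1 <ℤᵇ (rank m 3 0 0 ℤ.+ + m)) ≡ false
        a01 = trans near01-≡ (<ᵇ-false (≤-reflexive (cong (λ a → m + a) (sym fl-0))))
        gap : Right < Left
        gap = subst₂ _<_ (sym (+-identityʳ (m + f (suc c)))) (cong (_+ 3 * suc c) (sym fl-0)) (past (suc c) (≰⇒> ¬h) y≤Y)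
      go (suc x) zero nx x≤k y≤Y = via
        (labels (suc x) (suc x + 0) nx _ _ (less-true (Left<Right y≤k)) (att-table (a01-true (s≤s z≤n)) (a02-false y≤k)
          (trans (cong (ltab p₁ p₂ ∧_) (near12-false (sym (+-identityʳ (suc x))))) (∧-zeroʳ _)) (less-true (Left<Right y≤k) p₂ p₁)) false true refl
          (subst (λ z → (suc x ≡ᵇ z) ≡ true) (sym (+-identityʳ (suc x))) (≡ᵇ-refl x)))
        (shape-C W)
        where
        open Tables (suc x) (suc x + 0) P nx x≤k (m≤m+n (suc x) 0) y≤Y
        open import Data.Bool.Properties using (∧-zeroʳ)
        y≤k : suc x + 0 ≤ k
        y≤k = ≤-trans (≤-reflexive (+-identityʳ (suc x))) x≤k
      go (suc x) (suc c) nx x≤k y≤Y with suc x + suc c ≤ᵇ k in e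
      ... | true = via
        (labels (suc x) (suc x + suc c) nx _ _ (less-true (Left<Right y≤k)) (att-table (a01-true (s≤s z≤n)) (a02-false y≤k)
          (cong₂ _∧_ (less-true (Left<Right y≤k) p₁ p₂) (near12-true x<y)) (less-true (Left<Right y≤k) p₂ p₁)) false false refl (≢-code x<y))
        (shape-D₁ W)
        where
        open Tables (suc x) (suc x + suc c) P nx x≤k (m≤m+n (suc x) (suc c)) y≤Y
        y≤k : suc x + suc c ≤ k
        y≤k = ≤ᵇ-true⁻¹ _ _ e
        x<y : suc x < suc x + suc c
        x<y = m<m+n (suc x) (s≤s z≤n)
      -- Beyond column k either of the upper two steps may rank higher. Both orders lead to `outer`,
      -- and equality is excluded by `noTie`.
      ... | false = D₂ (<-cmp Left Right)
        where
        open Tables (suc x) (suc x + suc c) P nx x≤k (m≤m+n (suc x) (suc c)) y≤Y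
        x<y : suc x < suc x + suc c
        x<y = m<m+n (suc x) (s≤s z≤n)
        k<y : k < suc x + suc c
        k<y = ≰⇒> λ h → contradiction (trans (sym (≤ᵇ-true h)) e) λ ()
        D₂ : Tri (Left < Right) (Left ≡ Right) (Right < Left) → pathSum m P ≋ W ⊗ llt outer
        D₂ (tri≈ _ h _) = ⊥-elim (noTie (suc x) (suc x + suc c) x<y k<y y≤Y h)
        D₂ (tri< h _ _) = via
          (labels (suc x) (suc x + suc c) nx _ _ (less-true h) (att-table (a01-true (s≤s z≤n)) (a02-true k<y)
            (cong₂ _∧_ (less-true h p₁ p₂) (near12-true x<y)) (less-true h p₂ p₁)) false false refl (≢-code x<y))
          (shape-D₂ W)
        D₂ (tri> _ _ h) = via
          (labels (suc x) (suc x + suc c) nx _ _ (less-false h) (att-table (a01-true (s≤s z≤n)) (a02-true k<y)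
            (∧-falseˡ (less-false h p₁ p₂)) (less-false h p₂ p₁)) false false refl (≢-code x<y))
          (shape-D₂′ W)

-- Area and pdinv of a path

module AreaAndPdinv where
  open SplitPoints using (<ᵇ-true; <ᵇ-false)
  open Paths
  open import Data.Bool.ListAction using () renaming (any to anyᵇ)
  open import Data.Bool.Properties using (∧-zeroʳ; ∧-identityʳ)
  open import Data.Nat
  open import Data.Nat.Divisibility
  open import Data.Nat.GCD
  open import Data.Nat.Properties
  open import Relation.Binary.PropositionalEquality

  countUpTo : ℕ → (ℕ → Bool) → ℕ
  countUpTo zero    p = 0
  countUpTo (suc n) p = (if p 0 then 1 else 0) + countUpTo n (λ i → p (suc i))

  countᵇ-upTo : ∀ p n → countᵇ p (L.upTo n) ≡ countUpTo n p
  countᵇ-upTo p n = go n (λ i → i)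
    where
    go : ∀ n (g : ℕ → ℕ) → countᵇ p (L.applyUpTo g n) ≡ countUpTo n (λ i → p (g i))
    go zero    g = refl
    go (suc n) g with p (g 0)
    ... | true  = cong suc (go n (λ i → g (suc i)))
    ... | false = go n (λ i → g (suc i))

  countUpTo-cong : ∀ n {p p′ : ℕ → Bool} → (∀ i → i < n → p i ≡ p′ i) → countUpTo n p ≡ countUpTo n p′
  countUpTo-cong zero    e = refl
  countUpTo-cong (suc n) e = cong₂ (λ b r → (if b then 1 else 0) + r) (e 0 (s≤s z≤n)) (countUpTo-cong n λ i h → e (suc i) (s≤s h))

  countUpTo-true : ∀ n → countUpTo n (λ _ → true) ≡ n
  countUpTo-true zero    = refl
  countUpTo-true (suc n) = cong suc (countUpTo-true n)

  countUpTo-false : ∀ n → countUpTo n (λ _ → false) ≡ 0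
  countUpTo-false zero    = refl
  countUpTo-false (suc n) = countUpTo-false n

  countUpTo-+ : ∀ a b p → countUpTo (a + b) p ≡ countUpTo a p + countUpTo b (λ i → p (a + i))
  countUpTo-+ zero    b p = refl
  countUpTo-+ (suc a) b p = trans (cong ((if p 0 then 1 else 0) +_) (countUpTo-+ a b (λ i → p (suc i)))) (sym (+-assoc (if p 0 then 1 else 0) _ _))

  countUpTo-≥ : ∀ n a → countUpTo n (λ i → a ≤ᵇ i) ≡ n ∸ a
  countUpTo-≥ n       zero    = countUpTo-true n
  countUpTo-≥ zero    (suc a) = refl
  countUpTo-≥ (suc n) (suc a) = trans (countUpTo-cong n λ i _ → lem a i) (countUpTo-≥ n a)
    where
    lem : ∀ a i → (suc a ≤ᵇ suc i) ≡ (a ≤ᵇ i)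
    lem zero    i = refl
    lem (suc a) i = refl

  countUpTo-< : ∀ n a → countUpTo n (λ i → i <ᵇ a) ≡ n ⊓ a
  countUpTo-< n       zero    = trans (countUpTo-false n) (sym (⊓-zeroʳ n))
  countUpTo-< zero    (suc a) = refl
  countUpTo-< (suc n) (suc a) = cong suc (countUpTo-< n a)

  ≤ᵇ-iff : ∀ {a b c d} → (a ≤ b → c ≤ d) → (c ≤ d → a ≤ b) → (a ≤ᵇ b) ≡ (c ≤ᵇ d)
  ≤ᵇ-iff {a} {b} {c} {d} f g with a ≤? b
  ... | yes h = trans (≤ᵇ-true h) (sym (≤ᵇ-true (f h)))
  ... | no ¬h = trans (≤ᵇ-false (≰⇒> ¬h)) (sym (≤ᵇ-false (≰⇒> λ h → ¬h (g h))))

  module _ (m k Y : ℕ) (k-lo : 3 * k ≤ m) (k-hi : m < 3 * suc k) (Y-lo : 3 * Y ≤ m * 2) (Y-hi : m * 2 < 3 * suc Y) (Y≤m : Y ≤ m) (k≤m : k ≤ m) where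

    -- The last two hypotheses say that B is the floor of m h / 3, the number of full cells to the
    -- left of the diagonal at height h.
    row-area : ∀ x h B → B ≤ m → 3 * B ≤ m * h → m * h < 3 * suc B →
               countᵇ (λ x' → (x ≤ᵇ x') ∧ (3 * suc x' ≤ᵇ m * h)) (L.upTo m) ≡ B ∸ x
    row-area x h B B≤m lo hi = begin
      countᵇ p (L.upTo m)                                       ≡⟨ trans (countᵇ-upTo p m) (cong (λ n → countUpTo n p) (sym (m+[n∸m]≡n B≤m))) ⟩
      countUpTo (B + (m ∸ B)) p                                 ≡⟨ countUpTo-+ B (m ∸ B) p ⟩
      countUpTo B p + countUpTo (m ∸ B) (λ i → p (B + i))       ≡⟨ cong₂ _+_ (countUpTo-cong B inside) (countUpTo-cong (m ∸ B) outside) ⟩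
      countUpTo B (λ i → x ≤ᵇ i) + countUpTo (m ∸ B) (λ _ → false) ≡⟨ cong₂ _+_ (countUpTo-≥ B x) (countUpTo-false (m ∸ B)) ⟩
      (B ∸ x) + 0                                               ≡⟨ +-identityʳ _ ⟩
      B ∸ x ∎
      where
      open ≡-Reasoning
      p : ℕ → Bool
      p x' = (x ≤ᵇ x') ∧ (3 * suc x' ≤ᵇ m * h)
      inside : ∀ i → i < B → p i ≡ (x ≤ᵇ i)
      inside i h = trans (cong ((x ≤ᵇ i) ∧_) (≤ᵇ-true (≤-trans (*-monoʳ-≤ 3 h) lo))) (∧-identityʳ _)
      outside : ∀ i → i < m ∸ B → p (B + i) ≡ false
      outside i _ = trans (cong ((x ≤ᵇ (B + i)) ∧_) (≤ᵇ-false (<-≤-trans hi (*-monoʳ-≤ 3 (s≤s (m≤m+n B i)))))) (∧-zeroʳ _)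

    module _ (x c : ℕ) (P : List Bool) (nx : northXs P ≡ 0 ∷ x ∷ (x + c) ∷ []) (x≤k : x ≤ k) (y≤Y : x + c ≤ Y) where

      area-≡ : area m 3 P ≡ (k ∸ x) + (Y ∸ (x + c))
      area-≡ rewrite nx = begin
        A 0 0 + (A x 1 + (A (x + c) 2 + 0))     ≡⟨ cong₂ _+_ (row-area 0 0 0 z≤n z≤n (subst (_< 3) (sym (*-zeroʳ m)) (s≤s z≤n)))
                                                      (cong₂ _+_ (row-area x 1 k k≤m (≤-trans k-lo (≤-reflexive (sym (*-identityʳ m)))) (subst (_< 3 * suc k) (sym (*-identityʳ m)) k-hi))
                                                        (trans (+-identityʳ _) (row-area (x + c) 2 Y Y≤m Y-lo Y-hi))) ⟩
        0 + ((k ∸ x) + (Y ∸ (x + c))) ∎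
        where
        open ≡-Reasoning
        A : ℕ → ℕ → ℕ
        A x h = countᵇ (λ x' → (x ≤ᵇ x') ∧ (3 * suc x' ≤ᵇ m * h)) (L.upTo m)

      private
        y = x + c

        leg : ℕ → ℕ → ℕ
        leg r j = countᵇ (λ r' → (r <ᵇ r') ∧ (j <ᵇ nth 0 (y ∷ x ∷ 0 ∷ []) r')) (L.upTo 3)

        cell : ℕ → ℕ → Bool
        cell a l = (a * 3 ≤ᵇ m * (l + 1)) ∧ (m * l <ᵇ 3 * (a + 1))

        pdinv-rows : pdinv m 3 P ≡ countᵇ (λ j → cell (y ∸ j ∸ 1) (leg 0 j)) (L.upTo y) + (countᵇ (λ j → cell (x ∸ j ∸ 1) (leg 1 j)) (L.upTo x) + 0)
        pdinv-rows rewrite nx = refl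

        leg₀ : ∀ j → leg 0 j ≡ (if j <ᵇ x then 1 else 0)
        leg₀ j with j <ᵇ x
        ... | true  = refl
        ... | false = refl

        pred-< : ∀ x j → j < x → suc (x ∸ j ∸ 1) ≡ x ∸ j
        pred-< (suc x) zero    _       = refl
        pred-< (suc x) (suc j) (s≤s h) = pred-< x j h

        short : ∀ a → a ≤ k → a * 3 ≤ m * 1
        short a h = ≤-trans (≤-reflexive (*-comm a 3)) (≤-trans (*-monoʳ-≤ 3 h) (≤-trans k-lo (≤-reflexive (sym (*-identityʳ m)))))

        leg0-cell : ∀ a → cell a 0 ≡ (a ≤ᵇ k)
        leg0-cell a = trans (cong₂ _∧_ (≤ᵇ-iff fwd (short a)) (<ᵇ-true (subst (_< 3 * (a + 1)) (sym (*-zeroʳ m)) (subst (λ z → 0 < 3 * z) (+-comm 1 a) (s≤s z≤n))))) (∧-identityʳ _)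
          where
          fwd : a * 3 ≤ m * 1 → a ≤ k
          fwd h = ≤-pred (*-cancelˡ-< 3 a (suc k) (≤-<-trans (≤-trans (≤-reflexive (*-comm 3 a)) (≤-trans h (≤-reflexive (*-identityʳ m)))) k-hi))

        -- For leg 1 the first condition, a ≤ 2m/3, follows from `a ≤ Y`. The second, m/3 < a + 1,
        -- says that the arm is at least k; for leg 0 the arm had to be at most k.
        leg1-cell : ∀ a → a ≤ Y → cell a 1 ≡ (k ≤ᵇ a)
        leg1-cell a h = trans (cong₂ _∧_ (≤ᵇ-true (≤-trans (≤-reflexive (*-comm a 3)) (≤-trans (*-monoʳ-≤ 3 h) Y-lo))) (≤ᵇ-iff fwd bwd)) refl
          where
          fwd : suc (m * 1) ≤ 3 * (a + 1) → k ≤ a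
          fwd g = ≤-pred (subst (k <_) (+-comm a 1) (*-cancelˡ-< 3 k (a + 1) (≤-<-trans k-lo (<-≤-trans (s≤s (≤-reflexive (sym (*-identityʳ m)))) g))))
          bwd : k ≤ a → suc (m * 1) ≤ 3 * (a + 1)
          bwd g = <-≤-trans (subst (_< 3 * suc k) (sym (*-identityʳ m)) k-hi) (*-monoʳ-≤ 3 (subst (suc k ≤_) (+-comm 1 a) (s≤s g)))

        row₁ : countᵇ (λ j → cell (x ∸ j ∸ 1) (leg 1 j)) (L.upTo x) ≡ x
        row₁ = trans (countᵇ-upTo _ x) (trans (countUpTo-cong x (λ j _ →
          trans (leg0-cell (x ∸ j ∸ 1)) (≤ᵇ-true (≤-trans (m∸n≤m (x ∸ j) 1) (≤-trans (m∸n≤m x j) x≤k))))) (countUpTo-true x))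

        row₀ : countᵇ (λ j → cell (y ∸ j ∸ 1) (leg 0 j)) (L.upTo y) ≡ (x ⊓ (y ∸ k)) + (c ∸ (c ∸ suc k))
        row₀ = trans (countᵇ-upTo _ y) (trans (countUpTo-+ x c _)
          (cong₂ _+_ (trans (countUpTo-cong x left) (countUpTo-< x (y ∸ k))) (trans (countUpTo-cong c right) (countUpTo-≥ c (c ∸ suc k)))))
          where
          left : ∀ j → j < x → cell (y ∸ j ∸ 1) (leg 0 j) ≡ (j <ᵇ y ∸ k)
          left j j<x = trans (cong (cell (y ∸ j ∸ 1)) (trans (leg₀ j) (cong (if_then 1 else 0) (<ᵇ-true j<x))))
            (trans (leg1-cell (y ∸ j ∸ 1) (≤-trans (m∸n≤m (y ∸ j) 1) (≤-trans (m∸n≤m y j) y≤Y))) (≤ᵇ-iff fwd bwd))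
            where
            j<y : j < y
            j<y = <-≤-trans j<x (m≤m+n x c)
            total : (y ∸ j) + j ≡ y
            total = m∸n+n≡m (<⇒≤ j<y)
            fwd : k ≤ y ∸ j ∸ 1 → suc j ≤ y ∸ k
            fwd h = m+n≤o⇒m≤o∸n (suc j) (subst (suc j + k ≤_) total
              (≤-trans (≤-reflexive (trans (+-comm (suc j) k) (+-suc k j))) (+-monoˡ-≤ j (subst (suc k ≤_) (pred-< y j j<y) (s≤s h)))))
            bwd : suc j ≤ y ∸ k → k ≤ y ∸ j ∸ 1
            bwd h = ≤-pred (subst (suc k ≤_) (sym (pred-< y j j<y)) (m+n≤o⇒m≤o∸n (suc k) (subst (_≤ y) (lem j k) (m≤o∸n⇒m+n≤o (suc j) (k≤y h) h))))
              where
              lem : ∀ j k → suc j + k ≡ suc k + j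
              lem = solve-∀
              k≤y : suc j ≤ y ∸ k → k ≤ y
              k≤y h with k ≤? y
              ... | yes g = g
              ... | no ¬g = contradiction (subst (suc j ≤_) (m≤n⇒m∸n≡0 (<⇒≤ (≰⇒> ¬g))) h) λ ()
          right : ∀ s → s < c → cell (y ∸ (x + s) ∸ 1) (leg 0 (x + s)) ≡ ((c ∸ suc k) ≤ᵇ s)
          right s s<c = trans (cong₂ cell (cong (_∸ 1) ([m+n]∸[m+o]≡n∸o x c s)) (trans (leg₀ (x + s)) (cong (if_then 1 else 0) (<ᵇ-false (m≤m+n x s)))))
            (trans (leg0-cell (c ∸ s ∸ 1)) (≤ᵇ-iff fwd bwd))
            where
            total : (c ∸ s) + s ≡ c
            total = m∸n+n≡m (<⇒≤ s<c)
            fwd : c ∸ s ∸ 1 ≤ k → c ∸ suc k ≤ s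
            fwd h = m≤n+o⇒m∸n≤o c (suc k) (≤-trans (≤-reflexive (sym total)) (+-monoˡ-≤ s (subst (_≤ suc k) (pred-< c s s<c) (s≤s h))))
            bwd : c ∸ suc k ≤ s → c ∸ s ∸ 1 ≤ k
            bwd h = ≤-pred (subst (_≤ suc k) (sym (pred-< c s s<c)) (m≤n+o⇒m∸n≤o c s (≤-trans (m≤n+m∸n c (suc k)) (≤-trans (+-monoʳ-≤ (suc k) h) (≤-reflexive (+-comm (suc k) s))))))

      -- In the long row, the x cells with leg 1 need an arm of at least k and the c cells with leg
      -- 0 an arm of at most k; this gives the first two terms, the second being the minimum of c
      -- and k + 1. The short row has x cells of leg 0 and arm below x ≤ k, and all of them count.
      pdinv-≡ : pdinv m 3 P ≡ ((x ⊓ (x + c ∸ k)) + (c ∸ (c ∸ suc k))) + x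
      pdinv-≡ = trans pdinv-rows (cong₂ _+_ row₀ (trans (+-identityʳ _) row₁))

-- Returns to the diagonal, and rank bounds in the two cases

module Returns where
  open Paths
  open AreaAndPdinv
  open RankOrder
  open PolynomialRing using (≡ᵇ-refl)
  open import Data.Bool using (T)
  open import Data.Bool.ListAction using () renaming (any to anyᵇ)
  open import Data.Bool.Properties using (∧-zeroʳ)
  open import Data.Nat
  open import Data.Nat.Divisibility
  open import Data.Nat.GCD
  open import Data.Nat.Properties
  open import Data.Nat.DivMod using (_%_; m<n⇒m/n≡0; +-distrib-/-∣ˡ; n/n≡1; [m+kn]%n≡m%n)
  open import Relation.Binary.PropositionalEquality

  gcd-1 : ∀ k → gcd (3 * k + 1) 3 ≡ 1
  gcd-1 k = ∣1⇒≡1 (∣m+n∣m⇒∣n (gcd[m,n]∣m (3 * k + 1) 3) (∣m⇒∣m*n k (gcd[m,n]∣n (3 * k + 1) 3)))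

  gcd-2 : ∀ k → gcd (3 * k + 2) 3 ≡ 1
  gcd-2 k = ∣1⇒≡1 (∣m+n∣m⇒∣n {n = 1} (gcd[m,n]∣n (3 * k + 2) 3)
    (∣m+n∣m⇒∣n (gcd[m,n]∣m (3 * k + 2) 3) (∣m⇒∣m*n k (gcd[m,n]∣n (3 * k + 2) 3))))

  gcd-0 : ∀ k → gcd (3 * k) 3 ≡ 3
  gcd-0 k = ∣-antisym (gcd[m,n]∣n (3 * k) 3) (gcd-greatest (m∣m*n k) ∣-refl)

  -- Only i = 1 is tested, and the default value of the search is the gcd, so the result is 1
  -- whatever the path.
  ret-coprime : ∀ m P → gcd m 3 ≡ 1 → ret m 3 P ≡ 1
  ret-coprime m P e rewrite e = lem _ e
    where
    lem : ∀ b {g} → g ≡ 1 → (if b then 1 else g) ≡ 1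
    lem true  _ = refl
    lem false e = e

  hit : ℕ → ℕ → ℕ × ℕ → Bool
  hit a h (x , y) = (x ≡ᵇ a) ∧ (y ≡ᵇ h)

  ≡ᵇ-false : ∀ {a b} → ¬ (a ≡ b) → (a ≡ᵇ b) ≡ false
  ≡ᵇ-false {a} {b} h with a ≡ᵇ b in e
  ... | false = refl
  ... | true  = contradiction (≡ᵇ⇒≡ a b (subst T (sym e) _)) h

  hit-above : ∀ a h x y P → h < y → anyᵇ (hit a h) (points x y P) ≡ false
  hit-above a h x y []          h<y rewrite ≡ᵇ-false {y} {h} (λ e → <-irrefl (sym e) h<y) | ∧-zeroʳ (x ≡ᵇ a) = refl
  hit-above a h x y (true ∷ P)  h<y rewrite ≡ᵇ-false {y} {h} (λ e → <-irrefl (sym e) h<y) | ∧-zeroʳ (x ≡ᵇ a) = hit-above a h x (suc y) P (m≤n⇒m≤1+n h<y)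
  hit-above a h x y (false ∷ P) h<y rewrite ≡ᵇ-false {y} {h} (λ e → <-irrefl (sym e) h<y) | ∧-zeroʳ (x ≡ᵇ a) = hit-above a h (suc x) y P h<y

  hit-below : ∀ a h x y i P → y < h → anyᵇ (hit a h) (points x y (east i ++ true ∷ P)) ≡ anyᵇ (hit a h) (points (x + i) (suc y) P)
  hit-below a h x y zero    P y<h rewrite ≡ᵇ-false {y} {h} (λ e → <-irrefl e y<h) | ∧-zeroʳ (x ≡ᵇ a) | +-identityʳ x = refl
  hit-below a h x y (suc i) P y<h rewrite ≡ᵇ-false {y} {h} (λ e → <-irrefl e y<h) | ∧-zeroʳ (x ≡ᵇ a) | +-suc x i = hit-below a h (suc x) y i P y<h

  hit-miss : ∀ a h x i P → x + i < a → anyᵇ (hit a h) (points x h (east i ++ true ∷ P)) ≡ false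
  hit-miss a h x zero    P lt rewrite ≡ᵇ-false {x} {a} (λ e → <-irrefl (trans (+-identityʳ x) e) lt) = hit-above a h x (suc h) P ≤-refl
  hit-miss a h x (suc i) P lt rewrite ≡ᵇ-false {x} {a} (λ e → <⇒≱ lt (≤-trans (≤-reflexive (sym e)) (m≤m+n x (suc i)))) =
    hit-miss a h (suc x) i P (subst (_< a) (+-suc x i) lt)

  hit-run : ∀ a h x i P → x ≤ a → a ≤ x + i → anyᵇ (hit a h) (points x h (east i ++ true ∷ P)) ≡ true
  hit-run a h x zero    P lo hi rewrite ≤-antisym lo (subst (a ≤_) (+-identityʳ x) hi) | ≡ᵇ-refl a | ≡ᵇ-refl h = refl
  hit-run a h x (suc i) P lo hi with x ≟ a
  ... | yes refl rewrite ≡ᵇ-refl x | ≡ᵇ-refl h = refl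
  ... | no ¬e    rewrite ≡ᵇ-false ¬e = hit-run a h (suc x) i P (≤∧≢⇒< lo ¬e) (subst (a ≤_) (+-suc x i) hi)

  module _ (K x c d : ℕ) where
    private
      m = 3 * suc K
      P = path x c d

      width : fdiv m 3 ≡ suc K
      width = trans (cong (λ n → n / 3) (*-comm 3 (suc K))) (m*n/n≡m (suc K) 3)
        where open import Data.Nat.DivMod using (_/_; m*n/n≡m)

      touch : ℕ → Bool
      touch i = anyᵇ (hit (i * suc K) (i * 1)) (points 0 0 P)

      ret-touch : ret m 3 P ≡ (if touch 1 then 1 else if touch 2 then 2 else 3)
      ret-touch rewrite gcd-0 (suc K) = lem (same 1) (same 2) (gcd-0 (suc K))
        where
        same : ∀ i → anyᵇ (hit (i * fdiv m (gcd m 3)) (i * fdiv 3 (gcd m 3))) (points 0 0 P) ≡ touch i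
        same i = cong₂ (λ w h → anyᵇ (hit (i * w) (i * h)) (points 0 0 P)) (trans (cong (fdiv m) (gcd-0 (suc K))) width) (cong (fdiv 3) (gcd-0 (suc K)))
        lem : ∀ {a b a′ b′ e g} → a ≡ a′ → b ≡ b′ → g ≡ 3 →
              (if a then 1 else if b then 2 else if e then 3 else g) ≡ (if a′ then 1 else if b′ then 2 else 3)
        lem {true}          refl refl _ = refl
        lem {false} {true}  refl refl _ = refl
        lem {false} {false} {e = true}  refl refl _ = refl
        lem {false} {false} {e = false} refl refl e = e

      touch₁-false : x < suc K → touch 1 ≡ false
      touch₁-false lt = hit-miss (1 * suc K) 1 0 x (east c ++ true ∷ east d) (subst (x <_) (sym (*-identityˡ (suc K))) lt)

      touch₂-eq : touch 2 ≡ anyᵇ (hit (2 * suc K) 2) (points x 2 (east c ++ true ∷ east d))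
      touch₂-eq = hit-below (2 * suc K) 2 0 1 x (east c ++ true ∷ east d) (s≤s (s≤s z≤n))

    ret-1 : x ≡ suc K → ret m 3 P ≡ 1
    ret-1 e = trans ret-touch (cong (λ b → if b then 1 else if touch 2 then 2 else 3)
      (hit-run (1 * suc K) 1 0 x (east c ++ true ∷ east d) z≤n (≤-reflexive (trans (*-identityˡ _) (sym e)))))

    ret-2 : x < suc K → x + c ≡ 2 * suc K → ret m 3 P ≡ 2
    ret-2 lt e = trans ret-touch (trans (cong (λ b → if b then 1 else if touch 2 then 2 else 3) (touch₁-false lt))
      (cong (λ b → if b then 2 else 3) (trans touch₂-eq (hit-run (2 * suc K) 2 x c (east d) (≤-trans (m≤m+n x c) (≤-reflexive e)) (≤-reflexive (sym e))))))

    ret-3 : x < suc K → x + c < 2 * suc K → ret m 3 P ≡ 3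
    ret-3 lt lt′ = trans ret-touch (trans (cong (λ b → if b then 1 else if touch 2 then 2 else 3) (touch₁-false lt))
      (cong (λ b → if b then 2 else 3) (trans touch₂-eq (hit-miss (2 * suc K) 2 x c (east d) lt′))))

  fdiv-small : ∀ m x → x < m → fdiv (x * 1) m ≡ 0
  fdiv-small (suc m) x h rewrite *-identityʳ x = m<n⇒m/n≡0 h

  module Coprime (m k Y : ℕ) (g : gcd m 3 ≡ 1) (Y<m : Y < m) (k≤Y : k ≤ Y) (k-hi : m < 3 * suc k)
    (k-lo : 3 * k < m) (Y-lo : 3 * Y < m * 2) (m≢3 : ∀ d → ¬ (3 * d ≡ m)) where

    private
      fl-zero : ∀ x → x ≤ Y → fl m x ≡ 0
      fl-zero x h = trans (cong (λ e → fdiv (x * e) m) g) (fdiv-small m x (≤-<-trans h Y<m))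

    rankBounds : RankBounds m k Y
    rankBounds = record
      { m>0 = ≤-<-trans z≤n Y<m
      ; fl-0 = fl-zero 0 z≤n
      ; row₁ = λ x h → ≤-<-trans (*-monoʳ-≤ 3 h) (<-≤-trans k-lo (m≤m+n m _))
      ; row₂ = λ y h → ≤-<-trans (*-monoʳ-≤ 3 h) (<-≤-trans Y-lo (≤-trans (≤-reflexive (trans (*-comm m 2) (cong (λ a → m + a) (+-identityʳ m)))) (m≤m+n (m + m) _)))
      ; past = λ y h y≤Y → ≤-<-trans (≤-reflexive (trans (cong (λ a → m + a) (fl-zero y y≤Y)) (+-identityʳ m))) (<-≤-trans k-hi (*-monoʳ-≤ 3 h))
      ; slope = λ x y h y≤Y → subst₂ (λ a b → a + 3 * x < b + 3 * y) (sym (fl-zero y y≤Y)) (sym (fl-zero x (≤-trans (<⇒≤ h) y≤Y))) (*-monoʳ-< 3 h)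
      ; noTie = λ x y h _ y≤Y e → m≢3 (y ∸ x) (trans (*-distribˡ-∸ 3 y x) (trans (cong (_∸ 3 * x)
          (trans (trans (sym (cong (_+ 3 * y) (fl-zero x (≤-trans (<⇒≤ h) y≤Y)))) e) (cong (λ a → a + 3 * x) (trans (cong (λ a → m + a) (fl-zero y y≤Y)) (+-identityʳ m))))) (m+n∸n≡m m (3 * x))))
      }

  module Multiple (K : ℕ) where
    private
      m = 3 * suc K

      fl-3 : ∀ x → fl m x ≡ fdiv (x * 3) m
      fl-3 x = cong (λ e → fdiv (x * e) m) (gcd-0 (suc K))

      fl-low : ∀ x → x < suc K → fl m x ≡ 0
      fl-low x h = trans (fl-3 x) (m<n⇒m/n≡0 (subst (_< m) (*-comm 3 x) (*-monoʳ-< 3 h)))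

      fl-shift : ∀ r → fl m (suc K + r) ≡ suc (fl m r)
      fl-shift r = trans (fl-3 (suc K + r)) (trans (cong (λ a → fdiv a m) (lem K r)) (trans (+-distrib-/-∣ˡ {m} (r * 3) {m} ∣-refl)
        (cong₂ _+_ (n/n≡1 m) (sym (fl-3 r)))))
        where
        lem : ∀ K r → (suc K + r) * 3 ≡ 3 * suc K + r * 3
        lem = solve-∀

      fl-mid : ∀ r → r < suc K → fl m (suc K + r) ≡ 1
      fl-mid r h = trans (fl-shift r) (cong suc (fl-low r h))

      fl-top : fl m (2 * suc K) ≡ 2
      fl-top = trans (fl-shift (suc K + 0)) (cong suc (trans (fl-shift 0) (cong suc (fl-low 0 (s≤s z≤n)))))

      -- For m = 3 (K + 1) the correction term of the rank is the floor of y / (K + 1). It takes the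
      -- values 0, 1, 2 on the columns that can occur, and 2 only in the last one.
      data Range (y : ℕ) : Set where
        low : y < suc K → fl m y ≡ 0 → Range y
        mid : suc K ≤ y → y < 2 * suc K → fl m y ≡ 1 → Range y
        top : y ≡ 2 * suc K → fl m y ≡ 2 → Range y

      range : ∀ y → y ≤ 2 * suc K → Range y
      range y h with y <? suc K
      ... | yes l = low l (fl-low y l)
      ... | no ¬l with y ≟ 2 * suc K
      ...   | yes e = top e (trans (cong (fl m) e) fl-top)
      ...   | no ¬e = mid (≮⇒≥ ¬l) y< (subst (λ z → fl m z ≡ 1) (m+[n∸m]≡n (≮⇒≥ ¬l)) (fl-mid (y ∸ suc K) r<))
        where
        y< : y < 2 * suc K
        y< = ≤∧≢⇒< h ¬e
        r< : y ∸ suc K < suc K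
        r< = m<n+o⇒m∸n<o y (suc K) (subst (y <_) (cong (λ a → suc K + a) (+-identityʳ (suc K))) y<)

      fl≤2 : ∀ y → y ≤ 2 * suc K → fl m y ≤ 2
      fl≤2 y h with range y h
      ... | low _ e   rewrite e = z≤n
      ... | mid _ _ e rewrite e = s≤s z≤n
      ... | top _ e   rewrite e = ≤-refl

      twice : m + m ≡ 3 * (2 * suc K)
      twice = lem K
        where
        lem : ∀ K → 3 * suc K + 3 * suc K ≡ 3 * (2 * suc K)
        lem = solve-∀

      step : ∀ x y → x < y → 2 + 3 * x < 3 * y
      step x y h = ≤-trans (≤-reflexive (sym (*-suc 3 x))) (*-monoʳ-≤ 3 h)

    rankBounds : RankBounds m (suc K) (2 * suc K)
    rankBounds = record
      { m>0 = s≤s z≤n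
      ; fl-0 = fl-low 0 (s≤s z≤n)
      ; row₁ = row₁
      ; row₂ = row₂
      ; past = λ y h y≤Y → ≤-<-trans (≤-reflexive (+-comm m (fl m y))) (≤-<-trans (+-monoˡ-≤ m (fl≤2 y y≤Y)) (step (suc K) y h))
      ; slope = λ x y h y≤Y → ≤-<-trans (+-monoˡ-≤ (3 * x) (fl≤2 y y≤Y)) (<-≤-trans (step x y h) (m≤n+m (3 * y) (fl m x)))
      ; noTie = noTie
      }
      where
      row₁ : ∀ x → x ≤ suc K → 3 * x < m + fl m x
      row₁ x h with range x (≤-trans h (m≤m+n (suc K) (suc K + 0)))
      ... | low l e   = <-≤-trans (*-monoʳ-< 3 l) (m≤m+n m (fl m x))
      ... | mid _ _ e rewrite e = ≤-<-trans (*-monoʳ-≤ 3 h) (m<m+n m (s≤s z≤n))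
      ... | top _ e   rewrite e = ≤-<-trans (*-monoʳ-≤ 3 h) (m<m+n m (s≤s z≤n))
      row₂ : ∀ y → y ≤ 2 * suc K → 3 * y < m + m + fl m y
      row₂ y h with range y h
      ... | low l e   = <-≤-trans (*-monoʳ-< 3 l) (≤-trans (m≤m+n m m) (m≤m+n (m + m) (fl m y)))
      ... | mid _ l e = <-≤-trans (subst (3 * y <_) (sym twice) (*-monoʳ-< 3 l)) (m≤m+n (m + m) (fl m y))
      ... | top _ e   rewrite e = ≤-<-trans (subst (3 * y ≤_) (sym twice) (*-monoʳ-≤ 3 h)) (m<m+n (m + m) (s≤s z≤n))
      -- Modulo 3 a tie forces the two correction terms to agree, as both are at most 2. Then y = x
      -- + K + 1, and a shift by K + 1 raises the correction term by one, a contradiction.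
      noTie : ∀ x y → x < y → suc K < y → y ≤ 2 * suc K → ¬ (fl m x + 3 * y ≡ m + fl m y + 3 * x)
      noTie x y x<y k<y y≤Y e = cases (range x (≤-trans (<⇒≤ x<y) y≤Y)) (range y y≤Y)
        where
        mod3 : ∀ a b c → (a + 3 * b) % 3 ≡ (c + 3 * (suc K + x)) % 3 → a % 3 ≡ c % 3
        mod3 a b c h = trans (sym (lem a b)) (trans h (lem c (suc K + x)))
          where
          lem : ∀ a b → (a + 3 * b) % 3 ≡ a % 3
          lem a b = trans (cong (λ z → (a + z) % 3) (*-comm 3 b)) ([m+kn]%n≡m%n a b 3)
        residues : fl m x % 3 ≡ fl m y % 3
        residues = mod3 (fl m x) y (fl m y) (cong (_% 3) (trans e (lem (suc K) (fl m y) x)))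
          where
          lem : ∀ a b c → 3 * a + b + 3 * c ≡ b + 3 * (a + c)
          lem = solve-∀
        level : fl m x ≡ fl m y → y ≡ suc K + x
        level s = *-cancelˡ-≡ y (suc K + x) 3 (+-cancelˡ-≡ (fl m x) (3 * y) (3 * (suc K + x)) (trans e (trans (lem (suc K) (fl m y) x) (cong (_+ 3 * (suc K + x)) (sym s)))))
          where
          lem : ∀ a b c → 3 * a + b + 3 * c ≡ b + 3 * (a + c)
          lem = solve-∀
        shifted : ¬ (fl m x ≡ fl m y)
        shifted s = 1+n≢n (sym (trans s (trans (cong (fl m) (level s)) (fl-shift x))))
        cases : Range x → Range y → _
        cases (low _ a)   (low l _)   = <⇒≱ k<y (<⇒≤ l)
        cases (low _ a)   (mid _ _ b) = contradiction (trans (sym (cong (_% 3) a)) (trans residues (cong (_% 3) b))) λ ()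
        cases (low _ a)   (top _ b)   = contradiction (trans (sym (cong (_% 3) a)) (trans residues (cong (_% 3) b))) λ ()
        cases (mid _ _ a) (low l _)   = <⇒≱ k<y (<⇒≤ l)
        cases (mid _ _ a) (mid _ _ b) = shifted (trans a (sym b))
        cases (mid _ _ a) (top _ b)   = contradiction (trans (sym (cong (_% 3) a)) (trans residues (cong (_% 3) b))) λ ()
        cases (top a _)   _           = <⇒≱ x<y (≤-trans y≤Y (≤-reflexive (sym a)))

-- Geometric sums over triangles and trapezoids

module TriangularSums where
  open RingSolve
  open Paths using (module Ranges)
  open import Data.Nat using (_<_; _≤_; s≤s; _∸_)

  module Triangles (R : CommutativeRing 0ℓ 0ℓ) where
    open CommutativeRing R hiding (zero) renaming (Carrier to A)
    open Solver R
    open Ranges R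
    open import Relation.Binary.Reasoning.Setoid setoid

    pair : A → A → ℕ → A
    pair v w n = Σ< n λ c → v ^ c * w ^ (n ∸ suc c)

    -- The complete homogeneous polynomial of degree n - 1 in u, v, w, with value 0 for n = 0.
    tri : A → A → A → ℕ → A
    tri u v w n = Σ< n λ x → Σ< (n ∸ x) λ c → u ^ x * (v ^ c * w ^ (n ∸ suc x ∸ c))

    pair-suc : ∀ v w n → pair v w (suc n) ≈ w ^ n + v * pair v w n
    pair-suc v w n = +-cong (*-identityˡ _) (trans (Σ<-cong n λ c _ → *-assoc v (v ^ c) (w ^ (n ∸ suc c))) (Σ<-*ˡ n v _))

    pair-closed : ∀ v w n → (v - w) * pair v w n ≈ v ^ n - w ^ n
    pair-closed v w zero    = solve 2 (λ v w → (v :- w) :* :0 := :1 :- :1) ≡.refl v w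
    pair-closed v w (suc n) = begin
      (v - w) * pair v w (suc n)             ≈⟨ *-congˡ (pair-suc v w n) ⟩
      (v - w) * (w ^ n + v * pair v w n)     ≈⟨ solve 4 (λ v w W p → (v :- w) :* (W :+ v :* p) := (v :- w) :* W :+ v :* ((v :- w) :* p)) ≡.refl v w (w ^ n) _ ⟩
      (v - w) * w ^ n + v * ((v - w) * pair v w n) ≈⟨ +-congˡ (*-congˡ (pair-closed v w n)) ⟩
      (v - w) * w ^ n + v * (v ^ n - w ^ n)  ≈⟨ solve 4 (λ v w V W → (v :- w) :* W :+ v :* (V :- W) := v :* V :- w :* W) ≡.refl v w (v ^ n) (w ^ n) ⟩
      v ^ suc n - w ^ suc n ∎

    tri-suc : ∀ u v w n → tri u v w (suc n) ≈ pair v w (suc n) + u * tri u v w n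
    tri-suc u v w n = +-cong (Σ<-cong (suc n) {λ c → u ^ 0 * (v ^ c * w ^ (n ∸ c))} {λ c → v ^ c * w ^ (n ∸ c)} λ c _ → *-identityˡ _)
      (trans (Σ<-cong n λ x _ → trans (Σ<-cong (n ∸ x) λ c _ → *-assoc u (u ^ x) (v ^ c * w ^ (n ∸ suc x ∸ c))) (Σ<-*ˡ (n ∸ x) u _)) (Σ<-*ˡ n u _))

    vandermonde : A → A → A → A
    vandermonde u v w = (u - v) * ((u - w) * (v - w))

    -- The bialternant formula with exponents n + 1, 1, 0. Peeling off the row x = 0 leaves a
    -- complete homogeneous polynomial in v and w, whose closed form is `pair-closed`.
    tri-closed : ∀ u v w n → vandermonde u v w * tri u v w n ≈ u ^ suc n * (v - w) - v ^ suc n * (u - w) + w ^ suc n * (u - v)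
    tri-closed u v w zero    = solve 3 (λ u v w → ((u :- v) :* ((u :- w) :* (v :- w))) :* :0 := (u :^ 1) :* (v :- w) :- (v :^ 1) :* (u :- w) :+ (w :^ 1) :* (u :- v)) ≡.refl u v w
    tri-closed u v w (suc n) = begin
      vandermonde u v w * tri u v w (suc n)   ≈⟨ *-congˡ (tri-suc u v w n) ⟩
      vandermonde u v w * (pair v w (suc n) + u * tri u v w n)
        ≈⟨ solve 5 (λ u v w p r → ((u :- v) :* ((u :- w) :* (v :- w))) :* (p :+ u :* r) := (u :- v) :* ((u :- w) :* ((v :- w) :* p)) :+ u :* (((u :- v) :* ((u :- w) :* (v :- w))) :* r)) ≡.refl u v w _ _ ⟩
      (u - v) * ((u - w) * ((v - w) * pair v w (suc n))) + u * (vandermonde u v w * tri u v w n)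
        ≈⟨ +-cong (*-congˡ (*-congˡ (pair-closed v w (suc n)))) (*-congˡ (tri-closed u v w n)) ⟩
      (u - v) * ((u - w) * (v ^ suc n - w ^ suc n)) + u * (u ^ suc n * (v - w) - v ^ suc n * (u - w) + w ^ suc n * (u - v))
        ≈⟨ solve 6 (λ u v w U V W → (u :- v) :* ((u :- w) :* (V :- W)) :+ u :* (U :* (v :- w) :- V :* (u :- w) :+ W :* (u :- v))
             := (u :* U) :* (v :- w) :- (v :* V) :* (u :- w) :+ (w :* W) :* (u :- v)) ≡.refl u v w (u ^ suc n) (v ^ suc n) (w ^ suc n) ⟩
      _ ∎

    -- Exchanges summation along antidiagonals with summation along rows; induction adds the longest
    -- antidiagonal.
    Σ<-triangle : ∀ n (f : ℕ → ℕ → A) → Σ< n (λ x → Σ< (suc x) (λ i → f i (x ∸ i))) ≈ Σ< n (λ i → Σ< (n ∸ i) (f i))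
    Σ<-triangle zero    f = refl
    Σ<-triangle (suc n) f = begin
      Σ< (suc n) (λ x → Σ< (suc x) (λ i → f i (x ∸ i)))
        ≈⟨ Σ<-last n (λ x → Σ< (suc x) (λ i → f i (x ∸ i))) ⟩
      Σ< n (λ x → Σ< (suc x) (λ i → f i (x ∸ i))) + Σ< (suc n) (λ i → f i (n ∸ i))
        ≈⟨ +-congʳ (Σ<-triangle n f) ⟩
      Σ< n (λ i → Σ< (n ∸ i) (f i)) + Σ< (suc n) (λ i → f i (n ∸ i))
        ≈⟨ +-congʳ (trans (Σ<-last n (λ i → Σ< (n ∸ i) (f i))) (trans (+-congˡ (reflexive (≡.cong (λ z → Σ< z (f n)) (ℕP.n∸n≡0 n)))) (+-identityʳ _))) ⟨
      Σ< (suc n) (λ i → Σ< (n ∸ i) (f i)) + Σ< (suc n) (λ i → f i (n ∸ i))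
        ≈⟨ Σ<-add (suc n) (λ i → Σ< (n ∸ i) (f i)) (λ i → f i (n ∸ i)) ⟨
      Σ< (suc n) (λ i → Σ< (n ∸ i) (f i) + f i (n ∸ i))
        ≈⟨ Σ<-cong (suc n) {λ i → Σ< (n ∸ i) (f i) + f i (n ∸ i)} {λ i → Σ< (suc n ∸ i) (f i)} (λ { i (s≤s h) → sym (trans (reflexive (≡.cong (λ z → Σ< z (f i)) (ℕP.+-∸-assoc 1 h))) (Σ<-last (n ∸ i) (f i))) }) ⟩
      Σ< (suc n) (λ i → Σ< (suc n ∸ i) (f i)) ∎

    -- Every row x is cut at c = k - x and at c = k, where pdinv changes shape.
    regions : ∀ k X Y (g : ℕ → ℕ → A) → X ≤ suc k → (∀ x → x < X → k ℕ.+ x ≤ Y) →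
      Σ< X (λ x → Σ< (suc Y ∸ x) (g x)) ≈
        Σ< X (λ x → Σ< (suc (k ∸ x)) (g x)) + (Σ< X (λ x → Σ< x (λ i → g x (suc (k ∸ x) ℕ.+ i)))
          + Σ< X (λ x → Σ< (Y ∸ k ∸ x) (λ j → g x (suc k ℕ.+ j))))
    regions k X Y g X≤ Y≥ = trans (Σ<-cong X row)
      (trans (Σ<-add X (λ x → Σ< (suc (k ∸ x)) (g x)) (λ x → Σ< x (λ i → g x (suc (k ∸ x) ℕ.+ i)) + Σ< (Y ∸ k ∸ x) (λ j → g x (suc k ℕ.+ j))))
        (+-congˡ (Σ<-add X (λ x → Σ< x (λ i → g x (suc (k ∸ x) ℕ.+ i))) (λ x → Σ< (Y ∸ k ∸ x) (λ j → g x (suc k ℕ.+ j))))))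
      where
      row : ∀ x → x < X → Σ< (suc Y ∸ x) (g x) ≈
        Σ< (suc (k ∸ x)) (g x) + (Σ< x (λ i → g x (suc (k ∸ x) ℕ.+ i)) + Σ< (Y ∸ k ∸ x) (λ j → g x (suc k ℕ.+ j)))
      row x x<X = trans (reflexive (≡.cong (λ n → Σ< n (g x)) length))
        (trans (Σ<-+ (suc (k ∸ x)) (x ℕ.+ (Y ∸ k ∸ x)) (g x))
          (+-congˡ (trans (Σ<-+ x (Y ∸ k ∸ x) (λ i → g x (suc (k ∸ x) ℕ.+ i)))
            (+-congˡ (Σ<-cong (Y ∸ k ∸ x) λ j _ → reflexive (≡.cong (g x) (≡.trans (≡.cong suc (≡.sym (ℕP.+-assoc (k ∸ x) x j))) (≡.cong (λ z → suc (z ℕ.+ j)) k-x+x))))))))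
        where
        x≤k : x ≤ k
        x≤k = ℕP.≤-pred (ℕP.≤-trans x<X X≤)
        k-x+x : (k ∸ x) ℕ.+ x ≡ k
        k-x+x = ℕP.m∸n+n≡m x≤k
        length : suc Y ∸ x ≡ suc (k ∸ x) ℕ.+ (x ℕ.+ (Y ∸ k ∸ x))
        length = ≡.trans (ℕP.+-∸-assoc 1 (ℕP.≤-trans x≤k (ℕP.≤-trans (ℕP.m≤m+n k x) (Y≥ x x<X)))) (≡.cong suc (≡.sym
          (≡.trans (≡.cong ((k ∸ x) ℕ.+_) (ℕP.m+[n∸m]≡n (ℕP.m+n≤o⇒m≤o∸n x (≡.subst (_≤ Y) (ℕP.+-comm k x) (Y≥ x x<X)))))
            (≡.trans (≡.sym (ℕP.+-∸-comm (Y ∸ k) x≤k)) (≡.cong (_∸ x) (ℕP.m+[n∸m]≡n (ℕP.≤-trans (ℕP.m≤m+n k x) (Y≥ x x<X))))))))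

-- Path weights in the three regions

module WeightSums where
  open RingSolve
  open Paths using (module Ranges; ≤ᵇ-true; ≤ᵇ-false; <∸⇒+<)
  open TriangularSums
  open import Data.Nat using (_<_; _≤_; s≤s; z≤n; _∸_; _⊓_)

  -- q- and t-exponents of the path north, x east, north, c east, north, …
  qExp : ℕ → ℕ → ℕ → ℕ
  qExp k x c = ((x ⊓ (x ℕ.+ c ∸ k)) ℕ.+ (c ∸ (c ∸ suc k))) ℕ.+ x

  tExp : ℕ → ℕ → ℕ → ℕ → ℕ
  tExp k Y x c = (k ∸ x) ℕ.+ (Y ∸ (x ℕ.+ c))

  module _ where
    open ≡
    open import Data.Nat using (_+_)

    -- The truncated subtractions disappear once k is written as a sum adapted to the region. Here x
    -- + c ≤ k, and `e` is the slack.
    qExp-I : ∀ x c e → qExp (x + (c + e)) x c ≡ c + x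
    qExp-I x c e = cong (_+ x) (cong₂ _+_
      (trans (cong (x ⊓_) (ℕP.m≤n⇒m∸n≡0 (ℕP.+-monoʳ-≤ x (ℕP.m≤m+n c e)))) (ℕP.⊓-zeroʳ x))
      (cong (c ∸_) (ℕP.m≤n⇒m∸n≡0 (ℕP.m≤n⇒m≤1+n (ℕP.≤-trans (ℕP.m≤m+n c e) (ℕP.m≤n+m (c + e) x))))))

    -- Throughout, Y = 2k + δ with δ = 1 for m = 3k + 2 and δ = 0 otherwise.
    tExp-I : ∀ x c e δ → tExp (x + (c + e)) ((x + (c + e)) + (x + (c + e)) + δ) x c ≡ x + (c + c) + (e + e + e) + δ
    tExp-I x c e δ = trans (cong₂ _+_ (ℕP.m+n∸m≡n x (c + e))
      (trans (cong (_∸ (x + c)) (lem x c e δ)) (ℕP.m+n∸m≡n (x + c) (x + (c + e) + e + δ)))) (lem′ x c e δ)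
      where
      lem : ∀ x c e δ → (x + (c + e)) + (x + (c + e)) + δ ≡ (x + c) + (x + (c + e) + e + δ)
      lem = solve-∀
      lem′ : ∀ x c e δ → (c + e) + (x + (c + e) + e + δ) ≡ x + (c + c) + (e + e + e) + δ
      lem′ = solve-∀

    -- The region k - x < c ≤ k, with `a` = k - x, `i` the distance of c from the left end of the
    -- region, and `b` its distance from the right end.
    qExp-II : ∀ i b a → qExp (suc (i + b) + a) (suc (i + b)) (suc a + i) ≡ i + i + i + b + a + 3
    qExp-II i b a = trans (cong₂ (λ z z′ → ((suc (i + b) ⊓ z) + (suc a + i ∸ z′)) + suc (i + b))
        (trans (cong (_∸ (suc (i + b) + a)) (lem i b a)) (ℕP.m+n∸n≡m (suc i) (suc (i + b) + a)))
        (ℕP.m≤n⇒m∸n≡0 (≤lem i b a)))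
      (trans (cong (λ z → z + (suc a + i) + suc (i + b)) (ℕP.m≥n⇒m⊓n≡n (s≤s (ℕP.m≤m+n i b)))) (lem′ i b a))
      where
      lem : ∀ i b a → suc (i + b) + (suc a + i) ≡ suc i + (suc (i + b) + a)
      lem = solve-∀
      lem′ : ∀ i b a → suc i + (suc a + i) + suc (i + b) ≡ i + i + i + b + a + 3
      lem′ = solve-∀
      ≤lem : ∀ i b a → suc a + i ≤ suc (suc (i + b) + a)
      ≤lem i b a = ℕP.≤-trans (ℕP.m≤m+n (suc a + i) (suc b)) (ℕP.≤-reflexive (eq″ i b a))
        where
        eq″ : ∀ i b a → suc a + i + suc b ≡ suc (suc (i + b) + a)
        eq″ = solve-∀

    tExp-II : ∀ i b a δ → tExp (suc (i + b) + a) ((suc (i + b) + a) + (suc (i + b) + a) + δ) (suc (i + b)) (suc a + i) ≡ a + (b + a + δ)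
    tExp-II i b a δ = cong₂ _+_ (ℕP.m+n∸m≡n (suc (i + b)) a)
      (trans (cong (_∸ (suc (i + b) + (suc a + i))) (lem i b a δ)) (ℕP.m+n∸m≡n (suc (i + b) + (suc a + i)) (b + a + δ)))
      where
      lem : ∀ i b a δ → (suc (i + b) + a) + (suc (i + b) + a) + δ ≡ (suc (i + b) + (suc a + i)) + (b + a + δ)
      lem = solve-∀

    qExp-III : ∀ k x j → qExp k x (suc k + j) ≡ x + suc k + x
    qExp-III k x j = cong (_+ x) (cong₂ _+_
      (trans (cong (x ⊓_) (trans (cong (_∸ k) (lem k x j)) (ℕP.m+n∸n≡m (x + suc j) k))) (ℕP.m≤n⇒m⊓n≡m (ℕP.m≤m+n x (suc j))))
      (trans (cong (suc k + j ∸_) (ℕP.m+n∸m≡n (suc k) j)) (ℕP.m+n∸n≡m (suc k) j)))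
      where
      lem : ∀ k x j → x + (suc k + j) ≡ x + suc j + k
      lem = solve-∀

    -- The region c > k. Row x has a + δ cells there, and the hypothesis says that `e` of them
    -- follow the j-th.
    tExp-III : ∀ x a j e δ → a + δ ≡ suc (j + e) → tExp (x + a) ((x + a) + (x + a) + δ) x (suc (x + a) + j) ≡ a + e
    tExp-III x a j e δ h = cong₂ _+_ (ℕP.m+n∸m≡n x a)
      (trans (cong (_∸ (x + (suc (x + a) + j))) (trans (lem x a δ) (trans (cong (λ z → x + (x + a) + z) h) (lem′ x a j e)))) (ℕP.m+n∸m≡n (x + (suc (x + a) + j)) e))
      where
      lem : ∀ x a δ → (x + a) + (x + a) + δ ≡ x + (x + a) + (a + δ)
      lem = solve-∀
      lem′ : ∀ x a j e → x + (x + a) + suc (j + e) ≡ (x + (suc (x + a) + j)) + e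
      lem′ = solve-∀

  module HSums (R : CommutativeRing 0ℓ 0ℓ) (q t qi : CommutativeRing.Carrier R)
    (q*qi : CommutativeRing._≈_ R (CommutativeRing._*_ R q qi) (CommutativeRing.1# R)) where
    open CommutativeRing R hiding (zero) renaming (Carrier to A)
    open Solver R
    open Ranges R
    open Triangles R
    open import Relation.Binary.Reasoning.Setoid setoid
    open import Algebra.Properties.CommutativeSemiring.Exp commutativeSemiring using (^-distrib-*)

    -- The exponents are linear in each region, so every weight is a product of powers of three
    -- monomials up to a fixed factor: the F-triple serves x + c ≤ k, the E-triple the other two
    -- regions.
    uF vF wF uE vE wE : A
    uF = q * t
    vF = q * (t * t)
    wF = t * (t * t)
    uE = q * (q * q)
    vE = q * t
    wE = q * (t * t)

    pow₂ : ∀ a b n → (a * b) ^ n ≈ a ^ n * b ^ n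
    pow₂ a b n = ^-distrib-* a b n

    pow₃ : ∀ a b c n → (a * (b * c)) ^ n ≈ a ^ n * (b ^ n * c ^ n)
    pow₃ a b c n = trans (pow₂ a (b * c) n) (*-congˡ (pow₂ b c n))

    μ : ℕ → ℕ → ℕ → ℕ → A
    μ k Y x c = q ^ qExp k x c * t ^ tExp k Y x c

    -- Excess of the path weight over an edge path, as a multiple of s3 + q s21.
    ε : ℕ → ℕ → ℕ → A
    ε k zero    c       = 0#
    ε k (suc x) zero    = 0#
    ε k (suc x) (suc c) = if suc x ℕ.+ suc c ℕ.≤ᵇ k then qi * qi else qi * (qi * qi)

    μ-I : ∀ δ x c e → μ (x ℕ.+ (c ℕ.+ e)) ((x ℕ.+ (c ℕ.+ e)) ℕ.+ (x ℕ.+ (c ℕ.+ e)) ℕ.+ δ) x c ≈ t ^ δ * (uF ^ x * (vF ^ c * wF ^ e))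
    μ-I δ x c e = begin
      _ ≡⟨ ≡.cong₂ (λ a b → q ^ a * t ^ b) (qExp-I x c e) (tExp-I x c e δ) ⟩
      q ^ (c ℕ.+ x) * t ^ (x ℕ.+ (c ℕ.+ c) ℕ.+ (e ℕ.+ e ℕ.+ e) ℕ.+ δ)
        ≈⟨ *-cong (^-homo-* q c x) (trans (^-homo-* t (x ℕ.+ (c ℕ.+ c) ℕ.+ (e ℕ.+ e ℕ.+ e)) δ) (*-congʳ (trans (^-homo-* t (x ℕ.+ (c ℕ.+ c)) (e ℕ.+ e ℕ.+ e))
             (*-cong (trans (^-homo-* t x (c ℕ.+ c)) (*-congˡ (^-homo-* t c c))) (trans (^-homo-* t (e ℕ.+ e) e) (*-congʳ (^-homo-* t e e))))))) ⟩
      (q ^ c * q ^ x) * (((t ^ x * (t ^ c * t ^ c)) * (t ^ e * t ^ e * t ^ e)) * t ^ δ)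
        ≈⟨ solve 6 (λ qc qx tx tc te td → (qc :* qx) :* (((tx :* (tc :* tc)) :* (te :* te :* te)) :* td)
             := td :* ((qx :* tx) :* ((qc :* (tc :* tc)) :* (te :* (te :* te))))) ≡.refl (q ^ c) (q ^ x) (t ^ x) (t ^ c) (t ^ e) (t ^ δ) ⟩
      t ^ δ * ((q ^ x * t ^ x) * ((q ^ c * (t ^ c * t ^ c)) * (t ^ e * (t ^ e * t ^ e))))
        ≈⟨ *-congˡ (*-cong (pow₂ q t x) (*-cong (pow₃ q t t c) (pow₃ t t t e))) ⟨
      t ^ δ * (uF ^ x * (vF ^ c * wF ^ e)) ∎

    μ-II : ∀ δ i b a → μ (suc (i ℕ.+ b) ℕ.+ a) ((suc (i ℕ.+ b) ℕ.+ a) ℕ.+ (suc (i ℕ.+ b) ℕ.+ a) ℕ.+ δ) (suc (i ℕ.+ b)) (suc a ℕ.+ i)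
                       ≈ q ^ 3 * t ^ δ * (uE ^ i * (vE ^ b * wE ^ a))
    μ-II δ i b a = begin
      _ ≡⟨ ≡.cong₂ (λ a b → q ^ a * t ^ b) (qExp-II i b a) (tExp-II i b a δ) ⟩
      q ^ (i ℕ.+ i ℕ.+ i ℕ.+ b ℕ.+ a ℕ.+ 3) * t ^ (a ℕ.+ (b ℕ.+ a ℕ.+ δ))
        ≈⟨ *-cong (trans (^-homo-* q (i ℕ.+ i ℕ.+ i ℕ.+ b ℕ.+ a) 3) (*-congʳ (trans (^-homo-* q (i ℕ.+ i ℕ.+ i ℕ.+ b) a) (*-congʳ (trans (^-homo-* q (i ℕ.+ i ℕ.+ i) b)
             (*-congʳ (trans (^-homo-* q (i ℕ.+ i) i) (*-congʳ (^-homo-* q i i)))))))))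
             (trans (^-homo-* t a (b ℕ.+ a ℕ.+ δ)) (*-congˡ (trans (^-homo-* t (b ℕ.+ a) δ) (*-congʳ (^-homo-* t b a))))) ⟩
      (q ^ i * q ^ i * q ^ i * q ^ b * q ^ a * q ^ 3) * (t ^ a * (t ^ b * t ^ a * t ^ δ))
        ≈⟨ solve 7 (λ Q qi qb qa ta tb td → (qi :* qi :* qi :* qb :* qa :* Q) :* (ta :* (tb :* ta :* td))
             := Q :* td :* ((qi :* (qi :* qi)) :* ((qb :* tb) :* (qa :* (ta :* ta))))) ≡.refl (q ^ 3) (q ^ i) (q ^ b) (q ^ a) (t ^ a) (t ^ b) (t ^ δ) ⟩
      q ^ 3 * t ^ δ * ((q ^ i * (q ^ i * q ^ i)) * ((q ^ b * t ^ b) * (q ^ a * (t ^ a * t ^ a))))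
        ≈⟨ *-congˡ (*-cong (pow₃ q q q i) (*-cong (pow₂ q t b) (pow₃ q t t a))) ⟨
      _ ∎

    private
      μ-III-exp : ∀ x j e → q ^ (x ℕ.+ (x ℕ.+ x) ℕ.+ (j ℕ.+ e)) * t ^ (j ℕ.+ (e ℕ.+ e)) ≈ uE ^ x * (vE ^ j * wE ^ e)
      μ-III-exp x j e = begin
        _ ≈⟨ *-cong (trans (^-homo-* q (x ℕ.+ (x ℕ.+ x)) (j ℕ.+ e)) (*-cong (trans (^-homo-* q x (x ℕ.+ x)) (*-congˡ (^-homo-* q x x))) (^-homo-* q j e)))
                    (trans (^-homo-* t j (e ℕ.+ e)) (*-congˡ (^-homo-* t e e))) ⟩
        (q ^ x * (q ^ x * q ^ x)) * (q ^ j * q ^ e) * (t ^ j * (t ^ e * t ^ e))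
          ≈⟨ solve 5 (λ qx qj qe tj te → (qx :* (qx :* qx)) :* (qj :* qe) :* (tj :* (te :* te)) := (qx :* (qx :* qx)) :* ((qj :* tj) :* (qe :* (te :* te)))) ≡.refl (q ^ x) (q ^ j) (q ^ e) (t ^ j) (t ^ e) ⟩
        _ ≈⟨ *-cong (pow₃ q q q x) (*-cong (pow₂ q t j) (pow₃ q t t e)) ⟨
        _ ∎

    μ-III₀ : ∀ x j e → let k = x ℕ.+ suc (j ℕ.+ e) in μ k (k ℕ.+ k ℕ.+ 0) x (suc k ℕ.+ j) ≈ q ^ 2 * t * (uE ^ x * (vE ^ j * wE ^ e))
    μ-III₀ x j e = begin
      _ ≡⟨ ≡.cong₂ (λ a b → q ^ a * t ^ b) (≡.trans (qExp-III (x ℕ.+ suc (j ℕ.+ e)) x j) (lem x j e)) (≡.trans (tExp-III x (suc (j ℕ.+ e)) j e 0 (ℕP.+-identityʳ _)) (lem′ j e)) ⟩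
      q ^ (2 ℕ.+ (x ℕ.+ (x ℕ.+ x) ℕ.+ (j ℕ.+ e))) * t ^ (1 ℕ.+ (j ℕ.+ (e ℕ.+ e)))
        ≈⟨ solve 4 (λ q t a b → (q :* (q :* a)) :* (t :* b) := (q :^ 2) :* t :* (a :* b)) ≡.refl q t _ _ ⟩
      _ ≈⟨ *-congˡ (μ-III-exp x j e) ⟩
      _ ∎
      where
      lem : ∀ x j e → x ℕ.+ suc (x ℕ.+ suc (j ℕ.+ e)) ℕ.+ x ≡ 2 ℕ.+ (x ℕ.+ (x ℕ.+ x) ℕ.+ (j ℕ.+ e))
      lem = solve-∀
      lem′ : ∀ j e → suc (j ℕ.+ e) ℕ.+ e ≡ 1 ℕ.+ (j ℕ.+ (e ℕ.+ e))
      lem′ = solve-∀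

    μ-III₁ : ∀ x j e → let k = x ℕ.+ (j ℕ.+ e) in μ k (k ℕ.+ k ℕ.+ 1) x (suc k ℕ.+ j) ≈ q * (uE ^ x * (vE ^ j * wE ^ e))
    μ-III₁ x j e = begin
      _ ≡⟨ ≡.cong₂ (λ a b → q ^ a * t ^ b) (≡.trans (qExp-III (x ℕ.+ (j ℕ.+ e)) x j) (lem x j e)) (≡.trans (tExp-III x (j ℕ.+ e) j e 1 (ℕP.+-comm (j ℕ.+ e) 1)) (ℕP.+-assoc j e e)) ⟩
      q ^ (1 ℕ.+ (x ℕ.+ (x ℕ.+ x) ℕ.+ (j ℕ.+ e))) * t ^ (j ℕ.+ (e ℕ.+ e))
        ≈⟨ *-assoc q _ _ ⟩
      _ ≈⟨ *-congˡ (μ-III-exp x j e) ⟩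
      _ ∎
      where
      lem : ∀ x j e → x ℕ.+ suc (x ℕ.+ (j ℕ.+ e)) ℕ.+ x ≡ 1 ℕ.+ (x ℕ.+ (x ℕ.+ x) ℕ.+ (j ℕ.+ e))
      lem = solve-∀

    εC : A
    εC = qi * (qi * qi)

    triF triE : ℕ → A
    triF = tri uF vF wF
    triE = tri uE vE wE

    cellF cellE : ℕ → ℕ → ℕ → A
    cellF n x c = uF ^ x * (vF ^ c * wF ^ (n ∸ suc x ∸ c))
    cellE n x c = uE ^ x * (vE ^ c * wE ^ (n ∸ suc x ∸ c))

    private
      split-k : ∀ {k x c} → c ≤ k ∸ x → x ≤ k → k ≡ x ℕ.+ (c ℕ.+ (k ∸ x ∸ c))
      split-k {k} {x} {c} h x≤k = ≡.sym (≡.trans (≡.cong (x ℕ.+_) (ℕP.m+[n∸m]≡n h)) (ℕP.m+[n∸m]≡n x≤k))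

      μ-I-at : ∀ δ k x c e → k ≡ x ℕ.+ (c ℕ.+ e) → μ k (k ℕ.+ k ℕ.+ δ) x c ≈ t ^ δ * (uF ^ x * (vF ^ c * wF ^ e))
      μ-I-at δ _ x c e ≡.refl = μ-I δ x c e

      μ-II-at : ∀ δ k i b a → k ≡ suc (i ℕ.+ b) ℕ.+ a → μ k (k ℕ.+ k ℕ.+ δ) (suc (i ℕ.+ b)) (suc a ℕ.+ i) ≈ q ^ 3 * t ^ δ * (uE ^ i * (vE ^ b * wE ^ a))
      μ-II-at δ _ i b a ≡.refl = μ-II δ i b a

      εC-false : ∀ k x c → k < suc x ℕ.+ suc c → ε k (suc x) (suc c) ≈ εC
      εC-false k x c h rewrite ≤ᵇ-false {suc x ℕ.+ suc c} {k} h = refl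

      ε-true : ∀ k x c → suc x ℕ.+ suc c ≤ k → ε k (suc x) (suc c) ≈ qi * qi
      ε-true k x c h rewrite ≤ᵇ-true h = refl

      cancel³ : ∀ a → q ^ 3 * a * εC ≈ a
      cancel³ a = trans (solve 3 (λ q p a → (q :^ 3) :* a :* (p :* (p :* p)) := (q :* p) :* ((q :* p) :* ((q :* p) :* a))) ≡.refl q qi a)
        (trans (*-congʳ q*qi) (trans (*-identityˡ _) (trans (*-congʳ q*qi) (trans (*-identityˡ _) (trans (*-congʳ q*qi) (*-identityˡ _))))))

    module _ (k δ : ℕ) where
      private
        Y : ℕ
        Y = k ℕ.+ k ℕ.+ δ
        g gε : ℕ → ℕ → A
        g = μ k Y
        gε x c = μ k Y x c * ε k x c

      cell-I : ∀ x c → x ≤ k → c < suc (k ∸ x) → g x c ≈ t ^ δ * cellF (suc k) x c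
      cell-I x c x≤k (s≤s h) = μ-I-at δ k x c (k ∸ x ∸ c) (split-k h x≤k)

      row-I : ∀ x → x ≤ k → Σ< (suc (k ∸ x)) (g x) ≈ t ^ δ * Σ< (suc k ∸ x) (cellF (suc k) x)
      row-I x x≤k = trans (Σ<-cong (suc (k ∸ x)) (λ c → cell-I x c x≤k))
        (trans (Σ<-*ˡ (suc (k ∸ x)) (t ^ δ) (cellF (suc k) x)) (*-congˡ (reflexive (≡.cong (λ n → Σ< n (cellF (suc k) x)) (≡.sym (ℕP.+-∸-assoc 1 x≤k))))))

      sum-I : Σ< (suc k) (λ x → Σ< (suc (k ∸ x)) (g x)) ≈ t ^ δ * triF (suc k)
      sum-I = trans (Σ<-cong (suc k) (λ x h → row-I x (ℕP.≤-pred h))) (Σ<-*ˡ (suc k) (t ^ δ) (λ x → Σ< (suc k ∸ x) (cellF (suc k) x)))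

      -- The omitted row x = k has the single cell c = 0 in this region, of weight t^δ (qt)^k.
      sum-I-short : Σ< k (λ x → Σ< (suc (k ∸ x)) (g x)) ≈ t ^ δ * (triF (suc k) - uF ^ k)
      sum-I-short = begin
        Σ< k rows                                   ≈⟨ solve 2 (λ a b → a := (a :+ b) :- b) ≡.refl (Σ< k rows) (rows k) ⟩
        (Σ< k rows + rows k) - rows k               ≈⟨ +-cong (sym (Σ<-last k rows)) (-‿cong last) ⟩
        Σ< (suc k) rows - t ^ δ * uF ^ k            ≈⟨ +-congʳ sum-I ⟩
        t ^ δ * triF (suc k) - t ^ δ * uF ^ k       ≈⟨ solve 3 (λ a b c → a :* b :- a :* c := a :* (b :- c)) ≡.refl (t ^ δ) _ _ ⟩
        t ^ δ * (triF (suc k) - uF ^ k)             ∎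
        where
        rows : ℕ → A
        rows x = Σ< (suc (k ∸ x)) (g x)
        last : rows k ≈ t ^ δ * uF ^ k
        last = begin
          rows k                    ≡⟨ ≡.cong (λ n → Σ< (suc n) (g k)) (ℕP.n∸n≡0 k) ⟩
          g k 0 + 0#                ≈⟨ +-identityʳ _ ⟩
          g k 0                     ≈⟨ μ-I-at δ k k 0 0 (≡.sym (ℕP.+-identityʳ k)) ⟩
          t ^ δ * (uF ^ k * (1# * 1#)) ≈⟨ solve 2 (λ a b → a :* (b :* (:1 :* :1)) := a :* b) ≡.refl (t ^ δ) (uF ^ k) ⟩
          t ^ δ * uF ^ k            ∎

      -- `ε` vanishes for x = 0 and for c = 0, so the triangle begins at (1 , 1) and its size drops
      -- from k + 1 to k - 1. The factor t^3 is `uF * vF` divided by q^2. Row k has only the cell c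
      -- = 0, so X may be k or k + 1.
      sum-εI : ∀ X → k ≤ X → X ≤ suc k → Σ< X (λ x → Σ< (suc (k ∸ x)) (gε x)) ≈ t ^ 3 * t ^ δ * triF (k ∸ 1)
      sum-εI zero    z≤n _  = sym (zeroʳ _)
      sum-εI (suc X) k≤X (s≤s X≤k) = trans (+-cong (Σ<-zero (suc k) {gε 0} λ c → zeroʳ _) (rest k ≡.refl X k≤X X≤k)) (+-identityˡ _)
        where
        rest : ∀ k′ → k′ ≡ k → ∀ X → k′ ≤ suc X → X ≤ k′ → Σ< X (λ x → Σ< (suc (k ∸ suc x)) (gε (suc x))) ≈ t ^ 3 * t ^ δ * triF (k′ ∸ 1)
        rest zero    _ zero _ _ = sym (zeroʳ _)
        rest (suc n) e X k≤ X≤ = trans (Σ<-cong X row) (trans (Σ<-*ˡ X (t ^ 3 * t ^ δ) rowsF)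
          (*-congˡ (Σ<-restrict rowsF (ℕP.≤-pred k≤) λ x h → reflexive (≡.cong (λ z → Σ< z (cellF n x)) (ℕP.m≤n⇒m∸n≡0 h)))))
          where
          rowsF : ℕ → A
          rowsF x = Σ< (n ∸ x) (cellF n x)
          row : ∀ x → x < X → Σ< (suc (k ∸ suc x)) (gε (suc x)) ≈ t ^ 3 * t ^ δ * rowsF x
          row x x<X = trans (+-congʳ (zeroʳ _)) (trans (+-identityˡ _)
            (trans (reflexive (≡.cong (λ z → Σ< (z ∸ suc x) (λ c → gε (suc x) (suc c))) (≡.sym e)))
              (trans (Σ<-cong (n ∸ x) cell) (Σ<-*ˡ (n ∸ x) (t ^ 3 * t ^ δ) (cellF n x)))))
            where
            cell : ∀ c → c < n ∸ x → gε (suc x) (suc c) ≈ t ^ 3 * t ^ δ * cellF n x c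
            cell c h = trans (*-cong (trans (cell-I (suc x) (suc c) sx≤k c<) (*-congˡ (*-congˡ (*-congˡ (reflexive (≡.cong (wF ^_) expo)))))) (ε-true k x c fits))
              (trans (solve 7 (λ td q t p a b d → td :* ((q :* t :* a) :* ((q :* (t :* t) :* b) :* d)) :* (p :* p) := (q :* p) :* ((q :* p) :* ((t :^ 3) :* td :* (a :* (b :* d)))))
                         ≡.refl (t ^ δ) q t qi (uF ^ x) (vF ^ c) _)
                (trans (*-congʳ q*qi) (trans (*-identityˡ _) (trans (*-congʳ q*qi) (*-identityˡ _)))))
              where
              x+c<n : x ℕ.+ c < n
              x+c<n = <∸⇒+< n x h
              sx≤k : suc x ≤ k
              sx≤k = ≡.subst (suc x ≤_) e (s≤s (ℕP.≤-trans (ℕP.m≤m+n x c) (ℕP.<⇒≤ x+c<n)))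
              fits : suc x ℕ.+ suc c ≤ k
              fits = ≡.subst (suc x ℕ.+ suc c ≤_) e (s≤s (≡.subst (_≤ n) (≡.sym (ℕP.+-suc x c)) x+c<n))
              c< : suc c < suc (k ∸ suc x)
              c< = s≤s (≡.subst (λ z → suc c ≤ z ∸ suc x) e h)
              expo : k ∸ suc x ∸ suc c ≡ n ∸ suc x ∸ c
              expo = ≡.trans (≡.cong (λ z → z ∸ suc x ∸ suc c) (≡.sym e)) (≡.trans (ℕP.∸-+-assoc n x (suc c)) (≡.trans (≡.cong (n ∸_) (ℕP.+-suc x c)) (≡.sym (ℕP.∸-+-assoc n (suc x) c))))

      private
        cell-II : ∀ n r → k ≡ n ℕ.+ r → ∀ x → x < n → ∀ i → i < suc x →
                  g (suc x) (suc (k ∸ suc x) ℕ.+ i) ≈ q ^ 3 * (t ^ δ * wE ^ r) * cellE n i (x ∸ i)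
        cell-II n r e x x<n i (s≤s i≤x) = begin
          g (suc x) (suc (k ∸ suc x) ℕ.+ i)
            ≡⟨ ≡.cong₂ (λ y a → g (suc y) (suc a ℕ.+ i)) (≡.sym i+b) a≡ ⟩
          g (suc (i ℕ.+ (x ∸ i))) (suc ((n ∸ suc x) ℕ.+ r) ℕ.+ i)
            ≈⟨ μ-II-at δ k i (x ∸ i) ((n ∸ suc x) ℕ.+ r) k≡ ⟩
          q ^ 3 * t ^ δ * (uE ^ i * (vE ^ (x ∸ i) * wE ^ ((n ∸ suc x) ℕ.+ r)))
            ≈⟨ *-congˡ (*-congˡ (*-congˡ (^-homo-* wE (n ∸ suc x) r))) ⟩
          q ^ 3 * t ^ δ * (uE ^ i * (vE ^ (x ∸ i) * (wE ^ (n ∸ suc x) * wE ^ r)))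
            ≈⟨ solve 6 (λ Q td a b d f → Q :* td :* (a :* (b :* (d :* f))) := Q :* (td :* f) :* (a :* (b :* d))) ≡.refl (q ^ 3) (t ^ δ) (uE ^ i) (vE ^ (x ∸ i)) (wE ^ (n ∸ suc x)) (wE ^ r) ⟩
          q ^ 3 * (t ^ δ * wE ^ r) * (uE ^ i * (vE ^ (x ∸ i) * wE ^ (n ∸ suc x)))
            ≡⟨ ≡.cong (λ z → q ^ 3 * (t ^ δ * wE ^ r) * (uE ^ i * (vE ^ (x ∸ i) * wE ^ z))) (≡.sym (≡.trans (ℕP.∸-+-assoc n (suc i) (x ∸ i)) (≡.cong (λ z → n ∸ suc z) i+b))) ⟩
          q ^ 3 * (t ^ δ * wE ^ r) * cellE n i (x ∸ i) ∎
          where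
          i+b : i ℕ.+ (x ∸ i) ≡ x
          i+b = ℕP.m+[n∸m]≡n i≤x
          a≡ : k ∸ suc x ≡ (n ∸ suc x) ℕ.+ r
          a≡ = ≡.trans (≡.cong (_∸ suc x) e) (ℕP.+-∸-comm r x<n)
          k≡ : k ≡ suc (i ℕ.+ (x ∸ i)) ℕ.+ ((n ∸ suc x) ℕ.+ r)
          k≡ = ≡.trans e (≡.trans (≡.cong (ℕ._+ r) (≡.sym (≡.trans (≡.cong (λ z → suc z ℕ.+ (n ∸ suc x)) i+b) (ℕP.m+[n∸m]≡n x<n)))) (ℕP.+-assoc _ (n ∸ suc x) r))

        triangle-II : ∀ n a → Σ< n (λ x → Σ< (suc x) (λ i → a * cellE n i (x ∸ i))) ≈ a * triE n
        triangle-II n a = trans (Σ<-cong n λ x _ → Σ<-*ˡ (suc x) a (λ i → cellE n i (x ∸ i))) (trans (Σ<-*ˡ n a _) (*-congˡ (Σ<-triangle n (cellE n))))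

      -- Row x contributes x cells, which `Σ<-triangle` rearranges into a triangle. The case r = 0
      -- includes the row x = k, the case r = 1 leaves it out.
      sum-II : ∀ n r → k ≡ n ℕ.+ r → Σ< (suc n) (λ x → Σ< x (λ i → g x (suc (k ∸ x) ℕ.+ i))) ≈ q ^ 3 * (t ^ δ * wE ^ r) * triE n
      sum-II n r e = trans (+-identityˡ _) (trans (Σ<-cong n λ x x<n → Σ<-cong (suc x) (cell-II n r e x x<n)) (triangle-II n _))

      sum-εII : ∀ n r → k ≡ n ℕ.+ r → Σ< (suc n) (λ x → Σ< x (λ i → gε x (suc (k ∸ x) ℕ.+ i))) ≈ t ^ δ * wE ^ r * triE n
      sum-εII n r e = trans (+-identityˡ _) (trans (Σ<-cong n λ x x<n → Σ<-cong (suc x) λ i i≤x → trans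
          (*-cong (cell-II n r e x x<n i i≤x) (εC-false k x ((k ∸ suc x) ℕ.+ i) (beyond x i x<n)))
          (trans (solve 4 (λ Q a c f → Q :* a :* c :* f := Q :* (a :* c) :* f) ≡.refl (q ^ 3) (t ^ δ * wE ^ r) (cellE n i (x ∸ i)) εC) (cancel³ _))) (triangle-II n _))
        where
        beyond : ∀ x i → x < n → k < suc x ℕ.+ suc ((k ∸ suc x) ℕ.+ i)
        beyond x i h = ℕP.≤-trans (s≤s (ℕP.≤-trans (ℕP.≤-reflexive (≡.sym (ℕP.m+[n∸m]≡n (ℕP.≤-trans h (ℕP.≤-trans (ℕP.m≤m+n n r) (ℕP.≤-reflexive (≡.sym e)))))))
          (ℕP.+-monoʳ-≤ (suc x) (ℕP.m≤m+n (k ∸ suc x) i)))) (ℕP.≤-reflexive (≡.sym (ℕP.+-suc (suc x) ((k ∸ suc x) ℕ.+ i))))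

      module _ (n : ℕ) (κ : A) (cell-III : ∀ x j → x ℕ.+ j < n → g x (suc k ℕ.+ j) ≈ κ * cellE n x j) where

        sum-III : ∀ X → n ≤ X → Σ< X (λ x → Σ< (n ∸ x) (λ j → g x (suc k ℕ.+ j))) ≈ κ * triE n
        sum-III X n≤X = trans (Σ<-cong X λ x _ → trans (Σ<-cong (n ∸ x) λ j h → cell-III x j (<∸⇒+< n x h)) (Σ<-*ˡ (n ∸ x) κ (cellE n x)))
          (trans (Σ<-*ˡ X κ (λ x → Σ< (n ∸ x) (cellE n x))) (*-congˡ (Σ<-restrict _ n≤X λ x h → reflexive (≡.cong (λ z → Σ< z (cellE n x)) (ℕP.m≤n⇒m∸n≡0 h)))))

      -- As c > k, only the row x = 0 drops out. Shifting x by one costs `uE` = q^3, which cancels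
      -- the factor q^(-3) of `ε`.
      sum-εIII : ∀ n κ → (∀ x j → x ℕ.+ j < n → g x (suc k ℕ.+ j) ≈ κ * cellE n x j) → ∀ X → n ≤ suc X →
        Σ< (suc X) (λ x → Σ< (n ∸ x) (λ j → gε x (suc k ℕ.+ j))) ≈ κ * triE (n ∸ 1)
      sum-εIII zero κ cell X _ = trans (Σ<-zero (suc X) λ x → reflexive (≡.cong (λ z → Σ< z (λ j → gε x (suc k ℕ.+ j))) (ℕP.0∸n≡0 x))) (sym (zeroʳ κ))
      sum-εIII (suc n) κ cell X (s≤s n≤X) = trans (+-cong (Σ<-zero (suc n) {λ j → gε 0 (suc k ℕ.+ j)} λ j → zeroʳ (g 0 (suc k ℕ.+ j))) (Σ<-cong X row)) (trans (+-identityˡ _)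
          (trans (Σ<-*ˡ X κ (λ x → Σ< (n ∸ x) (cellE n x))) (*-congˡ (Σ<-restrict _ n≤X λ x h → reflexive (≡.cong (λ z → Σ< z (cellE n x)) (ℕP.m≤n⇒m∸n≡0 h))))))
        where
        row : ∀ x → x < X → Σ< (n ∸ x) (λ j → gε (suc x) (suc k ℕ.+ j)) ≈ κ * Σ< (n ∸ x) (cellE n x)
        row x _ = trans (Σ<-cong (n ∸ x) λ j h → trans (*-cong (cell (suc x) j (s≤s (<∸⇒+< n x h))) (εC-false k x (k ℕ.+ j) (beyond x j)))
            (trans (solve 5 (λ κ Q a d f → κ :* (Q :* (Q :* Q) :* a :* d) :* f := (Q :^ 3) :* (κ :* (a :* d)) :* f) ≡.refl κ q (uE ^ x) _ εC)
              (cancel³ _))) (Σ<-*ˡ (n ∸ x) κ (cellE n x))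
          where
          beyond : ∀ x j → k < suc x ℕ.+ suc (k ℕ.+ j)
          beyond x j = ℕP.≤-trans (s≤s (ℕP.m≤m+n k j)) (ℕP.m≤n+m (suc (k ℕ.+ j)) (suc x))

-- Ladder sums and their closed forms

module Ladders where
  open RingSolve
  open Paths using (module Ranges)
  open TriangularSums
  open WeightSums
  open import Data.Nat using (_∸_)

  module HVariants (R : CommutativeRing 0ℓ 0ℓ) (q t qi : CommutativeRing.Carrier R)
    (q*qi : CommutativeRing._≈_ R (CommutativeRing._*_ R q qi) (CommutativeRing.1# R)) where
    open CommutativeRing R hiding (zero) renaming (Carrier to A)
    open Solver R
    open Ranges R
    open Triangles R
    open HSums R q t qi q*qi
    open import Relation.Binary.Reasoning.Setoid setoid

    -- [n]_{q,t}
    br : ℕ → A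
    br zero    = 0#
    br (suc n) = q * br n + t ^ n

    br-closed : ∀ n → (q - t) * br n ≈ q ^ n - t ^ n
    br-closed zero    = solve 2 (λ q t → (q :- t) :* :0 := :1 :- :1) ≡.refl q t
    br-closed (suc n) = trans (solve 4 (λ q t b T → (q :- t) :* (q :* b :+ T) := q :* ((q :- t) :* b) :+ (q :- t) :* T) ≡.refl q t (br n) (t ^ n))
      (trans (+-congʳ (*-congˡ (br-closed n))) (solve 4 (λ q t Q T → q :* (Q :- T) :+ (q :- t) :* T := q :* Q :- t :* T) ≡.refl q t (q ^ n) (t ^ n)))

    -- Σ_{i<k} (qt)^{k-1-i} [3i+s]
    ladder : ℕ → ℕ → A
    ladder s zero    = 0#
    ladder s (suc k) = q * t * ladder s k + br (3 ℕ.* k ℕ.+ s)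

    Δ : A
    Δ = (q - t) * ((q ^ 2 - t) * (q - t ^ 2))

    private
      cube : ∀ a k s → a ^ (3 ℕ.* k ℕ.+ s) ≈ (a ^ k * (a ^ k * a ^ k)) * a ^ s
      cube a k s = trans (reflexive (≡.cong (a ^_) (lem k s))) (trans (^-homo-* a (k ℕ.+ (k ℕ.+ k)) s) (*-congʳ (trans (^-homo-* a k (k ℕ.+ k)) (*-congˡ (^-homo-* a k k)))))
        where
        lem : ∀ k s → 3 ℕ.* k ℕ.+ s ≡ k ℕ.+ (k ℕ.+ k) ℕ.+ s
        lem = solve-∀

      ladder-step : ∀ s k {G} → Δ * ladder s k ≈ G →
        Δ * ladder s (suc k) ≈ q * t * G + (q ^ 2 - t) * (q - t ^ 2) * (q ^ k * (q ^ k * q ^ k) * q ^ s - t ^ k * (t ^ k * t ^ k) * t ^ s)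
      ladder-step s k {G} e = begin
        Δ * (q * t * ladder s k + br (3 ℕ.* k ℕ.+ s))
          ≈⟨ solve 6 (λ a b c m l r → (a :* (b :* c)) :* (m :* l :+ r) := m :* ((a :* (b :* c)) :* l) :+ b :* c :* (a :* r)) ≡.refl (q - t) (q ^ 2 - t) (q - t ^ 2) (q * t) _ _ ⟩
        q * t * (Δ * ladder s k) + (q ^ 2 - t) * (q - t ^ 2) * ((q - t) * br (3 ℕ.* k ℕ.+ s))
          ≈⟨ +-cong (*-congˡ e) (*-congˡ (trans (br-closed (3 ℕ.* k ℕ.+ s)) (+-cong (cube q k s) (-‿cong (cube t k s))))) ⟩
        _ ∎

    G₁ G₂ G₃ : A → A → A
    G₁ Q T = (q - t ^ 2) * (Q * Q * Q) + (q ^ 2 - t) * (T * T * T) - Q * T * (q - t) * (1# + q + t)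
    G₂ Q T = (q - t ^ 2) * (q * (Q * Q * Q)) + (q ^ 2 - t) * (t * (T * T * T)) - Q * T * (q - t) * (q + t + q * t)
    G₃ Q T = (q - t ^ 2) * (q ^ 2 * (Q * Q * Q)) + (q ^ 2 - t) * (t ^ 2 * (T * T * T)) - Q * T * (q - t) * (q ^ 2 + q * t + t ^ 2)

    module _ where
      eG₁ eG₂ eG₃ : ∀ {n} → Expr n → Expr n → Expr n → Expr n → Expr n
      eG₁ q t Q T = (q :- t :^ 2) :* (Q :* Q :* Q) :+ (q :^ 2 :- t) :* (T :* T :* T) :- Q :* T :* (q :- t) :* (:1 :+ q :+ t)
      eG₂ q t Q T = (q :- t :^ 2) :* (q :* (Q :* Q :* Q)) :+ (q :^ 2 :- t) :* (t :* (T :* T :* T)) :- Q :* T :* (q :- t) :* (q :+ t :+ q :* t)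
      eG₃ q t Q T = (q :- t :^ 2) :* (q :^ 2 :* (Q :* Q :* Q)) :+ (q :^ 2 :- t) :* (t :^ 2 :* (T :* T :* T)) :- Q :* T :* (q :- t) :* (q :^ 2 :+ q :* t :+ t :^ 2)
      eΔ : ∀ {n} → Expr n → Expr n → Expr n
      eΔ q t = (q :- t) :* ((q :^ 2 :- t) :* (q :- t :^ 2))

    ladder₁ : ∀ k → Δ * ladder 1 k ≈ G₁ (q ^ k) (t ^ k)
    ladder₁ zero    = solve 2 (λ q t → eΔ q t :* :0 := eG₁ q t :1 :1) ≡.refl q t
    ladder₁ (suc k) = trans (ladder-step 1 k (ladder₁ k)) (solve 4 (λ q t Q T →
      q :* t :* eG₁ q t Q T :+ (q :^ 2 :- t) :* (q :- t :^ 2) :* (Q :* (Q :* Q) :* q :^ 1 :- T :* (T :* T) :* t :^ 1) := eG₁ q t (q :* Q) (t :* T)) ≡.refl q t (q ^ k) (t ^ k))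

    ladder₂ : ∀ k → Δ * ladder 2 k ≈ G₂ (q ^ k) (t ^ k)
    ladder₂ zero    = solve 2 (λ q t → eΔ q t :* :0 := eG₂ q t :1 :1) ≡.refl q t
    ladder₂ (suc k) = trans (ladder-step 2 k (ladder₂ k)) (solve 4 (λ q t Q T →
      q :* t :* eG₂ q t Q T :+ (q :^ 2 :- t) :* (q :- t :^ 2) :* (Q :* (Q :* Q) :* q :^ 2 :- T :* (T :* T) :* t :^ 2) := eG₂ q t (q :* Q) (t :* T)) ≡.refl q t (q ^ k) (t ^ k))

    ladder₃ : ∀ k → Δ * ladder 3 k ≈ G₃ (q ^ k) (t ^ k)
    ladder₃ zero    = solve 2 (λ q t → eΔ q t :* :0 := eG₃ q t :1 :1) ≡.refl q t
    ladder₃ (suc k) = trans (ladder-step 3 k (ladder₃ k)) (solve 4 (λ q t Q T →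
      q :* t :* eG₃ q t Q T :+ (q :^ 2 :- t) :* (q :- t :^ 2) :* (Q :* (Q :* Q) :* q :^ 3 :- T :* (T :* T) :* t :^ 3) := eG₃ q t (q :* Q) (t :* T)) ≡.refl q t (q ^ k) (t ^ k))

    -- `VF` = q t^4 (1 - t)(q - t)(q - t^2) and `VE` = q^3 t (1 - t)(q^2 - t)(q^2 - t^2) are the
    -- denominators of the two kinds of triangular sums. Their product contains every factor of Δ,
    -- and `κ` is the quotient.
    VF VE Θ κ : A
    VF = vandermonde uF vF wF
    VE = vandermonde uE vE wE
    Θ = VF * VE
    κ = q ^ 4 * t ^ 5 * (1# - t) ^ 2 * (q ^ 2 - t ^ 2)

    private
      eV : ∀ {n} → Expr n → Expr n → Expr n → Expr n
      eV u v w = (u :- v) :* ((u :- w) :* (v :- w))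
      eVF eVE eκ : ∀ {n} → Expr n → Expr n → Expr n
      eVF q t = eV (q :* t) (q :* (t :* t)) (t :* (t :* t))
      eVE q t = eV (q :* (q :* q)) (q :* t) (q :* (t :* t))
      eκ q t = q :^ 4 :* t :^ 5 :* (:1 :- t) :^ 2 :* (q :^ 2 :- t :^ 2)
      eF eE : ∀ {n} → Expr n → Expr n → Expr n → Expr n → Expr n
      eF q t Q T = (q :* t) :* (Q :* T) :* (q :* (t :* t) :- t :* (t :* t)) :- q :* (t :* t) :* (Q :* (T :* T)) :* (q :* t :- t :* (t :* t))
                   :+ t :* (t :* t) :* (T :* (T :* T)) :* (q :* t :- q :* (t :* t))
      eE q t Q T = q :* (q :* q) :* (Q :* (Q :* Q)) :* (q :* t :- q :* (t :* t)) :- q :* t :* (Q :* T) :* (q :* (q :* q) :- q :* (t :* t))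
                   :+ q :* (t :* t) :* (Q :* (T :* T)) :* (q :* (q :* q) :- q :* t)

    CF CE : A → A → A
    CF Q T = q * t * (Q * T) * (vF - wF) - vF * (Q * (T * T)) * (uF - wF) + wF * (T * (T * T)) * (uF - vF)
    CE Q T = uE * (Q * (Q * Q)) * (vE - wE) - vE * (Q * T) * (uE - wE) + wE * (Q * (T * T)) * (uE - vE)

    triF-closed : ∀ n → VF * triF n ≈ CF (q ^ n) (t ^ n)
    triF-closed n = trans (tri-closed uF vF wF n) (+-cong (+-cong (*-congʳ (*-congˡ (pow₂ q t n))) (-‿cong (*-congʳ (*-congˡ (pow₃ q t t n))))) (*-congʳ (*-congˡ (pow₃ t t t n))))

    triE-closed : ∀ n → VE * triE n ≈ CE (q ^ n) (t ^ n)
    triE-closed n = trans (tri-closed uE vE wE n) (+-cong (+-cong (*-congʳ (*-congˡ (pow₃ q q q n))) (-‿cong (*-congʳ (*-congˡ (pow₂ q t n))))) (*-congʳ (*-congˡ (pow₃ q t t n))))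

    module Cancelling (Θ-cancel : ∀ f → Θ * f ≈ 0# → f ≈ 0#) (Δ-cancel : ∀ f → Δ * f ≈ 0# → f ≈ 0#) where

      Θ-injective : ∀ {x y a b} → Θ * x ≈ a → Δ * y ≈ b → a ≈ κ * b → x ≈ y
      Θ-injective {x} {y} {a} {b} ex ey e = x-y≈0⇒x≈y x y (Θ-cancel (x - y) (begin
        Θ * (x - y)         ≈⟨ solve 3 (λ c x y → c :* (x :- y) := c :* x :- c :* y) ≡.refl Θ x y ⟩
        Θ * x - Θ * y       ≈⟨ +-cong (trans ex e) (-‿cong (trans (*-congʳ Θ-κ) (trans (*-assoc κ Δ y) (*-congˡ ey)))) ⟩
        κ * b - κ * b       ≈⟨ -‿inverseʳ _ ⟩
        0# ∎))
        where
        Θ-κ : Θ ≈ κ * Δ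
        Θ-κ = solve 2 (λ q t → eVF q t :* eVE q t := eκ q t :* eΔ q t) ≡.refl q t

      Δ-injective : ∀ {x y a} → Δ * x ≈ a → Δ * y ≈ a → x ≈ y
      Δ-injective {x} {y} ex ey = x-y≈0⇒x≈y x y (Δ-cancel (x - y)
        (trans (solve 3 (λ c x y → c :* (x :- y) := c :* x :- c :* y) ≡.refl Δ x y) (trans (+-cong ex (-‿cong ey)) (-‿inverseʳ _))))

      combine : ∀ a b c n m l → Θ * (a * triF n + (b * triE m + c * triE l)) ≈
        a * VE * CF (q ^ n) (t ^ n) + (b * VF * CE (q ^ m) (t ^ m) + c * VF * CE (q ^ l) (t ^ l))
      combine a b c n m l = trans (solve 8 (λ f e a b c x y z → f :* e :* (a :* x :+ (b :* y :+ c :* z)) := a :* e :* (f :* x) :+ (b :* f :* (e :* y) :+ c :* f :* (e :* z)))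
          ≡.refl VF VE a b c (triF n) (triE m) (triE l))
        (+-cong (*-congˡ (triF-closed n)) (+-cong (*-congˡ (triE-closed m)) (*-congˡ (triE-closed l))))

      -- The summands on the left are the weights of the three regions for Y = 2k, with all rows x ≤
      -- k. The letter Z marks sums of weights, D sums of weights times `ε`.
      Z₁ : ∀ k → t ^ 0 * triF (suc k) + (q ^ 3 * (t ^ 0 * wE ^ 0) * triE k + q ^ 2 * t * triE k) ≈ ladder 1 (suc k)
      Z₁ k = Θ-injective (combine _ _ _ (suc k) k k) (ladder₁ (suc k))
        (solve 4 (λ q t Q T → t :^ 0 :* eVE q t :* eF q t (q :* Q) (t :* T) :+ (q :^ 3 :* (t :^ 0 :* (q :* (t :* t)) :^ 0) :* eVF q t :* eE q t Q T :+ q :^ 2 :* t :* eVF q t :* eE q t Q T)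
          := eκ q t :* eG₁ q t (q :* Q) (t :* T)) ≡.refl q t (q ^ k) (t ^ k))

      -- The case k = 0 is separate because the truncated k - 1 would not fit the closed form.
      D₁ : ∀ k → t ^ 3 * t ^ 0 * triF (k ∸ 1) + (t ^ 0 * wE ^ 0 * triE k + q ^ 2 * t * triE (k ∸ 1)) ≈ ladder 1 k
      D₁ zero    = solve 3 (λ a b c → a :* :0 :+ (b :* :0 :+ c :* :0) := :0) ≡.refl _ _ _
      D₁ (suc n) = Θ-injective (combine _ _ _ n (suc n) n) (ladder₁ (suc n))
        (solve 4 (λ q t Q T → t :^ 3 :* t :^ 0 :* eVE q t :* eF q t Q T :+ (t :^ 0 :* (q :* (t :* t)) :^ 0 :* eVF q t :* eE q t (q :* Q) (t :* T) :+ q :^ 2 :* t :* eVF q t :* eE q t Q T)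
          := eκ q t :* eG₁ q t (q :* Q) (t :* T)) ≡.refl q t (q ^ n) (t ^ n))

      -- The regions for Y = 2k + 1, that is for m = 3k + 2.
      Z₂ : ∀ k → t ^ 1 * triF (suc k) + (q ^ 3 * (t ^ 1 * wE ^ 0) * triE k + q * triE (suc k)) ≈ ladder 2 (suc k)
      Z₂ k = Θ-injective (combine _ _ _ (suc k) k (suc k)) (ladder₂ (suc k))
        (solve 4 (λ q t Q T → t :^ 1 :* eVE q t :* eF q t (q :* Q) (t :* T) :+ (q :^ 3 :* (t :^ 1 :* (q :* (t :* t)) :^ 0) :* eVF q t :* eE q t Q T :+ q :* eVF q t :* eE q t (q :* Q) (t :* T))
          := eκ q t :* eG₂ q t (q :* Q) (t :* T)) ≡.refl q t (q ^ k) (t ^ k))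

      D₂ : ∀ k → t ^ 3 * t ^ 1 * triF (k ∸ 1) + (t ^ 1 * wE ^ 0 * triE k + q * triE k) ≈ ladder 2 k
      D₂ zero    = solve 3 (λ a b c → a :* :0 :+ (b :* :0 :+ c :* :0) := :0) ≡.refl _ _ _
      D₂ (suc n) = Θ-injective (combine _ _ _ n (suc n) (suc n)) (ladder₂ (suc n))
        (solve 4 (λ q t Q T → t :^ 3 :* t :^ 1 :* eVE q t :* eF q t Q T :+ (t :^ 1 :* (q :* (t :* t)) :^ 0 :* eVF q t :* eE q t (q :* Q) (t :* T) :+ q :* eVF q t :* eE q t (q :* Q) (t :* T))
          := eκ q t :* eG₂ q t (q :* Q) (t :* T)) ≡.refl q t (q ^ n) (t ^ n))

      private
        Θ-short : ∀ n b c l → Θ * (t ^ 0 * (triF (suc (suc n)) - uF ^ suc n) + (b * triE n + c * triE l)) ≈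
          (t ^ 0 * VE * CF (q ^ suc (suc n)) (t ^ suc (suc n)) + (b * VF * CE (q ^ n) (t ^ n) + c * VF * CE (q ^ l) (t ^ l))) - Θ * (q ^ suc n * t ^ suc n)
        Θ-short n b c l = trans (solve 5 (λ th x u y z → th :* (:1 :* (x :- u) :+ (y :+ z)) := th :* (:1 :* x :+ (y :+ z)) :- th :* u) ≡.refl Θ _ _ _ _)
          (+-cong (combine (t ^ 0) b c (suc (suc n)) n l) (-‿cong (*-congˡ (pow₂ q t (suc n)))))

      -- For m a multiple of 3 and k = n + 1: the paths with x < k, which avoid the point of height
      -- 1 on the diagonal. The factor t on the right later meets the 1/t of a return number at
      -- least 2.
      Z₃ : ∀ n → t ^ 0 * (triF (suc (suc n)) - uF ^ suc n) + (q ^ 3 * (t ^ 0 * wE ^ 1) * triE n + q ^ 2 * t * triE (suc n)) ≈ t * ladder 3 (suc n)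
      Z₃ n = Θ-injective (Θ-short n _ _ (suc n)) (trans (solve 3 (λ d t l → d :* (t :* l) := t :* (d :* l)) ≡.refl Δ t _) (*-congˡ (ladder₃ (suc n))))
        (solve 4 (λ q t Q T → (t :^ 0 :* eVE q t :* eF q t (q :* (q :* Q)) (t :* (t :* T)) :+ (q :^ 3 :* (t :^ 0 :* (q :* (t :* t)) :^ 1) :* eVF q t :* eE q t Q T :+ q :^ 2 :* t :* eVF q t :* eE q t (q :* Q) (t :* T)))
            :- eVF q t :* eVE q t :* (q :* Q :* (t :* T))
          := eκ q t :* (t :* eG₃ q t (q :* Q) (t :* T))) ≡.refl q t (q ^ n) (t ^ n))

      D₃ : ∀ n → t ^ 3 * t ^ 0 * triF n + (t ^ 0 * wE ^ 1 * triE n + q ^ 2 * t * triE n) ≈ t * ladder 3 n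
      D₃ n = Θ-injective (combine _ _ _ n n n) (trans (solve 3 (λ d t l → d :* (t :* l) := t :* (d :* l)) ≡.refl Δ t _) (*-congˡ (ladder₃ n)))
        (solve 4 (λ q t Q T → t :^ 3 :* t :^ 0 :* eVE q t :* eF q t Q T :+ (t :^ 0 :* (q :* (t :* t)) :^ 1 :* eVF q t :* eE q t Q T :+ q :^ 2 :* t :* eVF q t :* eE q t Q T)
          := eκ q t :* (t :* eG₃ q t Q T)) ≡.refl q t (q ^ n) (t ^ n))

      -- The paths that also avoid the diagonal at height 2. Each row of the third region loses its
      -- last cell, which shortens that triangle and brings in the factor `wE`.
      Z₄ : ∀ n → t ^ 0 * (triF (suc (suc n)) - uF ^ suc n) + (q ^ 3 * (t ^ 0 * wE ^ 1) * triE n + q ^ 2 * t * wE * triE n) ≈ t ^ 2 * ladder 2 (suc n)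
      Z₄ n = Θ-injective (Θ-short n _ _ n) (trans (solve 3 (λ d t l → d :* (t :^ 2 :* l) := t :^ 2 :* (d :* l)) ≡.refl Δ t _) (*-congˡ (ladder₂ (suc n))))
        (solve 4 (λ q t Q T → (t :^ 0 :* eVE q t :* eF q t (q :* (q :* Q)) (t :* (t :* T)) :+ (q :^ 3 :* (t :^ 0 :* (q :* (t :* t)) :^ 1) :* eVF q t :* eE q t Q T :+ q :^ 2 :* t :* (q :* (t :* t)) :* eVF q t :* eE q t Q T))
            :- eVF q t :* eVE q t :* (q :* Q :* (t :* T))
          := eκ q t :* (t :^ 2 :* eG₂ q t (q :* Q) (t :* T))) ≡.refl q t (q ^ n) (t ^ n))

      D₄ : ∀ n → t ^ 3 * t ^ 0 * triF n + (t ^ 0 * wE ^ 1 * triE n + q ^ 2 * t * wE * triE (n ∸ 1)) ≈ t ^ 2 * ladder 2 n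
      D₄ zero    = solve 4 (λ a b c t → a :* :0 :+ (b :* :0 :+ c :* :0) := t :* :0) ≡.refl _ _ _ _
      D₄ (suc n) = Θ-injective (combine _ _ _ (suc n) (suc n) n) (trans (solve 3 (λ d t l → d :* (t :^ 2 :* l) := t :^ 2 :* (d :* l)) ≡.refl Δ t _) (*-congˡ (ladder₂ (suc n))))
        (solve 4 (λ q t Q T → t :^ 3 :* t :^ 0 :* eVE q t :* eF q t (q :* Q) (t :* T) :+ (t :^ 0 :* (q :* (t :* t)) :^ 1 :* eVF q t :* eE q t (q :* Q) (t :* T) :+ q :^ 2 :* t :* (q :* (t :* t)) :* eVF q t :* eE q t Q T)
          := eκ q t :* (t :^ 2 :* eG₂ q t (q :* Q) (t :* T))) ≡.refl q t (q ^ n) (t ^ n))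

      private
        Δ-hook : ∀ {z d r gz gd gr} c → Δ * z ≈ gz → Δ * d ≈ gd → Δ * r ≈ gr → gz + q ^ 2 * gd - Δ * c ≈ q * gr → z + q ^ 2 * d - c ≈ q * r
        Δ-hook {z} {d} {r} c ez ed er e = Δ-injective
          (trans (solve 5 (λ D z d c Q → D :* (z :+ Q :* d :- c) := D :* z :+ Q :* (D :* d) :- D :* c) ≡.refl Δ z d c (q ^ 2)) (trans (+-congʳ (+-cong ez (*-congˡ ed))) e))
          (trans (solve 3 (λ D q r → D :* (q :* r) := q :* (D :* r)) ≡.refl Δ q r) (*-congˡ er))

        sum-closed : ∀ {x y a b} → Δ * x ≈ a → Δ * y ≈ b → Δ * (x + y) ≈ a + b
        sum-closed ex ey = trans (distribˡ Δ _ _) (+-cong ex ey)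

      -- The three relations that turn the s111 and s3 coefficients into the s21 one.
      hook₁ : ∀ k → ladder 1 (suc k) + q ^ 2 * ladder 1 k - t ^ k * (t ^ k * t ^ k) ≈ q * (ladder 2 k + ladder 3 k)
      hook₁ k = Δ-hook _ (ladder₁ (suc k)) (ladder₁ k) (sum-closed (ladder₂ k) (ladder₃ k))
        (solve 4 (λ q t Q T → eG₁ q t (q :* Q) (t :* T) :+ q :^ 2 :* eG₁ q t Q T :- eΔ q t :* (T :* (T :* T)) := q :* (eG₂ q t Q T :+ eG₃ q t Q T)) ≡.refl q t (q ^ k) (t ^ k))

      hook₂ : ∀ k → ladder 2 (suc k) + q ^ 2 * ladder 2 k - t * (t ^ k * (t ^ k * t ^ k)) ≈ q * (ladder 3 k + ladder 1 (suc k))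
      hook₂ k = Δ-hook _ (ladder₂ (suc k)) (ladder₂ k) (sum-closed (ladder₃ k) (ladder₁ (suc k)))
        (solve 4 (λ q t Q T → eG₂ q t (q :* Q) (t :* T) :+ q :^ 2 :* eG₂ q t Q T :- eΔ q t :* (t :* (T :* (T :* T))) := q :* (eG₃ q t Q T :+ eG₁ q t (q :* Q) (t :* T))) ≡.refl q t (q ^ k) (t ^ k))

      hook₃ : ∀ n → ladder 3 (suc n) + q ^ 2 * ladder 3 n - t ^ 2 * (t ^ n * (t ^ n * t ^ n)) ≈ q * (ladder 1 (suc n) + ladder 2 (suc n) - q ^ n * t ^ n)
      hook₃ n = Δ-hook _ (ladder₃ (suc n)) (ladder₃ n) (trans (solve 3 (λ D x y → D :* (x :- y) := D :* x :- D :* y) ≡.refl Δ _ _) (+-congʳ (sum-closed (ladder₁ (suc n)) (ladder₂ (suc n)))))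
        (solve 4 (λ q t Q T → eG₃ q t (q :* Q) (t :* T) :+ q :^ 2 :* eG₃ q t Q T :- eΔ q t :* (t :^ 2 :* (T :* (T :* T)))
          := q :* (eG₁ q t (q :* Q) (t :* T) :+ eG₂ q t (q :* Q) (t :* T) :- eΔ q t :* (Q :* T))) ≡.refl q t (q ^ n) (t ^ n))

-- Totals of path weights as combinations of ladders

module PathTotals where
  open RingSolve
  open Paths using (module Ranges)
  open TriangularSums
  open WeightSums
  open Ladders
  open import Data.Nat using (_<_; _≤_; s≤s; _∸_)

  module HTotals (R : CommutativeRing 0ℓ 0ℓ) (q t qi : CommutativeRing.Carrier R)
    (q*qi : CommutativeRing._≈_ R (CommutativeRing._*_ R q qi) (CommutativeRing.1# R))
    (a b c : CommutativeRing.Carrier R) where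
    open CommutativeRing R hiding (zero) renaming (Carrier to A)
    open Solver R
    open Ranges R
    open Triangles R
    open HSums R q t qi q*qi
    open HVariants R q t qi q*qi
    open import Relation.Binary.Reasoning.Setoid setoid

    edgeR innerR outerR : A
    edgeR  = c + qi * b
    innerR = c + (qi * (b + b) + qi * qi * a)
    outerR = c + (qi * b + (qi * qi * b + qi * (qi * qi) * a))

    kindR : ℕ → ℕ → ℕ → A
    kindR k zero    zero    = c
    kindR k zero    (suc y) = edgeR
    kindR k (suc x) zero    = edgeR
    kindR k (suc x) (suc y) = if suc x ℕ.+ suc y ℕ.≤ᵇ k then innerR else outerR

    -- `Y` enters the exponents, whereas `X` and `Y′` bound the range; they vary independently for
    -- paths restricted by their returns.
    total : (k Y X Y′ : ℕ) → A
    total k Y X Y′ = Σ< X (λ x → Σ< (suc Y′ ∸ x) (λ y → μ k Y x y * kindR k x y))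

    private
      origin : ℕ → ℕ → A
      origin zero    zero    = 1#
      origin zero    (suc y) = 0#
      origin (suc x) y       = 0#

      qiq : ∀ x → qi * q * x ≈ x
      qiq x = trans (*-congʳ (trans (*-comm qi q) q*qi)) (*-identityˡ x)

      -- `innerR` and `outerR` exceed `edgeR` by q^(-2) and q^(-3) times the same element a + q b,
      -- and the corner falls short of `edgeR` by q^(-1) b. Three sums of scalars thus determine the
      -- total.
      kind-split : ∀ k x y → kindR k x y ≈ edgeR + ε k x y * (a + q * b) - origin x y * (qi * b)
      kind-split k zero zero = solve 5 (λ a b c q p → c := (c :+ p :* b) :+ :0 :* (a :+ q :* b) :- :1 :* (p :* b)) ≡.refl a b c q qi
      kind-split k zero (suc y) = solve 5 (λ a b c q p → c :+ p :* b := (c :+ p :* b) :+ :0 :* (a :+ q :* b) :- :0 :* (p :* b)) ≡.refl a b c q qi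
      kind-split k (suc x) zero = solve 5 (λ a b c q p → c :+ p :* b := (c :+ p :* b) :+ :0 :* (a :+ q :* b) :- :0 :* (p :* b)) ≡.refl a b c q qi
      kind-split k (suc x) (suc y) with suc x ℕ.+ suc y ℕ.≤ᵇ k
      ... | true = trans (+-congˡ (+-congʳ (trans (solve 2 (λ p b → p :* (b :+ b) := p :* b :+ p :* b) ≡.refl qi b) (+-congˡ (sym (qiq (qi * b)))))))
        (solve 5 (λ a b c q p → c :+ (p :* b :+ p :* q :* (p :* b) :+ p :* p :* a) := (c :+ p :* b) :+ (p :* p) :* (a :+ q :* b) :- :0 :* (p :* b)) ≡.refl a b c q qi)
      ... | false = trans (+-congˡ (+-congˡ (+-congʳ (sym (qiq (qi * qi * b))))))
        (solve 5 (λ a b c q p → c :+ (p :* b :+ (p :* q :* (p :* p :* b) :+ p :* (p :* p) :* a)) := (c :+ p :* b) :+ (p :* (p :* p)) :* (a :+ q :* b) :- :0 :* (p :* b)) ≡.refl a b c q qi)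

    module _ (k Y X Y′ : ℕ) where
      weights excesses : A
      weights  = Σ< (suc X) (λ x → Σ< (suc Y′ ∸ x) (μ k Y x))
      excesses = Σ< (suc X) (λ x → Σ< (suc Y′ ∸ x) (λ y → μ k Y x y * ε k x y))

      total-split : total k Y (suc X) Y′ ≈ edgeR * weights + (a + q * b) * excesses - qi * b * μ k Y 0 0
      total-split = begin
        total k Y (suc X) Y′
          ≈⟨ Σ<-cong (suc X) (λ x _ → trans (Σ<-cong (suc Y′ ∸ x) λ y _ → trans (*-congˡ (kind-split k x y))
               (solve 6 (λ m e f d o g → m :* (e :+ f :* d :- o :* g) := e :* m :+ (d :* (m :* f) :+ (:- g) :* (m :* o))) ≡.refl (μ k Y x y) edgeR (ε k x y) (a + q * b) (origin x y) (qi * b)))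
               (sum₃ (suc Y′ ∸ x) (μ k Y x) (λ y → μ k Y x y * ε k x y) (λ y → μ k Y x y * origin x y))) ⟩
        Σ< (suc X) (λ x → edgeR * Σ< (suc Y′ ∸ x) (μ k Y x) + ((a + q * b) * Σ< (suc Y′ ∸ x) (λ y → μ k Y x y * ε k x y) + (- (qi * b)) * Σ< (suc Y′ ∸ x) (λ y → μ k Y x y * origin x y)))
          ≈⟨ sum₃ (suc X) (λ x → Σ< (suc Y′ ∸ x) (μ k Y x)) (λ x → Σ< (suc Y′ ∸ x) (λ y → μ k Y x y * ε k x y)) (λ x → Σ< (suc Y′ ∸ x) (λ y → μ k Y x y * origin x y)) ⟩
        edgeR * weights + ((a + q * b) * excesses + (- (qi * b)) * Σ< (suc X) (λ x → Σ< (suc Y′ ∸ x) (λ y → μ k Y x y * origin x y)))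
          ≈⟨ +-congˡ (+-congˡ (*-congˡ corners)) ⟩
        edgeR * weights + ((a + q * b) * excesses + (- (qi * b)) * μ k Y 0 0)
          ≈⟨ solve 4 (λ x y g m → x :+ (y :+ (:- g) :* m) := x :+ y :- g :* m) ≡.refl _ _ (qi * b) (μ k Y 0 0) ⟩
        _ ∎
        where
        sum₃ : ∀ n (f g h : ℕ → A) → Σ< n (λ i → edgeR * f i + ((a + q * b) * g i + (- (qi * b)) * h i)) ≈
               edgeR * Σ< n f + ((a + q * b) * Σ< n g + (- (qi * b)) * Σ< n h)
        sum₃ n f g h = trans (Σ<-add n (λ i → edgeR * f i) _) (+-cong (Σ<-*ˡ n edgeR f)
          (trans (Σ<-add n (λ i → (a + q * b) * g i) _) (+-cong (Σ<-*ˡ n (a + q * b) g) (Σ<-*ˡ n (- (qi * b)) h))))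
        corners : Σ< (suc X) (λ x → Σ< (suc Y′ ∸ x) (λ y → μ k Y x y * origin x y)) ≈ μ k Y 0 0
        corners = trans (+-cong (trans (+-cong (*-identityʳ _) (Σ<-zero Y′ {λ y → μ k Y 0 (suc y) * 0#} λ y → zeroʳ _)) (+-identityʳ _))
          (Σ<-zero X {λ x → Σ< (Y′ ∸ x) (λ y → μ k Y (suc x) y * 0#)} λ x → Σ<-zero (Y′ ∸ x) {λ y → μ k Y (suc x) y * 0#} λ y → zeroʳ _)) (+-identityʳ _)

      -- The coefficient of `c` is the sum of weights and that of `a` the sum of excesses. The
      -- coefficient of `b` is z/q + q d minus the corner weight divided by q, which the last
      -- hypothesis identifies with `r`.
      assemble : ∀ {z d r} → weights ≈ z → excesses ≈ d → z + q ^ 2 * d - μ k Y 0 0 ≈ q * r →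
                 total k Y (suc X) Y′ ≈ d * a + (r * b + z * c)
      assemble {z} {d} {r} ez ed eh = begin
        total k Y (suc X) Y′                                      ≈⟨ total-split ⟩
        edgeR * weights + (a + q * b) * excesses - qi * b * m     ≈⟨ +-congʳ (+-cong (*-congˡ ez) (*-congˡ ed)) ⟩
        (c + qi * b) * z + (a + q * b) * d - qi * b * m
          ≈⟨ solve 8 (λ a b c q p z d m → (c :+ p :* b) :* z :+ (a :+ q :* b) :* d :- p :* b :* m := d :* a :+ (p :* z :+ q :* d :- p :* m) :* b :+ z :* c) ≡.refl a b c q qi z d m ⟩
        d * a + (qi * z + q * d - qi * m) * b + z * c             ≈⟨ +-congʳ (+-congˡ (*-congʳ hook)) ⟩
        d * a + r * b + z * c                                     ≈⟨ +-assoc _ _ _ ⟩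
        d * a + (r * b + z * c) ∎
        where
        m = μ k Y 0 0
        hook : qi * z + q * d - qi * m ≈ r
        hook = trans (+-congʳ (+-congˡ (sym (qiq (q * d))))) (trans (solve 5 (λ q p z d m → p :* z :+ p :* q :* (q :* d) :- p :* m := p :* (z :+ q :^ 2 :* d :- m)) ≡.refl q qi z d m)
          (trans (*-congˡ eh) (trans (sym (*-assoc qi q r)) (qiq r))))

    private
      t-cube : ∀ k δ → μ k (k ℕ.+ k ℕ.+ δ) 0 0 ≈ t ^ δ * (t ^ k * (t ^ k * t ^ k))
      t-cube k δ = trans (*-identityˡ _) (trans (^-homo-* t k (k ℕ.+ k ℕ.+ δ)) (trans (*-congˡ (trans (^-homo-* t (k ℕ.+ k) δ) (*-congʳ (^-homo-* t k k))))
        (solve 2 (λ T d → T :* (T :* T :* d) := d :* (T :* (T :* T))) ≡.refl (t ^ k) (t ^ δ))))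

      cell₀ : ∀ k x j → x ℕ.+ j < k → μ k (k ℕ.+ k ℕ.+ 0) x (suc k ℕ.+ j) ≈ q ^ 2 * t * cellE k x j
      cell₀ k x j h = at-k k (k ∸ suc x ∸ j) (≡.sym (≡.trans (≡.cong (λ z → x ℕ.+ suc (j ℕ.+ z)) (ℕP.∸-+-assoc k (suc x) j))
          (≡.trans (lem x j (k ∸ (suc x ℕ.+ j))) (ℕP.m+[n∸m]≡n h))))
        where
        lem : ∀ x j d → x ℕ.+ suc (j ℕ.+ d) ≡ suc (x ℕ.+ j) ℕ.+ d
        lem = solve-∀
        at-k : ∀ k e → k ≡ x ℕ.+ suc (j ℕ.+ e) → μ k (k ℕ.+ k ℕ.+ 0) x (suc k ℕ.+ j) ≈ q ^ 2 * t * (uE ^ x * (vE ^ j * wE ^ e))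
        at-k _ e ≡.refl = μ-III₀ x j e

      cell₁ : ∀ k x j → x ℕ.+ j < suc k → μ k (k ℕ.+ k ℕ.+ 1) x (suc k ℕ.+ j) ≈ q * cellE (suc k) x j
      cell₁ k x j (s≤s h) = at-k k (k ∸ x ∸ j) (≡.sym (≡.trans (≡.cong (λ z → x ℕ.+ (j ℕ.+ z)) (ℕP.∸-+-assoc k x j)) (≡.trans (≡.sym (ℕP.+-assoc x j _)) (ℕP.m+[n∸m]≡n h))))
        where
        at-k : ∀ k e → k ≡ x ℕ.+ (j ℕ.+ e) → μ k (k ℕ.+ k ℕ.+ 1) x (suc k ℕ.+ j) ≈ q * (uE ^ x * (vE ^ j * wE ^ e))
        at-k _ e ≡.refl = μ-III₁ x j e

      -- The exponents still belong to k = n + 1 while the triangle has size n, so one factor `wE`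
      -- is left over.
      cell₀-short : ∀ n x j → x ℕ.+ j < n → μ (suc n) (suc n ℕ.+ suc n ℕ.+ 0) x (suc (suc n) ℕ.+ j) ≈ q ^ 2 * t * wE * cellE n x j
      cell₀-short n x j h = trans (cell₀ (suc n) x j (ℕP.m≤n⇒m≤1+n h))
        (trans (*-congˡ (*-congˡ (*-congˡ (reflexive (≡.cong (wE ^_) expo)))))
          (solve 5 (λ p u v w W → p :* (u :* (v :* (w :* W))) := p :* w :* (u :* (v :* W))) ≡.refl (q ^ 2 * t) (uE ^ x) (vE ^ j) wE (wE ^ (n ∸ suc x ∸ j))))
        where
        expo : suc n ∸ suc x ∸ j ≡ suc (n ∸ suc x ∸ j)
        expo = ≡.trans (ℕP.∸-+-assoc (suc n) (suc x) j) (≡.trans (ℕP.+-∸-assoc 1 h) (≡.cong suc (≡.sym (ℕP.∸-+-assoc n (suc x) j))))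

      rows : ∀ k X Y n f g h (F : ℕ → ℕ → A) → Y ∸ k ≡ n → X ≤ suc k → (∀ x → x < X → k ℕ.+ x ≤ Y) →
        Σ< X (λ x → Σ< (suc (k ∸ x)) (F x)) ≈ f → Σ< X (λ x → Σ< x (λ i → F x (suc (k ∸ x) ℕ.+ i))) ≈ g → Σ< X (λ x → Σ< (n ∸ x) (λ j → F x (suc k ℕ.+ j))) ≈ h →
        Σ< X (λ x → Σ< (suc Y ∸ x) (F x)) ≈ f + (g + h)
      rows k X Y n f g h F ≡.refl X≤ Y≥ ef eg eh = trans (regions k X Y F X≤ Y≥) (+-cong ef (+-cong eg eh))

    module Coefficients (Θ-cancel : ∀ f → Θ * f ≈ 0# → f ≈ 0#) (Δ-cancel : ∀ f → Δ * f ≈ 0# → f ≈ 0#) where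
      open Cancelling Θ-cancel Δ-cancel

      total₁ : ∀ k → total k (k ℕ.+ k ℕ.+ 0) (suc k) (k ℕ.+ k) ≈ ladder 1 k * a + ((ladder 2 k + ladder 3 k) * b + ladder 1 (suc k) * c)
      total₁ k = assemble k (k ℕ.+ k ℕ.+ 0) k (k ℕ.+ k)
        (trans (rows k (suc k) (k ℕ.+ k) k _ _ _ (μ k (k ℕ.+ k ℕ.+ 0)) (ℕP.m+n∸m≡n k k) ℕP.≤-refl inside (sum-I k 0) (sum-II k 0 k 0 (≡.sym (ℕP.+-identityʳ k))) (sum-III k 0 k (q ^ 2 * t) (cell₀ k) (suc k) (ℕP.n≤1+n k))) (Z₁ k))
        (trans (rows k (suc k) (k ℕ.+ k) k _ _ _ (λ x y → μ k (k ℕ.+ k ℕ.+ 0) x y * ε k x y) (ℕP.m+n∸m≡n k k) ℕP.≤-refl inside (sum-εI k 0 (suc k) (ℕP.n≤1+n k) ℕP.≤-refl) (sum-εII k 0 k 0 (≡.sym (ℕP.+-identityʳ k))) (sum-εIII k 0 k (q ^ 2 * t) (cell₀ k) k (ℕP.n≤1+n k))) (D₁ k))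
        (trans (+-congˡ (-‿cong (trans (t-cube k 0) (*-identityˡ _)))) (hook₁ k))
        where
        inside : ∀ x → x < suc k → k ℕ.+ x ≤ k ℕ.+ k
        inside x (s≤s h) = ℕP.+-monoʳ-≤ k h

      total₂ : ∀ k → total k (k ℕ.+ k ℕ.+ 1) (suc k) (k ℕ.+ k ℕ.+ 1) ≈ ladder 2 k * a + ((ladder 3 k + ladder 1 (suc k)) * b + ladder 2 (suc k) * c)
      total₂ k = assemble k (k ℕ.+ k ℕ.+ 1) k (k ℕ.+ k ℕ.+ 1)
        (trans (rows k (suc k) (k ℕ.+ k ℕ.+ 1) (suc k) _ _ _ (μ k (k ℕ.+ k ℕ.+ 1)) height ℕP.≤-refl inside (sum-I k 1) (sum-II k 1 k 0 (≡.sym (ℕP.+-identityʳ k))) (sum-III k 1 (suc k) q (cell₁ k) (suc k) ℕP.≤-refl)) (Z₂ k))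
        (trans (rows k (suc k) (k ℕ.+ k ℕ.+ 1) (suc k) _ _ _ (λ x y → μ k (k ℕ.+ k ℕ.+ 1) x y * ε k x y) height ℕP.≤-refl inside (sum-εI k 1 (suc k) (ℕP.n≤1+n k) ℕP.≤-refl) (sum-εII k 1 k 0 (≡.sym (ℕP.+-identityʳ k))) (sum-εIII k 1 (suc k) q (cell₁ k) k ℕP.≤-refl)) (D₂ k))
        (trans (+-congˡ (-‿cong (trans (t-cube k 1) (*-congʳ (*-identityʳ t))))) (hook₂ k))
        where
        height : k ℕ.+ k ℕ.+ 1 ∸ k ≡ suc k
        height = ≡.trans (≡.cong (_∸ k) (ℕP.+-assoc k k 1)) (≡.trans (ℕP.m+n∸m≡n k (k ℕ.+ 1)) (ℕP.+-comm k 1))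
        inside : ∀ x → x < suc k → k ℕ.+ x ≤ k ℕ.+ k ℕ.+ 1
        inside x (s≤s h) = ℕP.≤-trans (ℕP.+-monoʳ-≤ k h) (ℕP.m≤m+n (k ℕ.+ k) 1)

      total₃ : ∀ n → let k = suc n in total k (k ℕ.+ k ℕ.+ 0) k (k ℕ.+ k) ≈
        (t * ladder 3 n) * a + ((t * (ladder 1 k + ladder 2 k - q ^ n * t ^ n)) * b + (t * ladder 3 k) * c)
      total₃ n = assemble k (k ℕ.+ k ℕ.+ 0) n (k ℕ.+ k)
        (trans (rows k k (k ℕ.+ k) k _ _ _ (μ k (k ℕ.+ k ℕ.+ 0)) (ℕP.m+n∸m≡n k k) (ℕP.n≤1+n k) inside (sum-I-short k 0) (sum-II k 0 n 1 (ℕP.+-comm 1 n)) (sum-III k 0 k (q ^ 2 * t) (cell₀ k) k ℕP.≤-refl)) (Z₃ n))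
        (trans (rows k k (k ℕ.+ k) k _ _ _ (λ x y → μ k (k ℕ.+ k ℕ.+ 0) x y * ε k x y) (ℕP.m+n∸m≡n k k) (ℕP.n≤1+n k) inside (sum-εI k 0 k ℕP.≤-refl (ℕP.n≤1+n k)) (sum-εII k 0 n 1 (ℕP.+-comm 1 n)) (sum-εIII k 0 k (q ^ 2 * t) (cell₀ k) n ℕP.≤-refl)) (D₃ n))
        (trans (+-congˡ (-‿cong (t-cube k 0)))
          (trans (solve 5 (λ t q z d T → t :* z :+ q :^ 2 :* (t :* d) :- :1 :* (t :* T :* (t :* T :* (t :* T))) := t :* (z :+ q :^ 2 :* d :- t :^ 2 :* (T :* (T :* T)))) ≡.refl t q _ _ (t ^ n))
            (trans (*-congˡ (hook₃ n)) (solve 3 (λ t q r → t :* (q :* r) := q :* (t :* r)) ≡.refl t q _))))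
        where
        k = suc n
        inside : ∀ x → x < k → k ℕ.+ x ≤ k ℕ.+ k
        inside x h = ℕP.+-monoʳ-≤ k (ℕP.<⇒≤ h)

      total₄ : ∀ n → let k = suc n in total k (k ℕ.+ k ℕ.+ 0) k (k ℕ.+ n) ≈
        (t ^ 2 * ladder 2 n) * a + ((t ^ 2 * (ladder 3 n + ladder 1 k)) * b + (t ^ 2 * ladder 2 k) * c)
      total₄ n = assemble k (k ℕ.+ k ℕ.+ 0) n (k ℕ.+ n)
        (trans (rows k k (k ℕ.+ n) n _ _ _ (μ k (k ℕ.+ k ℕ.+ 0)) (ℕP.m+n∸m≡n k n) (ℕP.n≤1+n k) inside (sum-I-short k 0) (sum-II k 0 n 1 (ℕP.+-comm 1 n)) (sum-III k 0 n (q ^ 2 * t * wE) (cell₀-short n) k (ℕP.n≤1+n n))) (Z₄ n))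
        (trans (rows k k (k ℕ.+ n) n _ _ _ (λ x y → μ k (k ℕ.+ k ℕ.+ 0) x y * ε k x y) (ℕP.m+n∸m≡n k n) (ℕP.n≤1+n k) inside (sum-εI k 0 k ℕP.≤-refl (ℕP.n≤1+n k)) (sum-εII k 0 n 1 (ℕP.+-comm 1 n)) (sum-εIII k 0 n (q ^ 2 * t * wE) (cell₀-short n) n (ℕP.n≤1+n n))) (D₄ n))
        (trans (+-congˡ (-‿cong (t-cube k 0)))
          (trans (solve 5 (λ t q z d T → t :^ 2 :* z :+ q :^ 2 :* (t :^ 2 :* d) :- :1 :* (t :* T :* (t :* T :* (t :* T))) := t :^ 2 :* (z :+ q :^ 2 :* d :- t :* (T :* (T :* T)))) ≡.refl t q _ _ (t ^ n))
            (trans (*-congˡ (hook₂ n)) (solve 3 (λ t q r → t :^ 2 :* (q :* r) := q :* (t :^ 2 :* r)) ≡.refl t q _))))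
        where
        k = suc n
        inside : ∀ x → x < k → k ℕ.+ x ≤ k ℕ.+ n
        inside x (s≤s h) = ℕP.+-monoʳ-≤ k h

-- The parking function sum in terms of ladders

module CombinatorialSide where
  open RingSolve
  open PolynomialRing
  open Localisation
  open CoefficientRing using (q-difference-cancellable; t-difference-cancellable)
  open SymmetricSums using (module Sums)
  open SchurExpansions
  open Labels
  open PathShapes
  open Paths
  open RankOrder
  open AreaAndPdinv
  open Returns
  open WeightSums
  open PathTotals
  open Ladders
  open import Data.Integer using (+_)
  open import Data.Nat using (_<_; _≤_; s≤s; z≤n; _∸_)
  open import Data.Nat.GCD using (gcd)

  module RetSum (R : CommutativeRing 0ℓ 0ℓ) where
    open CommutativeRing R hiding (zero) renaming (Carrier to A)
    open Solver R using (solve)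
    open Ranges R

    -- Paths meeting the diagonal early lose the terms s, then s′, of 1 + s + s′.
    return-sum : ∀ k Y (s s′ : A) (g M : ℕ → ℕ → A) → (∀ x → x < k → x ≤ Y) →
      (∀ y → y < suc Y ∸ k → g k y ≈ M k y) →
      (∀ x → x < k → ∀ y → y < Y ∸ x → g x y ≈ M x y + (s * M x y + s′ * M x y)) →
      (∀ x → x < k → g x (Y ∸ x) ≈ M x (Y ∸ x) + s * M x (Y ∸ x)) →
      Σ< (suc k) (λ x → Σ< (suc Y ∸ x) (g x)) ≈
        Σ< (suc k) (λ x → Σ< (suc Y ∸ x) (M x)) + (s * Σ< k (λ x → Σ< (suc Y ∸ x) (M x)) + s′ * Σ< k (λ x → Σ< (Y ∸ x) (M x)))
    return-sum k Y s s′ g M x≤Y last inner diagonal = begin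
      Σ< (suc k) (λ x → Σ< (suc Y ∸ x) (g x))
        ≈⟨ Σ<-last k (λ x → Σ< (suc Y ∸ x) (g x)) ⟩
      Σ< k (λ x → Σ< (suc Y ∸ x) (g x)) + Σ< (suc Y ∸ k) (g k)
        ≈⟨ +-cong (Σ<-cong k row) (Σ<-cong (suc Y ∸ k) last) ⟩
      Σ< k (λ x → r x + (s * r x + s′ * r′ x)) + r k
        ≈⟨ +-congʳ (trans (Σ<-add k r (λ x → s * r x + s′ * r′ x)) (+-congˡ (trans (Σ<-add k (λ x → s * r x) (λ x → s′ * r′ x)) (+-cong (Σ<-*ˡ k s r) (Σ<-*ˡ k s′ r′))))) ⟩
      (Σ< k r + (s * Σ< k r + s′ * Σ< k r′)) + r k
        ≈⟨ solve 4 (λ a b c d → (a :+ (b :+ c)) :+ d := (a :+ d) :+ (b :+ c)) ≡.refl _ _ _ _ ⟩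
      (Σ< k r + r k) + (s * Σ< k r + s′ * Σ< k r′)
        ≈⟨ +-congʳ (Σ<-last k r) ⟨
      Σ< (suc k) r + (s * Σ< k r + s′ * Σ< k r′) ∎
      where
      open import Relation.Binary.Reasoning.Setoid setoid
      r r′ : ℕ → A
      r x = Σ< (suc Y ∸ x) (M x)
      r′ x = Σ< (Y ∸ x) (M x)
      row : ∀ x → x < k → Σ< (suc Y ∸ x) (g x) ≈ r x + (s * r x + s′ * r′ x)
      row x h = begin
        Σ< (suc Y ∸ x) (g x)                     ≈⟨ last-cell (g x) ⟩
        Σ< (Y ∸ x) (g x) + g x (Y ∸ x)           ≈⟨ +-cong (Σ<-cong (Y ∸ x) (inner x h)) (diagonal x h) ⟩
        Σ< (Y ∸ x) (λ y → M x y + (s * M x y + s′ * M x y)) + (d + s * d)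
          ≈⟨ +-congʳ (trans (Σ<-add (Y ∸ x) (M x) _) (+-congˡ (trans (Σ<-add (Y ∸ x) (λ y → s * M x y) (λ y → s′ * M x y)) (+-cong (Σ<-*ˡ (Y ∸ x) s (M x)) (Σ<-*ˡ (Y ∸ x) s′ (M x)))))) ⟩
        (r′ x + (s * r′ x + s′ * r′ x)) + (d + s * d)
          ≈⟨ solve 4 (λ a d s s′ → (a :+ (s :* a :+ s′ :* a)) :+ (d :+ s :* d) := (a :+ d) :+ (s :* (a :+ d) :+ s′ :* a)) ≡.refl (r′ x) d s s′ ⟩
        (r′ x + d) + (s * (r′ x + d) + s′ * r′ x) ≈⟨ +-cong (last-cell (M x)) (+-congʳ (*-congˡ (last-cell (M x)))) ⟨
        r x + (s * r x + s′ * r′ x) ∎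
        where
        d : A
        d = M x (Y ∸ x)
        last-cell : ∀ f → Σ< (suc Y ∸ x) f ≈ Σ< (Y ∸ x) f + f (Y ∸ x)
        last-cell f = trans (reflexive (≡.cong (λ n → Σ< n f) (ℕP.+-∸-assoc 1 (x≤Y x h)))) (Σ<-last (Y ∸ x) f)

  module Differences (R : CommutativeRing 0ℓ 0ℓ) (q t : CommutativeRing.Carrier R) where
    open CommutativeRing R
    open Solver R using (_^_)
    open Cancel R using (Cancellable)

    q-Differs t-Differs : Set
    q-Differs = ∀ a b c d → c < a → Cancellable (q ^ a * t ^ b - q ^ c * t ^ d)
    t-Differs = ∀ a b c d → d < b → Cancellable (q ^ a * t ^ b - q ^ c * t ^ d)

  module Cancellations (R : CommutativeRing 0ℓ 0ℓ) (q t qi : CommutativeRing.Carrier R)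
    (q*qi : CommutativeRing._≈_ R (CommutativeRing._*_ R q qi) (CommutativeRing.1# R))
    (q-differs : Differences.q-Differs R q t) (t-differs : Differences.t-Differs R q t) where
    open CommutativeRing R hiding (zero) renaming (Carrier to A)
    open Solver R
    open Cancel R
    open HSums R q t qi q*qi using (uF; vF)
    open HVariants R q t qi q*qi using (Θ; Δ)

    private
      1<2 : 1 < 2
      1<2 = s≤s (s≤s z≤n)
      0<1 : ∀ {n} → 0 < suc n
      0<1 = s≤s z≤n

    Δ-cancellable : Cancellable Δ
    Δ-cancellable = *-cancellable
      (cancellable-resp (solve 2 (λ q t → q :- t := q :^ 1 :* t :^ 0 :- q :^ 0 :* t :^ 1) ≡.refl q t) (q-differs 1 0 0 1 0<1))
      (*-cancellable
        (cancellable-resp (solve 2 (λ q t → q :^ 2 :- t := q :^ 2 :* t :^ 0 :- q :^ 0 :* t :^ 1) ≡.refl q t) (q-differs 2 0 0 1 0<1))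
        (cancellable-resp (solve 2 (λ q t → q :- t :^ 2 := q :^ 1 :* t :^ 0 :- q :^ 0 :* t :^ 2) ≡.refl q t) (q-differs 1 0 0 2 0<1)))

    -- Each factor of the two Vandermonde products is a difference of two monomials. They differ in
    -- the exponent of q, except for `uF - vF`, which equals `vE - wE` and is separated by the
    -- exponent of t.
    Θ-cancellable : Cancellable Θ
    Θ-cancellable = *-cancellable (*-cancellable u-v (*-cancellable
        (cancellable-resp (solve 2 (λ q t → q :* t :- t :* (t :* t) := q :^ 1 :* t :^ 1 :- q :^ 0 :* t :^ 3) ≡.refl q t) (q-differs 1 1 0 3 0<1))
        (cancellable-resp (solve 2 (λ q t → q :* (t :* t) :- t :* (t :* t) := q :^ 1 :* t :^ 2 :- q :^ 0 :* t :^ 3) ≡.refl q t) (q-differs 1 2 0 3 0<1))))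
      (*-cancellable
        (cancellable-resp (solve 2 (λ q t → q :* (q :* q) :- q :* t := q :^ 3 :* t :^ 0 :- q :^ 1 :* t :^ 1) ≡.refl q t) (q-differs 3 0 1 1 1<3))
        (*-cancellable
          (cancellable-resp (solve 2 (λ q t → q :* (q :* q) :- q :* (t :* t) := q :^ 3 :* t :^ 0 :- q :^ 1 :* t :^ 2) ≡.refl q t) (q-differs 3 0 1 2 1<3))
          u-v))
      where
      1<3 : 1 < 3
      1<3 = s≤s (s≤s z≤n)
      u-v : Cancellable (uF - vF)
      u-v = swap-cancellable (cancellable-resp (solve 2 (λ q t → q :* (t :* t) :- q :* t := q :^ 1 :* t :^ 2 :- q :^ 1 :* t :^ 1) ≡.refl q t) (t-differs 1 2 1 1 1<2))

    module Totals (a b c : A) = HTotals.Coefficients R q t qi q*qi a b c (cancel Θ-cancellable) (cancel Δ-cancellable)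

  module Combinatorial (N : ℕ) where
    private
      module P = CommutativeRing (polyRing {N})
    open Cancel (polyRing {N}) using (Cancellable; cancellable-resp)
    open Sums (polyRing {N})
    open Ranges (polyRing {N})
    open Shapes N
    open Solver (polyRing {N}) using (_^_; solve)

    q t qi ti : Poly N
    q  = qtP (+ 1) (+ 0)
    t  = qtP (+ 0) (+ 1)
    qi = qtP (ℤ.- + 1) (+ 0)
    ti = qtP (+ 0) (ℤ.- + 1)

    q*qi : q ⊗ qi ≋ constP 1ℚ
    q*qi = P.reflexive (qtP-⊗ (+ 1) (+ 0) (ℤ.- + 1) (+ 0))

    ti*t : ti ⊗ t ≋ constP 1ℚ
    ti*t = P.reflexive (qtP-⊗ (+ 0) (ℤ.- + 1) (+ 0) (+ 1))

    open HSums (polyRing {N}) q t qi q*qi using (μ)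
    open HVariants (polyRing {N}) q t qi q*qi using (ladder)
    open HTotals (polyRing {N}) q t qi q*qi (s3 N) (s21 N) (s111 N) using (total; kindR)

    q-power : ∀ a → q ^ a ≋ qtP (+ a) (+ 0)
    q-power zero    = P.refl
    q-power (suc a) = P.trans (⊗-cong (P.refl {q}) (q-power a)) (P.reflexive (qtP-⊗ (+ 1) (+ 0) (+ a) (+ 0)))

    t-power : ∀ b → t ^ b ≋ qtP (+ 0) (+ b)
    t-power zero    = P.refl
    t-power (suc b) = P.trans (⊗-cong (P.refl {t}) (t-power b)) (P.reflexive (qtP-⊗ (+ 0) (+ 1) (+ 0) (+ b)))

    qtP-power : ∀ a b → qtP (+ a) (+ b) ≋ q ^ a ⊗ t ^ b
    qtP-power a b = P.sym (P.trans (⊗-cong (q-power a) (t-power b)) (P.reflexive (≡.trans (qtP-⊗ (+ a) (+ 0) (+ 0) (+ b)) (≡.cong (λ z → qtP (+ z) (+ b)) (ℕP.+-identityʳ a)))))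

    hSum : ℕ → Poly N
    hSum m = sumP (L.map (λ { (P , w) → weight m 3 P w ⊗ Fund N (pides m 3 P w) }) (PF m 3))

    hSum-paths : ∀ m → hSum m ≋ S (Dyck m 3) (pathSum m)
    hSum-paths m = P.trans (S-concatMap (λ P → L.map (λ w → (P , w)) (labellings 3 P)) (Dyck m 3) (λ { (P , w) → weight m 3 P w ⊗ Fund N (pides m 3 P w) }))
      (S-cong (Dyck m 3) λ P → P.reflexive (S-map (λ w → (P , w)) (labellings 3 P) (λ { (P , w) → weight m 3 P w ⊗ Fund N (pides m 3 P w) })))

    shifted : ℕ → ℕ → ℕ → Poly N
    shifted a b r = S (L.upTo r) (λ j → qtP (+ a) (+ b ℤ.- + j))

    shifted-1 : ∀ a b → shifted a b 1 ≋ q ^ a ⊗ t ^ b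
    shifted-1 a b = P.trans (P.+-identityʳ (qtP (+ a) (+ b ℤ.- + 0))) (P.trans (P.reflexive (≡.cong (qtP (+ a)) (ℤP.+-identityʳ (+ b)))) (qtP-power a b))

    qtP-back : ∀ a b i → qtP (+ a) (+ b ℤ.- + i) ≋ qtP (+ 0) (ℤ.- + i) ⊗ (q ^ a ⊗ t ^ b)
    qtP-back a b i = P.sym (P.trans (⊗-cong (P.refl {qtP (+ 0) (ℤ.- + i)}) (P.sym (qtP-power a b))) (P.reflexive (≡.trans (qtP-⊗ (+ 0) (ℤ.- + i) (+ a) (+ b)) (≡.cong (qtP (+ a)) (ℤP.+-comm (ℤ.- + i) (+ b))))))

    ti² : Poly N
    ti² = qtP (+ 0) (ℤ.- + 2)

    shifted-2 : ∀ a b → shifted a b 2 ≋ q ^ a ⊗ t ^ b ⊕ ti ⊗ (q ^ a ⊗ t ^ b)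
    shifted-2 a b = ⊕-cong (P.trans (P.reflexive (≡.cong (qtP (+ a)) (ℤP.+-identityʳ (+ b)))) (qtP-power a b)) (P.trans (P.+-identityʳ _) (qtP-back a b 1))

    shifted-3 : ∀ a b → shifted a b 3 ≋ q ^ a ⊗ t ^ b ⊕ (ti ⊗ (q ^ a ⊗ t ^ b) ⊕ ti² ⊗ (q ^ a ⊗ t ^ b))
    shifted-3 a b = ⊕-cong (P.trans (P.reflexive (≡.cong (qtP (+ a)) (ℤP.+-identityʳ (+ b)))) (qtP-power a b))
      (⊕-cong (qtP-back a b 1) (P.trans (P.+-identityʳ _) (qtP-back a b 2)))

    module Setting (m k Y : ℕ) (k-lo : 3 ℕ.* k ≤ m) (k-hi : m < 3 ℕ.* suc k) (Y-lo : 3 ℕ.* Y ≤ m ℕ.* 2) (Y-hi : m ℕ.* 2 < 3 ℕ.* suc Y)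
      (Y≤m : Y ≤ m) (k≤m : k ≤ m) (k≤Y : k ≤ Y) (bounds : RankBounds m k Y) where
      open PathKinds N m k Y k≤Y bounds

      private
        kind-R : ∀ x c → llt (kind x c) ≋ kindR k x c
        kind-R zero    zero    = P.refl
        kind-R zero    (suc c) = P.refl
        kind-R (suc x) zero    = P.refl
        kind-R (suc x) (suc c) with suc x ℕ.+ suc c ℕ.≤ᵇ k
        ... | true  = ⊕-cong (P.refl {s111 N}) (⊕-cong (P.refl {z (ℤ.- + 1) ⊗ (s21 N ⊕ s21 N)}) (⊗-cong z2 (P.refl {s3 N})))
          where
          z2 : z (ℤ.- + 2) ≋ qi ⊗ qi
          z2 = P.reflexive (≡.sym (qtP-⊗ (ℤ.- + 1) (+ 0) (ℤ.- + 1) (+ 0)))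
        ... | false = ⊕-cong (P.refl {s111 N}) (⊕-cong (P.refl {z (ℤ.- + 1) ⊗ s21 N}) (⊕-cong (⊗-cong z2 (P.refl {s21 N})) (⊗-cong z3 (P.refl {s3 N}))))
          where
          z2 : z (ℤ.- + 2) ≋ qi ⊗ qi
          z2 = P.reflexive (≡.sym (qtP-⊗ (ℤ.- + 1) (+ 0) (ℤ.- + 1) (+ 0)))
          z3 : z (ℤ.- + 3) ≋ qi ⊗ (qi ⊗ qi)
          z3 = P.trans (P.reflexive (≡.sym (qtP-⊗ (ℤ.- + 1) (+ 0) (ℤ.- + 2) (+ 0)))) (⊗-cong (P.refl {qi}) z2)

      cell : ℕ → ℕ → Poly N
      cell x c = pathSum m (path x c (m ∸ x ∸ c))

      hSum-cells : hSum m ≋ Σ< (suc k) (λ x → Σ< (suc Y ∸ x) (cell x))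
      hSum-cells = P.trans (hSum-paths m) (Dyck-sum m k Y k-lo k-hi Y-lo Y-hi Y≤m k≤m (pathSum m))

      cell-≋ : ∀ x c → x ≤ k → x ℕ.+ c ≤ Y → cell x c ≋ shifted (qExp k x c) (tExp k Y x c) (ret m 3 (path x c (m ∸ x ∸ c))) ⊗ kindR k x c
      cell-≋ x c x≤k y≤Y = P.trans (pathSum-kind x c P nx x≤k y≤Y) (⊗-cong
          (P.reflexive (≡.cong₂ (λ a b → shifted a b (ret m 3 P)) (pdinv-≡ m k Y k-lo k-hi Y-lo Y-hi Y≤m k≤m x c P nx x≤k y≤Y) (area-≡ m k Y k-lo k-hi Y-lo Y-hi Y≤m k≤m x c P nx x≤k y≤Y)))
          (kind-R x c))
        where
        P = path x c (m ∸ x ∸ c)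
        nx = northXs-path x c (m ∸ x ∸ c)

      cell-once : ∀ x c → x ≤ k → x ℕ.+ c ≤ Y → ret m 3 (path x c (m ∸ x ∸ c)) ≡ 1 → cell x c ≋ μ k Y x c ⊗ kindR k x c
      cell-once x c x≤k y≤Y r = P.trans (cell-≋ x c x≤k y≤Y) (⊗-cong
        (P.trans (P.reflexive (≡.cong (shifted (qExp k x c) (tExp k Y x c)) r)) (shifted-1 (qExp k x c) (tExp k Y x c))) (P.refl {kindR k x c}))

      fits : ∀ x c → c < suc Y ∸ x → x ℕ.+ c ≤ Y
      fits x c h = ℕP.≤-pred (<∸⇒+< (suc Y) x h)

      hSum-coprime : gcd m 3 ≡ 1 → hSum m ≋ total k Y (suc k) Y
      hSum-coprime g = P.trans hSum-cells (Σ<-cong (suc k) {λ x → Σ< (suc Y ∸ x) (cell x)} {λ x → Σ< (suc Y ∸ x) (λ y → μ k Y x y ⊗ kindR k x y)} λ { x (s≤s x≤k) →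
        Σ<-cong (suc Y ∸ x) {cell x} {λ y → μ k Y x y ⊗ kindR k x y} λ c h → cell-once x c x≤k (fits x c h) (ret-coprime m (path x c (m ∸ x ∸ c)) g) })

    monomials-q : ∀ a b c d → c < a → Cancellable (q ^ a ⊗ t ^ b P.- q ^ c ⊗ t ^ d)
    monomials-q a b c d h = cancellable-resp (P.sym (⊕-cong (qtP-power a b) (scaleP-cong -1ℚ (qtP-power c d))))
      (q-difference-cancellable (+ a) (+ b) (+ c) (+ d) (ℤ.+<+ h))

    monomials-t : ∀ a b c d → d < b → Cancellable (q ^ a ⊗ t ^ b P.- q ^ c ⊗ t ^ d)
    monomials-t a b c d h = cancellable-resp (P.sym (⊕-cong (qtP-power a b) (scaleP-cong -1ℚ (qtP-power c d))))
      (t-difference-cancellable (+ a) (+ b) (+ c) (+ d) (ℤ.+<+ h))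

    open Cancellations (polyRing {N}) q t qi q*qi monomials-q monomials-t using (Δ-cancellable; module Totals) public
    open Totals (s3 N) (s21 N) (s111 N)

    private
      -- The inequalities that place m, k and Y are linear in k; each is proved by naming the
      -- difference of its sides.
      by : ∀ {a b} d → a ℕ.+ d ≡ b → a ≤ b
      by {a} d e = ≡.subst (a ≤_) e (ℕP.m≤m+n a d)

      mod₃ : ∀ d k r → 0 < r → r < 3 → ¬ (3 ℕ.* d ≡ 3 ℕ.* k ℕ.+ r)
      mod₃ d k (suc r) _ r<3 e = ℕP.<⇒≢ (s≤s z≤n) (≡.trans (≡.sym (m*n%n≡0 d 3)) (≡.trans (≡.cong (_% 3) (≡.trans (ℕP.*-comm d 3) (≡.trans e (≡.trans (ℕP.+-comm (3 ℕ.* k) (suc r)) (≡.cong (suc r ℕ.+_) (ℕP.*-comm 3 k))))))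
        (≡.trans ([m+kn]%n≡m%n (suc r) k 3) (m<n⇒m%n≡m r<3))))
        where open import Data.Nat.DivMod using (_%_; m*n%n≡0; [m+kn]%n≡m%n; m<n⇒m%n≡m)

    hSum-1 : ∀ k → hSum (3 ℕ.* k ℕ.+ 1) ≋ ladder 1 k ⊗ s3 N ⊕ ((ladder 2 k ⊕ ladder 3 k) ⊗ s21 N ⊕ ladder 1 (suc k) ⊗ s111 N)
    hSum-1 k = P.trans (Setting.hSum-coprime m k (k ℕ.+ k) (by 1 ≡.refl) (by 1 (e₁ k)) (by 2 (e₂ k)) (by 0 (e₃ k)) (by (suc k) (e₄ k)) (by (k ℕ.+ suc k) (e₅ k)) (ℕP.m≤m+n k k)
        (Coprime.rankBounds m k (k ℕ.+ k) (gcd-1 k) (by k (e₆ k)) (ℕP.m≤m+n k k) (by 1 (e₁ k)) (by 0 (e₇ k)) (by 1 (e₈ k)) (λ d → mod₃ d k 1 (s≤s z≤n) (s≤s (s≤s z≤n)))) (gcd-1 k))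
      (P.trans (P.reflexive (≡.cong (λ Y → total k Y (suc k) (k ℕ.+ k)) (≡.sym (ℕP.+-identityʳ (k ℕ.+ k))))) (total₁ k))
      where
      m = 3 ℕ.* k ℕ.+ 1
      e₁ : ∀ k → suc (3 ℕ.* k ℕ.+ 1) ℕ.+ 1 ≡ 3 ℕ.* suc k
      e₁ = solve-∀
      e₂ : ∀ k → 3 ℕ.* (k ℕ.+ k) ℕ.+ 2 ≡ (3 ℕ.* k ℕ.+ 1) ℕ.* 2
      e₂ = solve-∀
      e₃ : ∀ k → suc ((3 ℕ.* k ℕ.+ 1) ℕ.* 2) ℕ.+ 0 ≡ 3 ℕ.* suc (k ℕ.+ k)
      e₃ = solve-∀
      e₄ : ∀ k → (k ℕ.+ k) ℕ.+ suc k ≡ 3 ℕ.* k ℕ.+ 1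
      e₄ = solve-∀
      e₅ : ∀ k → k ℕ.+ (k ℕ.+ suc k) ≡ 3 ℕ.* k ℕ.+ 1
      e₅ = solve-∀
      e₆ : ∀ k → suc (k ℕ.+ k) ℕ.+ k ≡ 3 ℕ.* k ℕ.+ 1
      e₆ = solve-∀
      e₇ : ∀ k → suc (3 ℕ.* k) ℕ.+ 0 ≡ 3 ℕ.* k ℕ.+ 1
      e₇ = solve-∀
      e₈ : ∀ k → suc (3 ℕ.* (k ℕ.+ k)) ℕ.+ 1 ≡ (3 ℕ.* k ℕ.+ 1) ℕ.* 2
      e₈ = solve-∀

    hSum-2 : ∀ k → hSum (3 ℕ.* k ℕ.+ 2) ≋ ladder 2 k ⊗ s3 N ⊕ ((ladder 3 k ⊕ ladder 1 (suc k)) ⊗ s21 N ⊕ ladder 2 (suc k) ⊗ s111 N)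
    hSum-2 k = P.trans (Setting.hSum-coprime m k (k ℕ.+ k ℕ.+ 1) (by 2 ≡.refl) (by 0 (e₁ k)) (by 1 (e₂ k)) (by 1 (e₃ k)) (by (suc k) (e₄ k)) (by (k ℕ.+ k ℕ.+ 2) (e₅ k)) k≤Y
        (Coprime.rankBounds m k (k ℕ.+ k ℕ.+ 1) (gcd-2 k) (by k (e₆ k)) k≤Y (by 0 (e₁ k)) (by 1 (e₇ k)) (by 0 (e₈ k)) (λ d → mod₃ d k 2 (s≤s z≤n) (s≤s (s≤s (s≤s z≤n))))) (gcd-2 k))
      (total₂ k)
      where
      m = 3 ℕ.* k ℕ.+ 2
      k≤Y : k ≤ k ℕ.+ k ℕ.+ 1
      k≤Y = ℕP.≤-trans (ℕP.m≤m+n k k) (ℕP.m≤m+n (k ℕ.+ k) 1)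
      e₁ : ∀ k → suc (3 ℕ.* k ℕ.+ 2) ℕ.+ 0 ≡ 3 ℕ.* suc k
      e₁ = solve-∀
      e₂ : ∀ k → 3 ℕ.* (k ℕ.+ k ℕ.+ 1) ℕ.+ 1 ≡ (3 ℕ.* k ℕ.+ 2) ℕ.* 2
      e₂ = solve-∀
      e₃ : ∀ k → suc ((3 ℕ.* k ℕ.+ 2) ℕ.* 2) ℕ.+ 1 ≡ 3 ℕ.* suc (k ℕ.+ k ℕ.+ 1)
      e₃ = solve-∀
      e₄ : ∀ k → (k ℕ.+ k ℕ.+ 1) ℕ.+ suc k ≡ 3 ℕ.* k ℕ.+ 2
      e₄ = solve-∀
      e₅ : ∀ k → k ℕ.+ (k ℕ.+ k ℕ.+ 2) ≡ 3 ℕ.* k ℕ.+ 2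
      e₅ = solve-∀
      e₆ : ∀ k → suc (k ℕ.+ k ℕ.+ 1) ℕ.+ k ≡ 3 ℕ.* k ℕ.+ 2
      e₆ = solve-∀
      e₇ : ∀ k → suc (3 ℕ.* k) ℕ.+ 1 ≡ 3 ℕ.* k ℕ.+ 2
      e₇ = solve-∀
      e₈ : ∀ k → suc (3 ℕ.* (k ℕ.+ k ℕ.+ 1)) ℕ.+ 0 ≡ (3 ℕ.* k ℕ.+ 2) ℕ.* 2
      e₈ = solve-∀

    module Triple (n : ℕ) where
      private
        k = suc n
        m = 3 ℕ.* k
        Y = 2 ℕ.* k
        M : ℕ → ℕ → Poly N
        M x c = μ k Y x c ⊗ kindR k x c

        k≤Y : k ≤ Y
        k≤Y = ℕP.m≤m+n k (k ℕ.+ 0)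

        Ym : Y ℕ.+ k ≡ m
        Ym = lem k
          where
          lem : ∀ k → 2 ℕ.* k ℕ.+ k ≡ 3 ℕ.* k
          lem = solve-∀

        double : ∀ k → 3 ℕ.* (2 ℕ.* k) ℕ.+ 0 ≡ (3 ℕ.* k) ℕ.* 2
        double = solve-∀

        double< : ∀ k → suc ((3 ℕ.* k) ℕ.* 2) ℕ.+ 2 ≡ 3 ℕ.* suc (2 ℕ.* k)
        double< = solve-∀

        next< : ∀ k → suc (3 ℕ.* k) ℕ.+ 2 ≡ 3 ℕ.* suc k
        next< = solve-∀

        open Setting m k Y ℕP.≤-refl (by 2 (next< k)) (by 0 (double k)) (by 2 (double< k)) (by k Ym) (ℕP.m≤n*m k 3) k≤Y (Multiple.rankBounds n)

        many : ∀ x c r {p} → x ≤ k → x ℕ.+ c ≤ Y → ret m 3 (path x c (m ∸ x ∸ c)) ≡ r →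
               shifted (qExp k x c) (tExp k Y x c) r ⊗ kindR k x c ≋ p → cell x c ≋ p
        many x c r x≤k y≤Y e h = P.trans (cell-≋ x c x≤k y≤Y) (P.trans (P.reflexive (≡.cong (λ r → shifted (qExp k x c) (tExp k Y x c) r ⊗ kindR k x c) e)) h)

        last : ∀ y → y < suc Y ∸ k → cell k y ≋ M k y
        last y h = cell-once k y ℕP.≤-refl (fits k y h) (ret-1 n k y (m ∸ k ∸ y) ≡.refl)

        interior : ∀ x → x < k → ∀ y → y < Y ∸ x → cell x y ≋ M x y ⊕ (ti ⊗ M x y ⊕ ti² ⊗ M x y)
        interior x x<k y h = many x y 3 (ℕP.<⇒≤ x<k) (ℕP.<⇒≤ (<∸⇒+< Y x h)) (ret-3 n x y (m ∸ x ∸ y) x<k (<∸⇒+< Y x h))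
          (P.trans (⊗-cong (shifted-3 (qExp k x y) (tExp k Y x y)) (P.refl {kindR k x y}))
            (solve 4 (λ g l s s′ → (g :+ (s :* g :+ s′ :* g)) :* l := g :* l :+ (s :* (g :* l) :+ s′ :* (g :* l))) ≡.refl (μ k Y x y) (kindR k x y) ti ti²))

        diagonal : ∀ x → x < k → cell x (Y ∸ x) ≋ M x (Y ∸ x) ⊕ ti ⊗ M x (Y ∸ x)
        diagonal x x<k = many x (Y ∸ x) 2 (ℕP.<⇒≤ x<k) (ℕP.≤-reflexive meets) (ret-2 n x (Y ∸ x) (m ∸ x ∸ (Y ∸ x)) x<k meets)
          (P.trans (⊗-cong (shifted-2 (qExp k x (Y ∸ x)) (tExp k Y x (Y ∸ x))) (P.refl {kindR k x (Y ∸ x)}))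
            (solve 3 (λ g l s → (g :+ s :* g) :* l := g :* l :+ s :* (g :* l)) ≡.refl (μ k Y x (Y ∸ x)) (kindR k x (Y ∸ x)) ti))
          where
          meets : x ℕ.+ (Y ∸ x) ≡ Y
          meets = ℕP.m+[n∸m]≡n (ℕP.≤-trans (ℕP.<⇒≤ x<k) k≤Y)

        -- The row x = k consists of the paths through (k , 1). In the other rows the last cell, x +
        -- c = 2k, is the path through (2k , 2), and the remaining cells return only at the end.
        by-return : hSum m ≋ total k Y (suc k) Y ⊕ (ti ⊗ total k Y k Y ⊕ ti² ⊗ Σ< k (λ x → Σ< (Y ∸ x) (M x)))
        by-return = P.trans hSum-cells (RetSum.return-sum (polyRing {N}) k Y ti ti² cell M (λ x h → ℕP.≤-trans (ℕP.<⇒≤ h) k≤Y) last interior diagonal)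

        Y≡ : Y ≡ k ℕ.+ k
        Y≡ = ≡.cong (k ℕ.+_) (ℕP.+-identityʳ k)

        Y≡₀ : Y ≡ k ℕ.+ k ℕ.+ 0
        Y≡₀ = ≡.sym (ℕP.+-assoc k k 0)

        Y≡suc : Y ≡ suc (k ℕ.+ n)
        Y≡suc = ≡.trans Y≡ (ℕP.+-suc k n)

      -- The restricted totals carry factors t and t^2, which cancel the 1/t and 1/t^2 of the return
      -- weights. The term subtracted in the coefficient of s21 comes from `total₃`.
      hSum-0 : hSum m ≋ (ladder 1 k ⊕ (ladder 3 n ⊕ ladder 2 n)) ⊗ s3 N
        ⊕ (((ladder 2 k ⊕ ladder 3 k) ⊕ (((ladder 1 k ⊕ ladder 2 k) P.- (q ^ n ⊗ t ^ n)) ⊕ (ladder 3 n ⊕ ladder 1 k))) ⊗ s21 N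
        ⊕ (ladder 1 (suc k) ⊕ (ladder 3 k ⊕ ladder 2 k)) ⊗ s111 N)
      hSum-0 = P.trans by-return (P.trans (⊕-cong
          (P.trans (P.reflexive (≡.cong₂ (λ Y Y′ → total k Y (suc k) Y′) Y≡₀ Y≡)) (total₁ k))
          (⊕-cong (⊗-cong (P.refl {ti}) (P.trans (P.reflexive (≡.cong₂ (λ Y Y′ → total k Y k Y′) Y≡₀ Y≡)) (total₃ n)))
                  (⊗-cong (P.refl {ti²}) (P.trans (P.reflexive (≡.cong₂ (λ Y Y′ → Σ< k (λ x → Σ< (Y′ ∸ x) (λ c → μ k Y x c ⊗ kindR k x c))) Y≡₀ Y≡suc)) (total₄ n)))))
        (P.trans (⊕-cong (P.refl {T₁}) (⊕-cong (drop ti t ti*t (ladder 3 n) G₃ (ladder 3 k)) (drop ti² (t ^ 2) ti²*t² (ladder 2 n) (ladder 3 n ⊕ ladder 1 k) (ladder 2 k))))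
          (solve 12 (λ a b c x y z u v w r s l → (x :* a :+ (y :* b :+ z :* c)) :+ ((u :* a :+ (v :* b :+ w :* c)) :+ (r :* a :+ (s :* b :+ l :* c)))
              := (x :+ (u :+ r)) :* a :+ ((y :+ (v :+ s)) :* b :+ (z :+ (w :+ l)) :* c)) ≡.refl (s3 N) (s21 N) (s111 N)
            (ladder 1 k) (ladder 2 k ⊕ ladder 3 k) (ladder 1 (suc k)) (ladder 3 n) G₃ (ladder 3 k) (ladder 2 n) (ladder 3 n ⊕ ladder 1 k) (ladder 2 k))))
        where
        T₁ G₃ : Poly N
        T₁ = ladder 1 k ⊗ s3 N ⊕ ((ladder 2 k ⊕ ladder 3 k) ⊗ s21 N ⊕ ladder 1 (suc k) ⊗ s111 N)
        G₃ = (ladder 1 k ⊕ ladder 2 k) P.- (q ^ n ⊗ t ^ n)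
        ti²*t² : ti² ⊗ t ^ 2 ≋ constP 1ℚ
        ti²*t² = P.trans (⊗-cong (P.refl {ti²}) (t-power 2)) (P.reflexive (qtP-⊗ (+ 0) (ℤ.- + 2) (+ 0) (+ 2)))
        drop : ∀ s r → s ⊗ r ≋ constP 1ℚ → ∀ x y z →
               s ⊗ ((r ⊗ x) ⊗ s3 N ⊕ ((r ⊗ y) ⊗ s21 N ⊕ (r ⊗ z) ⊗ s111 N)) ≋ x ⊗ s3 N ⊕ (y ⊗ s21 N ⊕ z ⊗ s111 N)
        drop s r e x y z = P.trans (solve 8 (λ s r a b c x y z → s :* ((r :* x) :* a :+ ((r :* y) :* b :+ (r :* z) :* c)) := s :* r :* (x :* a :+ (y :* b :+ z :* c))) ≡.refl s r (s3 N) (s21 N) (s111 N) x y z)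
          (P.trans (⊗-cong e (P.refl {x ⊗ s3 N ⊕ (y ⊗ s21 N ⊕ z ⊗ s111 N)})) (P.*-identityˡ _))

-- The Schur expansions of the theorem as ladders

module SchurSide where
  open RingSolve
  open PolynomialRing
  open SymmetricSums using (module Sums)
  open Paths using (module Ranges)
  open Ladders
  open CombinatorialSide
  open import Data.Integer using (+_)
  open import Data.Nat using (_<_; _≤_; s≤s; z≤n; _∸_)

  ≤ℤᵇ-true : ∀ {a b} → a ℤ.≤ b → (a ≤ℤᵇ b) ≡ true
  ≤ℤᵇ-true {a} {b} h with a ℤP.≤? b
  ... | yes _  = ≡.refl
  ... | no a≰b = contradiction h a≰b

  ≤ℤᵇ-false : ∀ {a b} → ¬ (a ℤ.≤ b) → (a ≤ℤᵇ b) ≡ false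
  ≤ℤᵇ-false {a} {b} h with a ℤP.≤? b
  ... | yes a≤b = contradiction a≤b h
  ... | no _    = ≡.refl

  module LadderSum (R : CommutativeRing 0ℓ 0ℓ) (q t qi : CommutativeRing.Carrier R)
    (q*qi : CommutativeRing._≈_ R (CommutativeRing._*_ R q qi) (CommutativeRing.1# R)) where
    open CommutativeRing R hiding (zero) renaming (Carrier to A)
    open Solver R
    open Sums R
    open Ranges R
    open HVariants R q t qi q*qi using (br; ladder)
    open import Relation.Binary.Reasoning.Setoid setoid

    upTo-Σ : ∀ n (f : ℕ → A) → S (L.upTo n) f ≈ Σ< n f
    upTo-Σ n f = go n (λ i → i)
      where
      go : ∀ n (h : ℕ → ℕ) → S (L.applyUpTo h n) f ≈ Σ< n (λ i → f (h i))
      go zero    h = refl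
      go (suc n) h = +-congˡ (go n (λ i → h (suc i)))

    ^-distrib : ∀ n → (q * t) ^ n ≈ q ^ n * t ^ n
    ^-distrib zero    = sym (*-identityˡ 1#)
    ^-distrib (suc n) = trans (*-congˡ (^-distrib n)) (solve 4 (λ q t Q T → q :* t :* (Q :* T) := q :* Q :* (t :* T)) ≡.refl q t (q ^ n) (t ^ n))

    br-Σ : ∀ n → br n ≈ Σ< n (λ j → q ^ j * t ^ (n ∸ 1 ∸ j))
    br-Σ zero    = refl
    br-Σ (suc n) = begin
      q * br n + t ^ n
        ≈⟨ +-congʳ (trans (*-congˡ (br-Σ n)) (sym (Σ<-*ˡ n q _))) ⟩
      Σ< n (λ j → q * (q ^ j * t ^ (n ∸ 1 ∸ j))) + t ^ n
        ≈⟨ +-cong (Σ<-cong n λ j _ → trans (sym (*-assoc q (q ^ j) _)) (*-congˡ (reflexive (≡.cong (t ^_) (ℕP.∸-+-assoc n 1 j))))) (sym (*-identityˡ _)) ⟩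
      Σ< n (λ j → q ^ suc j * t ^ (n ∸ suc j)) + q ^ 0 * t ^ n
        ≈⟨ +-comm _ _ ⟩
      _ ∎

    term : ℕ → ℕ → ℕ → A
    term s k j = (q * t) ^ (k ∸ suc j) * br (3 ℕ.* j ℕ.+ s)

    ladder-Σ : ∀ s k → ladder s k ≈ Σ< k (term s k)
    ladder-Σ s zero    = refl
    ladder-Σ s (suc k) = begin
      q * t * ladder s k + br (3 ℕ.* k ℕ.+ s)
        ≈⟨ +-cong (trans (*-congˡ (ladder-Σ s k)) (sym (Σ<-*ˡ k (q * t) _))) (sym (trans (*-congʳ (reflexive (≡.cong ((q * t) ^_) (ℕP.n∸n≡0 k)))) (*-identityˡ _))) ⟩
      Σ< k (λ j → q * t * term s k j) + term s (suc k) k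
        ≈⟨ +-congʳ (Σ<-cong k λ j j<k → trans (sym (*-assoc _ _ _)) (*-congʳ (reflexive (≡.cong ((q * t) ^_) (≡.sym (ℕP.+-∸-assoc 1 j<k)))))) ⟩
      Σ< k (term s (suc k)) + term s (suc k) k
        ≈⟨ Σ<-last k (term s (suc k)) ⟨
      _ ∎

    term-suc : ∀ s k j → term s (suc k) (suc j) ≈ term (3 ℕ.+ s) k j
    term-suc s k j = *-congˡ (reflexive (≡.cong br (lem j s)))
      where
      lem : ∀ j s → 3 ℕ.* suc j ℕ.+ s ≡ 3 ℕ.* j ℕ.+ (3 ℕ.+ s)
      lem j s = ≡.trans (≡.cong (ℕ._+ s) (≡.trans (ℕP.*-suc 3 j) (ℕP.+-comm 3 (3 ℕ.* j)))) (ℕP.+-assoc (3 ℕ.* j) 3 s)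

    -- Splitting off i = 0 turns [3i + s] into [3i + (3 + s)], so the shifted sums over i ≥ 1 in the
    -- case of multiples of 3 appear as `term` with larger s.
    ladder-head : ∀ s n → ladder s (suc n) ≈ (q * t) ^ n * br s + Σ< n (term (3 ℕ.+ s) n)
    ladder-head s n = trans (ladder-Σ s (suc n)) (+-congˡ (Σ<-cong n λ j _ → term-suc s n j))

    -- For sums whose first pair has a < b and therefore contributes 0; the rest is a ladder with
    -- one rung fewer.
    ladder-tail : ∀ s n {f} → f 0 ≈ 0# → (∀ j → j < n → f (suc j) ≈ term s n j) → Σ< (suc n) f ≈ ladder s n
    ladder-tail s n {f} z h = trans (+-cong z (Σ<-cong n {λ i → f (suc i)} {term s n} h)) (trans (+-identityˡ _) (sym (ladder-Σ s n)))

    ladder-by : ∀ s k {f} → (∀ j → j < k → f j ≈ term s k j) → Σ< k f ≈ ladder s k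
    ladder-by s k {f} h = trans (Σ<-cong k {f} {term s k} h) (sym (ladder-Σ s k))

    Σ<-add₃ : ∀ k f g h → Σ< k (λ j → f j + (g j + h j)) ≈ Σ< k f + (Σ< k g + Σ< k h)
    Σ<-add₃ k f g h = trans (Σ<-add k f (λ j → g j + h j)) (+-congˡ (Σ<-add k g h))

    Σ<-add₄ : ∀ k e f g h → Σ< k (λ j → e j + (f j + (g j + h j))) ≈ Σ< k e + (Σ< k f + (Σ< k g + Σ< k h))
    Σ<-add₄ k e f g h = trans (Σ<-add k e (λ j → f j + (g j + h j))) (+-congˡ (Σ<-add₃ k f g h))

    -- The left side lists the terms of the s21 coefficient with i = 0 apart from the others. The
    -- two copies of `ladder 1 (suc n)` on the right would count s_(k-1,k-1), for k = n + 1, once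
    -- too often; the subtracted q^n t^n is that extra copy.
    middle : ∀ n →
      ((q * t) ^ n * br 3 + (((q * t) ^ n * br 2 + (q * t) ^ n * br 2) + ((q * t) ^ n * br 1
        + (Σ< n (term 3 n) + ((Σ< n (term 4 n) + Σ< n (term 4 n)) + ((Σ< n (term 5 n) + Σ< n (term 5 n)) + Σ< n (term 6 n)))))))
      ≈ (ladder 2 (suc n) + ladder 3 (suc n)) + ((ladder 1 (suc n) + ladder 2 (suc n) - q ^ n * t ^ n) + (ladder 3 n + ladder 1 (suc n)))
    middle n = begin
      _ ≈⟨ solve 8 (λ x b₁ b₂ b₃ s₃ s₄ s₅ s₆ → x :* b₃ :+ ((x :* b₂ :+ x :* b₂) :+ (x :* b₁ :+ (s₃ :+ ((s₄ :+ s₄) :+ ((s₅ :+ s₅) :+ s₆)))))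
             := ((x :* b₂ :+ s₅) :+ (x :* b₃ :+ s₆)) :+ (((x :* b₁ :+ s₄) :+ (x :* b₂ :+ s₅) :- x :* b₁) :+ (s₃ :+ (x :* b₁ :+ s₄)))) ≡.refl
             ((q * t) ^ n) (br 1) (br 2) (br 3) (Σ< n (term 3 n)) (Σ< n (term 4 n)) (Σ< n (term 5 n)) (Σ< n (term 6 n)) ⟩
      _ ≈⟨ +-cong (+-cong (ladder-head 2 n) (ladder-head 3 n)) (+-cong (+-cong (+-cong (ladder-head 1 n) (ladder-head 2 n)) (-‿cong power)) (+-cong (ladder-Σ 3 n) (ladder-head 1 n))) ⟨
      _ ∎
      where
      power : q ^ n * t ^ n ≈ (q * t) ^ n * br 1
      power = trans (sym (^-distrib n)) (solve 2 (λ q x → x := x :* (q :* :0 :+ :1)) ≡.refl q ((q * t) ^ n))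

  module Values (N : ℕ) where
    private
      module P = CommutativeRing (polyRing {N})
    open Sums (polyRing {N})
    open Ranges (polyRing {N})
    module PS = Solver (polyRing {N})
    open PS using (_^_)
    open Combinatorial N using (q; t; qi; q*qi; qtP-power)
    open HVariants (polyRing {N}) q t qi q*qi using (br; ladder)
    open LadderSum (polyRing {N}) q t qi q*qi

    qtNum-br : ∀ n → qtNum n ≋ br n
    qtNum-br n = P.trans (upTo-Σ n (λ j → qtP (+ j) (+ (n ∸ 1 ∸ j)))) (P.trans (Σ<-cong n λ j _ → qtP-power j (n ∸ 1 ∸ j)) (P.sym (br-Σ n)))

    -- With b = d and a = d + l the definition gives (qt)^d [l + 1], the shape of a rung of a
    -- ladder.
    sqt-hit : ∀ {a b} d l → b ≡ + d → a ≡ b ℤ.+ + l → sqt a b ≋ (q ⊗ t) ^ d ⊗ br (suc l)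
    sqt-hit d l ≡.refl ≡.refl = P.trans (P.reflexive (≡.cong₂ (λ c n → if c then qtP (+ d) (+ d) ⊗ qtNum n else [])
        (≡.cong₂ _∧_ (≤ℤᵇ-true {+ 0} {+ d} (ℤ.+≤+ z≤n)) (≤ℤᵇ-true {+ d} {+ d ℤ.+ + l} (ℤ.+≤+ (ℕP.m≤m+n d l))))
        (≡.cong ℤ.∣_∣ (ZS.solve 2 (λ d l → d :+ l :- d :+ :1 := :1 :+ l) ≡.refl (+ d) (+ l)))))
      (⊗-cong {p = qtP (+ d) (+ d)} (P.trans (qtP-power d d) (P.sym (^-distrib d))) (qtNum-br (suc l)))
      where module ZS = Solver ℤP.+-*-commutativeRing

    sqt-miss : ∀ a b → a ℤ.< b → sqt {N} a b ≡ []
    sqt-miss a b h with + 0 ≤ℤᵇ b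
    ... | false = ≡.refl
    ... | true rewrite ≤ℤᵇ-false (ℤP.<⇒≱ h) = ≡.refl

    two-≋ : ∀ (p : Poly N) → two p ≋ p ⊕ p
    two-≋ p = ∫-≋ λ g → ≡.trans (∫-scaleP (+ 2 ℚ./ 1) p g) (≡.trans (QS.solve 1 (λ x → (:1 :+ :1) :* x := x :+ x) ≡.refl (∫ p g)) (≡.sym (∫-++ p p g)))
      where module QS = Solver ℚP.+-*-commutativeRing

    private
      module ZS = Solver ℤP.+-*-commutativeRing
      open ZS using () renaming (solve to solveℤ)

      diff : ∀ {m k} → m ≤ k → + k ℤ.- + m ≡ + (k ∸ m)
      diff {m} {k} h = ≡.trans (ℤP.m-n≡m⊖n k m) (ℤP.⊖-≥ h)

      :2 :3 :3* : ∀ {n} → Expr n → Expr n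
      :2 x = (:1 :+ :1) :* x
      :3 x = :1 :+ (:1 :+ (:1 :+ x))
      :3* j = j :+ (j :+ (j :+ :0))

      -- 3 * j + suc s is the normal form that term expects of suc (3 * j + s).
      hit : ∀ {a b} k j s → suc j ≤ k → b ≡ + k ℤ.- + suc j → a ≡ b ℤ.+ + (3 ℕ.* j ℕ.+ s) → sqt a b ≋ term (suc s) k j
      hit k j s h e f = P.trans (sqt-hit (k ∸ suc j) (3 ℕ.* j ℕ.+ s) (≡.trans e (diff h)) f)
        (P.reflexive (≡.cong (λ n → (q ⊗ t) ^ (k ∸ suc j) ⊗ br n) (≡.sym (ℕP.+-suc (3 ℕ.* j) s))))

      miss : ∀ a {b} d → b ≡ a ℤ.+ + suc d → sqt {N} a b ≋ []
      miss a d ≡.refl = P.reflexive (sqt-miss a _ (≡.subst (ℤ._< a ℤ.+ + suc d) (ℤP.+-identityʳ a) (ℤP.+-monoʳ-< a (ℤ.+<+ (s≤s z≤n)))))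

    ΣZ-Σ : ∀ lo hi f n → hi ℤ.+ + 1 ℤ.- lo ≡ + n → ΣZ lo hi f ≋ Σ< n (λ j → f (lo ℤ.+ + j))
    ΣZ-Σ lo hi f n e = P.trans (P.reflexive (≡.cong (λ m → S (L.upTo m) (λ j → f (lo ℤ.+ + j))) (≡.trans (≡.cong (λ z → ℤ.∣ z ℤ.⊔ + 0 ∣) e) (ℕP.⊔-identityʳ n))))
      (upTo-Σ n (λ j → f (lo ℤ.+ + j)))

    private
      below : ∀ k → + k ℤ.- + 1 ℤ.+ + 1 ℤ.- + 0 ≡ + k
      below k = solveℤ 1 (λ k → k :- :1 :+ :1 :- :0 := k) ≡.refl (+ k)

      upto : ∀ k → + k ℤ.+ + 1 ℤ.- + 0 ≡ + suc k
      upto k = solveℤ 1 (λ k → k :+ :1 :- :0 := :1 :+ k) ≡.refl (+ k)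

      b₁ : ∀ k j → + k ℤ.- (+ 0 ℤ.+ + j) ℤ.- + 1 ≡ + k ℤ.- + suc j
      b₁ k j = solveℤ 2 (λ k j → k :- (:0 :+ j) :- :1 := k :- (:1 :+ j)) ≡.refl (+ k) (+ j)

      b₀ : ∀ k j → + k ℤ.- (+ 0 ℤ.+ + j) ≡ + suc k ℤ.- + suc j
      b₀ k j = solveℤ 2 (λ k j → k :- (:0 :+ j) := (:1 :+ k) :- (:1 :+ j)) ≡.refl (+ k) (+ j)

      e : ∀ {n} → Expr n → Expr n → Expr n → Expr n
      e k j c = k :+ :2 (:0 :+ j) :+ c

    RHS₁-ladder : ∀ k → RHS₁ N k ≋ ladder 1 k ⊗ s3 N ⊕ ((ladder 2 k ⊕ ladder 3 k) ⊗ s21 N ⊕ ladder 1 (suc k) ⊗ s111 N)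
    RHS₁-ladder k = ⊕-cong (⊗-cong c₃ (P.refl {s3 N})) (⊕-cong (⊗-cong c₂₁ (P.refl {s21 N})) (⊗-cong c₁₁₁ (P.refl {s111 N})))
      where
      κ = + k
      c₃ = P.trans (ΣZ-Σ (+ 0) (κ ℤ.- + 1) (λ i → sqt (κ ℤ.+ + 2 ℤ.* i ℤ.- + 1) (κ ℤ.- i ℤ.- + 1)) k (below k))
        (ladder-by 1 k λ j j<k → hit k j 0 j<k (b₁ k j) (solveℤ 2 (λ k j → e k j (:- :1) := (k :- (:0 :+ j) :- :1) :+ (:3* j :+ :0)) ≡.refl κ (+ j)))
      f g : ℕ → Poly N
      f j = sqt (κ ℤ.+ + 2 ℤ.* (+ 0 ℤ.+ + j)) (κ ℤ.- (+ 0 ℤ.+ + j) ℤ.- + 1)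
      g j = sqt (κ ℤ.+ + 2 ℤ.* (+ 0 ℤ.+ + j) ℤ.+ + 1) (κ ℤ.- (+ 0 ℤ.+ + j) ℤ.- + 1)
      c₂₁ = P.trans (ΣZ-Σ (+ 0) (κ ℤ.- + 1) (λ i → sqt (κ ℤ.+ + 2 ℤ.* i) (κ ℤ.- i ℤ.- + 1) ⊕ sqt (κ ℤ.+ + 2 ℤ.* i ℤ.+ + 1) (κ ℤ.- i ℤ.- + 1)) k (below k))
        (P.trans (Σ<-add k f g) (⊕-cong
          (ladder-by 2 k λ j j<k → hit k j 1 j<k (b₁ k j) (solveℤ 2 (λ k j → k :+ :2 (:0 :+ j) := (k :- (:0 :+ j) :- :1) :+ (:3* j :+ :1)) ≡.refl κ (+ j)))
          (ladder-by 3 k λ j j<k → hit k j 2 j<k (b₁ k j) (solveℤ 2 (λ k j → e k j :1 := (k :- (:0 :+ j) :- :1) :+ (:3* j :+ (:1 :+ :1))) ≡.refl κ (+ j)))))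
      c₁₁₁ = P.trans (ΣZ-Σ (+ 0) κ (λ i → sqt (κ ℤ.+ + 2 ℤ.* i) (κ ℤ.- i)) (suc k) (upto k))
        (ladder-by 1 (suc k) λ j j<k → hit (suc k) j 0 j<k (b₀ k j) (solveℤ 2 (λ k j → k :+ :2 (:0 :+ j) := (k :- (:0 :+ j)) :+ (:3* j :+ :0)) ≡.refl κ (+ j)))

    RHS₂-ladder : ∀ k → RHS₂ N k ≋ ladder 2 k ⊗ s3 N ⊕ ((ladder 3 k ⊕ ladder 1 (suc k)) ⊗ s21 N ⊕ ladder 2 (suc k) ⊗ s111 N)
    RHS₂-ladder k = ⊕-cong (⊗-cong c₃ (P.refl {s3 N})) (⊕-cong (⊗-cong c₂₁ (P.refl {s21 N})) (⊗-cong c₁₁₁ (P.refl {s111 N})))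
      where
      κ = + k
      c₃ = P.trans (ΣZ-Σ (+ 0) (κ ℤ.- + 1) (λ i → sqt (κ ℤ.+ + 2 ℤ.* i) (κ ℤ.- i ℤ.- + 1)) k (below k))
        (ladder-by 2 k λ j j<k → hit k j 1 j<k (b₁ k j) (solveℤ 2 (λ k j → k :+ :2 (:0 :+ j) := (k :- (:0 :+ j) :- :1) :+ (:3* j :+ :1)) ≡.refl κ (+ j)))
      f g : ℕ → Poly N
      f j = sqt (κ ℤ.+ + 2 ℤ.* (ℤ.- + 1 ℤ.+ + j) ℤ.+ + 1) (κ ℤ.- (ℤ.- + 1 ℤ.+ + j) ℤ.- + 1)
      g j = sqt (κ ℤ.+ + 2 ℤ.* (ℤ.- + 1 ℤ.+ + j) ℤ.+ + 2) (κ ℤ.- (ℤ.- + 1 ℤ.+ + j) ℤ.- + 1)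
      b₋₁ : ∀ j → κ ℤ.- (ℤ.- + 1 ℤ.+ + j) ℤ.- + 1 ≡ + suc k ℤ.- + suc j
      b₋₁ j = solveℤ 2 (λ k j → k :- (:- :1 :+ j) :- :1 := (:1 :+ k) :- (:1 :+ j)) ≡.refl κ (+ j)
      c₂₁ = P.trans (ΣZ-Σ (ℤ.- + 1) (κ ℤ.- + 1) (λ i → sqt (κ ℤ.+ + 2 ℤ.* i ℤ.+ + 1) (κ ℤ.- i ℤ.- + 1) ⊕ sqt (κ ℤ.+ + 2 ℤ.* i ℤ.+ + 2) (κ ℤ.- i ℤ.- + 1)) (suc k)
          (solveℤ 1 (λ k → k :- :1 :+ :1 :- (:- :1) := :1 :+ k) ≡.refl κ))
        (P.trans (Σ<-add (suc k) f g) (⊕-cong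
          -- The term with i = -1 is s_(k-1,k), which vanishes.
          (ladder-tail 3 k {f} (miss (κ ℤ.+ + 2 ℤ.* (ℤ.- + 1 ℤ.+ + 0) ℤ.+ + 1) 0 (solveℤ 1 (λ k → k :- (:- :1 :+ :0) :- :1 := (k :+ :2 (:- :1 :+ :0) :+ :1) :+ :1) ≡.refl κ))
            (λ j j<k → hit k j 2 j<k (solveℤ 2 (λ k j → k :- (:- :1 :+ (:1 :+ j)) :- :1 := k :- (:1 :+ j)) ≡.refl κ (+ j))
              (solveℤ 2 (λ k j → k :+ :2 (:- :1 :+ (:1 :+ j)) :+ :1 := (k :- (:- :1 :+ (:1 :+ j)) :- :1) :+ (:3* j :+ (:1 :+ :1))) ≡.refl κ (+ j))))
          (ladder-by 1 (suc k) {g} λ j j<k → hit (suc k) j 0 j<k (b₋₁ j)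
            (solveℤ 2 (λ k j → k :+ :2 (:- :1 :+ j) :+ (:1 :+ :1) := (k :- (:- :1 :+ j) :- :1) :+ (:3* j :+ :0)) ≡.refl κ (+ j)))))
      c₁₁₁ = P.trans (ΣZ-Σ (+ 0) κ (λ i → sqt (κ ℤ.+ + 2 ℤ.* i ℤ.+ + 1) (κ ℤ.- i)) (suc k) (upto k))
        (ladder-by 2 (suc k) λ j j<k → hit (suc k) j 1 j<k (b₀ k j) (solveℤ 2 (λ k j → e k j :1 := (k :- (:0 :+ j)) :+ (:3* j :+ :1)) ≡.refl κ (+ j)))

    RHS₀-ladder : ∀ n → let k = suc n in RHS₀ N k ≋ (ladder 1 k ⊕ (ladder 3 n ⊕ ladder 2 n)) ⊗ s3 N
        ⊕ (((ladder 2 k ⊕ ladder 3 k) ⊕ (((ladder 1 k ⊕ ladder 2 k) P.- (q ^ n ⊗ t ^ n)) ⊕ (ladder 3 n ⊕ ladder 1 k))) ⊗ s21 N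
        ⊕ (ladder 1 (suc k) ⊕ (ladder 3 k ⊕ ladder 2 k)) ⊗ s111 N)
    RHS₀-ladder n = ⊕-cong (⊗-cong c₃ (P.refl {s3 N})) (⊕-cong (⊗-cong c₂₁ (P.refl {s21 N})) (⊗-cong c₁₁₁ (P.refl {s111 N})))
      where
      k = suc n
      κ = + k
      open PS using () renaming (solve to solveP)
      rev : ∀ x y z → x ⊕ (y ⊕ z) ≋ z ⊕ (y ⊕ x)
      rev x y z = solveP 3 (λ x y z → x :+ (y :+ z) := z :+ (y :+ x)) ≡.refl x y z
      f g h : ℕ → Poly N
      f j = sqt (κ ℤ.+ + 2 ℤ.* (+ 0 ℤ.+ + j) ℤ.- + 3) (κ ℤ.- (+ 0 ℤ.+ + j) ℤ.- + 1)
      g j = sqt (κ ℤ.+ + 2 ℤ.* (+ 0 ℤ.+ + j) ℤ.- + 2) (κ ℤ.- (+ 0 ℤ.+ + j) ℤ.- + 1)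
      h j = sqt (κ ℤ.+ + 2 ℤ.* (+ 0 ℤ.+ + j) ℤ.- + 1) (κ ℤ.- (+ 0 ℤ.+ + j) ℤ.- + 1)
      c₃ = P.trans (ΣZ-Σ (+ 0) (κ ℤ.- + 1) (λ i → sqt (κ ℤ.+ + 2 ℤ.* i ℤ.- + 3) (κ ℤ.- i ℤ.- + 1) ⊕ sqt (κ ℤ.+ + 2 ℤ.* i ℤ.- + 2) (κ ℤ.- i ℤ.- + 1) ⊕ sqt (κ ℤ.+ + 2 ℤ.* i ℤ.- + 1) (κ ℤ.- i ℤ.- + 1)) k (below k))
        (P.trans (Σ<-add₃ k f g h) (P.trans (⊕-cong
          -- For i = 0 this is s_(k-3,k-1), which vanishes, as does s_(k-2,k-1) in the next sum.
          (ladder-tail 2 n {f} (miss (κ ℤ.+ + 2 ℤ.* (+ 0 ℤ.+ + 0) ℤ.- + 3) 1 (solveℤ 1 (λ k → k :- (:0 :+ :0) :- :1 := (k :+ :2 (:0 :+ :0) :- :3 :0) :+ (:1 :+ :1)) ≡.refl κ))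
            (λ j j<n → hit n j 1 j<n (solveℤ 2 (λ n j → (:1 :+ n) :- (:0 :+ (:1 :+ j)) :- :1 := n :- (:1 :+ j)) ≡.refl (+ n) (+ j))
              (solveℤ 2 (λ n j → (:1 :+ n) :+ :2 (:0 :+ (:1 :+ j)) :- :3 :0 := ((:1 :+ n) :- (:0 :+ (:1 :+ j)) :- :1) :+ (:3* j :+ :1)) ≡.refl (+ n) (+ j))))
          (⊕-cong
          (ladder-tail 3 n {g} (miss (κ ℤ.+ + 2 ℤ.* (+ 0 ℤ.+ + 0) ℤ.- + 2) 0 (solveℤ 1 (λ k → k :- (:0 :+ :0) :- :1 := (k :+ :2 (:0 :+ :0) :- (:1 :+ :1)) :+ :1) ≡.refl κ))
            (λ j j<n → hit n j 2 j<n (solveℤ 2 (λ n j → (:1 :+ n) :- (:0 :+ (:1 :+ j)) :- :1 := n :- (:1 :+ j)) ≡.refl (+ n) (+ j))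
              (solveℤ 2 (λ n j → (:1 :+ n) :+ :2 (:0 :+ (:1 :+ j)) :- (:1 :+ :1) := ((:1 :+ n) :- (:0 :+ (:1 :+ j)) :- :1) :+ (:3* j :+ (:1 :+ :1))) ≡.refl (+ n) (+ j))))
          (ladder-by 1 k {h} λ j j<k → hit k j 0 j<k (b₁ k j) (solveℤ 2 (λ k j → e k j (:- :1) := (k :- (:0 :+ j) :- :1) :+ (:3* j :+ :0)) ≡.refl κ (+ j)))))
          (rev (ladder 2 n) (ladder 3 n) (ladder 1 k))))
      f′ g′ h′ : ℕ → Poly N
      f′ j = sqt (κ ℤ.+ + 2 ℤ.* (+ 0 ℤ.+ + j) ℤ.- + 2) (κ ℤ.- (+ 0 ℤ.+ + j))
      g′ j = sqt (κ ℤ.+ + 2 ℤ.* (+ 0 ℤ.+ + j) ℤ.- + 1) (κ ℤ.- (+ 0 ℤ.+ + j))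
      h′ j = sqt (κ ℤ.+ + 2 ℤ.* (+ 0 ℤ.+ + j)) (κ ℤ.- (+ 0 ℤ.+ + j))
      c₁₁₁ = P.trans (ΣZ-Σ (+ 0) κ (λ i → sqt (κ ℤ.+ + 2 ℤ.* i ℤ.- + 2) (κ ℤ.- i) ⊕ sqt (κ ℤ.+ + 2 ℤ.* i ℤ.- + 1) (κ ℤ.- i) ⊕ sqt (κ ℤ.+ + 2 ℤ.* i) (κ ℤ.- i)) (suc k) (upto k))
        (P.trans (Σ<-add₃ (suc k) f′ g′ h′) (P.trans (⊕-cong
          (ladder-tail 2 k {f′} (miss (κ ℤ.+ + 2 ℤ.* (+ 0 ℤ.+ + 0) ℤ.- + 2) 1 (solveℤ 1 (λ k → k :- (:0 :+ :0) := (k :+ :2 (:0 :+ :0) :- (:1 :+ :1)) :+ (:1 :+ :1)) ≡.refl κ))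
            (λ j j<k → hit k j 1 j<k (solveℤ 2 (λ k j → k :- (:0 :+ (:1 :+ j)) := k :- (:1 :+ j)) ≡.refl κ (+ j))
              (solveℤ 2 (λ k j → k :+ :2 (:0 :+ (:1 :+ j)) :- (:1 :+ :1) := (k :- (:0 :+ (:1 :+ j))) :+ (:3* j :+ :1)) ≡.refl κ (+ j))))
          (⊕-cong
          (ladder-tail 3 k {g′} (miss (κ ℤ.+ + 2 ℤ.* (+ 0 ℤ.+ + 0) ℤ.- + 1) 0 (solveℤ 1 (λ k → k :- (:0 :+ :0) := (k :+ :2 (:0 :+ :0) :- :1) :+ :1) ≡.refl κ))
            (λ j j<k → hit k j 2 j<k (solveℤ 2 (λ k j → k :- (:0 :+ (:1 :+ j)) := k :- (:1 :+ j)) ≡.refl κ (+ j))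
              (solveℤ 2 (λ k j → k :+ :2 (:0 :+ (:1 :+ j)) :- :1 := (k :- (:0 :+ (:1 :+ j))) :+ (:3* j :+ (:1 :+ :1))) ≡.refl κ (+ j))))
          (ladder-by 1 (suc k) {h′} λ j j<k → hit (suc k) j 0 j<k (b₀ k j) (solveℤ 2 (λ k j → k :+ :2 (:0 :+ j) := (k :- (:0 :+ j)) :+ (:3* j :+ :0)) ≡.refl κ (+ j)))))
          (rev (ladder 2 k) (ladder 3 k) (ladder 1 (suc k)))))
      first : ∀ {a} l → a ≡ κ ℤ.- + 1 ℤ.+ + l → sqt a (κ ℤ.- + 1) ≋ (q ⊗ t) ^ n ⊗ br (suc l)
      first l = sqt-hit n l (solveℤ 1 (λ n → (:1 :+ n) :- :1 := n) ≡.refl (+ n))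
      u v w x : ℕ → Poly N
      u j = sqt (κ ℤ.+ + 2 ℤ.* (+ 1 ℤ.+ + j) ℤ.- + 2) (κ ℤ.- (+ 1 ℤ.+ + j) ℤ.- + 1)
      v j = sqt (κ ℤ.+ + 2 ℤ.* (+ 1 ℤ.+ + j) ℤ.- + 1) (κ ℤ.- (+ 1 ℤ.+ + j) ℤ.- + 1)
      w j = sqt (κ ℤ.+ + 2 ℤ.* (+ 1 ℤ.+ + j)) (κ ℤ.- (+ 1 ℤ.+ + j) ℤ.- + 1)
      x j = sqt (κ ℤ.+ + 2 ℤ.* (+ 1 ℤ.+ + j) ℤ.+ + 1) (κ ℤ.- (+ 1 ℤ.+ + j) ℤ.- + 1)
      b₂ : ∀ j → κ ℤ.- (+ 1 ℤ.+ + j) ℤ.- + 1 ≡ + n ℤ.- + suc j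
      b₂ j = solveℤ 2 (λ n j → (:1 :+ n) :- (:1 :+ j) :- :1 := n :- (:1 :+ j)) ≡.refl (+ n) (+ j)
      doubled : ∀ {p r} → p ≋ r → two p ≋ r ⊕ r
      doubled {p} {r} h = P.trans (two-≋ p) (⊕-cong h h)
      rest = P.trans (ΣZ-Σ (+ 1) (κ ℤ.- + 1) (λ i → sqt (κ ℤ.+ + 2 ℤ.* i ℤ.- + 2) (κ ℤ.- i ℤ.- + 1) ⊕ two (sqt (κ ℤ.+ + 2 ℤ.* i ℤ.- + 1) (κ ℤ.- i ℤ.- + 1))
            ⊕ two (sqt (κ ℤ.+ + 2 ℤ.* i) (κ ℤ.- i ℤ.- + 1)) ⊕ sqt (κ ℤ.+ + 2 ℤ.* i ℤ.+ + 1) (κ ℤ.- i ℤ.- + 1)) n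
          (solveℤ 1 (λ n → (:1 :+ n) :- :1 :+ :1 :- :1 := n) ≡.refl (+ n)))
        (P.trans (Σ<-cong n {λ j → u j ⊕ two (v j) ⊕ two (w j) ⊕ x j} {λ j → term 3 n j ⊕ ((term 4 n j ⊕ term 4 n j) ⊕ ((term 5 n j ⊕ term 5 n j) ⊕ term 6 n j))} λ j j<n →
          ⊕-cong (hit n j 2 j<n (b₂ j) (solveℤ 2 (λ n j → (:1 :+ n) :+ :2 (:1 :+ j) :- (:1 :+ :1) := ((:1 :+ n) :- (:1 :+ j) :- :1) :+ (:3* j :+ (:1 :+ :1))) ≡.refl (+ n) (+ j)))
          (⊕-cong (doubled {v j} (hit n j 3 j<n (b₂ j) (solveℤ 2 (λ n j → (:1 :+ n) :+ :2 (:1 :+ j) :- :1 := ((:1 :+ n) :- (:1 :+ j) :- :1) :+ (:3* j :+ :3 :0)) ≡.refl (+ n) (+ j))))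
          (⊕-cong (doubled {w j} (hit n j 4 j<n (b₂ j) (solveℤ 2 (λ n j → (:1 :+ n) :+ :2 (:1 :+ j) := ((:1 :+ n) :- (:1 :+ j) :- :1) :+ (:3* j :+ :3 :1)) ≡.refl (+ n) (+ j))))
            (hit n j 5 j<n (b₂ j) (solveℤ 2 (λ n j → (:1 :+ n) :+ :2 (:1 :+ j) :+ :1 := ((:1 :+ n) :- (:1 :+ j) :- :1) :+ (:3* j :+ :3 (:1 :+ :1))) ≡.refl (+ n) (+ j))))))
        (P.trans (Σ<-add₄ n (term 3 n) (λ j → term 4 n j ⊕ term 4 n j) (λ j → term 5 n j ⊕ term 5 n j) (term 6 n))
          (⊕-cong (P.refl {Σ< n (term 3 n)}) (⊕-cong (Σ<-add n (term 4 n) (term 4 n)) (⊕-cong (Σ<-add n (term 5 n) (term 5 n)) (P.refl {Σ< n (term 6 n)}))))))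
      c₂₁ = P.trans (⊕-cong (first 2 (solveℤ 1 (λ k → k :+ :1 := (k :- :1) :+ (:1 :+ :1)) ≡.refl κ))
        (⊕-cong (doubled {sqt κ (κ ℤ.- + 1)} (first 1 (solveℤ 1 (λ k → k := (k :- :1) :+ :1) ≡.refl κ)))
        (⊕-cong (first 0 (solveℤ 1 (λ k → k :- :1 := (k :- :1) :+ :0) ≡.refl κ)) rest))) (middle n)

-- Comparison of operators, parking functions and Schur expansions

module Conclusion where
  open RingSolve
  open PolynomialRing
  open Localisation
  open CoefficientRing using (module Fractions)
  open OperatorCalculus
  open Operators
  open SchurExpansions using (module Expansions)
  open Ladders
  open CombinatorialSide
  open SchurSide
  open import Data.Integer using (+_)
  open import Data.Nat using (_<_; s≤s)

  module LadderValues (R : CommutativeRing 0ℓ 0ℓ) (q t qi : CommutativeRing.Carrier R)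
    (q*qi : CommutativeRing._≈_ R (CommutativeRing._*_ R q qi) (CommutativeRing.1# R)) where
    open CommutativeRing R hiding (zero) renaming (Carrier to A)
    open Solver R using (_^_)
    open HVariants R q t qi q*qi using (ladder)

    value₁ value₂ value₀ : ℕ → A → A → A → A
    value₁ k X Y Z = ladder 1 k * X + ((ladder 2 k + ladder 3 k) * Y + ladder 1 (suc k) * Z)
    value₂ k X Y Z = ladder 2 k * X + ((ladder 3 k + ladder 1 (suc k)) * Y + ladder 2 (suc k) * Z)
    value₀ n X Y Z = (ladder 1 k + (ladder 3 n + ladder 2 n)) * X
      + (((ladder 2 k + ladder 3 k) + ((ladder 1 k + ladder 2 k - q ^ n * t ^ n) + (ladder 3 n + ladder 1 k))) * Y
      + (ladder 1 (suc k) + (ladder 3 k + ladder 2 k)) * Z)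
      where k = suc n

  module Evaluation (R : CommutativeRing 0ℓ 0ℓ) (q t qi : CommutativeRing.Carrier R)
    (q*qi : CommutativeRing._≈_ R (CommutativeRing._*_ R q qi) (CommutativeRing.1# R))
    (u h third : CommutativeRing.Carrier R)
    (pM sgn : ℕ → CommutativeRing.Carrier R)
    (Eel : ℕ → (List ℕ → CommutativeRing.Carrier R) → CommutativeRing.Carrier R)
    (hyp : QAlgebra.Hypotheses R q t u h third pM sgn Eel)
    (Δ-cancellable : Cancel.Cancellable R (HVariants.Δ R q t qi q*qi)) where
    open CommutativeRing R hiding (zero) renaming (Carrier to A)
    open Solver R
    open Cancel R using (cancel)
    open HVariants R q t qi q*qi using (Δ; ladder; ladder₁; ladder₂; ladder₃; eΔ; eG₁; eG₂; eG₃)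
    open LadderValues R q t qi q*qi
    open QAlgebra R q t u h third pM sgn Eel hiding (Hypotheses)
    open Transpose R u pM sgn Eel using (Qᵗ)
    open Calculus hyp using (Q₃₁; Q₃₂; Q₃₀; eH₃; eH₂₁)

    Δ-injective : ∀ {x y z} → Δ * x ≈ z → Δ * y ≈ z → x ≈ y
    Δ-injective {x} {y} e e′ = x-y≈0⇒x≈y _ _ (cancel Δ-cancellable _
      (trans (solve 3 (λ d x y → d :* (x :- y) := d :* x :- d :* y) ≡.refl Δ x y)
        (trans (+-cong e (-‿cong e′)) (-‿inverseʳ _))))

    private
      eG : ∀ {n} → (α β γ q t Q T X Y Z : Expr n) → Expr n
      eG α β γ q t Q T X Y Z = (q :- t :^ 2) :* α :* eH₃ q X Y Z :+ (q :^ 2 :- t) :* β :* eH₃ t X Y Z :- Q :* T :* (q :- t) :* γ :* eH₂₁ q t X Y Z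

    -- Multiplied by Δ, both sides are the same polynomial: the operator side groups it by the
    -- pairings with H_3, H_111 and H_21, the ladders group it by the Schur coordinates X, Y, Z.
    Q-1 : ∀ k f → k ℕ.+ k < f → ∀ {φ X Y Z} → Deg3 φ X Y Z → Qᵗ f (1 ℕ.+ 3 ℕ.* k) 3 φ [] ≈ value₁ k X Y Z
    Q-1 k f k<f {φ} {X} {Y} {Z} d = Δ-injective (Q₃₁ k f k<f d)
      (trans (solve 8 (λ D a b c e X Y Z → D :* (a :* X :+ ((b :+ c) :* Y :+ e :* Z)) := D :* a :* X :+ ((D :* b :+ D :* c) :* Y :+ D :* e :* Z)) ≡.refl Δ (ladder 1 k) (ladder 2 k) (ladder 3 k) (ladder 1 (suc k)) X Y Z)
        (trans (+-cong (*-congʳ (ladder₁ k)) (+-cong (*-congʳ (+-cong (ladder₂ k) (ladder₃ k))) (*-congʳ (ladder₁ (suc k)))))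
          (solve 7 (λ q t Q T X Y Z → eG₁ q t Q T :* X :+ ((eG₂ q t Q T :+ eG₃ q t Q T) :* Y :+ eG₁ q t (q :* Q) (t :* T) :* Z)
            := eG (Q :* Q :* Q) (T :* T :* T) (:1 :+ q :+ t) q t Q T X Y Z) ≡.refl q t (q ^ k) (t ^ k) X Y Z)))

    Q-2 : ∀ k f → k < f → ∀ {φ X Y Z} → Deg3 φ X Y Z → Qᵗ (suc f) (2 ℕ.+ 3 ℕ.* k) 3 φ [] ≈ value₂ k X Y Z
    Q-2 k f k<f {φ} {X} {Y} {Z} d = Δ-injective (Q₃₂ k f k<f d)
      (trans (solve 8 (λ D a b c e X Y Z → D :* (a :* X :+ ((b :+ c) :* Y :+ e :* Z)) := D :* a :* X :+ ((D :* b :+ D :* c) :* Y :+ D :* e :* Z)) ≡.refl Δ (ladder 2 k) (ladder 3 k) (ladder 1 (suc k)) (ladder 2 (suc k)) X Y Z)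
        (trans (+-cong (*-congʳ (ladder₂ k)) (+-cong (*-congʳ (+-cong (ladder₃ k) (ladder₁ (suc k)))) (*-congʳ (ladder₂ (suc k)))))
          (solve 7 (λ q t Q T X Y Z → eG₂ q t Q T :* X :+ ((eG₃ q t Q T :+ eG₁ q t (q :* Q) (t :* T)) :* Y :+ eG₂ q t (q :* Q) (t :* T) :* Z)
            := eG (q :* (Q :* Q :* Q)) (t :* (T :* T :* T)) (q :+ t :+ q :* t) q t Q T X Y Z) ≡.refl q t (q ^ k) (t ^ k) X Y Z)))

    Q-0 : ∀ n f → n < f → ∀ {φ X Y Z} → Deg3 φ X Y Z → Qᵗ (suc (suc f)) (3 ℕ.+ 3 ℕ.* n) 3 φ [] ≈ value₀ n X Y Z
    Q-0 n f n<f {φ} {X} {Y} {Z} d = Δ-injective (Q₃₀ n f n<f d)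
      (trans (solve 12 (λ D a b c a′ b′ c′ d′ e X Y Z →
          D :* ((a :+ (c′ :+ b′)) :* X :+ (((b :+ c) :+ ((a :+ b :- e) :+ (c′ :+ a))) :* Y :+ (d′ :+ (c :+ b)) :* Z))
          := (D :* a :+ (D :* c′ :+ D :* b′)) :* X :+ (((D :* b :+ D :* c) :+ ((D :* a :+ D :* b :- D :* e) :+ (D :* c′ :+ D :* a))) :* Y :+ (D :* d′ :+ (D :* c :+ D :* b)) :* Z))
          ≡.refl Δ (ladder 1 (suc n)) (ladder 2 (suc n)) (ladder 3 (suc n)) (ladder 1 n) (ladder 2 n) (ladder 3 n) (ladder 1 (suc (suc n))) (q ^ n * t ^ n) X Y Z)
        (trans (+-cong (*-congʳ (+-cong l₁ (+-cong (ladder₃ n) (ladder₂ n))))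
                  (+-cong (*-congʳ (+-cong (+-cong l₂ l₃) (+-cong (+-congʳ (+-cong l₁ l₂)) (+-cong (ladder₃ n) l₁)))) (*-congʳ (+-cong (ladder₁ (suc (suc n))) (+-cong l₃ l₂)))))
          (solve 7 (λ q t Q T X Y Z →
            (eG₁ q t (q :* Q) (t :* T) :+ (eG₃ q t Q T :+ eG₂ q t Q T)) :* X
            :+ (((eG₂ q t (q :* Q) (t :* T) :+ eG₃ q t (q :* Q) (t :* T)) :+ ((eG₁ q t (q :* Q) (t :* T) :+ eG₂ q t (q :* Q) (t :* T) :- eΔ q t :* (Q :* T)) :+ (eG₃ q t Q T :+ eG₁ q t (q :* Q) (t :* T)))) :* Y
            :+ (eG₁ q t (q :* (q :* Q)) (t :* (t :* T)) :+ (eG₃ q t (q :* Q) (t :* T) :+ eG₂ q t (q :* Q) (t :* T))) :* Z)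
            := eG (q :* (Q :* Q :* Q) :* (:1 :+ q :+ q :^ 2)) (t :* (T :* T :* T) :* (:1 :+ t :+ t :^ 2)) ((q :+ t :+ q :* t) :* (:1 :+ q :+ t)) q t Q T X Y Z)
            ≡.refl q t (q ^ n) (t ^ n) X Y Z)))
      where
      l₁ = ladder₁ (suc n)
      l₂ = ladder₂ (suc n)
      l₃ = ladder₃ (suc n)

  -- Ladders are built twice, among Laurent polynomials for the paths and in the localisation at M
  -- for the operators. A ring homomorphism carries one construction to the other.
  module Homomorphism (R R′ : CommutativeRing 0ℓ 0ℓ) (φ : CommutativeRing.Carrier R → CommutativeRing.Carrier R′)
    (φ-+ : ∀ x y → CommutativeRing._≈_ R′ (φ (CommutativeRing._+_ R x y)) (CommutativeRing._+_ R′ (φ x) (φ y)))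
    (φ-sub : ∀ x y → CommutativeRing._≈_ R′ (φ (CommutativeRing._-_ R x y)) (CommutativeRing._-_ R′ (φ x) (φ y)))
    (φ-* : ∀ x y → CommutativeRing._≈_ R′ (φ (CommutativeRing._*_ R x y)) (CommutativeRing._*_ R′ (φ x) (φ y)))
    (φ-0 : CommutativeRing._≈_ R′ (φ (CommutativeRing.0# R)) (CommutativeRing.0# R′))
    (φ-1 : CommutativeRing._≈_ R′ (φ (CommutativeRing.1# R)) (CommutativeRing.1# R′))
    (q t qi : CommutativeRing.Carrier R)
    (q*qi : CommutativeRing._≈_ R (CommutativeRing._*_ R q qi) (CommutativeRing.1# R))
    (q*qi′ : CommutativeRing._≈_ R′ (CommutativeRing._*_ R′ (φ q) (φ qi)) (CommutativeRing.1# R′)) where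
    private
      module R = CommutativeRing R
      module Lad = HVariants R q t qi q*qi
      module Lad′ = HVariants R′ (φ q) (φ t) (φ qi) q*qi′
      module Val = LadderValues R q t qi q*qi
      module Val′ = LadderValues R′ (φ q) (φ t) (φ qi) q*qi′
    open CommutativeRing R′ hiding (zero)
    open Solver R using () renaming (_^_ to _^ᴿ_)
    open Solver R′ using (_^_)

    φ-^ : ∀ x n → φ (x ^ᴿ n) ≈ φ x ^ n
    φ-^ x zero    = φ-1
    φ-^ x (suc n) = trans (φ-* _ _) (*-congˡ (φ-^ x n))

    φ-br : ∀ n → φ (Lad.br n) ≈ Lad′.br n
    φ-br zero    = φ-0
    φ-br (suc n) = trans (φ-+ _ _) (+-cong (trans (φ-* _ _) (*-congˡ (φ-br n))) (φ-^ t n))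

    φ-ladder : ∀ s k → φ (Lad.ladder s k) ≈ Lad′.ladder s k
    φ-ladder s zero    = φ-0
    φ-ladder s (suc k) = trans (φ-+ _ _) (+-cong (trans (φ-* _ _) (*-cong (φ-* _ _) (φ-ladder s k))) (φ-br (3 ℕ.* k ℕ.+ s)))

    φ-Δ : φ Lad.Δ ≈ Lad′.Δ
    φ-Δ = trans (φ-* _ _) (*-cong (φ-sub q t) (trans (φ-* _ _) (*-cong (trans (φ-sub _ _) (+-congʳ (φ-^ q 2))) (trans (φ-sub _ _) (+-congˡ (-‿cong (φ-^ t 2)))))))

    private
      sum : ∀ {x y x′ y′} → φ x ≈ x′ → φ y ≈ y′ → φ (x R.+ y) ≈ x′ + y′
      sum e f = trans (φ-+ _ _) (+-cong e f)

      combine : ∀ {x y z x′ y′ z′} X Y Z → φ x ≈ x′ → φ y ≈ y′ → φ z ≈ z′ →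
                φ (x R.* X R.+ (y R.* Y R.+ z R.* Z)) ≈ x′ * φ X + (y′ * φ Y + z′ * φ Z)
      combine X Y Z e f g = sum (trans (φ-* _ X) (*-congʳ e)) (sum (trans (φ-* _ Y) (*-congʳ f)) (trans (φ-* _ Z) (*-congʳ g)))

    φ-value₁ : ∀ k X Y Z → φ (Val.value₁ k X Y Z) ≈ Val′.value₁ k (φ X) (φ Y) (φ Z)
    φ-value₁ k X Y Z = combine X Y Z (φ-ladder 1 k) (sum (φ-ladder 2 k) (φ-ladder 3 k)) (φ-ladder 1 (suc k))

    φ-value₂ : ∀ k X Y Z → φ (Val.value₂ k X Y Z) ≈ Val′.value₂ k (φ X) (φ Y) (φ Z)
    φ-value₂ k X Y Z = combine X Y Z (φ-ladder 2 k) (sum (φ-ladder 3 k) (φ-ladder 1 (suc k))) (φ-ladder 2 (suc k))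

    φ-value₀ : ∀ n X Y Z → φ (Val.value₀ n X Y Z) ≈ Val′.value₀ n (φ X) (φ Y) (φ Z)
    φ-value₀ n X Y Z = combine X Y Z (sum (φ-ladder 1 k) (sum (φ-ladder 3 n) (φ-ladder 2 n)))
      (sum (sum (φ-ladder 2 k) (φ-ladder 3 k)) (sum
        (trans (φ-sub _ _) (+-cong (sum (φ-ladder 1 k) (φ-ladder 2 k)) (-‿cong (trans (φ-* _ _) (*-cong (φ-^ q n) (φ-^ t n))))))
        (sum (φ-ladder 3 n) (φ-ladder 1 k))))
      (sum (φ-ladder 1 (suc k)) (sum (φ-ladder 3 k) (φ-ladder 2 k)))
      where k = suc n

  module Assembly (N : ℕ) where
    open Concrete N
    open Combinatorial N using (qi; q*qi; hSum; hSum-1; hSum-2; module Triple; Δ-cancellable)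
    private
      module P = CommutativeRing (polyRing {N})
      module F = CommutativeRing Kr
      module C = Combinatorial N
    open Expansions N using (p₁; p₂; p₁³; p₂p₁; p₃-schur; pEval-1; pEval-2; pEval-3; s3-τ; s21-τ; s111-τ)

    polyK-cancellable : ∀ {d} → Cancel.Cancellable (polyRing {N}) d → Cancel.Cancellable Kr (polyK d)
    polyK-cancellable {d} c = Cancel.mkCancel λ { (p , e) h →
      Fractions.mkᴸ (P.*-congʳ {constP 1ℚ} {p} {[]} (Cancel.cancel c p (P.trans (P.sym (P.*-identityʳ (d ⊗ p))) (Fractions.atᴸ h)))) }

    private
      q*qi′ : q F.* polyK qi F.≈ F.1#
      q*qi′ = polyK-cong q*qi

    open Homomorphism polyRing Kr polyK polyK-+ polyK-sub (λ _ _ → F.refl) F.refl F.refl C.q C.t qi q*qi q*qi′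

    open Evaluation Kr q t (polyK qi) q*qi′ Minv half third pM signK Eel hypotheses
      (Cancel.cancellable-resp Kr (F.sym φ-Δ) (polyK-cancellable Δ-cancellable))

    private
      X Y Z : F.Carrier
      X = polyK (s3 N)
      Y = polyK (s21 N)
      Z = polyK (s111 N)

      1⊗ : ∀ p → p ⊗ constP 1ℚ ≋ p
      1⊗ = P.*-identityʳ

      p-111 : pEval 1 ⊗ (pEval 1 ⊗ (pEval 1 ⊗ constP 1ℚ)) ≋ ((s3 N ⊕ s21 N) ⊕ s21 N) ⊕ s111 N
      p-111 = P.trans (P.reflexive (≡.cong (λ p → p ⊗ (p ⊗ (p ⊗ constP 1ℚ))) pEval-1))
        (P.trans (⊗-cong (P.refl {p₁}) (⊗-cong (P.refl {p₁}) (1⊗ p₁)))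
        (P.trans p₁³ (P.sym (⊕-cong (⊕-cong (⊕-cong s3-τ s21-τ) s21-τ) s111-τ))))

      p-21 : p₂ ⊗ p₁ ≋ s3 N P.- s111 N
      p-21 = P.trans p₂p₁ (P.sym (⊕-cong s3-τ (scaleP-cong -1ℚ s111-τ)))

      p-3 : pEval 3 ⊗ constP 1ℚ ≋ (s3 N P.- s21 N) ⊕ s111 N
      p-3 = P.trans (1⊗ (pEval 3)) (P.trans (P.reflexive pEval-3)
        (P.trans p₃-schur (P.sym (⊕-cong (⊕-cong s3-τ (scaleP-cong -1ℚ s21-τ)) s111-τ))))

      polyK-sum : ∀ {p x} r → polyK p F.≈ x → polyK (p ⊕ r) F.≈ x F.+ polyK r
      polyK-sum {p} {x} r e = F.trans {polyK (p ⊕ r)} {polyK p F.+ polyK r} {x F.+ polyK r} (polyK-+ p r) (F.+-congʳ {polyK r} {polyK p} {x} e)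

    -- Power sums expand into Schur functions by the characters of the symmetric group on three
    -- letters. This makes the three Schur polynomials the coordinates of the evaluation functional.
    powersum-Deg3 : QAlgebra.Deg3 Kr q t Minv half third pM signK Eel powersum X Y Z
    powersum-Deg3 = record
      { at-111 = F.trans (polyK-cong p-111) (polyK-sum (s111 N) (polyK-sum (s21 N) (polyK-+ (s3 N) (s21 N))))
      ; at-21  = F.trans (polyK-cong (P.trans (P.reflexive (≡.cong₂ (λ p r → p ⊗ (r ⊗ constP 1ℚ)) pEval-2 pEval-1)) (P.trans (⊗-cong (P.refl {p₂}) (1⊗ p₁)) p-21))) (polyK-sub (s3 N) (s111 N))
      ; at-12  = F.trans (polyK-cong (P.trans (P.reflexive (≡.cong₂ (λ p r → p ⊗ (r ⊗ constP 1ℚ)) pEval-1 pEval-2)) (P.trans (⊗-cong (P.refl {p₁}) (1⊗ p₂)) (P.trans (P.*-comm p₁ p₂) p-21)))) (polyK-sub (s3 N) (s111 N))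
      ; at-3   = F.trans (polyK-cong p-3) (polyK-sum (s111 N) (polyK-sub (s3 N) (s21 N)))
      }

    private
      conclude : ∀ m {p x} → Q1 N m 3 F.≈ x → polyK p F.≈ x → hSum m ≋ p → Q1 N m 3 ≈K Hmn N m 3
      conclude m {p} {x} e f g = at (Fractions.atᴸ (F.trans {Q1 N m 3} {x} {polyK (hSum m)} e
        (F.trans {x} {polyK p} {polyK (hSum m)} (F.sym {polyK p} {x} f) (F.sym {polyK (hSum m)} {polyK p} (polyK-cong g)))))

      conclude′ : ∀ m {p r} → hSum m ≋ p → r ≋ p → Hmn N m 3 ≈K polyK r
      conclude′ m {p} {r} g h = at (Fractions.atᴸ (polyK-cong {hSum m} {r} (P.trans {hSum m} {p} {r} g (P.sym {r} {p} h))))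

      Q1-at : ∀ m m′ {x} → m ≡ m′ → Transpose.Qᵗ Kr Minv pM signK Eel m′ m′ 3 powersum [] F.≈ x → Q1 N m 3 F.≈ x
      Q1-at m m′ {x} ≡.refl e = F.trans {Q1 N m 3} {Transpose.Qᵗ Kr Minv pM signK Eel m m 3 powersum []} {x} (Q1-transpose m 3) e

    case₁ : ∀ k → (Q1 N (3 ℕ.* k ℕ.+ 1) 3 ≈K Hmn N (3 ℕ.* k ℕ.+ 1) 3) × (Hmn N (3 ℕ.* k ℕ.+ 1) 3 ≈K polyK (RHS₁ N k))
    case₁ k =
      conclude (3 ℕ.* k ℕ.+ 1) (Q1-at (3 ℕ.* k ℕ.+ 1) (1 ℕ.+ 3 ℕ.* k) (ℕP.+-comm (3 ℕ.* k) 1) (Q-1 k (1 ℕ.+ 3 ℕ.* k) (s≤s (ℕP.+-monoʳ-≤ k (ℕP.m≤m+n k (k ℕ.+ 0)))) powersum-Deg3))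
        (φ-value₁ k (s3 N) (s21 N) (s111 N)) (hSum-1 k)
      , conclude′ (3 ℕ.* k ℕ.+ 1) (hSum-1 k) (Values.RHS₁-ladder N k)

    case₂ : ∀ k → (Q1 N (3 ℕ.* k ℕ.+ 2) 3 ≈K Hmn N (3 ℕ.* k ℕ.+ 2) 3) × (Hmn N (3 ℕ.* k ℕ.+ 2) 3 ≈K polyK (RHS₂ N k))
    case₂ k =
      conclude (3 ℕ.* k ℕ.+ 2) (Q1-at (3 ℕ.* k ℕ.+ 2) (2 ℕ.+ 3 ℕ.* k) (ℕP.+-comm (3 ℕ.* k) 2) (Q-2 k (1 ℕ.+ 3 ℕ.* k) (s≤s (ℕP.m≤n*m k 3)) powersum-Deg3))
        (φ-value₂ k (s3 N) (s21 N) (s111 N)) (hSum-2 k)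
      , conclude′ (3 ℕ.* k ℕ.+ 2) (hSum-2 k) (Values.RHS₂-ladder N k)

    case₀ : ∀ n → (Q1 N (3 ℕ.* suc n) 3 ≈K Hmn N (3 ℕ.* suc n) 3) × (Hmn N (3 ℕ.* suc n) 3 ≈K polyK (RHS₀ N (suc n)))
    case₀ n =
      conclude (3 ℕ.* suc n) (Q1-at (3 ℕ.* suc n) (3 ℕ.+ 3 ℕ.* n) (ℕP.*-suc 3 n) (Q-0 n (1 ℕ.+ 3 ℕ.* n) (s≤s (ℕP.m≤n*m n 3)) powersum-Deg3))
        (φ-value₀ n (s3 N) (s21 N) (s111 N)) (Triple.hSum-0 n)
      , conclude′ (3 ℕ.* suc n) (Triple.hSum-0 n) (Values.RHS₀-ladder N n)

open import Data.Nat using (_+_; _*_; _≤_; s≤s)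
open Conclusion.Assembly

theorem4 :
    ((k N : ℕ) → (Q1 N (3 * k + 1) 3 ≈K Hmn N (3 * k + 1) 3)
                 × (Hmn N (3 * k + 1) 3 ≈K polyK (RHS₁ N k)))
    × ((k N : ℕ) → (Q1 N (3 * k + 2) 3 ≈K Hmn N (3 * k + 2) 3)
                   × (Hmn N (3 * k + 2) 3 ≈K polyK (RHS₂ N k)))
    × ((k : ℕ) → 1 ≤ k → (N : ℕ) → (Q1 N (3 * k) 3 ≈K Hmn N (3 * k) 3)
                                   × (Hmn N (3 * k) 3 ≈K polyK (RHS₀ N k)))
theorem4 = (λ k N → case₁ N k) , (λ k N → case₂ N k) , λ { (suc n) (s≤s _) N → case₀ N n }
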